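{- Let $\pi=1\pi'\in S_n$, where $\pi'$ is a dominant permutation of $\{2,\ldots,n\}$. Then the canonical reduced form of $m[T(\pi)]$ at $\beta=-1$, evaluated by substituting $$x_{ij}=\frac{1}{x_{\phi_{ij}(i)}-y_{\phi_{ij}(j)}+x_{\phi_{ij}(i)}y_{\phi_{ij}(j)}}$$ for each variable $x_{ij}$ with $(i,j)_T\in R(\pi)$ (i.e. for each tree label $(i,j)$ of a box of $R(\pi)$), satisfies $$\mathrm{Crf}^{\beta=-1}_{T(\pi)}\Big(x_{ij}=\tfrac{1}{x_{\phi_{ij}(i)}-y_{\phi_{ij}(j)}+x_{\phi_{ij}(i)}y_{\phi_{ij}(j)}}\Big)=\Big(\prod_{(i,j)_T\in R(\pi)}\frac{1}{x_{\phi_{ij}(i)}-y_{\phi_{ij}(j)}+x_{\phi_{ij}(i)}y_{\phi_{ij}(j)}}\Big)\,\mathfrak{G}_{\pi}(\mathbf{x},\mathbf{y}).$$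
   Context: Permutations and diagrams. A permutation $\pi\in S_n$ is written in one-line notation $\pi_1\cdots\pi_n$. Positions in the $n\times n$ grid are (row, column), rows numbered top to bottom and columns left to right. The diagram of $\pi$ is $D(\pi)=\{(\pi_j,i): i<j,\ \pi_i>\pi_j\}$. $\pi=1\pi'$ with $\pi'$ dominant means $\pi_1=1$ and $\pi'=\pi_2\cdots\pi_n$ is a $132$-avoiding permutation of $\{2,\ldots,n\}$; equivalently $D(\pi)$ is the Young diagram of a partition whose north-west most box is at $(2,2)$. Pipe dreams. A pipe dream for $w\in S_n$ is a tiling of the $n\times n$ grid by crosses (two strands cross straight) and elbows (one strand joins the left edge to the top edge, another joins the bottom edge to the right edge) such that all tiles at $(a,b)$ with $a+b\ge n+1$ are elbows, and if the strands entering from the left in rows $1,\ldots,n$ are labelled $1,\ldots,n$ and followed (ignoring second crossings among the same strands), they exit at the top reading $w_1,\ldots,w_n$ from left to right. It is reduced if no two strands cross twice. $PD(w)$ is the simplicial complex with vertices the entries $(a,b)$, $a+b\le n$, and facets the sets of elbow positions (in this triangle) of reduced pipe dreams for $w$. $\mathrm{Pipes}(w)$ is the set of all pipe dreams of $w$, reduced and nonreduced; for $P\in\mathrm{Pipes}(w)$, $F(P)$ is the (interior) face of $PD(w)$ given by the elbow positions of $P$. Double Grothendieck polynomial. With $\mathbf{x}=(x_1,\ldots,x_{n-1})$, $\mathbf{y}=(y_1,\ldots,y_{n-1})$, $\mathfrak{G}_w(\mathbf{x},\mathbf{y})=\sum_{P\in\mathrm{Pipes}(w)}(-1)^{\mathrm{codim}_{PD(w)}F(P)}\prod_{(i,j)\in\mathrm{cross}(P)}(x_i-y_j+x_iy_j)$,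 where $\mathrm{cross}(P)$ is the set of positions (row $i$, column $j$) of the crosses of $P$. The region $R(\pi)$. The bottom reduced pipe dream of $\pi$ has crosses at the boxes obtained by pushing $D(\pi)$ left (left-justifying each row); the top reduced pipe dream has crosses at the boxes obtained by pushing $D(\pi)$ up. The core region $\mathrm{cr}(\pi)$ is the union of the cross positions of these two pipe dreams, and $R(\pi)=\mathrm{cr}(\pi)\cup\{(1,1)\}$. The tree $T(\pi)$. Traverse the southeast boundary of $R(\pi)$ from its SW corner to its NE corner as a sequence of east steps (E) and north steps (N). Let $A$ consist of all N steps together with those E steps such that E bounds the bottom reduced pipe dream (the box of $R(\pi)$ directly above E is a cross of it) but the N step directly preceding E (if the preceding step is an N step) does not bound it (the box directly left of that N step is not a cross of it). Label the steps of $A$ by $1,\ldots,m$ in the order traversed; an E step not in $A$ receives the label of the N step directly preceding it. Place a dot in each box of $R(\pi)$ that is an elbow in the bottom reduced pipe dream, then let the dots in each column drop south so that they occupy the lowest boxes of that column of $R(\pi)$. $T(\pi)$ is the (noncrossing) tree on $[m]$ with an edge $(i,j)$, $i<j$, whenever there is a dot in the box in the column of the E step labelled $i$ and the row of the N step labelled $j$. Tree labels and $\phi$. A box of $R(\pi)$ has tree label $(i,j)$, written $(i,j)_T$, if the E step of the boundary below it (in its column) is labelled $i$ and the N step of the boundary to its right (in its row) is labelled $j$. The tree labels of the boxes of $R(\pi)$ are exactly the edges of the directed transitive closure of $T(\pi)$ ($T(\pi)$ together with all $(i,j)$ joined by an increasing path in $T(\pi)$), and only variables $x_{ij}$ with such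 $(i,j)$ occur in reduced forms of $m[T(\pi)]$. The map $\phi$ sends the tree label $(i,j)$ of a box to its conventional label $(\phi_{ij}(i),\phi_{ij}(j))=(\text{row},\text{column})$. On the right-hand side of the substitution, $x_{\phi_{ij}(i)}$ and $y_{\phi_{ij}(j)}$ are the singly indexed variables of $\mathbf{x},\mathbf{y}$. Canonical reduced form. The subdivision algebra is the commutative algebra over $\mathbb{Q}[\beta]$ generated by $x_{ij}$, $1\le i<j\le m$, subject to $x_{ij}x_{jk}=x_{ik}(x_{ij}+x_{jk}+\beta)$ for $i<j<k$. A reduced form of a monomial is a polynomial obtained by successively substituting $x_{ik}(x_{ij}+x_{jk}+\beta)$ in place of an occurrence of $x_{ij}x_{jk}$ ($i<j<k$), on each monomial separately, until no further reduction is possible. For a noncrossing tree $T$ (no edges $(i,k),(j,l)$ with $i<j<k<l$), $m[T]=\prod_{(i,j)\in E(T),\,i<j}x_{ij}$, and the canonical reduced form $\mathrm{Crf}_T(x_{ij})$ is the reduced form of $m[T]$ obtained by performing the reductions from front to back (or back to front) along the vertices $1,2,\ldots,m$, always on the topmost edges: at a vertex $j$ having both an edge $(i,j)$ with $i<j$ and an edge $(j,k)$ with $j<k$, the pair with $i$ smallest and $k$ largest is reduced. $\mathrm{Crf}^{\beta=-1}_T$ denotes it with $\beta=-1$. -}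

module Defs where

open import Algebra.Bundles using (CommutativeRing)
import Algebra.Properties.Semiring.Exp as Exp
open import Data.Bool.Base using (if_then_else_)
open import Data.Fin.Base as Fin using (Fin; toℕ)
import Data.Fin.Properties as Fin
open import Data.Fin.Permutation using (Permutation′; _⟨$⟩ʳ_)
open import Data.List.Base
  using (List; []; _∷_; _++_; map; filter; find; foldr; foldl; length; reverse;
         concatMap; allFin; applyUpTo; applyDownFrom; cartesianProduct)
import Data.List.Membership.DecPropositional as DecMembership
open import Data.List.Membership.Propositional using (_∈_; _∉_)
import Data.List.Properties as List
open import Data.List.Relation.Unary.Unique.Propositional using (Unique)
import Data.List.Relation.Unary.Unique.DecPropositional as DecUnique
open import Data.List.Sort.InsertionSort using (sort)
open import Data.Maybe.Base using (Maybe; just; nothing; maybe′)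
open import Data.Nat.Base using (ℕ; zero; suc; _+_; _∸_; _≤_; _<_; _⊔_; _⊓_)
open import Data.Nat.Properties using (_≟_; _≤?_; _<?_; ≤-decTotalOrder)
open import Data.Product.Base using (_×_; _,_; proj₁; proj₂)
open import Data.Product.Properties using (≡-dec)
open import Data.Unit.Base using (⊤; tt)
open import Relation.Binary.Definitions using (DecidableEquality)
open import Relation.Binary.PropositionalEquality using (_≡_)
open import Relation.Nullary.Decidable
  using (Dec; yes; no; does; ¬?; _×-dec_; _⊎-dec_)
open import Relation.Nullary.Negation using (¬_)

-- (row , column), both counted from 1, rows downwards.
Box : Set
Box = ℕ × ℕ

_≟₂_ : DecidableEquality (ℕ × ℕ)
_≟₂_ = ≡-dec _≟_ _≟_

open DecMembership _≟₂_ using (_∈?_)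

oneTo : ℕ → List ℕ
oneTo = applyUpTo suc

grid : ℕ → List Box
grid n = cartesianProduct (oneTo n) (oneTo n)

sublists : ∀ {a} {A : Set a} → List A → List (List A)
sublists []       = [] ∷ []
sublists (x ∷ xs) = map (x ∷_) (sublists xs) ++ sublists xs

maximum : List ℕ → ℕ
maximum = foldr _⊔_ 0

Avoids132 : ∀ {n m} → (Fin n → Fin m) → Set
Avoids132 f = ∀ {i j k} → i Fin.< j → j Fin.< k → ¬ (f i Fin.< f k × f k Fin.< f j)

module _ {n : ℕ} (π : Permutation′ n) where

  -- The letter π_i, counted from 1; positions i : Fin n are counted from 0.
  letter : Fin n → ℕ
  letter i = suc (toℕ (π ⟨$⟩ʳ i))

  oneLine : List ℕ
  oneLine = map letter (allFin n)

  diagram : List Box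
  diagram = map (λ (i , j) → letter j , suc (toℕ i))
    (filter (λ (i , j) → (i Fin.<? j) ×-dec (letter j <? letter i))
            (cartesianProduct (allFin n) (allFin n)))

-- A tiling is given by the list of its crosses; every other tile of the
-- n × n grid is an elbow.
PipeDream : Set
PipeDream = List Box

-- A crossing of two strands, recorded as (smaller label , larger label).
Crossing : Set
Crossing = ℕ × ℕ

crossing : ℕ → ℕ → Crossing
crossing p q = p ⊓ q , p ⊔ q

-- One row of tiles, read from left to right starting in column c.  The strand
-- h enters the tile from the left and v from below; vs are the strands entering
-- the remaining tiles of the row from below, and χ lists the crosses met so
-- far.  The result lists the strands leaving through the top edges.  A cross
-- whose two strands have already crossed is passed as if it were an elbow.
sweepRow : PipeDream → (r c : ℕ) → ℕ → List ℕ → List Crossing →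
           List ℕ × List Crossing
sweepRow P r c h []       χ = [] , χ
sweepRow P r c h (v ∷ vs) χ with (r , c) ∈? P | crossing h v ∈? χ
... | no _  | _     = let (ts , χ′) = sweepRow P r (suc c) v vs χ
                      in h ∷ ts , χ′
... | yes _ | no _  = let (ts , χ′) = sweepRow P r (suc c) h vs (crossing h v ∷ χ)
                      in v ∷ ts , χ′
... | yes _ | yes _ = let (ts , χ′) = sweepRow P r (suc c) v vs (crossing h v ∷ χ)
                      in h ∷ ts , χ′

-- All rows, from row n up to row 1, so that every strand is followed from its
-- left end onwards.  Strand r enters from the left in row r; the strands
-- entering from below the grid are labelled n+1 , … , 2n.
sweep : (n : ℕ) → PipeDream → List ℕ × List Crossing
sweep n P = foldl (λ (vs , χ) r → sweepRow P r 1 r vs χ)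
                  (applyUpTo (λ i → suc n + i) n , [])
                  (applyDownFrom suc n)

exits : (n : ℕ) → PipeDream → List ℕ
exits n P = proj₁ (sweep n P)

crossings : (n : ℕ) → PipeDream → List Crossing
crossings n P = proj₂ (sweep n P)

Reduced : (n : ℕ) → PipeDream → Set
Reduced n P = Unique (crossings n P)

reduced? : (n : ℕ) (P : PipeDream) → Dec (Reduced n P)
reduced? n P = DecUnique.unique? _≟₂_ (crossings n P)

triangle : ℕ → List Box
triangle n = filter (λ (a , b) → a + b ≤? n) (grid n)

-- Elbow positions inside the triangle; also the face F(P).
elbows : ℕ → PipeDream → List Box
elbows n P = filter (λ b → ¬? (b ∈? P)) (triangle n)

module _ {n : ℕ} (w : Permutation′ n) where

  Pipes : List PipeDream
  Pipes = filter (λ P → List.≡-dec _≟_ (exits n P) (oneLine w)) (sublists (triangle n))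

  facetsPD : List (List Box)
  facetsPD = map (elbows n) (filter (reduced? n) Pipes)

  -- dim PD(w) - dim F, where a face with k vertices has dimension k - 1.
  codimPD : List Box → ℕ
  codimPD F = maximum (map length facetsPD) ∸ length F

-- A step of the south-east boundary, together with the box it bounds: an east
-- step runs below its box, a north step to the right of its box.
data Step : Set where
  east north : Box → Step

labelEast : ℕ → List (Step × ℕ) → ℕ
labelEast c []                          = 0
labelEast c ((east (_ , c′) , k) ∷ ss) = if does (c ≟ c′) then k else labelEast c ss
labelEast c ((north _ , _) ∷ ss)       = labelEast c ss

labelNorth : ℕ → List (Step × ℕ) → ℕ
labelNorth r []                           = 0
labelNorth r ((north (r′ , _) , k) ∷ ss) = if does (r ≟ r′) then k else labelNorth r ss
labelNorth r ((east _ , _) ∷ ss)         = labelNorth r ss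

Edge : Set
Edge = ℕ × ℕ

module _ {n : ℕ} (π : Permutation′ n) where

  -- The diagram pushed left: row r keeps as many boxes as the diagram has in
  -- row r.  Likewise topCrosses is the diagram pushed up.
  bottomCrosses : PipeDream
  bottomCrosses = filter
    (λ (r , c) → c ≤? length (filter (λ (r′ , _) → r′ ≟ r) (diagram π))) (grid n)

  topCrosses : PipeDream
  topCrosses = filter
    (λ (r , c) → r ≤? length (filter (λ (_ , c′) → c′ ≟ c) (diagram π))) (grid n)

  R : List Box
  R = filter (λ b → (b ∈? bottomCrosses ⊎-dec b ∈? topCrosses) ⊎-dec b ≟₂ (1 , 1)) (grid n)

  boundaryInRow : ℕ → List Step
  boundaryInRow r =
       map east  (filter (λ (r′ , c) → r′ ≟ r ×-dec ¬? ((suc r , c) ∈? R)) R)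
    ++ map north (filter (λ (r′ , c) → r′ ≟ r ×-dec ¬? ((r , suc c) ∈? R)) R)

  boundary : List Step
  boundary = concatMap boundaryInRow (applyDownFrom suc n)

  -- InA p s: the step s, directly preceded by p, belongs to A.  The first
  -- step is an east step that bounds the bottom pipe dream unless π is the
  -- identity; there R(π) is a single box, and counting the first step as a
  -- member of A makes T(π) the one-edge tree.
  InA : Maybe Step → Step → Set
  InA nothing          _         = ⊤
  InA (just _)         (north _) = ⊤
  InA (just (east _))  (east b)  = b ∈ bottomCrosses
  InA (just (north a)) (east b)  = b ∈ bottomCrosses × a ∉ bottomCrosses

  inA? : ∀ p s → Dec (InA p s)
  inA? nothing          _         = yes tt
  inA? (just _)         (north _) = yes tt
  inA? (just (east _))  (east b)  = b ∈? bottomCrosses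
  inA? (just (north a)) (east b)  = b ∈? bottomCrosses ×-dec ¬? (a ∈? bottomCrosses)

  -- p is the preceding step and k its label.  A step outside A repeats k, and
  -- it is directly preceded by a north step.
  labelFrom : Maybe Step → ℕ → List Step → List (Step × ℕ)
  labelFrom p k []       = []
  labelFrom p k (s ∷ ss) =
    let l = if does (inA? p s) then suc k else k
    in (s , l) ∷ labelFrom (just s) l ss

  labelledBoundary : List (Step × ℕ)
  labelledBoundary = labelFrom nothing 0 boundary

  treeLabel : Box → Edge
  treeLabel (r , c) = labelEast c labelledBoundary , labelNorth r labelledBoundary

  columnBelow? : (b a : Box) → Dec (proj₂ a ≡ proj₂ b × proj₁ b < proj₁ a)
  columnBelow? b a = proj₂ a ≟ proj₂ b ×-dec proj₁ b <? proj₁ a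

  columnElbow? : (b a : Box) → Dec (proj₂ a ≡ proj₂ b × a ∉ bottomCrosses)
  columnElbow? b a = proj₂ a ≟ proj₂ b ×-dec ¬? (a ∈? bottomCrosses)

  -- The elbows of the bottom pipe dream in R(π), dropped south: b carries a
  -- dot when fewer boxes of R(π) lie below b than its column has elbows.
  dots : List Box
  dots = filter (λ b → length (filter (columnBelow? b) R)
                         <? length (filter (columnElbow? b) R)) R

  -- The vertices of T(π) are 1 , … , numVertices.
  numVertices : ℕ
  numVertices = maximum (map proj₂ labelledBoundary)

  T : List Edge
  T = map treeLabel dots

  treeLabels : List Edge
  treeLabels = map treeLabel R

  -- The conventional label of the box with a given tree label; nothing when
  -- no box has that label.
  φ : Edge → Maybe Box
  φ e = find (λ b → treeLabel b ≟₂ e) R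

-- (k , e₁ ∷ … ∷ eᵣ ∷ []) stands for β^k x_{e₁} ⋯ x_{eᵣ}.
Term : Set
Term = ℕ × List Edge

-- A list of terms stands for their sum.
Poly : Set
Poly = List Term

monomial : List Edge → Term
monomial es = 0 , es

-- Repeated reduction at the vertex j of β^k x_{es} ∏ x_{ij} ∏ x_{jk}, where the
-- sources i are listed increasingly and the targets k decreasingly.
reduceFan : (j : ℕ) (sources targets : List ℕ) → Term → Poly
reduceFan j []       os       (k , es) = (k , map (j ,_) os ++ es) ∷ []
reduceFan j (i ∷ is) []       (k , es) = (k , map (_, j) (i ∷ is) ++ es) ∷ []
reduceFan j (i ∷ is) (o ∷ os) (k , es) =
     reduceFan j (i ∷ is) os       (k     , (i , o) ∷ es)
  ++ reduceFan j is       (o ∷ os) (k     , (i , o) ∷ es)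
  ++ reduceFan j is       os       (suc k , (i , o) ∷ es)

reduceAt : ℕ → Term → Poly
reduceAt j (k , es) = reduceFan j
  (sort ≤-decTotalOrder (map proj₁ (filter (λ e → proj₂ e ≟ j) es)))
  (reverse (sort ≤-decTotalOrder (map proj₂ (filter (λ e → proj₁ e ≟ j) es))))
  (k , filter (λ e → ¬? (proj₁ e ≟ j) ×-dec ¬? (proj₂ e ≟ j)) es)

-- Front to back.  Reducing at j only creates edges (i , k) with i < j < k, and
-- i was left without incoming edges when it was treated, so one pass suffices.
crf : (m : ℕ) → List Edge → Poly
crf m es = foldl (λ p j → concatMap (reduceAt j) p) (monomial es ∷ []) (oneTo m)

module _ {c ℓ} (K : CommutativeRing c ℓ) where
  open CommutativeRing K renaming (_+_ to _⊕_; _*_ to _⊗_; _-_ to _⊖_; -_ to ⊝_)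
  open Exp semiring using (_^_)

  ∑ : ∀ {a} {A : Set a} → List A → (A → Carrier) → Carrier
  ∑ as f = foldr _⊕_ 0# (map f as)

  ∏ : ∀ {a} {A : Set a} → List A → (A → Carrier) → Carrier
  ∏ as f = foldr _⊗_ 1# (map f as)

  eval : (β : Carrier) (v : Edge → Carrier) → Poly → Carrier
  eval β v p = ∑ p (λ (k , es) → (β ^ k) ⊗ ∏ es v)

  weight : (x y : ℕ → Carrier) → Box → Carrier
  weight x y (i , j) = (x i ⊖ y j) ⊕ x i ⊗ y j

  𝔊 : ∀ {n} → Permutation′ n → (x y : ℕ → Carrier) → Carrier
  𝔊 {n} w x y =
    ∑ (Pipes w) (λ P → ((⊝ 1#) ^ codimPD w (elbows n P)) ⊗ ∏ P (weight x y))

  -- x_{ij} ↦ u(φ(i,j)); the value at pairs that are not tree labels is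
  -- irrelevant, as such variables do not occur.
  substitution : ∀ {n} → Permutation′ n → (u : Box → Carrier) → Edge → Carrier
  substitution π u e = maybe′ u 0# (φ π e)

-- Let t_b be the weight of a cross at b, and z_b = 1 / t_b − 1 for b ∈ R(π).  Both
-- sides equal the sum of ∏_{b ∈ F} z_b over the sets F of boxes of R(π) that contain
-- no two boxes (r , c), (r′ , c′) with r′ < r, c < c′ and (r , c′) ∈ D(π).
--
-- The codimension of F(P) is the number of crosses at which two strands meet
-- again.  By the 0-Hecke relation the signed sum 𝔊 is therefore a sum, without
-- signs, over those tilings whose crosses, read backwards as a bubble sort, take
-- π to the identity; a cross at b counts t_b and an elbow 1 − t_b.  For
-- π = 1π′ with π′ dominant these are the tilings whose elbows satisfy the
-- condition on F.  The boxes outside R(π) are unconstrained and contribute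
-- t_b + (1 − t_b) = 1; inside R(π), dividing by t_b turns the weights into 1 and
-- (1 − t_b) / t_b = z_b.
--
-- On the other side, the reduction x_ij x_jk = x_ik (x_ij + x_jk − 1) at a vertex
-- with several sources and targets expands into lattice chains in a grid of
-- sources and targets.  Summing the possible elbow sets of R(π) row by row, and
-- keeping track only of the labels of the columns that may still hold an elbow,
-- gives the same recursion.

module Submission where

open import Algebra.Bundles using (CommutativeRing)
import Algebra.Properties.Ring as RingProperties
import Algebra.Properties.Semiring.Exp as Exp
import Algebra.Solver.Ring.NaturalCoefficients.Default as SemiringSolver
open import Data.Bool.Base using (Bool; true; false; _∧_; _∨_; if_then_else_) renaming (T to IsTrue)
open import Data.Bool.Properties using (T?)
open import Data.Empty using (⊥; ⊥-elim)
open import Data.Fin.Base as Fin using (Fin; toℕ)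
import Data.Fin.Properties as Fin
open import Data.Fin.Permutation using (Permutation′; _⟨$⟩ʳ_; _⟨$⟩ˡ_; inverseʳ; inverseˡ)
open import Data.List.Base using (List; []; _∷_; _++_; [_]; _∷ʳ_; map; filter; concatMap; length; take; drop; replicate; reverse; foldl; foldr; find; applyUpTo; applyDownFrom; allFin; tabulate; cartesianProduct)
import Data.List.Membership.DecPropositional as DecMembership
open import Data.List.Membership.Propositional using (_∈_; _∉_)
import Data.List.Membership.Propositional.Properties as Mem
import Data.List.Properties as List
open import Data.List.Relation.Binary.Permutation.Propositional as Perm using (_↭_; ↭-sym; ↭-trans; ↭⇒↭ₛ)
import Data.List.Relation.Binary.Permutation.Propositional.Properties as Perm
import Data.List.Relation.Binary.Permutation.Setoid.Properties as SPerm
open import Data.List.Relation.Binary.Pointwise using (Pointwise-≡⇒≡)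
open import Data.List.Relation.Unary.All as All using (All; []; _∷_)
import Data.List.Relation.Unary.All.Properties as All
open import Data.List.Relation.Unary.AllPairs as AllPairs using (AllPairs; []; _∷_)
import Data.List.Relation.Unary.AllPairs.Properties as AllPairs
open import Data.List.Relation.Unary.Any using (here; there)
open import Data.List.Relation.Unary.Sorted.TotalOrder.Properties using (AllPairs⇒Sorted; ↗↭↗⇒≋)
open import Data.List.Relation.Unary.Unique.Propositional using (Unique)
import Data.List.Relation.Unary.Unique.Propositional.Properties as Unique
open import Data.List.Sort.Base using (module SortingAlgorithm)
open import Data.List.Sort.InsertionSort using (sort; insertionSort)
open import Data.Maybe.Base using (just; nothing; maybe′)
open import Data.Nat.Base as ℕ using (ℕ; zero; suc; _+_; _∸_; _⊓_; _⊔_; _≤_; _<_; z≤n; s≤s)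
open import Data.Nat.Properties as ℕ using (_≟_; _≤?_; _<?_; ≤-decTotalOrder; ≤-totalOrder)
open import Data.Nat.Tactic.RingSolver using (solve-∀)
open import Data.Product.Base using (_×_; _,_; proj₁; proj₂; ∃-syntax)
open import Data.Product.Properties using (≡-dec)
open import Data.Sum.Base using (_⊎_; inj₁; inj₂)
open import Data.Unit.Base using (⊤; tt)
open import Function.Base using (_∘_; id; const; case_of_)
import Level
open import Relation.Binary.Definitions using (DecidableEquality; tri<; tri≈; tri>)
open import Relation.Binary.PropositionalEquality as ≡ using (_≡_; _≢_)
open import Relation.Nullary.Decidable using (Dec; yes; no; does; ¬?; _×-dec_; _⊎-dec_; dec-true; dec-false)
open import Relation.Nullary.Negation using (¬_; contradiction)
open import Relation.Unary using (Pred; Decidable)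
open import Defs

open DecMembership _≟₂_ using (_∈?_)

-- The passage from the signed sum to the sorting tilings rests on one tile. On the two orders of a
-- pair of strands, a signed cross of weight t together with an elbow of weight 1 acts by a 2 × 2
-- matrix; a sorting cross of weight t together with an elbow of weight 1 - t acts by its transpose.
-- The expansion into chains rests on a corner of a rectangle. The box in its leftmost column and
-- top row forms no forbidden pair, while elbows elsewhere in that column exclude elbows elsewhere
-- in that row. Inclusion-exclusion over the sets avoiding the rest of the row or the rest of the
-- column gives the three terms of x_ik (x_ij + x_jk - 1) for all sources and targets of a vertex at
-- once. The rectangles of successive vertices are not independent: an edge into the next vertex
-- that also has outgoing edges is reduced again there. Moreover the last column to begin in a row
-- shares its label with that row, where it has no box. This is why a row passes on a whole list of
-- labels, and why `rowSum` takes the column without a box separately, as τ.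

-- Finite sums, products and indicators in a commutative ring.

module Sums {c ℓ} (K : CommutativeRing c ℓ) where
  open CommutativeRing K renaming (_+_ to _⊕_)
  open import Relation.Binary.Reasoning.Setoid setoid

  ∑-cong-All : ∀ {a} {A : Set a} {as : List A} {f g : A → Carrier} →
    All (λ x → f x ≈ g x) as → ∑ K as f ≈ ∑ K as g
  ∑-cong-All []       = refl
  ∑-cong-All (p ∷ ps) = +-cong p (∑-cong-All ps)

  ∑-cong : ∀ {a} {A : Set a} (as : List A) {f g : A → Carrier} →
    (∀ x → f x ≈ g x) → ∑ K as f ≈ ∑ K as g
  ∑-cong []       p = refl
  ∑-cong (a ∷ as) p = +-cong (p a) (∑-cong as p)

  ∑-++ : ∀ {a} {A : Set a} (as bs : List A) (f : A → Carrier) →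
    ∑ K (as ++ bs) f ≈ ∑ K as f ⊕ ∑ K bs f
  ∑-++ []       bs f = sym (+-identityˡ _)
  ∑-++ (a ∷ as) bs f = trans (+-congˡ (∑-++ as bs f)) (sym (+-assoc _ _ _))

  ∑-map : ∀ {a b} {A : Set a} {B : Set b} (h : A → B) (as : List A) (f : B → Carrier) →
    ∑ K (map h as) f ≡ ∑ K as (f ∘ h)
  ∑-map h []       f = ≡.refl
  ∑-map h (a ∷ as) f = ≡.cong (f (h a) ⊕_) (∑-map h as f)

  ∑-concatMap : ∀ {a b} {A : Set a} {B : Set b} (h : A → List B) (as : List A) (f : B → Carrier) →
    ∑ K (concatMap h as) f ≈ ∑ K as (λ x → ∑ K (h x) f)
  ∑-concatMap h []       f = refl
  ∑-concatMap h (a ∷ as) f = trans (∑-++ (h a) _ f) (+-congˡ (∑-concatMap h as f))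

  ∑-zero : ∀ {a} {A : Set a} (as : List A) → ∑ K as (λ _ → 0#) ≈ 0#
  ∑-zero []       = refl
  ∑-zero (a ∷ as) = trans (+-identityˡ _) (∑-zero as)

  private
    interchange : ∀ w x y z → (w ⊕ x) ⊕ (y ⊕ z) ≈ (w ⊕ y) ⊕ (x ⊕ z)
    interchange = solve 4 (λ w x y z → (w :+ x) :+ (y :+ z) := (w :+ y) :+ (x :+ z)) refl
      where open SemiringSolver commutativeSemiring

  ∑-+ : ∀ {a} {A : Set a} (as : List A) (f g : A → Carrier) →
    ∑ K as (λ x → f x ⊕ g x) ≈ ∑ K as f ⊕ ∑ K as g
  ∑-+ []       f g = sym (+-identityˡ _)
  ∑-+ (a ∷ as) f g = trans (+-congˡ (∑-+ as f g)) (interchange _ _ _ _)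

  ∑-*ˡ : ∀ {a} {A : Set a} (as : List A) (x : Carrier) (f : A → Carrier) →
    ∑ K as (λ y → x * f y) ≈ x * ∑ K as f
  ∑-*ˡ []       x f = sym (zeroʳ x)
  ∑-*ˡ (a ∷ as) x f = trans (+-congˡ (∑-*ˡ as x f)) (sym (distribˡ _ _ _))

  ∑-swap : ∀ {a b} {A : Set a} {B : Set b} (as : List A) (bs : List B) (f : A → B → Carrier) →
    ∑ K as (λ x → ∑ K bs (f x)) ≈ ∑ K bs (λ y → ∑ K as (λ x → f x y))
  ∑-swap []       bs f = sym (∑-zero bs)
  ∑-swap (a ∷ as) bs f = trans (+-congˡ (∑-swap as bs f)) (sym (∑-+ bs (f a) _))

  ⟦_⟧ : ∀ {p} {P : Set p} → Dec P → Carrier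
  ⟦ yes _ ⟧ = 1#
  ⟦ no _ ⟧  = 0#

  ⟦⟧-cong : ∀ {p q} {P : Set p} {Q : Set q} (P? : Dec P) (Q? : Dec Q) → (P → Q) → (Q → P) → ⟦ P? ⟧ ≈ ⟦ Q? ⟧
  ⟦⟧-cong (yes p) (yes q) f g = refl
  ⟦⟧-cong (yes p) (no ¬q) f g = contradiction (f p) ¬q
  ⟦⟧-cong (no ¬p) (yes q) f g = contradiction (g q) ¬p
  ⟦⟧-cong (no ¬p) (no ¬q) f g = refl

  ⟦⟧-yes : ∀ {p} {P : Set p} (P? : Dec P) → P → ⟦ P? ⟧ ≈ 1#
  ⟦⟧-yes (yes _) p = refl
  ⟦⟧-yes (no ¬p) p = contradiction p ¬p

  ⟦⟧-× : ∀ {p q} {P : Set p} {Q : Set q} (P? : Dec P) (Q? : Dec Q) → ⟦ P? ×-dec Q? ⟧ ≈ ⟦ P? ⟧ * ⟦ Q? ⟧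
  ⟦⟧-× (yes _) (yes _) = sym (*-identityˡ _)
  ⟦⟧-× (yes _) (no _)  = sym (*-identityˡ _)
  ⟦⟧-× (no _)  (yes _) = sym (zeroˡ _)
  ⟦⟧-× (no _)  (no _)  = sym (zeroˡ _)

  ⟦⟧-*-cong : ∀ {p} {P : Set p} (P? : Dec P) {x y : Carrier} → (P → x ≈ y) → ⟦ P? ⟧ * x ≈ ⟦ P? ⟧ * y
  ⟦⟧-*-cong (yes p) f = *-congˡ (f p)
  ⟦⟧-*-cong (no _)  f = trans (zeroˡ _) (sym (zeroˡ _))

  ∑-filter : ∀ {a p} {A : Set a} {P : Pred A p} (P? : Decidable P) (as : List A) (f : A → Carrier) →
    ∑ K (filter P? as) f ≈ ∑ K as (λ x → ⟦ P? x ⟧ * f x)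
  ∑-filter P? []       f = refl
  ∑-filter P? (a ∷ as) f with P? a
  ... | yes _ = +-cong (sym (*-identityˡ _)) (∑-filter P? as f)
  ... | no _  = trans (∑-filter P? as f) (sym (trans (+-congʳ (zeroˡ _)) (+-identityˡ _)))

  ∏-cong-All : ∀ {a} {A : Set a} {as : List A} {f g : A → Carrier} →
    All (λ x → f x ≈ g x) as → ∏ K as f ≈ ∏ K as g
  ∏-cong-All []       = refl
  ∏-cong-All (p ∷ ps) = *-cong p (∏-cong-All ps)

  ∏-++ : ∀ {a} {A : Set a} (as bs : List A) (f : A → Carrier) →
    ∏ K (as ++ bs) f ≈ ∏ K as f * ∏ K bs f
  ∏-++ []       bs f = sym (*-identityˡ _)
  ∏-++ (a ∷ as) bs f = trans (*-congˡ (∏-++ as bs f)) (sym (*-assoc _ _ _))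

  ∏-map : ∀ {a b} {A : Set a} {B : Set b} (h : A → B) (as : List A) (f : B → Carrier) →
    ∏ K (map h as) f ≡ ∏ K as (f ∘ h)
  ∏-map h []       f = ≡.refl
  ∏-map h (a ∷ as) f = ≡.cong (f (h a) *_) (∏-map h as f)

  ∏-↭ : ∀ {a} {A : Set a} {as bs : List A} (f : A → Carrier) → as ↭ bs → ∏ K as f ≈ ∏ K bs f
  ∏-↭ f Perm.refl         = refl
  ∏-↭ f (Perm.prep x p)   = *-congˡ (∏-↭ f p)
  ∏-↭ f (Perm.swap x y p) = trans (*-congˡ (*-congˡ (∏-↭ f p)))
    (trans (sym (*-assoc _ _ _)) (trans (*-congʳ (*-comm _ _)) (*-assoc _ _ _)))
  ∏-↭ f (Perm.trans p q)  = trans (∏-↭ f p) (∏-↭ f q)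

-- Staircase tilings, read forwards as pipe dreams and backwards as sorting.

bits : ℕ → List (List Bool)
bits zero    = [] ∷ []
bits (suc m) = map (true ∷_) (bits m) ++ map (false ∷_) (bits m)

-- The rows of a staircase of width m, top row first; true marks a cross.
staircases : ℕ → List (List (List Bool))
staircases zero    = [] ∷ []
staircases (suc m) = concatMap (λ b → map (b ∷_) (staircases m)) (bits (suc m))

choose : ∀ {a p} {A : Set a} {P : Set p} → Dec P → A → A → A
choose (yes _) x y = x
choose (no _)  x y = y

-- The labels themselves replace the record of crossings: strands enter in increasing order from
-- left to right and have crossed exactly when they stand in decreasing order. So a cross with
-- `h < v` is a real crossing, and any other one acts as an elbow.
rowF : List Bool → ℕ → List ℕ → List ℕ
rowF bs           h []       = h ∷ []
rowF []           h (v ∷ vs) = h ∷ v ∷ vs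
rowF (false ∷ bs) h (v ∷ vs) = h ∷ rowF bs v vs
rowF (true ∷ bs)  h (v ∷ vs) = choose (h <? v) (v ∷ rowF bs h vs) (h ∷ rowF bs v vs)

wasted : List Bool → ℕ → List ℕ → ℕ
wasted bs           h []       = 0
wasted []           h (v ∷ vs) = 0
wasted (false ∷ bs) h (v ∷ vs) = wasted bs v vs
wasted (true ∷ bs)  h (v ∷ vs) = choose (h <? v) (wasted bs h vs) (suc (wasted bs v vs))

unstep : Bool → ℕ → ℕ × List ℕ → ℕ × List ℕ
unstep true  w (h , vs) = choose (h <? w) (h , w ∷ vs) (w , h ∷ vs)
unstep false w (h , vs) = w , h ∷ vs

-- Bubble sort, read from right to left: a cross moves the smaller entry to the left.
backR : List Bool → List ℕ → ℕ × List ℕ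
backR bs       []          = 0 , []
backR bs       (w ∷ [])    = w , []
backR []       (w ∷ x ∷ W) = unstep false w (backR [] (x ∷ W))
backR (b ∷ bs) (w ∷ x ∷ W) = unstep b w (backR bs (x ∷ W))

fwd : ℕ → List (List Bool) → List ℕ
fwd r []      = r ∷ []
fwd r (b ∷ M) = rowF b r (fwd (suc r) M)

wastedM : ℕ → List (List Bool) → ℕ
wastedM r []      = 0
wastedM r (b ∷ M) = wasted b r (fwd (suc r) M) ℕ.+ wastedM (suc r) M

-- Row r is undone from the word W at its top; the strand that then comes out on the left has to be
-- r, the strand that enters there.
Good : ℕ → List (List Bool) → List ℕ → Set
Good r []      W = W ≡ r ∷ []
Good r (b ∷ M) W = proj₁ (backR b W) ≡ r × Good (suc r) M (proj₂ (backR b W))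

_≟ₗ_ : DecidableEquality (List ℕ)
_≟ₗ_ = List.≡-dec _≟_

_≟ₚ_ : DecidableEquality (ℕ × List ℕ)
_≟ₚ_ = ≡-dec _≟_ _≟ₗ_

good? : ∀ r M W → Dec (Good r M W)
good? r []      W = W ≟ₗ (r ∷ [])
good? r (b ∷ M) W = (proj₁ (backR b W) ≟ r) ×-dec good? (suc r) M (proj₂ (backR b W))

rowF-↭ : ∀ bs h vs → rowF bs h vs ↭ h ∷ vs
rowF-↭ bs           h []       = Perm.refl
rowF-↭ []           h (v ∷ vs) = Perm.refl
rowF-↭ (false ∷ bs) h (v ∷ vs) = Perm.prep h (rowF-↭ bs v vs)
rowF-↭ (true ∷ bs)  h (v ∷ vs) with h <? v
... | yes _ = Perm.trans (Perm.prep v (rowF-↭ bs h vs)) (Perm.swap v h Perm.refl)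
... | no _  = Perm.prep h (rowF-↭ bs v vs)

fwd-≥ : ∀ r M → All (r ≤_) (fwd r M)
fwd-≥ r []      = ℕ.≤-refl ∷ []
fwd-≥ r (b ∷ M) = Perm.All-resp-↭ (↭-sym (rowF-↭ b r _))
  (ℕ.≤-refl ∷ All.map ℕ.<⇒≤ (fwd-≥ (suc r) M))

Unique-resp-↭ : ∀ {xs ys : List ℕ} → xs ↭ ys → Unique xs → Unique ys
Unique-resp-↭ p = SPerm.Unique-resp-↭ (≡.setoid ℕ) (↭⇒↭ₛ p)

fwd-unique′ : ∀ r M → Unique (r ∷ fwd (suc r) M)
fwd-unique : ∀ r M → Unique (fwd r M)
fwd-unique′ r M = All.map ℕ.<⇒≢ (fwd-≥ (suc r) M) ∷ fwd-unique (suc r) M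
fwd-unique r []      = [] ∷ []
fwd-unique r (b ∷ M) = Unique-resp-↭ (↭-sym (rowF-↭ b r _)) (fwd-unique′ r M)

fwd-length : ∀ r M → length (fwd r M) ≡ suc (length M)
fwd-length r []      = ≡.refl
fwd-length r (b ∷ M) = ≡.trans (Perm.↭-length (rowF-↭ b r (fwd (suc r) M))) (≡.cong suc (fwd-length (suc r) M))

unstep-length : ∀ b w h vs → length (proj₂ (unstep b w (h , vs))) ≡ suc (length vs)
unstep-length false w h vs = ≡.refl
unstep-length true w h vs with h <? w
... | yes _ = ≡.refl
... | no _  = ≡.refl

backR-length : ∀ bs w W → length (proj₂ (backR bs (w ∷ W))) ≡ length W
backR-length bs       w []      = ≡.refl
backR-length []       w (x ∷ W) = ≡.cong suc (backR-length [] x W)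
backR-length (b ∷ bs) w (x ∷ W) = ≡.trans (unstep-length b w _ _) (≡.cong suc (backR-length bs x W))

bits-length : ∀ m → All (λ b → length b ≡ m) (bits m)
bits-length zero    = ≡.refl ∷ []
bits-length (suc m) = All.++⁺ (All.map⁺ (All.map (≡.cong suc) (bits-length m)))
                              (All.map⁺ (All.map (≡.cong suc) (bits-length m)))

staircases-length : ∀ m → All (λ M → length M ≡ m) (staircases m)
staircases-length zero    = ≡.refl ∷ []
staircases-length (suc m) = All.concat⁺ (All.map⁺ (All.tabulate {xs = bits (suc m)} λ {b} _ →
  All.map⁺ {f = b ∷_} (All.map (≡.cong suc) (staircases-length m))))

-- The 0-Hecke identity between signed and sorting tilings.

module Hecke {c ℓ} (K : CommutativeRing c ℓ) where
  open CommutativeRing K renaming (_+_ to _⊕_; -_ to ⊝_; _-_ to _⊖_)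
  open RingProperties ring using (-1*x≈-x; -‿distribˡ-*)
  open Exp semiring using (_^_; ^-homo-*)
  open Sums K
  open import Relation.Binary.Reasoning.Setoid setoid
  open SemiringSolver commutativeSemiring using (solve; _:+_; _:*_; _:=_; con)

  rowWt : (t e : ℕ → Carrier) → ℕ → List Bool → Carrier
  rowWt t e i []           = 1#
  rowWt t e i (true ∷ bs)  = t i * rowWt t e (suc i) bs
  rowWt t e i (false ∷ bs) = e i * rowWt t e (suc i) bs

  wt : (t e : ℕ → ℕ → Carrier) → ℕ → List (List Bool) → Carrier
  wt t e r []      = 1#
  wt t e r (b ∷ M) = rowWt (t r) (e r) 0 b * wt t e (suc r) M

  one : ℕ → Carrier
  one _ = 1#

  ∑-bits : ∀ m (f : List Bool → Carrier) →
    ∑ K (bits (suc m)) f ≈ ∑ K (bits m) (f ∘ (true ∷_)) ⊕ ∑ K (bits m) (f ∘ (false ∷_))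
  ∑-bits m f = trans (∑-++ (map (true ∷_) (bits m)) _ f)
    (+-cong (reflexive (∑-map (true ∷_) (bits m) f)) (reflexive (∑-map (false ∷_) (bits m) f)))

  ∑-staircases : ∀ m (f : List (List Bool) → Carrier) →
    ∑ K (staircases (suc m)) f ≈ ∑ K (bits (suc m)) (λ b → ∑ K (staircases m) (λ M → f (b ∷ M)))
  ∑-staircases m f = trans (∑-concatMap _ (bits (suc m)) f)
    (∑-cong (bits (suc m)) (λ b → reflexive (∑-map (b ∷_) (staircases m) f)))

  ⟦⟧-∷ : ∀ h w (a b : List ℕ) → ⟦ (h ∷ a) ≟ₗ (w ∷ b) ⟧ ≈ ⟦ h ≟ w ⟧ * ⟦ a ≟ₗ b ⟧
  ⟦⟧-∷ h w a b = trans (⟦⟧-cong ((h ∷ a) ≟ₗ (w ∷ b)) ((h ≟ w) ×-dec (a ≟ₗ b)) List.∷-injective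
    (λ { (p , q) → ≡.cong₂ _∷_ p q })) (⟦⟧-× (h ≟ w) (a ≟ₗ b))

  ⟦⟧-, : ∀ x w h v (a b : List ℕ) → ⟦ (x , h ∷ a) ≟ₚ (w , v ∷ b) ⟧ ≈ ⟦ w ≟ x ⟧ * ⟦ (h , a) ≟ₚ (v , b) ⟧
  ⟦⟧-, x w h v a b = trans (⟦⟧-cong ((x , h ∷ a) ≟ₚ (w , v ∷ b)) ((w ≟ x) ×-dec ((h , a) ≟ₚ (v , b)))
    (λ { ≡.refl → ≡.refl , ≡.refl }) (λ { (≡.refl , ≡.refl) → ≡.refl })) (⟦⟧-× (w ≟ x) ((h , a) ≟ₚ (v , b)))

  ⟦⟧-,′ : ∀ x w h v (a b : List ℕ) → ⟦ (h , x ∷ a) ≟ₚ (v , w ∷ b) ⟧ ≈ ⟦ w ≟ x ⟧ * ⟦ (h , a) ≟ₚ (v , b) ⟧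
  ⟦⟧-,′ x w h v a b = trans (⟦⟧-cong ((h , x ∷ a) ≟ₚ (v , w ∷ b)) ((w ≟ x) ×-dec ((h , a) ≟ₚ (v , b)))
    (λ { ≡.refl → ≡.refl , ≡.refl }) (λ { (≡.refl , ≡.refl) → ≡.refl })) (⟦⟧-× (w ≟ x) ((h , a) ≟ₚ (v , b)))

  ⟦⟧⟦⟧-zero : ∀ {p q} {P : Set p} {Q : Set q} (P? : Dec P) (Q? : Dec Q) → (P → Q → ⊥) → ⟦ P? ⟧ * ⟦ Q? ⟧ ≈ 0#
  ⟦⟧⟦⟧-zero (no _)  Q?      f = zeroˡ _
  ⟦⟧⟦⟧-zero (yes _) (no _)  f = zeroʳ _
  ⟦⟧⟦⟧-zero (yes p) (yes q) f = ⊥-elim (f p q)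

  absorb : ∀ {t e} x → t ⊕ e ≈ 1# → t * x ⊕ e * x ≈ x
  absorb x t+e = trans (sym (distribʳ x _ _)) (trans (*-congʳ t+e) (*-identityˡ x))

  e≈1-t : ∀ {t e} x → t ⊕ e ≈ 1# → ⊝ 1# * (t * x) ⊕ x ≈ e * x
  e≈1-t {t} {e} x t+e = begin
    ⊝ 1# * (t * x) ⊕ x               ≈⟨ +-congˡ (sym (absorb x t+e)) ⟩
    ⊝ 1# * (t * x) ⊕ (t * x ⊕ e * x) ≈⟨ sym (+-assoc _ _ _) ⟩
    (⊝ 1# * (t * x) ⊕ t * x) ⊕ e * x ≈⟨ +-congʳ (+-congʳ (-1*x≈-x _)) ⟩
    (⊝ (t * x) ⊕ t * x) ⊕ e * x      ≈⟨ +-congʳ (-‿inverseˡ _) ⟩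
    0# ⊕ e * x                       ≈⟨ +-identityˡ _ ⟩
    e * x                            ∎

  module Local {t e : Carrier} (t+e : t ⊕ e ≈ 1#) (w h v : ℕ) (V : List ℕ) where

    -- Here w leaves the tile through the top and p is the result of undoing the tiles to its right.
    -- Forwards, a tile sends an ascent to itself plus t times the descent, and a descent to 1 - t
    -- times itself. Backwards, it sends a descent to e times itself plus t times the ascent, and
    -- fixes an ascent because t + e = 1. This lemma and `unstep-desc` compare the two matrices row
    -- by row: they are transposes of each other.
    unstep-asc : h < v → ∀ p →
      t * ⟦ unstep true w p ≟ₚ (h , v ∷ V) ⟧ ⊕ e * ⟦ unstep false w p ≟ₚ (h , v ∷ V) ⟧
      ≈ t * (⟦ v ≟ w ⟧ * ⟦ p ≟ₚ (h , V) ⟧) ⊕ ⟦ h ≟ w ⟧ * ⟦ p ≟ₚ (v , V) ⟧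
    unstep-asc h<v (h′ , vs) with h′ <? w
    ... | yes h′<w = +-cong (*-congˡ (⟦⟧-,′ w v h′ h vs V))
            (trans (*-congˡ (⟦⟧-, w h h′ v vs V)) (trans (*-congˡ z) (trans (zeroʳ _) (sym z))))
      where z = ⟦⟧⟦⟧-zero (h ≟ w) ((h′ , vs) ≟ₚ (v , V))
                  λ { ≡.refl ≡.refl → ℕ.<-asym h<v h′<w }
    ... | no h′≮w = trans (+-cong (*-congˡ (⟦⟧-, w h h′ v vs V)) (*-congˡ (⟦⟧-, w h h′ v vs V)))
            (trans (absorb _ t+e)
              (trans (sym (+-identityˡ _)) (+-congʳ (sym (trans (*-congˡ z) (zeroʳ _))))))
      where z = ⟦⟧⟦⟧-zero (v ≟ w) ((h′ , vs) ≟ₚ (h , V)) λ { ≡.refl ≡.refl → h′≮w h<v }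

    unstep-desc : v < h → ∀ p →
      t * ⟦ unstep true w p ≟ₚ (h , v ∷ V) ⟧ ⊕ e * ⟦ unstep false w p ≟ₚ (h , v ∷ V) ⟧
      ≈ ⊝ 1# * (t * (⟦ h ≟ w ⟧ * ⟦ p ≟ₚ (v , V) ⟧)) ⊕ ⟦ h ≟ w ⟧ * ⟦ p ≟ₚ (v , V) ⟧
    unstep-desc v<h (h′ , vs) with h′ <? w
    ... | yes h′<w = trans (+-cong (trans (*-congˡ (trans (⟦⟧-,′ w v h′ h vs V) z)) (zeroʳ _)) (*-congˡ (⟦⟧-, w h h′ v vs V)))
            (trans (+-identityˡ _) (sym (e≈1-t _ t+e)))
      where z = ⟦⟧⟦⟧-zero (v ≟ w) ((h′ , vs) ≟ₚ (h , V)) λ { ≡.refl ≡.refl → ℕ.<-asym v<h h′<w }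
    ... | no h′≮w = trans (+-cong (*-congˡ eq) (*-congˡ eq)) (trans (absorb _ t+e) (trans z
            (sym (trans (+-cong (trans (*-congˡ (trans (*-congˡ z) (zeroʳ _))) (zeroʳ _)) z) (+-identityˡ _)))))
      where
        eq = ⟦⟧-, w h h′ v vs V
        z = ⟦⟧⟦⟧-zero (h ≟ w) ((h′ , vs) ≟ₚ (v , V)) λ { ≡.refl ≡.refl → h′≮w v<h }

  module _ {t e : ℕ → Carrier} (t+e : ∀ i → t i ⊕ e i ≈ 1#) where

    -- The first tile fixes the top exit w and sends h or v on to the right, so the induction
    -- hypothesis is used for both of them. What remains is the comparison of the first tiles, made
    -- in `Local` according to the order of h and v.
    hecke-row : ∀ m i h V W → length V ≡ m → length W ≡ suc m → Unique (h ∷ V) →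
      ∑ K (bits m) (λ b → rowWt t one i b * ((⊝ 1#) ^ wasted b h V * ⟦ rowF b h V ≟ₗ W ⟧))
      ≈ ∑ K (bits m) (λ b → rowWt t e i b * ⟦ backR b W ≟ₚ (h , V) ⟧)
    hecke-row zero i h [] (w ∷ []) _ _ _ = +-congʳ (*-congˡ (trans (*-identityˡ _)
      (⟦⟧-cong ((h ∷ []) ≟ₗ (w ∷ [])) ((w , []) ≟ₚ (h , [])) (λ { ≡.refl → ≡.refl }) (λ { ≡.refl → ≡.refl }))))
    hecke-row (suc m) i h (v ∷ V) (w ∷ x ∷ W) lV lW ((h≢v ∷ h∉V) ∷ uV@(v∉V ∷ uV′)) = begin
      ∑ K (bits (suc m)) F
        ≈⟨ ∑-bits m F ⟩
      ∑ K (bits m) (F ∘ (true ∷_)) ⊕ ∑ K (bits m) (F ∘ (false ∷_))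
        ≈⟨ main (ℕ.<-cmp h v) ⟩
      ∑ K (bits m) (G ∘ (true ∷_)) ⊕ ∑ K (bits m) (G ∘ (false ∷_))
        ≈⟨ sym (∑-bits m G) ⟩
      ∑ K (bits (suc m)) G ∎
      where
        F = λ b → rowWt t one i b * ((⊝ 1#) ^ wasted b h (v ∷ V) * ⟦ rowF b h (v ∷ V) ≟ₗ (w ∷ x ∷ W) ⟧)
        G = λ b → rowWt t e i b * ⟦ backR b (w ∷ x ∷ W) ≟ₚ (h , v ∷ V) ⟧
        IH : ∀ y → Unique (y ∷ V) → _
        IH y u = hecke-row m (suc i) y V (x ∷ W) (ℕ.suc-injective lV) (ℕ.suc-injective lW) u
        -- The sum over the remaining tiles, read backwards, when y enters them from the left.
        S : ℕ → Carrier
        S y = ∑ K (bits m) (λ b → rowWt t e (suc i) b * ⟦ backR b (x ∷ W) ≟ₚ (y , V) ⟧)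
        rw : List Bool → Carrier
        rw = rowWt t e (suc i)
        -- Forwards, a first tile of weight c sends z to the top and y to the right.
        push : ∀ (c : Carrier) y z → Unique (y ∷ V) →
          ∑ K (bits m) (λ b → c * rowWt t one (suc i) b * ((⊝ 1#) ^ wasted b y V * ⟦ (z ∷ rowF b y V) ≟ₗ (w ∷ x ∷ W) ⟧))
          ≈ c * (⟦ z ≟ w ⟧ * S y)
        push c y z u = begin
          ∑ K (bits m) (λ b → c * rowWt t one (suc i) b * ((⊝ 1#) ^ wasted b y V * ⟦ (z ∷ rowF b y V) ≟ₗ (w ∷ x ∷ W) ⟧))
            ≈⟨ ∑-cong (bits m) (λ b → trans (*-congˡ (*-congˡ (⟦⟧-∷ z w (rowF b y V) (x ∷ W))))
                 (solve 5 (λ c a s d k → c :* a :* (s :* (d :* k)) := c :* d :* (a :* (s :* k))) refl c _ _ _ _)) ⟩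
          ∑ K (bits m) (λ b → c * ⟦ z ≟ w ⟧ * (rowWt t one (suc i) b * ((⊝ 1#) ^ wasted b y V * ⟦ rowF b y V ≟ₗ (x ∷ W) ⟧)))
            ≈⟨ ∑-*ˡ (bits m) _ _ ⟩
          c * ⟦ z ≟ w ⟧ * ∑ K (bits m) (λ b → rowWt t one (suc i) b * ((⊝ 1#) ^ wasted b y V * ⟦ rowF b y V ≟ₗ (x ∷ W) ⟧))
            ≈⟨ trans (*-congˡ (IH y u)) (*-assoc _ _ _) ⟩
          c * (⟦ z ≟ w ⟧ * S y) ∎
        backward : (A B : List Bool → Carrier) →
          (∀ b → t i * ⟦ unstep true w (backR b (x ∷ W)) ≟ₚ (h , v ∷ V) ⟧ ⊕ e i * ⟦ unstep false w (backR b (x ∷ W)) ≟ₚ (h , v ∷ V) ⟧ ≈ A b ⊕ B b) →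
          ∑ K (bits m) (λ b → rw b * A b) ⊕ ∑ K (bits m) (λ b → rw b * B b)
          ≈ ∑ K (bits m) (G ∘ (true ∷_)) ⊕ ∑ K (bits m) (G ∘ (false ∷_))
        backward A B eq = begin
          ∑ K (bits m) (λ b → rw b * A b) ⊕ ∑ K (bits m) (λ b → rw b * B b)
            ≈⟨ sym (∑-+ (bits m) _ _) ⟩
          ∑ K (bits m) (λ b → rw b * A b ⊕ rw b * B b)
            ≈⟨ ∑-cong (bits m) (λ b → trans (sym (distribˡ _ _ _)) (trans (*-congˡ (sym (eq b)))
                 (solve 5 (λ r t a e b → r :* (t :* a :+ e :* b) := t :* r :* a :+ e :* r :* b) refl (rw b) (t i) _ (e i) _))) ⟩
          ∑ K (bits m) (λ b → G (true ∷ b) ⊕ G (false ∷ b))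
            ≈⟨ ∑-+ (bits m) _ _ ⟩
          ∑ K (bits m) (G ∘ (true ∷_)) ⊕ ∑ K (bits m) (G ∘ (false ∷_)) ∎
        gather : ∀ (c d : Carrier) y → c * (d * S y) ≈ ∑ K (bits m) (λ b → rw b * (c * (d * ⟦ backR b (x ∷ W) ≟ₚ (y , V) ⟧)))
        gather c d y = trans (sym (*-assoc _ _ _)) (trans (sym (∑-*ˡ (bits m) _ _))
          (∑-cong (bits m) λ b → solve 4 (λ c d r k → c :* d :* (r :* k) := r :* (c :* (d :* k))) refl c d _ _))
        falsePart : ∑ K (bits m) (F ∘ (false ∷_)) ≈ ∑ K (bits m) (λ b → rw b * (⟦ h ≟ w ⟧ * ⟦ backR b (x ∷ W) ≟ₚ (v , V) ⟧))
        falsePart = trans (push 1# v h uV) (trans (gather _ _ v) (∑-cong (bits m) λ b → *-congˡ (*-identityˡ _)))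
        main : _ → ∑ K (bits m) (F ∘ (true ∷_)) ⊕ ∑ K (bits m) (F ∘ (false ∷_))
          ≈ ∑ K (bits m) (G ∘ (true ∷_)) ⊕ ∑ K (bits m) (G ∘ (false ∷_))
        main (tri≈ _ h≡v _) = contradiction h≡v h≢v
        main (tri< h<v _ _) = trans (+-cong truePart falsePart)
            (backward _ _ (λ b → Local.unstep-asc (t+e i) w h v V h<v (backR b (x ∷ W))))
          where
            truePart : ∑ K (bits m) (F ∘ (true ∷_)) ≈ ∑ K (bits m) (λ b → rw b * (t i * (⟦ v ≟ w ⟧ * ⟦ backR b (x ∷ W) ≟ₚ (h , V) ⟧)))
            truePart with h <? v
            ... | yes _   = trans (push (t i) h v (h∉V ∷ uV′)) (gather _ _ h)
            ... | no h≮v = contradiction h<v h≮v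
        main (tri> _ _ v<h) = trans (+-cong truePart falsePart)
            (backward _ _ (λ b → Local.unstep-desc (t+e i) w h v V v<h (backR b (x ∷ W))))
          where
            truePart : ∑ K (bits m) (F ∘ (true ∷_)) ≈ ∑ K (bits m) (λ b → rw b * (⊝ 1# * (t i * (⟦ h ≟ w ⟧ * ⟦ backR b (x ∷ W) ≟ₚ (v , V) ⟧))))
            truePart with h <? v
            ... | yes h<v = contradiction h<v (ℕ.<-asym v<h)
            ... | no _   = trans (∑-cong (bits m) (λ b →
                     solve 5 (λ c r o s k → c :* r :* (o :* s :* k) := o :* c :* r :* (s :* k)) refl (t i) _ (⊝ 1#) _ _))
                   (trans (push (⊝ 1# * t i) v h uV) (trans (gather _ _ v)
                     (∑-cong (bits m) λ b → *-congˡ (*-assoc _ _ _))))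

  -- The sums are exchanged twice. With the lower rows fixed, the strands that enter row r from
  -- below are fixed too and `hecke-row` applies; with row r fixed, the lower rows see the word that
  -- is left after undoing it, and the induction hypothesis applies.
  hecke : ∀ {t e : ℕ → ℕ → Carrier} → (∀ r i → t r i ⊕ e r i ≈ 1#) → ∀ m r W → length W ≡ suc m →
    ∑ K (staircases m) (λ M → wt t (λ _ → one) r M * ((⊝ 1#) ^ wastedM r M * ⟦ fwd r M ≟ₗ W ⟧))
    ≈ ∑ K (staircases m) (λ M → wt t e r M * ⟦ good? r M W ⟧)
  hecke {t} {e} t+e zero r W lW = +-congʳ (*-congˡ (trans (*-identityˡ _)
    (⟦⟧-cong ((r ∷ []) ≟ₗ W) (W ≟ₗ (r ∷ [])) ≡.sym ≡.sym)))
  hecke {t} {e} t+e (suc m) r (w ∷ W) lW = begin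
    ∑ K (staircases (suc m)) F
      ≈⟨ ∑-staircases m F ⟩
    ∑ K (bits (suc m)) (λ b → ∑ K (staircases m) (λ M → F (b ∷ M)))
      ≈⟨ ∑-swap (bits (suc m)) (staircases m) (λ b M → F (b ∷ M)) ⟩
    ∑ K (staircases m) (λ M → ∑ K (bits (suc m)) (λ b → F (b ∷ M)))
      ≈⟨ ∑-cong-All (All.map (λ {M} → row {M}) (staircases-length m)) ⟩
    ∑ K (staircases m) (λ M → ∑ K (bits (suc m)) (λ b → H M b))
      ≈⟨ ∑-swap (staircases m) (bits (suc m)) H ⟩
    ∑ K (bits (suc m)) (λ b → ∑ K (staircases m) (λ M → H M b))
      ≈⟨ ∑-cong (bits (suc m)) below ⟩
    ∑ K (bits (suc m)) (λ b → ∑ K (staircases m) (λ M → G (b ∷ M)))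
      ≈⟨ sym (∑-staircases m G) ⟩
    ∑ K (staircases (suc m)) G ∎
    where
      F = λ M → wt t (λ _ → one) r M * ((⊝ 1#) ^ wastedM r M * ⟦ fwd r M ≟ₗ (w ∷ W) ⟧)
      G = λ M → wt t e r M * ⟦ good? r M (w ∷ W) ⟧
      o : List (List Bool) → Carrier
      o M = wt t (λ _ → one) (suc r) M * (⊝ 1#) ^ wastedM (suc r) M
      H : List (List Bool) → List Bool → Carrier
      H M b = o M * (rowWt (t r) (e r) 0 b * ⟦ backR b (w ∷ W) ≟ₚ (r , fwd (suc r) M) ⟧)
      row : ∀ {M} → length M ≡ m → ∑ K (bits (suc m)) (λ b → F (b ∷ M)) ≈ ∑ K (bits (suc m)) (H M)
      row {M} lM = begin
        ∑ K (bits (suc m)) (λ b → F (b ∷ M))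
          ≈⟨ ∑-cong (bits (suc m)) (λ b → trans (*-congˡ (*-congʳ (^-homo-* (⊝ 1#) (wasted b r (fwd (suc r) M)) _)))
               (solve 5 (λ a b s s′ k → a :* b :* (s :* s′ :* k) := b :* s′ :* (a :* (s :* k))) refl _ _ _ _ _)) ⟩
        ∑ K (bits (suc m)) (λ b → o M * (rowWt (t r) one 0 b * ((⊝ 1#) ^ wasted b r (fwd (suc r) M) * ⟦ rowF b r (fwd (suc r) M) ≟ₗ (w ∷ W) ⟧)))
          ≈⟨ ∑-*ˡ (bits (suc m)) (o M) _ ⟩
        o M * ∑ K (bits (suc m)) (λ b → rowWt (t r) one 0 b * ((⊝ 1#) ^ wasted b r (fwd (suc r) M) * ⟦ rowF b r (fwd (suc r) M) ≟ₗ (w ∷ W) ⟧))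
          ≈⟨ *-congˡ (hecke-row (t+e r) (suc m) 0 r (fwd (suc r) M) (w ∷ W)
               (≡.trans (fwd-length (suc r) M) (≡.cong suc lM)) lW (fwd-unique′ r M)) ⟩
        o M * ∑ K (bits (suc m)) (λ b → rowWt (t r) (e r) 0 b * ⟦ backR b (w ∷ W) ≟ₚ (r , fwd (suc r) M) ⟧)
          ≈⟨ sym (∑-*ˡ (bits (suc m)) (o M) _) ⟩
        ∑ K (bits (suc m)) (H M) ∎
      below : ∀ b → ∑ K (staircases m) (λ M → H M b) ≈ ∑ K (staircases m) (λ M → G (b ∷ M))
      below b = begin
        ∑ K (staircases m) (λ M → H M b)
          ≈⟨ ∑-cong (staircases m) (λ M → trans (*-congˡ (*-congˡ (split M)))
               (solve 5 (λ u s x p q → u :* s :* (x :* (p :* q)) := x :* p :* (u :* (s :* q))) refl _ _ _ _ _)) ⟩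
        ∑ K (staircases m) (λ M → d * (wt t (λ _ → one) (suc r) M * ((⊝ 1#) ^ wastedM (suc r) M * ⟦ fwd (suc r) M ≟ₗ V ⟧)))
          ≈⟨ ∑-*ˡ (staircases m) d _ ⟩
        d * ∑ K (staircases m) (λ M → wt t (λ _ → one) (suc r) M * ((⊝ 1#) ^ wastedM (suc r) M * ⟦ fwd (suc r) M ≟ₗ V ⟧))
          ≈⟨ *-congˡ (hecke {t} {e} t+e m (suc r) V (≡.trans (backR-length b w W) (ℕ.suc-injective lW))) ⟩
        d * ∑ K (staircases m) (λ M → wt t e (suc r) M * ⟦ good? (suc r) M V ⟧)
          ≈⟨ sym (∑-*ˡ (staircases m) d _) ⟩
        ∑ K (staircases m) (λ M → d * (wt t e (suc r) M * ⟦ good? (suc r) M V ⟧))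
          ≈⟨ ∑-cong (staircases m) (λ M → trans
               (solve 4 (λ x p u q → x :* p :* (u :* q) := x :* u :* (p :* q)) refl _ _ _ _)
               (*-congˡ (sym (⟦⟧-× (h ≟ r) (good? (suc r) M V))))) ⟩
        ∑ K (staircases m) (λ M → G (b ∷ M)) ∎
        where
          h = proj₁ (backR b (w ∷ W))
          V = proj₂ (backR b (w ∷ W))
          d = rowWt (t r) (e r) 0 b * ⟦ h ≟ r ⟧
          split : ∀ M → ⟦ backR b (w ∷ W) ≟ₚ (r , fwd (suc r) M) ⟧ ≈ ⟦ h ≟ r ⟧ * ⟦ fwd (suc r) M ≟ₗ V ⟧
          split M = trans (⟦⟧-cong (backR b (w ∷ W) ≟ₚ (r , fwd (suc r) M)) ((h ≟ r) ×-dec (fwd (suc r) M ≟ₗ V))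
            (λ p → ≡.cong proj₁ p , ≡.sym (≡.cong proj₂ p)) (λ { (p , q) → ≡.cong₂ _,_ p (≡.sym q) })) (⟦⟧-× (h ≟ r) (fwd (suc r) M ≟ₗ V))

-- Positions, prefix counts and inversion codes of words.

data At : List ℕ → ℕ → ℕ → Set where
  here  : ∀ {x xs} → At (x ∷ xs) 0 x
  there : ∀ {x xs i v} → At xs i v → At (x ∷ xs) (suc i) v

-- Columns are counted from 0 here, those of boxes from 1.
data Elbow : List Bool → ℕ → Set where
  here  : ∀ {bs} → Elbow (false ∷ bs) 0
  there : ∀ {b bs c} → Elbow bs c → Elbow (b ∷ bs) (suc c)

le : ℕ → ℕ → ℕ
le v x = choose (x ≤? v) 1 0

count≤ : ℕ → List ℕ → ℕ
count≤ v []       = 0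
count≤ v (x ∷ xs) = le v x + count≤ v xs

-- The entry of the inversion code at the value v: only what stands in front of the first v is
-- counted.
larger : ℕ → List ℕ → ℕ
larger v []       = 0
larger v (x ∷ xs) = choose (x ≟ v) 0 (choose (v <? x) 1 0 + larger v xs)

le-≤ : ∀ {v x} → x ≤ v → le v x ≡ 1
le-≤ {v} {x} p with x ≤? v
... | yes _  = ≡.refl
... | no x≰v = contradiction p x≰v

le-≤1 : ∀ v x → le v x ≤ 1
le-≤1 v x with x ≤? v
... | yes _ = ℕ.≤-refl
... | no _  = z≤n

At⇒∈ : ∀ {xs i v} → At xs i v → v ∈ xs
At⇒∈ here      = here ≡.refl
At⇒∈ (there a) = there (At⇒∈ a)

∈⇒At : ∀ {xs v} → v ∈ xs → ∃[ i ] At xs i v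
∈⇒At (here ≡.refl) = 0 , here
∈⇒At (there p)     = let i , a = ∈⇒At p in suc i , there a

At-unique : ∀ {xs i j v} → Unique xs → At xs i v → At xs j v → i ≡ j
At-unique u       here      here      = ≡.refl
At-unique (p ∷ u) here      (there b) = contradiction ≡.refl (All.lookup p (At⇒∈ b))
At-unique (p ∷ u) (there a) here      = contradiction ≡.refl (All.lookup p (At⇒∈ a))
At-unique (p ∷ u) (there a) (there b) = ≡.cong suc (At-unique u a b)

At-functional : ∀ {xs i v w} → At xs i v → At xs i w → v ≡ w
At-functional here      here      = ≡.refl
At-functional (there a) (there b) = At-functional a b

At-<length : ∀ {xs i v} → At xs i v → i < length xs
At-<length here      = s≤s z≤n
At-<length (there a) = s≤s (At-<length a)

count≤-At : ∀ {xs i v x} k → At xs i x → i < k → x ≤ v → 1 ≤ count≤ v (take k xs)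
count≤-At {v = v} (suc k) (here {xs = xs}) _ x≤v = ℕ.≤-trans (ℕ.≤-reflexive (≡.sym (le-≤ x≤v))) (ℕ.m≤m+n _ _)
count≤-At (suc k) (there a) (s≤s i<k) x≤v = ℕ.≤-trans (count≤-At k a i<k x≤v) (ℕ.m≤n+m _ _)

count≤-At₂ : ∀ {xs i j v x y} k → At xs i x → At xs j y → i < j → j < k → x ≤ v → y ≤ v →
  2 ≤ count≤ v (take k xs)
count≤-At₂ (suc k) here (there b) _ (s≤s j<k) x≤v y≤v =
  ℕ.+-mono-≤ (ℕ.≤-reflexive (≡.sym (le-≤ x≤v))) (count≤-At k b j<k y≤v)
count≤-At₂ (suc k) (there a) (there b) (s≤s i<j) (s≤s j<k) x≤v y≤v =
  ℕ.≤-trans (count≤-At₂ k a b i<j j<k x≤v y≤v) (ℕ.m≤n+m _ _)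

-- Everything in front of the minimum is larger than it.
larger-At : ∀ {xs q r} → Unique xs → All (r ≤_) xs → At xs q r → larger r xs ≡ q
larger-At {x ∷ xs} u all here with x ≟ x
... | yes _  = ≡.refl
... | no x≢x = contradiction ≡.refl x≢x
larger-At {x ∷ xs} {r = r} (p ∷ u) (r≤x ∷ all) (there a) with x ≟ r | r <? x
... | yes ≡.refl | _      = contradiction ≡.refl (All.lookup p (At⇒∈ a))
... | no x≢r     | yes _  = ≡.cong suc (larger-At u all a)
... | no x≢r     | no r≮x = contradiction (ℕ.≤∧≢⇒< r≤x (x≢r ∘ ≡.sym)) r≮x

larger-head : ∀ v xs → larger v (v ∷ xs) ≡ 0
larger-head v xs with v ≟ v
... | yes _  = ≡.refl
... | no v≢v = contradiction ≡.refl v≢v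

larger-skip : ∀ v x xs → x < v → larger v (x ∷ xs) ≡ larger v xs
larger-skip v x xs x<v with x ≟ v | v <? x
... | yes x≡v | _       = contradiction x<v (ℕ.<-irrefl x≡v)
... | no _    | yes v<x = contradiction v<x (ℕ.<-asym x<v)
... | no _    | no _    = ≡.refl

larger-cons : ∀ v x xs ys → larger v xs ≤ larger v ys → larger v (x ∷ xs) ≤ larger v (x ∷ ys)
larger-cons v x xs ys p with x ≟ v
... | yes _ = z≤n
... | no _  = ℕ.+-monoʳ-≤ (choose (v <? x) 1 0) p

larger-swap : ∀ v w h xs → h < w → v ≢ w → larger v (h ∷ w ∷ xs) ≤ larger v (w ∷ h ∷ xs)
larger-swap v w h xs h<w v≢w with w ≟ v
... | yes w≡v = contradiction (≡.sym w≡v) v≢w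
... | no _ with h ≟ v
...   | yes ≡.refl = z≤n
...   | no _       = ℕ.≤-reflexive (lemma (choose (v <? h) 1 0) (choose (v <? w) 1 0) (larger v xs))
  where
    lemma : ∀ a b c → a + (b + c) ≡ b + (a + c)
    lemma = solve-∀

-- How entries move when one row is undone.

unstep-↭ : ∀ b w h V → proj₁ (unstep b w (h , V)) ∷ proj₂ (unstep b w (h , V)) ↭ w ∷ h ∷ V
unstep-↭ false w h V = Perm.refl
unstep-↭ true  w h V with h <? w
... | yes _ = Perm.swap h w Perm.refl
... | no _  = Perm.refl

backR-↭ : ∀ bs w W → proj₁ (backR bs (w ∷ W)) ∷ proj₂ (backR bs (w ∷ W)) ↭ w ∷ W
backR-↭ bs       w []      = Perm.refl
backR-↭ []       w (x ∷ W) = Perm.prep w (backR-↭ [] x W)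
backR-↭ (b ∷ bs) w (x ∷ W) = Perm.trans (unstep-↭ b w _ _) (Perm.prep w (backR-↭ bs x W))

unstep-count : ∀ v k b w h V →
  count≤ v (take (suc k) (proj₂ (unstep b w (h , V)))) + le v (proj₁ (unstep b w (h , V)))
  ≡ le v w + (count≤ v (take k V) + le v h)
unstep-count v k false w h V = lemma (le v h) (count≤ v (take k V)) (le v w)
  where
    lemma : ∀ a b c → (a + b) + c ≡ c + (b + a)
    lemma = solve-∀
unstep-count v k true w h V with h <? w
... | yes _ = ℕ.+-assoc (le v w) _ _
... | no _  = unstep-count v k false w h V

-- The strand that leaves on the left and the first k entries that stay behind consist of the first
-- k old entries and at most one more, carried in from further right; this one accounts for the
-- `suc`.
backR-count : ∀ v k bs w W →
  count≤ v (take k (proj₂ (backR bs (w ∷ W)))) + le v (proj₁ (backR bs (w ∷ W))) ≤ suc (count≤ v (take k (w ∷ W)))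
backR-count v zero    bs       w W       = le-≤1 v _
backR-count v (suc k) bs       w []      = ℕ.m≤n⇒m≤1+n (ℕ.m≤m+n _ _)
backR-count v (suc k) []       w (x ∷ W) = ℕ.≤-trans (ℕ.≤-reflexive (unstep-count v k false w _ _))
  (ℕ.≤-trans (ℕ.+-monoʳ-≤ (le v w) (backR-count v k [] x W)) (ℕ.≤-reflexive (ℕ.+-suc (le v w) _)))
backR-count v (suc k) (b ∷ bs) w (x ∷ W) = ℕ.≤-trans (ℕ.≤-reflexive (unstep-count v k b w _ _))
  (ℕ.≤-trans (ℕ.+-monoʳ-≤ (le v w) (backR-count v k bs x W)) (ℕ.≤-reflexive (ℕ.+-suc (le v w) _)))

-- An elbow in column c lets nothing through from the right, so the strand that leaves and the first
-- c entries that stay behind all come from the first c + 1 old entries.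
backR-count-elbow : ∀ v {c bs} w W → Elbow bs c →
  count≤ v (take c (proj₂ (backR bs (w ∷ W)))) + le v (proj₁ (backR bs (w ∷ W))) ≤ count≤ v (take (suc c) (w ∷ W))
backR-count-elbow v {zero}  w []      e         = ℕ.m≤m+n _ 0
backR-count-elbow v {suc c} w []      e         = ℕ.m≤m+n _ 0
backR-count-elbow v         w (x ∷ W) here      = ℕ.m≤m+n _ 0
backR-count-elbow v {suc c} w (x ∷ W) (there {b} e) = ℕ.≤-trans (ℕ.≤-reflexive (unstep-count v c b w _ _))
  (ℕ.+-monoʳ-≤ (le v w) (backR-count-elbow v x W e))

unstep-larger : ∀ v b w h V Y → v ∉ h ∷ V ⊎ v ≢ w → larger v (h ∷ V) ≤ larger v Y →
  larger v (proj₁ (unstep b w (h , V)) ∷ proj₂ (unstep b w (h , V))) ≤ larger v (w ∷ Y)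
unstep-larger v false w h V Y s p = larger-cons v w (h ∷ V) Y p
unstep-larger v true  w h V Y s p with h <? w
... | no _    = larger-cons v w (h ∷ V) Y p
... | yes h<w with v ≟ w
...   | no v≢w    = ℕ.≤-trans (larger-swap v w h V h<w v≢w) (larger-cons v w (h ∷ V) Y p)
...   | yes ≡.refl = ℕ.≤-trans (ℕ.≤-reflexive (≡.trans (larger-skip v h (v ∷ V) h<w) (larger-head v V))) z≤n

-- A cross only ever moves the smaller of two entries to the left, so no entry gains a larger one in
-- front of it.
backR-larger : ∀ v bs w W → Unique (w ∷ W) →
  larger v (proj₁ (backR bs (w ∷ W)) ∷ proj₂ (backR bs (w ∷ W))) ≤ larger v (w ∷ W)
backR-larger v bs       w []      u       = ℕ.≤-refl
backR-larger v []       w (x ∷ W) (_ ∷ u) = larger-cons v w (proj₁ (backR [] (x ∷ W)) ∷ proj₂ (backR [] (x ∷ W))) (x ∷ W) (backR-larger v [] x W u)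
backR-larger v (b ∷ bs) w (x ∷ W) (p ∷ u) = unstep-larger v b w _ _ (x ∷ W) s (backR-larger v bs x W u)
  where
    s : _ ∉ _ ⊎ _
    s with v ≟ w
    ... | no v≢w     = inj₂ v≢w
    ... | yes ≡.refl = inj₁ λ v∈ → All.lookup p (Perm.∈-resp-↭ (backR-↭ bs x W) v∈) ≡.refl

-- An entry v that ends up at index q was there before, or an elbow in column q
-- stopped it, or it was stopped by a smaller entry x.
backR-At : ∀ {v q} bs w W → length bs ≡ length W → At (proj₂ (backR bs (w ∷ W))) q v →
  At (w ∷ W) q v ⊎ Elbow bs q ⊎
  ∃[ x ] (At (w ∷ W) q x × x < v ×
    (proj₁ (backR bs (w ∷ W)) ≡ x ⊎ ∃[ i ] (i < q × At (w ∷ W) i (proj₁ (backR bs (w ∷ W))))))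
backR-At bs          w []      l ()
backR-At (false ∷ bs) w (x ∷ W) l here      = inj₂ (inj₁ here)
backR-At (false ∷ bs) w (x ∷ W) l (there a) with backR-At bs x W (ℕ.suc-injective l) a
... | inj₁ p                        = inj₁ (there p)
... | inj₂ (inj₁ p)                 = inj₂ (inj₁ (there p))
... | inj₂ (inj₂ (y , p , y<v , _)) = inj₂ (inj₂ (y , there p , y<v , inj₂ (0 , s≤s z≤n , here)))
backR-At {v} {q} (true ∷ bs) w (x ∷ W) l a
  with proj₁ (backR bs (x ∷ W)) <? w | (λ a → backR-At {v} {ℕ.pred q} bs x W (ℕ.suc-injective l) a)
... | yes h<w | IH with a
...   | here     = inj₁ here
...   | there a′ with IH a′
...     | inj₁ p        = inj₁ (there p)
...     | inj₂ (inj₁ p) = inj₂ (inj₁ (there p))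
...     | inj₂ (inj₂ (y , p , y<v , inj₁ h≡y))           = inj₂ (inj₂ (y , there p , y<v , inj₁ h≡y))
...     | inj₂ (inj₂ (y , p , y<v , inj₂ (i , i<q , a″))) = inj₂ (inj₂ (y , there p , y<v , inj₂ (suc i , s≤s i<q , there a″)))
backR-At {v} {q} (true ∷ bs) w (x ∷ W) l a | no h≮w | IH with a
...   | there a′ with IH a′
...     | inj₁ p                        = inj₁ (there p)
...     | inj₂ (inj₁ p)                 = inj₂ (inj₁ (there p))
...     | inj₂ (inj₂ (y , p , y<v , _)) = inj₂ (inj₂ (y , there p , y<v , inj₂ (0 , s≤s z≤n , here)))
backR-At {v} {q} (true ∷ bs) w (x ∷ W) l a | no h≮w | IH | here with w ≟ v
...     | yes ≡.refl = inj₁ here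
...     | no w≢v     = inj₂ (inj₂ (w , here , ℕ.≤∧≢⇒< (ℕ.≮⇒≥ h≮w) w≢v , inj₁ ≡.refl))

-- No strand from the right of an elbow gets past it.
backR-elbow : ∀ {c bs} w W → Elbow bs c → ∃[ i ] (i ≤ c × At (w ∷ W) i (proj₁ (backR bs (w ∷ W))))
backR-elbow w []      e    = 0 , z≤n , here
backR-elbow w (x ∷ W) here = 0 , z≤n , here
backR-elbow w (x ∷ W) (there {false} e) = 0 , z≤n , here
backR-elbow w (x ∷ W) (there {true} {bs} e) with proj₁ (backR bs (x ∷ W)) <? w | backR-elbow x W e
... | no _  | _             = 0 , z≤n , here
... | yes _ | (i , i≤c , a) = suc i , s≤s i≤c , there a

-- A cross never stops the smallest entry; only an elbow in front of it can.
backR-min : ∀ {r q} bs w W → length bs ≡ length W → Unique (w ∷ W) → All (r ≤_) (w ∷ W) → At (w ∷ W) q r →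
  (∀ {c} → c < q → ¬ Elbow bs c) → proj₁ (backR bs (w ∷ W)) ≡ r
backR-min bs w [] l u all here no-elbow = ≡.refl
backR-min (false ∷ bs) w (x ∷ W) l u all here no-elbow = ≡.refl
backR-min {r} (true ∷ bs) w (x ∷ W) l u (_ ∷ all) here no-elbow with proj₁ (backR bs (x ∷ W)) <? w
... | no _    = ≡.refl
... | yes h<w = contradiction h<w (ℕ.≤⇒≯ (All.lookup all (Perm.∈-resp-↭ (backR-↭ bs x W) (here ≡.refl))))
backR-min (false ∷ bs) w (x ∷ W) l u all (there a) no-elbow = contradiction here (no-elbow (s≤s z≤n))
backR-min {r} (true ∷ bs) w (x ∷ W) l (p ∷ u) (r≤w ∷ all) (there a) no-elbow
  with proj₁ (backR bs (x ∷ W)) <? w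
    | backR-min bs x W (ℕ.suc-injective l) u all a (λ c<q e → no-elbow (s≤s c<q) (there e))
... | yes _  | h≡r    = h≡r
... | no h≮w | h≡r = contradiction (≡.subst (_< w) (≡.sym h≡r) (ℕ.≤∧≢⇒< r≤w λ { ≡.refl → All.lookup p (At⇒∈ a) ≡.refl })) h≮w

-- Sorting tilings are those without a forbidden pair of elbows.

Staircase : List (List Bool) → Set
Staircase []      = ⊤
Staircase (b ∷ M) = length b ≡ suc (length M) × Staircase M

staircases-Staircase : ∀ m → All Staircase (staircases m)
staircases-Staircase zero    = tt ∷ []
staircases-Staircase (suc m) = All.concat⁺ (All.map⁺ (All.map
  (λ {b} lb → All.map⁺ {f = b ∷_} (All.zipWith (λ { (lM , s) → ≡.trans lb (≡.cong suc (≡.sym lM)) , s })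
    (staircases-length m , staircases-Staircase m))) (bits-length (suc m))))

module Shape (Λ : ℕ → ℕ) (Λ-anti : ∀ {r s} → r ≤ s → Λ s ≤ Λ r) where

  -- No elbow has another one above its row, to its right, in a column ≤ Λ of
  -- the lower row; Above holds of the columns with an elbow above M.
  NoBadPair : ℕ → List (List Bool) → (ℕ → Set) → Set
  NoBadPair r []      Above = ⊤
  NoBadPair r (b ∷ M) Above =
    (∀ {c c′} → Elbow b c → Above c′ → c < c′ → ¬ (c′ ≤ Λ r)) ×
    NoBadPair (suc r) M (λ c → Above c ⊎ Elbow b c)

  -- W is the word left after successfully undoing the rows above r. The first three fields say that
  -- it is a permutation of r, r + 1, .... In the diagram, row v corresponds to the indices 1, ...,
  -- Λ v, and in the word of π the letters up to v avoid these places; `atMost1` and `fewer` are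
  -- what survives of this. `stopped` and `beyond` describe the effect of the elbows passed so far:
  -- a letter comes to rest within its own row only at the front or under an elbow, and an elbow in
  -- column c ≤ Λ v leaves no letter up to v in front of c.
  record Inv (r : ℕ) (W : List ℕ) (Above : ℕ → Set) : Set where
    field
      unique  : Unique W
      bounded : All (r ≤_) W
      full    : ∀ {v} → r ≤ v → v < r + length W → v ∈ W
      atMost1 : ∀ {v} → r ≤ v → count≤ v (take (suc (Λ v)) W) ≤ 1
      fewer   : ∀ {v} → v ∈ W → larger v W ≤ Λ v
      stopped : ∀ {v q} → At W q v → q ≤ Λ v → q ≡ 0 ⊎ Above q
      beyond  : ∀ {v c} → r ≤ v → Above c → c ≤ Λ v → count≤ v (take c W) ≡ 0

  module RowStep {r W w Above} (I : Inv r (w ∷ W) Above) (b : List Bool) (lb : length b ≡ length W) where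
    open Inv I
    h = proj₁ (backR b (w ∷ W))
    V = proj₂ (backR b (w ∷ W))

    position : ∃[ q ] At (w ∷ W) q r
    position = ∈⇒At (full ℕ.≤-refl (ℕ.≤-trans (ℕ.≤-reflexive (ℕ.+-comm 1 r)) (ℕ.+-monoʳ-≤ r (s≤s z≤n))))

    q = proj₁ position
    at = proj₂ position

    q≤Λ : q ≤ Λ r
    q≤Λ = ≡.subst (_≤ Λ r) (larger-At unique bounded at) (fewer (At⇒∈ at))

    -- The strand that leaves on the left comes from an index up to c, whereas `beyond` excludes r
    -- from the first c′ places.
    good⇒ : h ≡ r → ∀ {c c′} → Elbow b c → Above c′ → c < c′ → ¬ (c′ ≤ Λ r)
    good⇒ h≡r {c} {c′} e ab c<c′ c′≤Λ with backR-elbow w W e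
    ... | i , i≤c , a = ℕ.n≮n 0 (≡.subst (1 ≤_) (beyond ℕ.≤-refl ab c′≤Λ)
            (count≤-At c′ (≡.subst (At (w ∷ W) i) h≡r a) (ℕ.≤-<-trans i≤c c<c′) ℕ.≤-refl))

    -- The letter r stands at an index q ≤ Λ r, hence at the front or under an elbow of column q. An
    -- elbow of row r in front of it would form a forbidden pair with that one, so r runs through to
    -- the left.
    ⇒good : (∀ {c c′} → Elbow b c → Above c′ → c < c′ → ¬ (c′ ≤ Λ r)) → h ≡ r
    ⇒good nb = backR-min b w W lb unique bounded at λ c<q e → elbow-free c<q e (stopped at q≤Λ)
      where
        elbow-free : ∀ {c} → c < q → Elbow b c → q ≡ 0 ⊎ Above q → ⊥
        elbow-free c<q e (inj₁ q≡0) = ℕ.n≮0 (≡.subst (_ <_) q≡0 c<q)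
        elbow-free c<q e (inj₂ ab)  = nb e ab c<q q≤Λ

    next : h ≡ r → Inv (suc r) V (λ c → Above c ⊎ Elbow b c)
    next h≡r = record
      { unique  = AllPairs.tail unique′
      ; bounded = All.zipWith (λ { (r≤x , h≢x) → ℕ.≤∧≢⇒< r≤x (h≢x ∘ ≡.trans h≡r) })
                    (All.tail bounded′ , AllPairs.head unique′)
      ; full    = λ {v} r<v v< → tail∈ r<v (Perm.∈-resp-↭ (↭-sym perm) (full (ℕ.<⇒≤ r<v) (≡.subst (v <_)
                    (≡.trans (≡.cong (suc r +_) (backR-length b w W)) (≡.sym (ℕ.+-suc r (length W)))) v<)))
      ; atMost1 = λ {v} r<v → ℕ.≤-trans (count-mono (ℕ.<⇒≤ r<v) (suc (Λ v))) (atMost1 (ℕ.<⇒≤ r<v))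
      ; fewer   = λ {v} v∈V → ℕ.≤-trans (ℕ.≤-reflexive (≡.sym (larger-skip v h V (h<V v∈V))))
                    (ℕ.≤-trans (backR-larger v b w W unique) (fewer (Perm.∈-resp-↭ perm (there v∈V))))
      ; stopped = stopped′
      ; beyond  = beyond′
      }
      where
        perm = backR-↭ b w W
        unique′ : Unique (h ∷ V)
        unique′ = Unique-resp-↭ (↭-sym perm) unique
        bounded′ : All (r ≤_) (h ∷ V)
        bounded′ = Perm.All-resp-↭ (↭-sym perm) bounded
        h≤ : ∀ {v} → r ≤ v → h ≤ v
        h≤ = ≡.subst (_≤ _) (≡.sym h≡r)
        h<V : ∀ {v} → v ∈ V → h < v
        h<V v∈V = ℕ.≤∧≢⇒< (h≤ (All.lookup bounded′ (there v∈V))) (All.lookup (AllPairs.head unique′) v∈V)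
        tail∈ : ∀ {v} → suc r ≤ v → v ∈ h ∷ V → v ∈ V
        tail∈ r<v (here v≡h) = contradiction r<v (ℕ.<-irrefl (≡.sym (≡.trans v≡h h≡r)))
        tail∈ r<v (there p)  = p
        count-mono : ∀ {v} → r ≤ v → ∀ k → count≤ v (take k V) ≤ count≤ v (take k (w ∷ W))
        count-mono {v} r≤v k = ℕ.s≤s⁻¹ (≡.subst (_≤ suc (count≤ v (take k (w ∷ W))))
          (≡.trans (≡.cong (count≤ v (take k V) +_) (le-≤ (h≤ r≤v))) (ℕ.+-comm _ 1)) (backR-count v k b w W))
        stopped′ : ∀ {v q} → At V q v → q ≤ Λ v → q ≡ 0 ⊎ (Above q ⊎ Elbow b q)
        stopped′ {v} {q} a q≤Λv with backR-At b w W lb a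
        ... | inj₁ a′ with stopped a′ q≤Λv
        ...   | inj₁ q≡0 = inj₁ q≡0
        ...   | inj₂ ab  = inj₂ (inj₁ ab)
        stopped′ a q≤Λv | inj₂ (inj₁ e) = inj₂ (inj₂ e)
        -- The smaller entry x was at index q itself, where `stopped` applies to it, since q ≤ Λ v ≤
        -- Λ x.
        stopped′ {v} {q} a q≤Λv | inj₂ (inj₂ (x , a′ , x<v , inj₁ h≡x))
          with stopped a′ (ℕ.≤-trans q≤Λv (Λ-anti (ℕ.<⇒≤ x<v)))
        ...   | inj₁ q≡0 = inj₁ q≡0
        ...   | inj₂ ab  = inj₂ (inj₁ ab)
        -- Both x and the strand that left stood within the first Λ v + 1 places, and neither
        -- exceeds v.
        stopped′ {v} {q} a q≤Λv | inj₂ (inj₂ (x , a′ , x<v , inj₂ (i , i<q , a″))) =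
          contradiction (count≤-At₂ (suc (Λ v)) a″ a′ i<q (s≤s q≤Λv) (ℕ.<⇒≤ (h<V (At⇒∈ a))) (ℕ.<⇒≤ x<v))
            (ℕ.≤⇒≯ (atMost1 (ℕ.≤-trans (All.lookup bounded (At⇒∈ a′)) (ℕ.<⇒≤ x<v))))
        beyond′ : ∀ {v c} → suc r ≤ v → Above c ⊎ Elbow b c → c ≤ Λ v → count≤ v (take c V) ≡ 0
        beyond′ {v} {c} r<v (inj₁ ab) c≤Λ = ℕ.n≤0⇒n≡0 (ℕ.≤-trans (count-mono (ℕ.<⇒≤ r<v) c)
          (ℕ.≤-reflexive (beyond (ℕ.<⇒≤ r<v) ab c≤Λ)))
        -- The elbow confines the first c + 1 places. At most one letter there was ≤ v, and r, which
        -- has left, takes this place in the count.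
        beyond′ {v} {c} r<v (inj₂ e) c≤Λ = ℕ.n≤0⇒n≡0 (ℕ.s≤s⁻¹ (ℕ.≤-trans (ℕ.≤-reflexive
            (≡.sym (≡.trans (≡.cong (count≤ v (take c V) +_) (le-≤ (h≤ (ℕ.<⇒≤ r<v)))) (ℕ.+-comm _ 1))))
          (ℕ.≤-trans (backR-count-elbow v w W e) (ℕ.≤-trans (count≤-take-mono v (w ∷ W) (s≤s c≤Λ)) (atMost1 (ℕ.<⇒≤ r<v))))))
          where
            count≤-take-mono : ∀ v xs {j k} → j ≤ k → count≤ v (take j xs) ≤ count≤ v (take k xs)
            count≤-take-mono v xs       z≤n       = z≤n
            count≤-take-mono v []       (s≤s p) = z≤n
            count≤-take-mono v (x ∷ xs) (s≤s p) = ℕ.+-monoʳ-≤ (le v x) (count≤-take-mono v xs p)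

  good⇔noBadPair : ∀ r M W {Above} → Inv r W Above → Staircase M → length W ≡ suc (length M) →
    (Good r M W → NoBadPair r M Above) × (NoBadPair r M Above → Good r M W)
  good⇔noBadPair r [] (w ∷ []) I _ _ = (λ _ → tt) , λ _ → lemma (full ℕ.≤-refl (ℕ.≤-reflexive (ℕ.+-comm 1 r)))
    where
      open Inv I
      lemma : r ∈ w ∷ [] → w ∷ [] ≡ r ∷ []
      lemma (here ≡.refl) = ≡.refl
  good⇔noBadPair r (b ∷ M) (w ∷ W) I (lb , s) lW =
    (λ { (h≡r , g) → S.good⇒ h≡r , proj₁ (rec h≡r) g }) ,
    (λ { (nb , g) → S.⇒good nb , proj₂ (rec (S.⇒good nb)) g })
    where
      module S = RowStep I b (≡.trans lb (≡.sym (ℕ.suc-injective lW)))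
      rec = λ h≡r → good⇔noBadPair (suc r) M S.V (S.next h≡r) s (≡.trans (backR-length b w W) (ℕ.suc-injective lW))

-- Flags of the permitted columns, propagated from the lowest row upwards.

matrices : List ℕ → List (List (List Bool))
matrices []       = [] ∷ []
matrices (l ∷ ls) = concatMap (λ b → map (b ∷_) (matrices ls)) (bits l)

-- The lengths of the rows r, …, 1 of a staircase of width m.
heights : ℕ → ℕ → List ℕ
heights m zero    = []
heights m (suc r) = m ∸ r ∷ heights m r

-- flag c says whether column c may still hold an elbow; columns beyond the list may.
Allowed : List Bool → ℕ → Set
Allowed []       c       = ⊤
Allowed (f ∷ fs) zero    = IsTrue f
Allowed (f ∷ fs) (suc c) = Allowed fs c

allows : List Bool → List Bool → Bool
allows []       b        = true
allows (f ∷ fs) []       = true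
allows (f ∷ fs) (x ∷ b) = (f ∨ x) ∧ allows fs b

-- Only the leftmost elbow of a row matters: it forbids every flagged column to its right and leaves
-- its own flag alone.
cut : List Bool → List Bool → List Bool
cut []       b           = []
cut (f ∷ fs) []          = f ∷ fs
cut (f ∷ fs) (true ∷ b)  = f ∷ cut fs b
cut (f ∷ fs) (false ∷ b) = f ∷ map (const false) fs

allows⇒ : ∀ fs {b c} → IsTrue (allows fs b) → Elbow b c → Allowed fs c
allows⇒ []           t e         = tt
allows⇒ (true ∷ fs)  t here      = tt
allows⇒ (true ∷ fs)  {_ ∷ b} t (there e) = allows⇒ fs t e
allows⇒ (false ∷ fs) {true ∷ b} t (there e) = allows⇒ fs t e

⇒allows : ∀ fs b → (∀ {c} → Elbow b c → Allowed fs c) → IsTrue (allows fs b)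
⇒allows []           b           f = tt
⇒allows (x ∷ fs)     []          f = tt
⇒allows (true ∷ fs)  (x ∷ b)     f = ⇒allows fs b (f ∘ there)
⇒allows (false ∷ fs) (true ∷ b)  f = ⇒allows fs b (f ∘ there)
⇒allows (false ∷ fs) (false ∷ b) f = ⊥-elim (f here)

Allowed-false⇒ : ∀ (fs : List Bool) {c} → Allowed (map (const false) fs) c → ¬ (c < length fs)
Allowed-false⇒ (f ∷ fs) {suc c} a (s≤s c<) = Allowed-false⇒ fs a c<

⇒Allowed-false : ∀ (fs : List Bool) {c} → ¬ (c < length fs) → Allowed (map (const false) fs) c
⇒Allowed-false []       c≮ = tt
⇒Allowed-false (f ∷ fs) {zero}  c≮ = ⊥-elim (c≮ (s≤s z≤n))
⇒Allowed-false (f ∷ fs) {suc c} c≮ = ⇒Allowed-false fs (c≮ ∘ s≤s)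

Allowed-≮ : ∀ fs {c} → ¬ (c < length fs) → Allowed fs c
Allowed-≮ []       c≮ = tt
Allowed-≮ (f ∷ fs) {zero}  c≮ = ⊥-elim (c≮ (s≤s z≤n))
Allowed-≮ (f ∷ fs) {suc c} c≮ = Allowed-≮ fs (c≮ ∘ s≤s)

Allowed-cut⇒ : ∀ fs {b c} → Allowed (cut fs b) c →
  Allowed fs c × (∀ {c′} → Elbow b c′ → c′ < c → ¬ (c < length fs))
Allowed-cut⇒ []       a = tt , λ _ _ ()
Allowed-cut⇒ (f ∷ fs) {[]}        a = a , λ ()
Allowed-cut⇒ (f ∷ fs) {true ∷ b}  {zero}  a = a , λ _ ()
Allowed-cut⇒ (f ∷ fs) {true ∷ b}  {suc c} a =
  proj₁ rec , λ { (there e) (s≤s c′<) (s≤s c<) → proj₂ rec e c′< c< }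
  where rec = Allowed-cut⇒ fs a
Allowed-cut⇒ (f ∷ fs) {false ∷ b} {zero}  a = a , λ _ ()
Allowed-cut⇒ (f ∷ fs) {false ∷ b} {suc c} a =
  Allowed-≮ fs (Allowed-false⇒ fs a) , λ { _ _ (s≤s c<) → Allowed-false⇒ fs a c< }

⇒Allowed-cut : ∀ fs {b c} → Allowed fs c → (∀ {c′} → Elbow b c′ → c′ < c → ¬ (c < length fs)) →
  Allowed (cut fs b) c
⇒Allowed-cut []       a g = tt
⇒Allowed-cut (f ∷ fs) {[]}        a g = a
⇒Allowed-cut (f ∷ fs) {true ∷ b}  {zero}  a g = a
⇒Allowed-cut (f ∷ fs) {true ∷ b}  {suc c} a g = ⇒Allowed-cut fs a λ e c′< c< → g (there e) (s≤s c′<) (s≤s c<)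
⇒Allowed-cut (f ∷ fs) {false ∷ b} {zero}  a g = a
⇒Allowed-cut (f ∷ fs) {false ∷ b} {suc c} a g = ⇒Allowed-false fs λ c< → g here (s≤s z≤n) (s≤s c<)

Allowed-++⇒ : ∀ fs k {c} → Allowed (fs ++ replicate k true) c → Allowed fs c
Allowed-++⇒ []       k a = tt
Allowed-++⇒ (f ∷ fs) k {zero}  a = a
Allowed-++⇒ (f ∷ fs) k {suc c} a = Allowed-++⇒ fs k a

⇒Allowed-++ : ∀ fs k {c} → Allowed fs c → Allowed (fs ++ replicate k true) c
⇒Allowed-++ []       zero    a = tt
⇒Allowed-++ []       (suc k) {zero}  a = tt
⇒Allowed-++ []       (suc k) {suc c} a = ⇒Allowed-++ [] k tt
⇒Allowed-++ (f ∷ fs) k {zero}  a = a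
⇒Allowed-++ (f ∷ fs) k {suc c} a = ⇒Allowed-++ fs k a

cut-length : ∀ fs b → length (cut fs b) ≡ length fs
cut-length []       b           = ≡.refl
cut-length (f ∷ fs) []          = ≡.refl
cut-length (f ∷ fs) (true ∷ b)  = ≡.cong suc (cut-length fs b)
cut-length (f ∷ fs) (false ∷ b) = ≡.cong suc (List.length-map _ fs)

data AnyElbow : List (List Bool) → ℕ → Set where
  here  : ∀ {b M c} → Elbow b c → AnyElbow (b ∷ M) c
  there : ∀ {b M c} → AnyElbow M c → AnyElbow (b ∷ M) c

AnyElbow-∷ʳ⇒ : ∀ M {b c} → AnyElbow (M ∷ʳ b) c → AnyElbow M c ⊎ Elbow b c
AnyElbow-∷ʳ⇒ []      (here e)  = inj₂ e
AnyElbow-∷ʳ⇒ (_ ∷ M) (here e)  = inj₁ (here e)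
AnyElbow-∷ʳ⇒ (_ ∷ M) (there e) with AnyElbow-∷ʳ⇒ M e
... | inj₁ p = inj₁ (there p)
... | inj₂ p = inj₂ p

⇒AnyElbow-∷ʳ : ∀ M {b c} → AnyElbow M c ⊎ Elbow b c → AnyElbow (M ∷ʳ b) c
⇒AnyElbow-∷ʳ []      (inj₂ e)         = here e
⇒AnyElbow-∷ʳ (_ ∷ M) (inj₁ (here e))  = here e
⇒AnyElbow-∷ʳ (_ ∷ M) (inj₁ (there e)) = there (⇒AnyElbow-∷ʳ M (inj₁ e))
⇒AnyElbow-∷ʳ (_ ∷ M) (inj₂ e)         = there (⇒AnyElbow-∷ʳ M (inj₂ e))

AnyElbow-reverse⇒ : ∀ M {c} → AnyElbow (reverse M) c → AnyElbow M c
AnyElbow-reverse⇒ (b ∷ M) e with AnyElbow-∷ʳ⇒ (reverse M) (≡.subst (λ X → AnyElbow X _) (List.unfold-reverse b M) e)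
... | inj₁ p = there (AnyElbow-reverse⇒ M p)
... | inj₂ p = here p

⇒AnyElbow-reverse : ∀ M {c} → AnyElbow M c → AnyElbow (reverse M) c
⇒AnyElbow-reverse (b ∷ M) e = ≡.subst (λ X → AnyElbow X _) (≡.sym (List.unfold-reverse b M)) (⇒AnyElbow-∷ʳ (reverse M) (lemma e))
  where
    lemma : AnyElbow (b ∷ M) _ → _
    lemma (here e)  = inj₂ e
    lemma (there e) = inj₁ (⇒AnyElbow-reverse M e)

module Upward (Λ : ℕ → ℕ) (Λ-anti : ∀ {r s} → r ≤ s → Λ s ≤ Λ r) where
  open Shape Λ Λ-anti

  -- Rows are now listed from the bottom upwards: row r comes first.
  allowsAll : ℕ → List Bool → List (List Bool) → Bool
  allowsAll r       fs []      = true
  allowsAll zero    fs (b ∷ M) = true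
  allowsAll (suc r) fs (b ∷ M) =
    allows fs b ∧ allowsAll r (cut fs b ++ replicate (Λ r ∸ Λ (suc r)) true) M

  NoBadPair↑ : ℕ → List (List Bool) → Set
  NoBadPair↑ r       []      = ⊤
  NoBadPair↑ zero    (b ∷ M) = ⊤
  NoBadPair↑ (suc r) (b ∷ M) =
    (∀ {c c′} → Elbow b c → AnyElbow M c′ → c < c′ → ¬ (c′ ≤ Λ (suc r))) × NoBadPair↑ r M

  private
    Λ-subst : ∀ {c i j} → i ≡ j → c ≤ Λ i → c ≤ Λ j
    Λ-subst ≡.refl p = p

    T-∧⇒ : ∀ {x y} → IsTrue (x ∧ y) → IsTrue x × IsTrue y
    T-∧⇒ {true} {true} _ = tt , tt

    ⇒T-∧ : ∀ {x y} → IsTrue x → IsTrue y → IsTrue (x ∧ y)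
    ⇒T-∧ {true} {true} _ _ = tt

    next-length : ∀ r fs b → length fs ≡ suc (Λ (suc r)) →
      length (cut fs b ++ replicate (Λ r ∸ Λ (suc r)) true) ≡ suc (Λ r)
    next-length r fs b l = ≡.trans (List.length-++ (cut fs b))
      (≡.trans (≡.cong₂ ℕ._+_ (≡.trans (cut-length fs b) l) (List.length-replicate (Λ r ∸ Λ (suc r))))
        (≡.cong suc (ℕ.m+[n∸m]≡n (Λ-anti (ℕ.n≤1+n r)))))

  -- The flags of row r cover the columns 0, ..., Λ r, so the condition c′ ≤ Λ r of a forbidden pair
  -- says just that c′ has a flag. Columns that are gained on the way up have met no elbow that
  -- could forbid them and start as permitted.
  allowsAll⇒ : ∀ r fs M → length M ≡ r → length fs ≡ suc (Λ r) → IsTrue (allowsAll r fs M) →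
    NoBadPair↑ r M × (∀ {c} → AnyElbow M c → Allowed fs c)
  allowsAll⇒ zero    fs []      lM lf t = tt , λ ()
  allowsAll⇒ (suc r) fs (b ∷ M) lM lf t
    with t₁ , t₂ ← T-∧⇒ {allows fs b} t
    with nb , al ← allowsAll⇒ r _ M (ℕ.suc-injective lM) (next-length r fs b lf) t₂ =
    ((λ e a c<c′ c′≤ → proj₂ (Allowed-cut⇒ fs (Allowed-++⇒ (cut fs b) _ (al a))) e c<c′
        (≡.subst (_ <_) (≡.sym lf) (s≤s c′≤))) , nb) ,
    λ { (here e) → allows⇒ fs t₁ e
      ; (there a) → proj₁ (Allowed-cut⇒ fs (Allowed-++⇒ (cut fs b) _ (al a))) }

  ⇒allowsAll : ∀ r fs M → length M ≡ r → length fs ≡ suc (Λ r) →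
    NoBadPair↑ r M → (∀ {c} → AnyElbow M c → Allowed fs c) → IsTrue (allowsAll r fs M)
  ⇒allowsAll zero    fs []      lM lf nb al = tt
  ⇒allowsAll (suc r) fs (b ∷ M) lM lf (nb , nbs) al = ⇒T-∧ (⇒allows fs b (al ∘ here))
    (⇒allowsAll r _ M (ℕ.suc-injective lM) (next-length r fs b lf) nbs
      (λ a → ⇒Allowed-++ (cut fs b) _ (⇒Allowed-cut fs (al (there a))
        (λ e c′<c c< → nb e a c′<c (ℕ.s≤s⁻¹ (≡.subst (_ <_) lf c<))))))

  NoBadPair-∷ʳ⇒ : ∀ r M b {Above} → NoBadPair r (M ∷ʳ b) Above → NoBadPair r M Above ×
    (∀ {c c′} → Elbow b c → Above c′ ⊎ AnyElbow M c′ → c < c′ → ¬ (c′ ≤ Λ (length M ℕ.+ r)))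
  NoBadPair-∷ʳ⇒ r []      b (nb , _) = tt , λ { e (inj₁ a) → nb e a ; e (inj₂ ()) }
  NoBadPair-∷ʳ⇒ r (x ∷ M) b {Above} (nb , nbs) with p , q ← NoBadPair-∷ʳ⇒ (suc r) M b nbs =
    (nb , p) , λ {c} {c′} e a c<c′ c′≤ → q e (shift {Above} c′ a) c<c′ (Λ-subst (≡.sym (ℕ.+-suc (length M) r)) c′≤)
    where
      shift : ∀ {Above : ℕ → Set} c → Above c ⊎ AnyElbow (x ∷ M) c → (Above c ⊎ Elbow x c) ⊎ AnyElbow M c
      shift c (inj₁ a)         = inj₁ (inj₁ a)
      shift c (inj₂ (here e))  = inj₁ (inj₂ e)
      shift c (inj₂ (there e)) = inj₂ e

  ⇒NoBadPair-∷ʳ : ∀ r M b {Above} → NoBadPair r M Above →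
    (∀ {c c′} → Elbow b c → Above c′ ⊎ AnyElbow M c′ → c < c′ → ¬ (c′ ≤ Λ (length M ℕ.+ r))) →
    NoBadPair r (M ∷ʳ b) Above
  ⇒NoBadPair-∷ʳ r []      b _          q = (λ e a → q e (inj₁ a)) , tt
  ⇒NoBadPair-∷ʳ r (x ∷ M) b {Above} (nb , nbs) q = nb , ⇒NoBadPair-∷ʳ (suc r) M b nbs
    λ e a c<c′ c′≤ → q e (shift a) c<c′ (Λ-subst (ℕ.+-suc (length M) r) c′≤)
    where
      shift : ∀ {c} → (Above c ⊎ Elbow x c) ⊎ AnyElbow M c → Above c ⊎ AnyElbow (x ∷ M) c
      shift (inj₁ (inj₁ a)) = inj₁ a
      shift (inj₁ (inj₂ e)) = inj₂ (here e)
      shift (inj₂ e)        = inj₂ (there e)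

  private
    index : ∀ r (M : List (List Bool)) → length M ≡ r → length (reverse M) ℕ.+ 1 ≡ suc r
    index r M lM = ≡.trans (ℕ.+-comm _ 1) (≡.cong suc (≡.trans (List.length-reverse M) lM))

  NoBadPair⇒↑ : ∀ r M → length M ≡ r → NoBadPair 1 (reverse M) (λ _ → ⊥) → NoBadPair↑ r M
  NoBadPair⇒↑ zero    []      lM nb = tt
  NoBadPair⇒↑ (suc r) (b ∷ M) lM nb
    with p , q ← NoBadPair-∷ʳ⇒ 1 (reverse M) b (≡.subst (λ X → NoBadPair 1 X _) (List.unfold-reverse b M) nb) =
    (λ e a c<c′ c′≤ → q e (inj₂ (⇒AnyElbow-reverse M a)) c<c′
      (Λ-subst (≡.sym (index r M (ℕ.suc-injective lM))) c′≤)) ,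
    NoBadPair⇒↑ r M (ℕ.suc-injective lM) p

  ↑⇒NoBadPair : ∀ r M → length M ≡ r → NoBadPair↑ r M → NoBadPair 1 (reverse M) (λ _ → ⊥)
  ↑⇒NoBadPair zero    []      lM nb = tt
  ↑⇒NoBadPair (suc r) (b ∷ M) lM (nb , nbs) =
    ≡.subst (λ X → NoBadPair 1 X _) (≡.sym (List.unfold-reverse b M))
      (⇒NoBadPair-∷ʳ 1 (reverse M) b (↑⇒NoBadPair r M (ℕ.suc-injective lM) nbs)
        λ { e (inj₂ a) c<c′ c′≤ → nb e (AnyElbow-reverse⇒ M a) c<c′
              (Λ-subst (index r M (ℕ.suc-injective lM)) c′≤) })

  Allowed-trues : ∀ k c → Allowed (replicate k true) c
  Allowed-trues k c = ⇒Allowed-++ [] k tt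

  noBadPair⇒allowsAll : ∀ r M → length M ≡ r → NoBadPair 1 (reverse M) (λ _ → ⊥) →
    IsTrue (allowsAll r (replicate (suc (Λ r)) true) M)
  noBadPair⇒allowsAll r M lM nb = ⇒allowsAll r _ M lM (List.length-replicate (suc (Λ r)))
    (NoBadPair⇒↑ r M lM nb) (λ {c} _ → Allowed-trues (suc (Λ r)) c)

  allowsAll⇒noBadPair : ∀ r M → length M ≡ r → IsTrue (allowsAll r (replicate (suc (Λ r)) true) M) →
    NoBadPair 1 (reverse M) (λ _ → ⊥)
  allowsAll⇒noBadPair r M lM t = ↑⇒NoBadPair r M lM (proj₁ (allowsAll⇒ r _ M lM (List.length-replicate (suc (Λ r))) t))

staircases-matrices : ∀ m → staircases m ≡ matrices (reverse (heights m m))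
staircases-matrices zero    = ≡.refl
staircases-matrices (suc m) = ≡.trans (≡.cong (λ X → concatMap (λ b → map (b ∷_) X) (bits (suc m))) (staircases-matrices m))
    (≡.cong matrices (≡.sym (≡.trans (≡.cong reverse (shift m m)) (List.reverse-++ (heights m m) [ suc m ]))))
  where
    shift : ∀ m r → heights (suc m) (suc r) ≡ heights m r ++ [ suc m ]
    shift m zero    = ≡.refl
    shift m (suc r) = ≡.cong (m ∸ r ∷_) (shift m r)

-- Summing out one row of tiles.

module Bottom {c ℓ} (K : CommutativeRing c ℓ) where
  open CommutativeRing K renaming (_+_ to _⊕_; -_ to ⊝_; _-_ to _⊖_)
  open Sums K
  open Hecke K
  open import Relation.Binary.Reasoning.Setoid setoid
  open SemiringSolver commutativeSemiring using (solve; _:+_; _:*_; _:=_; con)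

  ∑-matrices-∷ : ∀ l ls (f : List (List Bool) → Carrier) →
    ∑ K (matrices (l ∷ ls)) f ≈ ∑ K (bits l) (λ b → ∑ K (matrices ls) (λ M → f (b ∷ M)))
  ∑-matrices-∷ l ls f = trans (∑-concatMap _ (bits l) f)
    (∑-cong (bits l) (λ b → reflexive (∑-map (b ∷_) (matrices ls) f)))

  ∑-matrices-∷ʳ : ∀ ls l (f : List (List Bool) → Carrier) →
    ∑ K (matrices (ls ∷ʳ l)) f ≈ ∑ K (bits l) (λ b → ∑ K (matrices ls) (λ M → f (M ∷ʳ b)))
  ∑-matrices-∷ʳ []       l f = ∑-matrices-∷ l [] f
  ∑-matrices-∷ʳ (k ∷ ls) l f = begin
    ∑ K (matrices (k ∷ ls ∷ʳ l)) f
      ≈⟨ ∑-matrices-∷ k (ls ∷ʳ l) f ⟩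
    ∑ K (bits k) (λ x → ∑ K (matrices (ls ∷ʳ l)) (λ M → f (x ∷ M)))
      ≈⟨ ∑-cong (bits k) (λ x → ∑-matrices-∷ʳ ls l _) ⟩
    ∑ K (bits k) (λ x → ∑ K (bits l) (λ b → ∑ K (matrices ls) (λ M → f (x ∷ M ∷ʳ b))))
      ≈⟨ ∑-swap (bits k) (bits l) _ ⟩
    ∑ K (bits l) (λ b → ∑ K (bits k) (λ x → ∑ K (matrices ls) (λ M → f (x ∷ M ∷ʳ b))))
      ≈⟨ ∑-cong (bits l) (λ b → sym (∑-matrices-∷ k ls _)) ⟩
    ∑ K (bits l) (λ b → ∑ K (matrices (k ∷ ls)) (λ M → f (M ∷ʳ b))) ∎

  ∑-matrices-reverse : ∀ ls (f : List (List Bool) → Carrier) →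
    ∑ K (matrices (reverse ls)) f ≈ ∑ K (matrices ls) (f ∘ reverse)
  ∑-matrices-reverse []       f = refl
  ∑-matrices-reverse (l ∷ ls) f = begin
    ∑ K (matrices (reverse (l ∷ ls))) f
      ≡⟨ ≡.cong (λ X → ∑ K (matrices X) f) (List.unfold-reverse l ls) ⟩
    ∑ K (matrices (reverse ls ∷ʳ l)) f
      ≈⟨ ∑-matrices-∷ʳ (reverse ls) l f ⟩
    ∑ K (bits l) (λ b → ∑ K (matrices (reverse ls)) (λ M → f (M ∷ʳ b)))
      ≈⟨ ∑-cong (bits l) (λ b → trans (∑-matrices-reverse ls _)
           (∑-cong (matrices ls) (λ M → reflexive (≡.cong f (≡.sym (List.unfold-reverse b M)))))) ⟩
    ∑ K (bits l) (λ b → ∑ K (matrices ls) (λ M → f (reverse (b ∷ M))))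
      ≈⟨ sym (∑-matrices-∷ l ls _) ⟩
    ∑ K (matrices (l ∷ ls)) (f ∘ reverse) ∎

  wt↑ : (t e : ℕ → ℕ → Carrier) → ℕ → List (List Bool) → Carrier
  wt↑ t e r       []      = 1#
  wt↑ t e zero    (b ∷ M) = 1#
  wt↑ t e (suc r) (b ∷ M) = rowWt (t (suc r)) (e (suc r)) 0 b * wt↑ t e r M

  wt-∷ʳ : ∀ t e r M b → wt t e r (M ∷ʳ b) ≈ wt t e r M * rowWt (t (length M ℕ.+ r)) (e (length M ℕ.+ r)) 0 b
  wt-∷ʳ t e r []      b = *-comm _ _
  wt-∷ʳ t e r (x ∷ M) b = trans (*-congˡ (trans (wt-∷ʳ t e (suc r) M b)
    (*-congˡ (reflexive (≡.cong (λ z → rowWt (t z) (e z) 0 b) (ℕ.+-suc (length M) r)))))) (sym (*-assoc _ _ _))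

  wt-reverse : ∀ t e r M → length M ≡ r → wt t e 1 (reverse M) ≈ wt↑ t e r M
  wt-reverse t e zero    []      l = refl
  wt-reverse t e (suc r) (b ∷ M) l = begin
    wt t e 1 (reverse (b ∷ M)) ≡⟨ ≡.cong (wt t e 1) (List.unfold-reverse b M) ⟩
    wt t e 1 (reverse M ∷ʳ b)  ≈⟨ wt-∷ʳ t e 1 (reverse M) b ⟩
    wt t e 1 (reverse M) * rowWt (t k) (e k) 0 b
      ≈⟨ *-cong (wt-reverse t e r M l′) (reflexive (≡.cong (λ z → rowWt (t z) (e z) 0 b)
           (≡.trans (ℕ.+-comm _ 1) (≡.cong suc (≡.trans (List.length-reverse M) l′))))) ⟩
    wt↑ t e r M * rowWt (t (suc r)) (e (suc r)) 0 b ≈⟨ *-comm _ _ ⟩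
    wt↑ t e (suc r) (b ∷ M) ∎
    where
      l′ = ℕ.suc-injective l
      k = length (reverse M) ℕ.+ 1

  -- The sum over the sets of elbows in one row: the columns of S may hold an
  -- elbow, and an elbow forbids, in the rows above, the columns to its right.
  -- τ holds a column in which the row itself has no box.
  rowSum : {A : Set} → (A → Carrier) → List A → List A → (List A → Carrier) → Carrier
  rowSum v []      τ g = g τ
  rowSum v (s ∷ S) τ g = (v s ⊖ 1#) * (∏ K S v * g (s ∷ [])) ⊕ rowSum v S τ (g ∘ (s ∷_))

  rowSum-cong : {A : Set} (v : A → Carrier) (S τ : List A) {f g : List A → Carrier} →
    (∀ S′ → f S′ ≈ g S′) → rowSum v S τ f ≈ rowSum v S τ g
  rowSum-cong v []      τ p = p τ
  rowSum-cong v (s ∷ S) τ p = +-cong (*-congˡ (*-congˡ (p _))) (rowSum-cong v S τ (p ∘ (s ∷_)))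

  -- From here on a column is named by the label ε of its boundary step, which is all that the tree
  -- knows of it.
  select : (ℕ → ℕ) → ℕ → List Bool → List ℕ
  select ε i []           = []
  select ε i (true ∷ fs)  = ε i ∷ select ε (suc i) fs
  select ε i (false ∷ fs) = select ε (suc i) fs

  select-++ : ∀ ε i fs gs → select ε i (fs ++ gs) ≡ select ε i fs ++ select ε (length fs ℕ.+ i) gs
  select-++ ε i []           gs = ≡.refl
  select-++ ε i (true ∷ fs)  gs = ≡.cong (ε i ∷_) (≡.trans (select-++ ε (suc i) fs gs)
    (≡.cong (λ k → select ε (suc i) fs ++ select ε k gs) (ℕ.+-suc (length fs) i)))
  select-++ ε i (false ∷ fs) gs = ≡.trans (select-++ ε (suc i) fs gs)
    (≡.cong (λ k → select ε (suc i) fs ++ select ε k gs) (ℕ.+-suc (length fs) i))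

  select-false : ∀ ε i (fs : List Bool) → select ε i (map (const false) fs) ≡ []
  select-false ε i []       = ≡.refl
  select-false ε i (f ∷ fs) = select-false ε (suc i) fs

  -- The flag of a column in which the row itself has no box. There is at most one, the last column
  -- to begin in the row.
  data Extra : List Bool → Set where
    none : Extra []
    one′ : Extra (true ∷ [])

  module Row (ε : ℕ → ℕ) (v : ℕ → Carrier) (t e : ℕ → Carrier) where

    -- Inside the region the weights have been divided by that of a cross, which leaves 1 and z = v
    -- - 1; outside, cross and elbow still add up to 1.
    InR OutR : ℕ → Set _
    InR i  = (t i ≈ 1#) × (e i ≈ v (ε i) ⊖ 1#)
    OutR i = t i ⊕ e i ≈ 1#

    private
      1+z : ∀ x → 1# ⊕ (x ⊖ 1#) ≈ x
      1+z x = trans (+-comm _ _) (trans (+-assoc _ _ _) (trans (+-congˡ (-‿inverseˡ 1#)) (+-identityʳ x)))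

    ∑-rowWt : ∀ l i → (∀ {j} → i ≤ j → OutR j) → ∑ K (bits l) (rowWt t e i) ≈ 1#
    ∑-rowWt zero    i out = +-identityʳ 1#
    ∑-rowWt (suc l) i out = begin
      ∑ K (bits (suc l)) (rowWt t e i)
        ≈⟨ ∑-bits l _ ⟩
      ∑ K (bits l) (λ b → t i * rowWt t e (suc i) b) ⊕ ∑ K (bits l) (λ b → e i * rowWt t e (suc i) b)
        ≈⟨ +-cong (∑-*ˡ (bits l) _ _) (∑-*ˡ (bits l) _ _) ⟩
      t i * ∑ K (bits l) (rowWt t e (suc i)) ⊕ e i * ∑ K (bits l) (rowWt t e (suc i))
        ≈⟨ absorb _ (out ℕ.≤-refl) ⟩
      ∑ K (bits l) (rowWt t e (suc i))
        ≈⟨ ∑-rowWt l (suc i) (out ∘ ℕ.<⇒≤) ⟩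
      1# ∎

    -- Tiles outside the region are free, and an elbow in the extra column forbids nothing because
    -- no flag lies to its right.
    ∑-extra : ∀ l i {ext} → Extra ext → (∀ {j} → i ≤ j → OutR j) → (g : List Bool → Carrier) →
      ∑ K (bits l) (λ b → rowWt t e i b * (⟦ T? (allows ext b) ⟧ * g (cut ext b))) ≈ g ext
    ∑-extra l i {ext} x out g = begin
      ∑ K (bits l) (λ b → rowWt t e i b * (⟦ T? (allows ext b) ⟧ * g (cut ext b)))
        ≈⟨ ∑-cong (bits l) (λ b → trans (*-congˡ (trans (*-cong (⟦⟧-yes (T? (allows ext b)) (free x b)) (reflexive (≡.cong g (keep x b)))) (*-identityˡ _))) (*-comm _ _)) ⟩
      ∑ K (bits l) (λ b → g ext * rowWt t e i b)
        ≈⟨ trans (∑-*ˡ (bits l) (g ext) _) (trans (*-congˡ (∑-rowWt l i out)) (*-identityʳ _)) ⟩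
      g ext ∎
      where
        free : ∀ {ext} → Extra ext → ∀ b → IsTrue (allows ext b)
        free none b       = tt
        free one′ []      = tt
        free one′ (x ∷ b) = tt
        keep : ∀ {ext} → Extra ext → ∀ b → cut ext b ≡ ext
        keep none b           = ≡.refl
        keep one′ []          = ≡.refl
        keep one′ (true ∷ b)  = ≡.refl
        keep one′ (false ∷ b) = ≡.refl

    -- The row is split at its leftmost elbow: the tiles of the region in front of it are crosses of
    -- weight 1, its own weight is z, and the tiles behind it are summed by `∑-allows`.
    ∑-row : ∀ l i fs {ext} → Extra ext → length fs ≤ l →
      (∀ {j} → i ≤ j → j < length fs ℕ.+ i → InR j) → (∀ {j} → length fs ℕ.+ i ≤ j → OutR j) →
      (g : List Bool → Carrier) (g′ : List ℕ → Carrier) →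
      (∀ fs′ → length fs′ ≡ length (fs ++ ext) → g fs′ ≈ g′ (select ε i fs′)) →
      ∑ K (bits l) (λ b → rowWt t e i b * (⟦ T? (allows (fs ++ ext) b) ⟧ * g (cut (fs ++ ext) b)))
      ≈ rowSum v (select ε i fs) (select ε (length fs ℕ.+ i) ext) g′

    -- A forbidden column holds a cross, of weight 1; a permitted one contributes 1 + z = v.
    ∑-allows : ∀ l i fs {ext} → Extra ext → length fs ≤ l →
      (∀ {j} → i ≤ j → j < length fs ℕ.+ i → InR j) → (∀ {j} → length fs ℕ.+ i ≤ j → OutR j) →
      ∑ K (bits l) (λ b → rowWt t e i b * ⟦ T? (allows (fs ++ ext) b) ⟧) ≈ ∏ K (select ε i fs) v

    private
      module Cons (l i : ℕ) (f : Bool) (fs ext : List Bool) where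
        push : ∀ (x : Carrier) (F : List Bool → Carrier) →
          ∑ K (bits l) (λ b → x * rowWt t e (suc i) b * F b) ≈ x * ∑ K (bits l) (λ b → rowWt t e (suc i) b * F b)
        push x F = trans (∑-cong (bits l) (λ b → *-assoc _ _ _)) (∑-*ˡ (bits l) x _)

        inside : (∀ {j} → i ≤ j → j < suc (length fs) ℕ.+ i → InR j) → ∀ {j} → suc i ≤ j → j < length fs ℕ.+ suc i → InR j
        inside h {j} p q = h (ℕ.<⇒≤ p) (≡.subst (j <_) (ℕ.+-suc (length fs) i) q)

        outside : (∀ {j} → suc (length fs) ℕ.+ i ≤ j → OutR j) → ∀ {j} → length fs ℕ.+ suc i ≤ j → OutR j
        outside h {j} p = h (≡.subst (_≤ j) (ℕ.+-suc (length fs) i) p)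

    ∑-allows l i [] x _ inR out =
      trans (∑-cong (bits l) (λ b → *-congˡ (sym (*-identityʳ _)))) (∑-extra l i x out (λ _ → 1#))
    ∑-allows (suc l) i (f ∷ fs) {ext} x (s≤s fs≤l) inR out = begin
      ∑ K (bits (suc l)) (λ b → rowWt t e i b * ⟦ T? (allows (f ∷ fs ++ ext) b) ⟧)
        ≈⟨ ∑-bits l _ ⟩
      ∑ K (bits l) (λ b → t i * rowWt t e (suc i) b * ⟦ T? ((f ∨ true) ∧ allows (fs ++ ext) b) ⟧)
        ⊕ ∑ K (bits l) (λ b → e i * rowWt t e (suc i) b * ⟦ T? ((f ∨ false) ∧ allows (fs ++ ext) b) ⟧)
        ≈⟨ +-cong (push (t i) _) (push (e i) _) ⟩
      t i * ∑ K (bits l) (λ b → rowWt t e (suc i) b * ⟦ T? ((f ∨ true) ∧ allows (fs ++ ext) b) ⟧)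
        ⊕ e i * ∑ K (bits l) (λ b → rowWt t e (suc i) b * ⟦ T? ((f ∨ false) ∧ allows (fs ++ ext) b) ⟧)
        ≈⟨ rest f ⟩
      ∏ K (select ε i (f ∷ fs)) v ∎
      where
        open Cons l i f fs ext
        rec = ∑-allows l (suc i) fs x fs≤l (inside inR) (outside out)
        ti = proj₁ (inR ℕ.≤-refl (s≤s (ℕ.m≤n+m i (length fs))))
        ei = proj₂ (inR ℕ.≤-refl (s≤s (ℕ.m≤n+m i (length fs))))
        rest : ∀ f → t i * ∑ K (bits l) (λ b → rowWt t e (suc i) b * ⟦ T? ((f ∨ true) ∧ allows (fs ++ ext) b) ⟧)
          ⊕ e i * ∑ K (bits l) (λ b → rowWt t e (suc i) b * ⟦ T? ((f ∨ false) ∧ allows (fs ++ ext) b) ⟧)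
          ≈ ∏ K (select ε i (f ∷ fs)) v
        rest true = trans (sym (distribʳ _ _ _)) (*-cong (trans (+-cong ti ei) (1+z _)) rec)
        rest false = trans (+-cong (trans (*-cong ti rec) (*-identityˡ _))
          (trans (*-congˡ (trans (∑-cong (bits l) (λ b → zeroʳ _)) (∑-zero (bits l)))) (zeroʳ _))) (+-identityʳ _)

    ∑-row l i [] x _ inR out g g′ gg = trans (∑-extra l i x out g) (gg _ ≡.refl)
    ∑-row (suc l) i (f ∷ fs) {ext} x (s≤s fs≤l) inR out g g′ gg = begin
      ∑ K (bits (suc l)) (λ b → rowWt t e i b * (⟦ T? (allows (f ∷ fs ++ ext) b) ⟧ * g (cut (f ∷ fs ++ ext) b)))
        ≈⟨ ∑-bits l _ ⟩
      ∑ K (bits l) (λ b → t i * rowWt t e (suc i) b * (⟦ T? ((f ∨ true) ∧ allows (fs ++ ext) b) ⟧ * g (f ∷ cut (fs ++ ext) b)))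
        ⊕ ∑ K (bits l) (λ b → e i * rowWt t e (suc i) b * (⟦ T? ((f ∨ false) ∧ allows (fs ++ ext) b) ⟧ * g (f ∷ map (const false) (fs ++ ext))))
        ≈⟨ +-cong (push (t i) _) (push (e i) _) ⟩
      t i * ∑ K (bits l) (λ b → rowWt t e (suc i) b * (⟦ T? ((f ∨ true) ∧ allows (fs ++ ext) b) ⟧ * g (f ∷ cut (fs ++ ext) b)))
        ⊕ e i * ∑ K (bits l) (λ b → rowWt t e (suc i) b * (⟦ T? ((f ∨ false) ∧ allows (fs ++ ext) b) ⟧ * g (f ∷ map (const false) (fs ++ ext))))
        ≈⟨ rest f gg ⟩
      rowSum v (select ε i (f ∷ fs)) (select ε (suc (length fs) ℕ.+ i) ext) g′ ∎
      where
        open Cons l i f fs ext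
        ti = proj₁ (inR ℕ.≤-refl (s≤s (ℕ.m≤n+m i (length fs))))
        ei = proj₂ (inR ℕ.≤-refl (s≤s (ℕ.m≤n+m i (length fs))))
        rec = λ g g′ gg → trans (∑-row l (suc i) fs x fs≤l (inside inR) (outside out) g g′ gg)
          (reflexive (≡.cong (λ k → rowSum v (select ε (suc i) fs) (select ε k ext) g′) (ℕ.+-suc (length fs) i)))
        rest : ∀ f → (∀ fs′ → length fs′ ≡ suc (length (fs ++ ext)) → g fs′ ≈ g′ (select ε i fs′)) →
          t i * ∑ K (bits l) (λ b → rowWt t e (suc i) b * (⟦ T? ((f ∨ true) ∧ allows (fs ++ ext) b) ⟧ * g (f ∷ cut (fs ++ ext) b)))
          ⊕ e i * ∑ K (bits l) (λ b → rowWt t e (suc i) b * (⟦ T? ((f ∨ false) ∧ allows (fs ++ ext) b) ⟧ * g (f ∷ map (const false) (fs ++ ext))))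
          ≈ rowSum v (select ε i (f ∷ fs)) (select ε (suc (length fs) ℕ.+ i) ext) g′
        rest true gg = trans (+-comm _ _) (+-cong
          -- An elbow here switches off all flags to its right, so g no longer depends on the rest
          -- of the row and can be taken out of the sum.
          (*-cong ei (begin
            ∑ K (bits l) (λ b → rowWt t e (suc i) b * (⟦ T? (allows (fs ++ ext) b) ⟧ * g (true ∷ map (const false) (fs ++ ext))))
              ≈⟨ ∑-cong (bits l) (λ b → solve 3 (λ r a g → r :* (a :* g) := g :* (r :* a)) refl _ _ _) ⟩
            ∑ K (bits l) (λ b → g (true ∷ map (const false) (fs ++ ext)) * (rowWt t e (suc i) b * ⟦ T? (allows (fs ++ ext) b) ⟧))
              ≈⟨ trans (∑-*ˡ (bits l) _ _) (*-comm _ _) ⟩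
            ∑ K (bits l) (λ b → rowWt t e (suc i) b * ⟦ T? (allows (fs ++ ext) b) ⟧) * g (true ∷ map (const false) (fs ++ ext))
              ≈⟨ *-cong (∑-allows l (suc i) fs x fs≤l (inside inR) (outside out))
                   (trans (gg _ (≡.cong suc (List.length-map _ (fs ++ ext)))) (reflexive (≡.cong (λ S → g′ (ε i ∷ S)) (select-false ε (suc i) (fs ++ ext))))) ⟩
            ∏ K (select ε (suc i) fs) v * g′ (ε i ∷ []) ∎))
          (trans (*-cong ti (rec (g ∘ (true ∷_)) (g′ ∘ (ε i ∷_)) (λ fs′ l → gg (true ∷ fs′) (≡.cong suc l)))) (*-identityˡ _)))
        rest false gg = trans (+-cong
          (trans (*-cong ti (rec (g ∘ (false ∷_)) g′ (λ fs′ l → gg (false ∷ fs′) (≡.cong suc l)))) (*-identityˡ _))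
          (trans (*-congˡ (trans (∑-cong (bits l) (λ b → trans (*-congˡ (zeroˡ _)) (zeroʳ _))) (∑-zero (bits l)))) (zeroʳ _)))
          (+-identityʳ _)

-- The recursion over rows in terms of column labels.

interval : ℕ → ℕ → List ℕ
interval j zero    = []
interval j (suc n) = j ∷ interval (suc j) n

-- How many columns of the shape Λ start in each of the rows r, …, 2.
drops : (ℕ → ℕ) → ℕ → List ℕ
drops Λ zero          = []
drops Λ (suc zero)    = []
drops Λ (suc (suc r)) = Λ (2 ℕ.+ r) ∸ Λ (3 ℕ.+ r) ∷ drops Λ (suc r)

module Labelled {c ℓ} (K : CommutativeRing c ℓ) where
  open CommutativeRing K hiding (zero) renaming (_+_ to _⊕_; -_ to ⊝_; _-_ to _⊖_)
  open Sums K
  open Hecke K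
  open Bottom K
  open import Relation.Binary.Reasoning.Setoid setoid

  -- j is the next free label, S the labels of the columns that may hold an
  -- elbow, and ds lists how many columns start at each further row.
  labelSum : (Edge → Carrier) → ℕ → List ℕ → List ℕ → Carrier
  labelSum v j S []           = rowSum (λ s → v (s , j)) S [] (λ _ → 1#)
  labelSum v j S (zero ∷ ds)  = rowSum (λ s → v (s , j)) S [] (λ S′ → labelSum v (suc j) S′ ds)
  labelSum v j S (suc δ ∷ ds) = rowSum (λ s → v (s , j ℕ.+ δ)) (S ++ interval j δ) [ j ℕ.+ δ ]
                                  (λ S′ → labelSum v (suc (j ℕ.+ δ)) S′ ds)

  select-replicate : ∀ ε i j n → (∀ k → k < n → ε (k ℕ.+ i) ≡ k ℕ.+ j) → select ε i (replicate n true) ≡ interval j n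
  select-replicate ε i j zero    p = ≡.refl
  select-replicate ε i j (suc n) p = ≡.cong₂ _∷_ (p 0 (s≤s z≤n)) (select-replicate ε (suc i) (suc j) n λ k k<n →
    ≡.trans (≡.cong ε (ℕ.+-suc k i)) (≡.trans (p (suc k) (s≤s k<n)) (≡.sym (ℕ.+-suc k j))))

  module Climb
    (Λ : ℕ → ℕ) (Λ-anti : ∀ {r s} → r ≤ s → Λ s ≤ Λ r) (m : ℕ)
    (a e : ℕ → ℕ → Carrier) where
    open Upward Λ Λ-anti

    climb : ℕ → List Bool → Carrier
    climb r fs = ∑ K (matrices (heights m r)) (λ M → wt↑ a e r M * ⟦ T? (allowsAll r fs M) ⟧)

    ⟦⟧-∧ : ∀ x y → ⟦ T? (x ∧ y) ⟧ ≈ ⟦ T? x ⟧ * ⟦ T? y ⟧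
    ⟦⟧-∧ true  y = sym (*-identityˡ _)
    ⟦⟧-∧ false y = sym (zeroˡ _)

    climb-suc : ∀ r fs → climb (suc r) fs ≈ ∑ K (bits (m ∸ r)) (λ b → rowWt (a (suc r)) (e (suc r)) 0 b *
      (⟦ T? (allows fs b) ⟧ * climb r (cut fs b ++ replicate (Λ r ∸ Λ (suc r)) true)))
    climb-suc r fs = begin
      climb (suc r) fs
        ≈⟨ ∑-matrices-∷ (m ∸ r) (heights m r) _ ⟩
      ∑ K (bits (m ∸ r)) (λ b → ∑ K (matrices (heights m r)) (λ M →
        w b * wt↑ a e r M * ⟦ T? (allows fs b ∧ allowsAll r (next b) M) ⟧))
        ≈⟨ ∑-cong (bits (m ∸ r)) (λ b → trans (∑-cong (matrices (heights m r)) (λ M →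
             trans (*-congˡ (⟦⟧-∧ (allows fs b) _))
               (solve 4 (λ w x s t → w :* x :* (s :* t) := w :* s :* (x :* t)) refl (w b) _ _ _)))
             (trans (∑-*ˡ (matrices (heights m r)) _ _) (*-assoc _ _ _))) ⟩
      ∑ K (bits (m ∸ r)) (λ b → w b * (⟦ T? (allows fs b) ⟧ * climb r (next b))) ∎
      where
        open SemiringSolver commutativeSemiring using (solve; _:*_; _:=_)
        w = rowWt (a (suc r)) (e (suc r)) 0
        next = λ b → cut fs b ++ replicate (Λ r ∸ Λ (suc r)) true

    module _
      (ε ν : ℕ → ℕ) (v : Edge → Carrier) (h : ℕ) (ρ : ℕ → ℕ)
      (0<h : 0 < h) (Λ1≡Λ2 : Λ 1 ≡ Λ 2)
      (Λ-empty : ∀ {r} → h < r → Λ r ≡ 0) (ρ-empty : ∀ {r} → h < r → ρ r ≡ 0)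
      (ρ-flat : ∀ {r} → 0 < r → r ≤ h → Λ r ∸ Λ (suc r) ≡ 0 → ρ r ≡ suc (Λ r))
      (ρ-drop : ∀ {r δ} → 0 < r → r ≤ h → Λ r ∸ Λ (suc r) ≡ suc δ → ρ r ≡ Λ r)
      (ρ-fits : ∀ {r} → r < h → ρ (suc r) ≤ m ∸ r)
      (ν-step : ∀ {r} → 0 < r → r ≤ h → ν r ≡ suc (ν (suc r)) ℕ.+ (Λ r ∸ Λ (suc r) ∸ 1))
      (ε-step : ∀ {r i} → 0 < r → r ≤ h → i < Λ r ∸ Λ (suc r) → ε (i ℕ.+ suc (Λ (suc r))) ≡ i ℕ.+ suc (ν (suc r)))
      (inside : ∀ {r i} → r < h → i < ρ (suc r) → a (suc r) i ≈ 1# × e (suc r) i ≈ v (ε i , ν (suc r)) ⊖ 1#)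
      (outside : ∀ {r i} → ρ (suc r) ≤ i → a (suc r) i ⊕ e (suc r) i ≈ 1#) where

      -- `suc (ν (2 + r))` is the first label not given out further down. Row 1 gains no column
      -- because Λ 1 ≡ Λ 2, in agreement with the last step of `labelSum`.
      climb-labels : ∀ r fs → r < h → length fs ≡ suc (Λ (2 ℕ.+ r)) →
        climb (suc r) (fs ++ replicate (Λ (suc r) ∸ Λ (2 ℕ.+ r)) true)
        ≈ labelSum v (suc (ν (2 ℕ.+ r))) (select ε 0 fs) (drops Λ (suc r))

      -- No column begins in this row, so every flagged column has a box in it and `ext` is empty.
      climb-flat : ∀ r fs → r < h → length fs ≡ suc (Λ (2 ℕ.+ r)) → Λ (suc r) ∸ Λ (2 ℕ.+ r) ≡ 0 →
        (g : List Bool → Carrier) (g′ : List ℕ → Carrier) → (∀ fs′ → length fs′ ≡ suc (Λ (suc r)) → g fs′ ≈ g′ (select ε 0 fs′)) →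
        ∑ K (bits (m ∸ r)) (λ b → rowWt (a (suc r)) (e (suc r)) 0 b *
          (⟦ T? (allows (fs ++ replicate (Λ (suc r) ∸ Λ (2 ℕ.+ r)) true) b) ⟧
            * g (cut (fs ++ replicate (Λ (suc r) ∸ Λ (2 ℕ.+ r)) true) b)))
        ≈ rowSum (λ s → v (s , suc (ν (2 ℕ.+ r)))) (select ε 0 fs) [] g′
      climb-flat r fs r<h lf δ≡0 g g′ gg rewrite δ≡0 = trans
        (Row.∑-row ε (λ s → v (s , ν (suc r))) (a (suc r)) (e (suc r)) (m ∸ r) 0 fs none
          (≡.subst (_≤ m ∸ r) ρ≡ (ρ-fits r<h))
          (λ {j} _ j< → inside r<h (≡.subst (j <_) ρ≡+0 j<))
          (λ {j} ≤j → outside (≡.subst (_≤ j) ρ≡+0 ≤j)) g g′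
          (λ fs′ l → gg fs′ (≡.trans l (≡.trans (List.length-++ fs) (≡.trans (ℕ.+-identityʳ _) (≡.trans lf (≡.cong suc (≡.sym Λ≡))))))))
        (reflexive (≡.cong (λ n → rowSum (λ s → v (s , n)) (select ε 0 fs) [] g′) ν≡))
        where
          flat = ρ-flat (s≤s z≤n) r<h δ≡0
          Λ≡ : Λ (suc r) ≡ Λ (2 ℕ.+ r)
          Λ≡ = ℕ.≤-antisym (ℕ.m∸n≡0⇒m≤n δ≡0) (Λ-anti (ℕ.n≤1+n (suc r)))
          ρ≡ : ρ (suc r) ≡ length fs
          ρ≡ = ≡.trans flat (≡.trans (≡.cong suc Λ≡) (≡.sym lf))
          ρ≡+0 : length fs ℕ.+ 0 ≡ ρ (suc r)
          ρ≡+0 = ≡.trans (ℕ.+-identityʳ _) (≡.sym ρ≡)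
          ν≡ : ν (suc r) ≡ suc (ν (2 ℕ.+ r))
          ν≡ = ≡.trans (ν-step (s≤s z≤n) r<h) (≡.trans (≡.cong (λ d → suc (ν (2 ℕ.+ r)) ℕ.+ (d ∸ 1)) δ≡0) (ℕ.+-identityʳ _))

      -- Of the δ + 1 columns that begin, the first δ receive the labels j, ..., j + δ - 1. The last
      -- one has no box in this row; it shares the label j + δ of the row and is passed on as τ.
      climb-drop : ∀ r fs δ → r < h → length fs ≡ suc (Λ (2 ℕ.+ r)) → Λ (suc r) ∸ Λ (2 ℕ.+ r) ≡ suc δ →
        (g : List Bool → Carrier) (g′ : List ℕ → Carrier) → (∀ fs′ → length fs′ ≡ suc (Λ (suc r)) → g fs′ ≈ g′ (select ε 0 fs′)) →
        let j = suc (ν (2 ℕ.+ r)) in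
        ∑ K (bits (m ∸ r)) (λ b → rowWt (a (suc r)) (e (suc r)) 0 b *
          (⟦ T? (allows (fs ++ replicate (Λ (suc r) ∸ Λ (2 ℕ.+ r)) true) b) ⟧
            * g (cut (fs ++ replicate (Λ (suc r) ∸ Λ (2 ℕ.+ r)) true) b)))
        ≈ rowSum (λ s → v (s , j ℕ.+ δ)) (select ε 0 fs ++ interval j δ) [ j ℕ.+ δ ] g′
      climb-drop r fs δ r<h lf δ≡ g g′ gg = begin
        ∑ K (bits (m ∸ r)) (λ b → w b * (⟦ T? (allows (fs ++ replicate (Λ (suc r) ∸ Λ (2 ℕ.+ r)) true) b) ⟧
            * g (cut (fs ++ replicate (Λ (suc r) ∸ Λ (2 ℕ.+ r)) true) b)))
          ≡⟨ ≡.cong (λ fl → ∑ K (bits (m ∸ r)) (λ b → w b * (⟦ T? (allows fl b) ⟧ * g (cut fl b)))) flags ⟩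
        ∑ K (bits (m ∸ r)) (λ b → w b * (⟦ T? (allows (fs₀ ++ true ∷ []) b) ⟧ * g (cut (fs₀ ++ true ∷ []) b)))
          ≈⟨ Row.∑-row ε (λ s → v (s , ν (suc r))) (a (suc r)) (e (suc r)) (m ∸ r) 0 fs₀ one′
               (≡.subst (_≤ m ∸ r) ρ≡ (ρ-fits r<h))
               (λ {j} _ j< → inside r<h (≡.subst (j <_) ρ≡+0 j<))
               (λ {j} ≤j → outside (≡.subst (_≤ j) ρ≡+0 ≤j)) g g′
               (λ fs′ l → gg fs′ (≡.trans l (≡.trans (List.length-++ fs₀) (≡.trans (ℕ.+-comm _ 1) (≡.cong suc (≡.trans length₀ (≡.sym Λ≡))))))) ⟩
        rowSum (λ s → v (s , ν (suc r))) (select ε 0 fs₀) [ ε (length fs₀ ℕ.+ 0) ] g′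
          ≡⟨ ≡.cong (λ n → rowSum (λ s → v (s , n)) (select ε 0 fs₀) [ ε (length fs₀ ℕ.+ 0) ] g′) ν≡ ⟩
        rowSum (λ s → v (s , j ℕ.+ δ)) (select ε 0 fs₀) [ ε (length fs₀ ℕ.+ 0) ] g′
          ≡⟨ ≡.cong₂ (λ S x → rowSum (λ s → v (s , j ℕ.+ δ)) S [ x ] g′) select≡ last≡ ⟩
        rowSum (λ s → v (s , j ℕ.+ δ)) (select ε 0 fs ++ interval j δ) [ j ℕ.+ δ ] g′ ∎
        where
          j = suc (ν (2 ℕ.+ r))
          w = rowWt (a (suc r)) (e (suc r)) 0
          fs₀ = fs ++ replicate δ true
          replicate-∷ʳ : ∀ n → replicate (suc n) true ≡ replicate n true ++ true ∷ []
          replicate-∷ʳ zero    = ≡.refl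
          replicate-∷ʳ (suc n) = ≡.cong (true ∷_) (replicate-∷ʳ n)
          flags : fs ++ replicate (Λ (suc r) ∸ Λ (2 ℕ.+ r)) true ≡ fs₀ ++ true ∷ []
          flags = ≡.trans (≡.cong (λ d → fs ++ replicate d true) δ≡)
            (≡.trans (≡.cong (fs ++_) (replicate-∷ʳ δ)) (≡.sym (List.++-assoc fs (replicate δ true) _)))
          length₀ : length fs₀ ≡ δ ℕ.+ suc (Λ (2 ℕ.+ r))
          length₀ = ≡.trans (List.length-++ fs) (≡.trans (≡.cong₂ ℕ._+_ lf (List.length-replicate δ)) (ℕ.+-comm _ δ))
          Λ≡ : Λ (suc r) ≡ δ ℕ.+ suc (Λ (2 ℕ.+ r))
          Λ≡ = ≡.trans (≡.sym (ℕ.m∸n+n≡m (Λ-anti (ℕ.n≤1+n (suc r)))))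
            (≡.trans (≡.cong (ℕ._+ Λ (2 ℕ.+ r)) δ≡) (≡.sym (ℕ.+-suc δ _)))
          ρ≡ : ρ (suc r) ≡ length fs₀
          ρ≡ = ≡.trans (ρ-drop (s≤s z≤n) r<h δ≡) (≡.trans Λ≡ (≡.sym length₀))
          ρ≡+0 : length fs₀ ℕ.+ 0 ≡ ρ (suc r)
          ρ≡+0 = ≡.trans (ℕ.+-identityʳ _) (≡.sym ρ≡)
          ν≡ : ν (suc r) ≡ j ℕ.+ δ
          ν≡ = ≡.trans (ν-step (s≤s z≤n) r<h) (≡.cong (λ d → j ℕ.+ (d ∸ 1)) δ≡)
          last≡ : ε (length fs₀ ℕ.+ 0) ≡ j ℕ.+ δ
          last≡ = ≡.trans (≡.cong ε (≡.trans (ℕ.+-identityʳ _) length₀))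
            (≡.trans (ε-step (s≤s z≤n) r<h (≡.subst (δ <_) (≡.sym δ≡) ℕ.≤-refl)) (ℕ.+-comm δ j))
          select≡ : select ε 0 fs₀ ≡ select ε 0 fs ++ interval j δ
          select≡ = ≡.trans (select-++ ε 0 fs (replicate δ true)) (≡.cong (select ε 0 fs ++_)
            (select-replicate ε _ j δ λ k k<δ → ≡.trans (≡.cong (λ n → ε (k ℕ.+ n)) (≡.trans (ℕ.+-identityʳ _) lf))
              (ε-step (s≤s z≤n) r<h (≡.subst (k <_) (≡.sym δ≡) (ℕ.m≤n⇒m≤1+n k<δ)))))

      climb-labels zero fs r<h lf = trans (climb-suc 0 _) (climb-flat 0 fs r<h lf
          (≡.trans (≡.cong (_∸ Λ 2) Λ1≡Λ2) (ℕ.n∸n≡0 (Λ 2))) _ _ (λ _ _ → trans (+-identityʳ _) (*-identityˡ _)))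
      climb-labels (suc r) fs r<h lf = trans (climb-suc (suc r) _) (cases _ ≡.refl)
        where
          j = suc (ν (3 ℕ.+ r))
          g = λ fs′ → climb (suc r) (fs′ ++ replicate (Λ (suc r) ∸ Λ (2 ℕ.+ r)) true)
          label : ∀ d → Λ (2 ℕ.+ r) ∸ Λ (3 ℕ.+ r) ≡ d → suc (ν (2 ℕ.+ r)) ≡ suc (j ℕ.+ (d ∸ 1))
          label d δ≡ = ≡.cong suc (≡.trans (ν-step (s≤s z≤n) r<h) (≡.cong (λ d → j ℕ.+ (d ∸ 1)) δ≡))
          gg : ∀ d → Λ (2 ℕ.+ r) ∸ Λ (3 ℕ.+ r) ≡ d → ∀ fs′ → length fs′ ≡ suc (Λ (2 ℕ.+ r)) →
            g fs′ ≈ labelSum v (suc (j ℕ.+ (d ∸ 1))) (select ε 0 fs′) (drops Λ (suc r))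
          gg d δ≡ fs′ l = trans (climb-labels r fs′ (ℕ.<⇒≤ r<h) l)
            (reflexive (≡.cong (λ n → labelSum v n (select ε 0 fs′) (drops Λ (suc r))) (label d δ≡)))
          cases : ∀ d → Λ (2 ℕ.+ r) ∸ Λ (3 ℕ.+ r) ≡ d →
            ∑ K (bits (m ∸ suc r)) (λ b → rowWt (a (2 ℕ.+ r)) (e (2 ℕ.+ r)) 0 b *
              (⟦ T? (allows (fs ++ replicate (Λ (2 ℕ.+ r) ∸ Λ (3 ℕ.+ r)) true) b) ⟧
                * g (cut (fs ++ replicate (Λ (2 ℕ.+ r) ∸ Λ (3 ℕ.+ r)) true) b)))
            ≈ labelSum v j (select ε 0 fs) (Λ (2 ℕ.+ r) ∸ Λ (3 ℕ.+ r) ∷ drops Λ (suc r))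
          cases zero    δ≡ = trans (climb-flat (suc r) fs r<h lf δ≡ g _ (gg zero δ≡))
            (trans (rowSum-cong _ (select ε 0 fs) [] (λ S′ → reflexive (≡.cong (λ n → labelSum v (suc n) S′ (drops Λ (suc r))) (ℕ.+-identityʳ j))))
              (reflexive (≡.cong (λ d → labelSum v j (select ε 0 fs) (d ∷ drops Λ (suc r))) (≡.sym δ≡))))
          cases (suc δ) δ≡ = trans (climb-drop (suc r) fs δ r<h lf δ≡ g _ (gg (suc δ) δ≡))
            (reflexive (≡.cong (λ d → labelSum v j (select ε 0 fs) (d ∷ drops Λ (suc r))) (≡.sym δ≡)))

      -- Rows below the region contain no box of it and sum out to 1.
      climb-empty : ∀ d → climb (d ℕ.+ h) (replicate (suc (Λ (d ℕ.+ h))) true) ≈ climb h (replicate (suc (Λ h)) true)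
      climb-empty zero    = refl
      climb-empty (suc d) = trans (climb-suc (d ℕ.+ h) _)
          (trans (reflexive (≡.cong (λ n → ∑ K (bits (m ∸ (d ℕ.+ h))) (λ b → rowWt (a r) (e r) 0 b *
             (⟦ T? (allows (replicate (suc n) true) b) ⟧ * climb (d ℕ.+ h) (cut (replicate (suc n) true) b ++ replicate (Λ (d ℕ.+ h) ∸ n) true)))) Λ≡0))
          (trans (Row.∑-extra ε (λ s → v (s , 0)) (a r) (e r) (m ∸ (d ℕ.+ h)) 0 one′
            (λ {j} _ → outside (≡.subst (_≤ j) (≡.sym ρ≡0) z≤n))
            (λ fs′ → climb (d ℕ.+ h) (fs′ ++ replicate (Λ (d ℕ.+ h)) true)))
          (climb-empty d)))
        where
          r = suc (d ℕ.+ h)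
          Λ≡0 = Λ-empty (s≤s (ℕ.m≤n+m h d))
          ρ≡0 = ρ-empty (s≤s (ℕ.m≤n+m h d))

-- Sorted lists, and the tree in terms of its vertices.

Increasing : List ℕ → Set
Increasing = AllPairs _<_

private
  module Insertion = SortingAlgorithm (insertionSort ≤-decTotalOrder)

sort-resp-↭ : ∀ {xs ys} → xs ↭ ys → sort ≤-decTotalOrder xs ≡ sort ≤-decTotalOrder ys
sort-resp-↭ {xs} {ys} p = Pointwise-≡⇒≡ (↗↭↗⇒≋ ≤-totalOrder (Insertion.sort-↗ xs) (Insertion.sort-↗ ys)
  (↭⇒↭ₛ (↭-trans (Insertion.sort-↭ xs) (↭-trans p (↭-sym (Insertion.sort-↭ ys))))))

sort-increasing : ∀ {xs} → Increasing xs → sort ≤-decTotalOrder xs ≡ xs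
sort-increasing {xs} inc = Pointwise-≡⇒≡ (↗↭↗⇒≋ ≤-totalOrder (Insertion.sort-↗ xs)
  (AllPairs⇒Sorted ≤-totalOrder (AllPairs.map ℕ.<⇒≤ inc)) (↭⇒↭ₛ (Insertion.sort-↭ xs)))

Avoids : List ℕ → Edge → Set
Avoids js (a , b) = a ∉ js × b ∉ js

-- The edges of the tree from the vertex p on: p is the last vertex with both
-- an east and a north step, and j the next vertex.
treeEdges : ℕ → ℕ → List ℕ → List Edge
treeEdges p j []           = (p , j) ∷ []
treeEdges p j (zero ∷ ds)  = (p , j) ∷ treeEdges p (suc j) ds
treeEdges p j (suc δ ∷ ds) = (p , j ℕ.+ δ) ∷ map (_, j ℕ.+ δ) (interval j δ)
  ++ treeEdges (j ℕ.+ δ) (suc (j ℕ.+ δ)) ds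

-- Three kinds of vertices occur: those of `interval j δ` have only an east step, j + δ after them
-- has both kinds of steps, and the j of the other two clauses has only a north step.
vertices : ℕ → List ℕ → List ℕ
vertices j []           = j ∷ []
vertices j (zero ∷ ds)  = j ∷ vertices (suc j) ds
vertices j (suc δ ∷ ds) = interval j δ ++ j ℕ.+ δ ∷ vertices (suc (j ℕ.+ δ)) ds

-- Evaluated reductions, vertex by vertex, at β = -1.

module Fan {c ℓ} (K : CommutativeRing c ℓ) (v : Edge → CommutativeRing.Carrier K) where
  open CommutativeRing K hiding (zero) renaming (_+_ to _⊕_; -_ to ⊝_; _-_ to _⊖_)
  open Exp semiring using (_^_)
  open Sums K
  open Bottom K
  open Labelled K
  open import Relation.Binary.Reasoning.Setoid setoid
  open SemiringSolver commutativeSemiring using (solve; _:+_; _:*_; _:=_; con)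

  n₁ : Carrier
  n₁ = ⊝ 1#

  1+n₁ : 1# ⊕ n₁ ≈ 0#
  1+n₁ = -‿inverseʳ 1#

  -- What a term contributes in the end when the vertices js are still to be treated.
  value : List ℕ → Term → Carrier
  value []       (k , es) = n₁ ^ k * ∏ K es v
  value (j ∷ js) t        = ∑ K (reduceAt j t) (value js)

  eval-value : ∀ js p → eval K n₁ v (foldl (λ p j → concatMap (reduceAt j) p) p js) ≈ ∑ K p (value js)
  eval-value []       p = refl
  eval-value (j ∷ js) p = trans (eval-value js (concatMap (reduceAt j) p)) (∑-concatMap (reduceAt j) p (value js))

  -- What is needed of the continuation F, the evaluation of the reductions still to come: β counts
  -- as -1, and the order of the edges is irrelevant. The latter holds for `value` because
  -- `reduceAt` sorts sources and targets.
  record Linear (F : Term → Carrier) : Set (c Level.⊔ ℓ) where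
    field
      shift : ∀ k es → F (suc k , es) ≈ n₁ * F (k , es)
      perm  : ∀ k {es es′} → es ↭ es′ → F (k , es) ≈ F (k , es′)
  open Linear

  fan : (Term → Carrier) → ℕ → List ℕ → List ℕ → Term → Carrier
  fan F j is os t = ∑ K (reduceFan j is os t) F

  fan-∷ : ∀ F j i is o os k es → fan F j (i ∷ is) (o ∷ os) (k , es) ≈
    fan F j (i ∷ is) os (k , (i , o) ∷ es) ⊕ (fan F j is (o ∷ os) (k , (i , o) ∷ es) ⊕ fan F j is os (suc k , (i , o) ∷ es))
  fan-∷ F j i is o os k es = trans (∑-++ (reduceFan j (i ∷ is) os _) _ F) (+-congˡ (∑-++ (reduceFan j is (o ∷ os) _) _ F))

  fan-linear : ∀ {F} → Linear F → ∀ j is os → Linear (fan F j is os)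
  fan-linear {F} L j is os = record { shift = shift′ is os ; perm = perm′ is os }
    where
      shift′ : ∀ is os k es → fan F j is os (suc k , es) ≈ n₁ * fan F j is os (k , es)
      shift′ [] os k es = trans (+-identityʳ _) (trans (shift L k _) (*-congˡ (sym (+-identityʳ _))))
      shift′ (i ∷ is) [] k es = trans (+-identityʳ _) (trans (shift L k _) (*-congˡ (sym (+-identityʳ _))))
      shift′ (i ∷ is) (o ∷ os) k es = trans (fan-∷ F j i is o os (suc k) es)
        (trans (+-cong (shift′ (i ∷ is) os k _) (+-cong (shift′ is (o ∷ os) k _) (shift′ is os (suc k) _)))
        (trans (solve 4 (λ n a b c → n :* a :+ (n :* b :+ n :* c) := n :* (a :+ (b :+ c))) refl n₁ _ _ _)
        (*-congˡ (sym (fan-∷ F j i is o os k es)))))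
      perm′ : ∀ is os k {es es′} → es ↭ es′ → fan F j is os (k , es) ≈ fan F j is os (k , es′)
      perm′ [] os k p = +-congʳ (perm L k (Perm.++⁺ˡ (map (j ,_) os) p))
      perm′ (i ∷ is) [] k p = +-congʳ (perm L k (Perm.++⁺ˡ (map (_, j) (i ∷ is)) p))
      perm′ (i ∷ is) (o ∷ os) k {es} {es′} p = trans (fan-∷ F j i is o os k es)
        (trans (+-cong (perm′ (i ∷ is) os k q) (+-cong (perm′ is (o ∷ os) k q) (perm′ is os (suc k) q)))
        (sym (fan-∷ F j i is o os k es′)))
        where q = Perm.prep (i , o) p

  value-linear : ∀ js → Linear (value js)
  value-linear [] = record { shift = λ k es → *-assoc _ _ _ ; perm = λ k p → *-congˡ (∏-↭ v p) }
  value-linear (j ∷ js) = record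
    { shift = λ k es → shift (fan-linear (value-linear js) j (sources es) (targets es)) k (others es)
    ; perm  = λ k {es} {es′} p → begin
        fan (value js) j (sources es) (targets es) (k , others es)
          ≡⟨ ≡.cong₂ (λ is os → fan (value js) j is os (k , others es))
               (sort-resp-↭ (Perm.map⁺ proj₁ (Perm.filter-↭ (λ e → proj₂ e ≟ j) p)))
               (≡.cong reverse (sort-resp-↭ (Perm.map⁺ proj₂ (Perm.filter-↭ (λ e → proj₁ e ≟ j) p)))) ⟩
        fan (value js) j (sources es′) (targets es′) (k , others es)
          ≈⟨ perm (fan-linear (value-linear js) j (sources es′) (targets es′)) k (Perm.filter-↭ (λ e → ¬? (proj₁ e ≟ j) ×-dec ¬? (proj₂ e ≟ j)) p) ⟩
        fan (value js) j (sources es′) (targets es′) (k , others es′) ∎ }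
    where
      sources = λ es → sort ≤-decTotalOrder (map proj₁ (filter (λ e → proj₂ e ≟ j) es))
      targets = λ es → reverse (sort ≤-decTotalOrder (map proj₂ (filter (λ e → proj₁ e ≟ j) es)))
      others = filter (λ e → ¬? (proj₁ e ≟ j) ×-dec ¬? (proj₂ e ≟ j))

  value-fan : ∀ j js {is ts rest es} k → Increasing is → Increasing ts →
    All (_≢ j) is → All (_≢ j) ts → All (λ e → proj₁ e ≢ j × proj₂ e ≢ j) rest →
    es ↭ map (_, j) is ++ map (j ,_) ts ++ rest →
    value (j ∷ js) (k , es) ≈ fan (value js) j is (reverse ts) (k , rest)
  value-fan j js {is} {ts} {rest} {es} k incI incT i≢j t≢j avoid p = begin
    value (j ∷ js) (k , es)
      ≈⟨ perm (value-linear (j ∷ js)) k p ⟩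
    value (j ∷ js) (k , es′)
      ≡⟨ ≡.cong₂ (λ is os → fan (value js) j is os (k , filter P₃ es′)) sources≡ targets≡ ⟩
    fan (value js) j is (reverse ts) (k , filter P₃ es′)
      ≡⟨ ≡.cong (λ r → fan (value js) j is (reverse ts) (k , r)) others≡ ⟩
    fan (value js) j is (reverse ts) (k , rest) ∎
    where
      I = map (_, j) is
      O = map (j ,_) ts
      es′ = I ++ O ++ rest
      P₂ = λ (e : Edge) → proj₂ e ≟ j
      P₁ = λ (e : Edge) → proj₁ e ≟ j
      P₃ = λ (e : Edge) → ¬? (proj₁ e ≟ j) ×-dec ¬? (proj₂ e ≟ j)
      split : ∀ {P : Edge → Set} (P? : ∀ e → Dec (P e)) → filter P? es′ ≡ filter P? I ++ filter P? O ++ filter P? rest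
      split P? = ≡.trans (List.filter-++ P? I _) (≡.cong (filter P? I ++_) (List.filter-++ P? O rest))
      map-pair₁ : ∀ xs → map proj₁ (map (_, j) xs) ≡ xs
      map-pair₁ xs = ≡.trans (≡.sym (List.map-∘ xs)) (List.map-id xs)
      map-pair₂ : ∀ xs → map proj₂ (map (j ,_) xs) ≡ xs
      map-pair₂ xs = ≡.trans (≡.sym (List.map-∘ xs)) (List.map-id xs)
      sources≡ : sort ≤-decTotalOrder (map proj₁ (filter P₂ es′)) ≡ is
      sources≡ = ≡.trans (≡.cong (sort ≤-decTotalOrder) (≡.trans (≡.cong (map proj₁)
        (≡.trans (split P₂) (≡.cong₂ _++_ (List.filter-all P₂ (All.map⁺ (All.tabulate {xs = is} λ _ → ≡.refl)))
          (≡.cong₂ _++_ (List.filter-none P₂ (All.map⁺ t≢j)) (List.filter-none P₂ (All.map proj₂ avoid))))))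
        (≡.trans (≡.cong (map proj₁) (List.++-identityʳ I)) (map-pair₁ is)))) (sort-increasing incI)
      targets≡ : reverse (sort ≤-decTotalOrder (map proj₂ (filter P₁ es′))) ≡ reverse ts
      targets≡ = ≡.cong reverse (≡.trans (≡.cong (sort ≤-decTotalOrder) (≡.trans (≡.cong (map proj₂)
        (≡.trans (split P₁) (≡.cong₂ _++_ (List.filter-none P₁ (All.map⁺ i≢j))
          (≡.cong₂ _++_ (List.filter-all P₁ (All.map⁺ (All.tabulate {xs = ts} λ _ → ≡.refl))) (List.filter-none P₁ (All.map proj₁ avoid))))))
        (≡.trans (≡.cong (map proj₂) (List.++-identityʳ O)) (map-pair₂ ts)))) (sort-increasing incT))
      others≡ : filter P₃ es′ ≡ rest
      others≡ = ≡.trans (split P₃) (≡.cong₂ _++_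
        (List.filter-none P₃ (All.map⁺ (All.tabulate {xs = is} λ _ q → proj₂ q ≡.refl)))
        (≡.cong₂ _++_ (List.filter-none P₃ (All.map⁺ (All.tabulate {xs = ts} λ _ q → proj₁ q ≡.refl))) (List.filter-all P₃ avoid)))

  fan-frame : ∀ {F} → Linear F → ∀ e → (∀ k es → F (k , e ∷ es) ≈ v e * F (k , es)) →
    ∀ j is os k es → fan F j is os (k , e ∷ es) ≈ v e * fan F j is os (k , es)
  fan-frame L e f j []       os       k es = trans (+-congʳ (trans (perm L k (Perm.shift e (map (j ,_) os) es)) (f k _)))
    (trans (+-identityʳ _) (*-congˡ (sym (+-identityʳ _))))
  fan-frame L e f j (i ∷ is) []       k es = trans (+-congʳ (trans (perm L k (Perm.shift e (map (_, j) (i ∷ is)) es)) (f k _)))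
    (trans (+-identityʳ _) (*-congˡ (sym (+-identityʳ _))))
  fan-frame {F} L e f j (i ∷ is) (o ∷ os) k es = begin
    fan F j (i ∷ is) (o ∷ os) (k , e ∷ es)
      ≈⟨ fan-∷ F j i is o os k (e ∷ es) ⟩
    _ ≈⟨ +-cong (move (i ∷ is) os k) (+-cong (move is (o ∷ os) k) (move is os (suc k))) ⟩
    _ ≈⟨ solve 4 (λ v a b c → v :* a :+ (v :* b :+ v :* c) := v :* (a :+ (b :+ c))) refl (v e) _ _ _ ⟩
    _ ≈⟨ *-congˡ (sym (fan-∷ F j i is o os k es)) ⟩
    v e * fan F j (i ∷ is) (o ∷ os) (k , es) ∎
    where
      move : ∀ is os k → fan F j is os (k , (i , o) ∷ e ∷ es) ≈ v e * fan F j is os (k , (i , o) ∷ es)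
      move is os k = trans (perm (fan-linear L j is os) k (Perm.swap (i , o) e Perm.refl)) (fan-frame L e f j is os k _)

  -- An edge with no endpoint in js takes part in no further reduction.
  value-frame : ∀ js e → Avoids js e → ∀ k es → value js (k , e ∷ es) ≈ v e * value js (k , es)
  value-frame []       e _ k es = solve 3 (λ n a b → n :* (a :* b) := a :* (n :* b)) refl _ _ _
  value-frame (j ∷ js) e@(a , b) (a∉ , b∉) k es = trans
    (reflexive (≡.trans
      (≡.cong₂ (λ x y → fan (value js) j (sources x) (targets y) (k , filter P₃ (e ∷ es)))
        (List.filter-reject (λ e → proj₂ e ≟ j) {e} {es} (b∉ ∘ here)) (List.filter-reject (λ e → proj₁ e ≟ j) {e} {es} (a∉ ∘ here)))
      (≡.cong (λ z → fan (value js) j is os (k , z)) (List.filter-accept P₃ {e} {es} (a∉ ∘ here , b∉ ∘ here)))))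
    (fan-frame (value-linear js) e (value-frame js e (a∉ ∘ there , b∉ ∘ there)) j is os k (filter P₃ es))
    where
      sources targets : List Edge → List ℕ
      sources = λ es → sort ≤-decTotalOrder (map proj₁ es)
      targets = λ es → reverse (sort ≤-decTotalOrder (map proj₂ es))
      P₃ = λ (e : Edge) → ¬? (proj₁ e ≟ j) ×-dec ¬? (proj₂ e ≟ j)
      is = sources (filter (λ e → proj₂ e ≟ j) es)
      os = targets (filter (λ e → proj₁ e ≟ j) es)

-- Elbow sets in a rectangle and the reductions at one vertex.

module Chains {c ℓ} (K : CommutativeRing c ℓ) (v : Edge → CommutativeRing.Carrier K) where
  open CommutativeRing K hiding (zero) renaming (_+_ to _⊕_; -_ to ⊝_; _-_ to _⊖_)
  open Sums K
  open Bottom K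
  open Labelled K
  open Fan K v
  open Linear
  open import Relation.Binary.Reasoning.Setoid setoid
  open SemiringSolver commutativeSemiring using (solve; _:+_; _:*_; _:=_; con)

  into : ℕ → ℕ → Carrier
  into r s = v (s , r)

  -- The continuation only meets sublists of `S ++ τ`, which inherit order and bounds.
  rowSum-cong-on : ∀ (w : ℕ → Carrier) (Q : ℕ → Set) S τ {f g : List ℕ → Carrier} → Increasing (S ++ τ) → All Q (S ++ τ) →
    (∀ S′ → Increasing S′ → All Q S′ → f S′ ≈ g S′) → rowSum w S τ f ≈ rowSum w S τ g
  rowSum-cong-on w Q []      τ inc q p = p τ inc q
  rowSum-cong-on w Q (s ∷ S) τ (s< ∷ inc) (qs ∷ q) p = +-cong (*-congˡ (*-congˡ (p (s ∷ []) ([] ∷ []) (qs ∷ []))))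
    (rowSum-cong-on w (λ x → Q x × s < x) S τ inc (All.zipWith id (q , s<))
      (λ S′ inc′ q′ → p (s ∷ S′) (All.map proj₂ q′ ∷ inc′) (qs ∷ All.map proj₁ q′)))

  rowSum-+ : ∀ (w : ℕ → Carrier) S τ (f g : List ℕ → Carrier) → rowSum w S τ (λ S′ → f S′ ⊕ g S′) ≈ rowSum w S τ f ⊕ rowSum w S τ g
  rowSum-+ w []      τ f g = refl
  rowSum-+ w (s ∷ S) τ f g = trans (+-congˡ (rowSum-+ w S τ _ _))
    (solve 6 (λ z P a b c d → z :* (P :* (a :+ b)) :+ (c :+ d) := z :* (P :* a) :+ c :+ (z :* (P :* b) :+ d)) refl _ _ _ _ _ _)

  rowSum-* : ∀ (w : ℕ → Carrier) S τ x (f : List ℕ → Carrier) → rowSum w S τ (λ S′ → x * f S′) ≈ x * rowSum w S τ f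
  rowSum-* w []      τ x f = refl
  rowSum-* w (s ∷ S) τ x f = trans (+-congˡ (rowSum-* w S τ x _))
    (solve 5 (λ z P x a c → z :* (P :* (x :* a)) :+ x :* c := x :* (z :* (P :* a) :+ c)) refl _ _ _ _ _)

  z+1 : ∀ x → (x ⊖ 1#) ⊕ 1# ≈ x
  z+1 x = trans (+-assoc _ _ _) (trans (+-congˡ (-‿inverseˡ 1#)) (+-identityʳ x))

  rowSum-one : ∀ (w : ℕ → Carrier) S τ → rowSum w S τ (λ _ → 1#) ≈ ∏ K S w
  rowSum-one w []      τ = refl
  rowSum-one w (s ∷ S) τ = begin
    (w s ⊖ 1#) * (∏ K S w * 1#) ⊕ rowSum w S τ (λ _ → 1#) ≈⟨ +-congˡ (rowSum-one w S τ) ⟩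
    (w s ⊖ 1#) * (∏ K S w * 1#) ⊕ ∏ K S w ≈⟨ solve 2 (λ z P → z :* (P :* con 1) :+ P := (z :+ con 1) :* P) refl _ _ ⟩
    ((w s ⊖ 1#) ⊕ 1#) * ∏ K S w ≈⟨ *-congʳ (z+1 (w s)) ⟩
    w s * ∏ K S w ∎

  rowSum-singleton : ∀ (w : ℕ → Carrier) s (g : List ℕ → Carrier) → rowSum w [ s ] [] g ≈ w s * g [ s ]
  rowSum-singleton w s g = trans (solve 2 (λ z x → z :* (con 1 :* x) :+ x := (z :+ con 1) :* x) refl _ _) (*-congʳ (z+1 (w s)))

  -- Consecutive rows in which no column begins, so that the boxes form a full rectangle.
  rows : List ℕ → List ℕ → (List ℕ → Carrier) → Carrier
  rows []       S g = g S
  rows (r ∷ rs) S g = rowSum (into r) S [] (λ S′ → rows rs S′ g)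

  rows-cong-on : ∀ (Q : ℕ → Set) rs S {f g : List ℕ → Carrier} → Increasing S → All Q S →
    (∀ S′ → Increasing S′ → All Q S′ → f S′ ≈ g S′) → rows rs S f ≈ rows rs S g
  rows-cong-on Q []       S inc q p = p S inc q
  rows-cong-on Q (r ∷ rs) S inc q p = rowSum-cong-on (into r) Q S []
    (≡.subst Increasing (≡.sym (List.++-identityʳ S)) inc) (≡.subst (All Q) (≡.sym (List.++-identityʳ S)) q)
    (λ S′ inc′ q′ → rows-cong-on Q rs S′ inc′ q′ p)

  rows-∷ʳ : ∀ rs r S g → rows (rs ∷ʳ r) S g ≈ rows rs S (λ S′ → rowSum (into r) S′ [] g)
  rows-∷ʳ []       r S g = refl
  rows-∷ʳ (x ∷ rs) r S g = rowSum-cong (into x) S [] (λ S′ → rows-∷ʳ rs r S′ g)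

  chains : List ℕ → List ℕ → Carrier
  chains rs S = rows rs S (λ _ → 1#)

  chains-[] : ∀ rs → chains rs [] ≈ 1#
  chains-[] []       = refl
  chains-[] (r ∷ rs) = chains-[] rs

  -- Either the chain avoids column i, or it cuts the list of columns to i alone.
  rows-∷ : ∀ rs i S g → rows rs (i ∷ S) g ≈ rows rs S (g ∘ (i ∷_)) ⊕ g [ i ] * (chains rs (i ∷ S) ⊕ n₁ * chains rs S)

  -- An elbow never cuts off its own column, so a single column always survives.
  rows-singleton : ∀ rs i g → rows rs [ i ] g ≈ g [ i ] * chains rs [ i ]

  private
    -- The first row has weights of its own and a τ: this form serves the induction for `rows-∷` as
    -- well as the row of the vertex p, which lacks a box in column p.
    rowSum-rows-∷ : ∀ (w : ℕ → Carrier) rs i S τ g →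
      rowSum w (i ∷ S) τ (λ S′ → rows rs S′ g) ≈
      rowSum w S τ (λ S′ → rows rs S′ (g ∘ (i ∷_))) ⊕ g [ i ] * (rowSum w (i ∷ S) τ (chains rs) ⊕ n₁ * rowSum w S τ (chains rs))
    rowSum-rows-∷ w rs i S τ g = begin
      (w i ⊖ 1#) * (∏ K S w * rows rs [ i ] g) ⊕ rowSum w S τ (λ S′ → rows rs (i ∷ S′) g)
        ≈⟨ +-cong (*-congˡ (*-congˡ (rows-singleton rs i g))) (begin
             rowSum w S τ (λ S′ → rows rs (i ∷ S′) g)
               ≈⟨ rowSum-cong w S τ (λ S′ → rows-∷ rs i S′ g) ⟩
             rowSum w S τ (λ S′ → rows rs S′ (g ∘ (i ∷_)) ⊕ g [ i ] * (chains rs (i ∷ S′) ⊕ n₁ * chains rs S′))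
               ≈⟨ trans (rowSum-+ w S τ _ _) (+-congˡ (trans (rowSum-* w S τ _ _)
                    (*-congˡ (trans (rowSum-+ w S τ _ _) (+-congˡ (rowSum-* w S τ _ _)))))) ⟩
             rowSum w S τ (λ S′ → rows rs S′ (g ∘ (i ∷_))) ⊕ g [ i ] * (rowSum w S τ (chains rs ∘ (i ∷_)) ⊕ n₁ * rowSum w S τ (chains rs)) ∎) ⟩
      (w i ⊖ 1#) * (∏ K S w * (g [ i ] * chains rs [ i ]))
        ⊕ (rowSum w S τ (λ S′ → rows rs S′ (g ∘ (i ∷_))) ⊕ g [ i ] * (rowSum w S τ (chains rs ∘ (i ∷_)) ⊕ n₁ * rowSum w S τ (chains rs)))
        ≈⟨ solve 7 (λ z P g C A B D → z :* (P :* (g :* C)) :+ (A :+ g :* (B :+ D)) := A :+ g :* (z :* (P :* C) :+ B :+ D)) refl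
             _ _ (g [ i ]) _ _ _ _ ⟩
      rowSum w S τ (λ S′ → rows rs S′ (g ∘ (i ∷_))) ⊕ g [ i ] * (rowSum w (i ∷ S) τ (chains rs) ⊕ n₁ * rowSum w S τ (chains rs)) ∎

  rows-∷ [] i S g = sym (trans (+-congˡ (trans (*-congˡ (trans (+-congˡ (*-identityʳ _)) 1+n₁)) (zeroʳ _))) (+-identityʳ _))
  rows-∷ (r ∷ rs) i S g = rowSum-rows-∷ (into r) rs i S [] g

  rows-singleton rs i g = begin
    rows rs [ i ] g ≈⟨ rows-∷ rs i [] g ⟩
    rows rs [] (g ∘ (i ∷_)) ⊕ g [ i ] * (chains rs [ i ] ⊕ n₁ * chains rs [])
      ≈⟨ +-cong (rows-[] rs (g ∘ (i ∷_))) (*-congˡ (+-congˡ (trans (*-congˡ (chains-[] rs)) (*-identityʳ _)))) ⟩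
    g [ i ] ⊕ g [ i ] * (chains rs [ i ] ⊕ n₁)
      ≈⟨ solve 3 (λ g C n → g :+ g :* (C :+ n) := g :* (C :+ (con 1 :+ n))) refl _ _ _ ⟩
    g [ i ] * (chains rs [ i ] ⊕ (1# ⊕ n₁)) ≈⟨ *-congˡ (trans (+-congˡ 1+n₁) (+-identityʳ _)) ⟩
    g [ i ] * chains rs [ i ] ∎
    where
      rows-[] : ∀ rs g → rows rs [] g ≈ g []
      rows-[] []       g = refl
      rows-[] (r ∷ rs) g = rows-[] rs g

  -- Inclusion-exclusion at the corner. The box of the first column i in the last, topmost row o
  -- forms no forbidden pair and contributes the factor 1 + z = `v (i , o)`. Any other elbow of
  -- column i lies to the lower left of any other elbow of row o, so one of the two kinds is absent:
  -- row o or column i may be deleted, and the sets for which both may be deleted have been counted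
  -- twice.
  chains-∷ʳ : ∀ rs o i S → chains (rs ∷ʳ o) (i ∷ S) ≈
    v (i , o) * (chains rs (i ∷ S) ⊕ (chains (rs ∷ʳ o) S ⊕ n₁ * chains rs S))

  -- The same corner, with one more row below, in which the columns of τ have no box.
  rowSum-chains-∷ʳ : ∀ (w : ℕ → Carrier) rs o i S τ → rowSum w (i ∷ S) τ (chains (rs ∷ʳ o)) ≈
    v (i , o) * (rowSum w (i ∷ S) τ (chains rs) ⊕ (rowSum w S τ (chains (rs ∷ʳ o)) ⊕ n₁ * rowSum w S τ (chains rs)))
  rowSum-chains-∷ʳ w rs o i S τ = begin
    (w i ⊖ 1#) * (∏ K S w * chains (rs ∷ʳ o) [ i ]) ⊕ rowSum w S τ (chains (rs ∷ʳ o) ∘ (i ∷_))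
      ≈⟨ +-cong (*-congˡ (*-congˡ single)) (begin
           rowSum w S τ (chains (rs ∷ʳ o) ∘ (i ∷_))
             ≈⟨ rowSum-cong w S τ (λ S′ → chains-∷ʳ rs o i S′) ⟩
           rowSum w S τ (λ S′ → v (i , o) * (chains rs (i ∷ S′) ⊕ (chains (rs ∷ʳ o) S′ ⊕ n₁ * chains rs S′)))
             ≈⟨ trans (rowSum-* w S τ _ _) (*-congˡ (trans (rowSum-+ w S τ _ _)
                  (+-congˡ (trans (rowSum-+ w S τ _ _) (+-congˡ (rowSum-* w S τ _ _)))))) ⟩
           v (i , o) * (rowSum w S τ (chains rs ∘ (i ∷_)) ⊕ (rowSum w S τ (chains (rs ∷ʳ o)) ⊕ n₁ * rowSum w S τ (chains rs))) ∎) ⟩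
    (w i ⊖ 1#) * (∏ K S w * (v (i , o) * chains rs [ i ]))
      ⊕ v (i , o) * (rowSum w S τ (chains rs ∘ (i ∷_)) ⊕ (rowSum w S τ (chains (rs ∷ʳ o)) ⊕ n₁ * rowSum w S τ (chains rs)))
      ≈⟨ solve 6 (λ z P v C A B → z :* (P :* (v :* C)) :+ v :* (A :+ B) := v :* (z :* (P :* C) :+ A :+ B)) refl _ _ _ _ _ _ ⟩
    v (i , o) * (rowSum w (i ∷ S) τ (chains rs) ⊕ (rowSum w S τ (chains (rs ∷ʳ o)) ⊕ n₁ * rowSum w S τ (chains rs))) ∎
    where
      single : chains (rs ∷ʳ o) [ i ] ≈ v (i , o) * chains rs [ i ]
      single = trans (chains-∷ʳ rs o i []) (*-congˡ (trans (+-congˡ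
        (trans (+-cong (chains-[] (rs ∷ʳ o)) (trans (*-congˡ (chains-[] rs)) (*-identityʳ _))) 1+n₁)) (+-identityʳ _)))

  chains-∷ʳ [] o i S = begin
    rowSum (into o) (i ∷ S) [] (λ _ → 1#) ≈⟨ rowSum-one (into o) (i ∷ S) [] ⟩
    v (i , o) * ∏ K S (into o)
      ≈⟨ *-congˡ (sym (trans (solve 3 (λ a P n → a :+ (P :+ n :* a) := P :+ (a :+ n :* a)) refl 1# _ n₁)
           (trans (+-congˡ (trans (+-congˡ (*-identityʳ _)) 1+n₁)) (+-identityʳ _)))) ⟩
    v (i , o) * (1# ⊕ (∏ K S (into o) ⊕ n₁ * 1#)) ≈⟨ *-congˡ (+-congˡ (+-congʳ (sym (rowSum-one (into o) S [])))) ⟩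
    v (i , o) * (1# ⊕ (rowSum (into o) S [] (λ _ → 1#) ⊕ n₁ * 1#)) ∎
  chains-∷ʳ (r ∷ rs) o i S = rowSum-chains-∷ʳ (into r) rs o i S []

  -- All chains in the columns S and the rows p, rs: the row of p has no box in its own column.
  fanChains : ℕ → List ℕ → List ℕ → Carrier
  fanChains p S rs = rowSum (into p) S [ p ] (chains rs)

  -- Boxes of one column never form a forbidden pair, so each contributes 1 + z.
  chains-singleton : ∀ p rs → chains rs [ p ] ≈ ∏ K rs (λ r → v (p , r))
  chains-singleton p []       = refl
  chains-singleton p (r ∷ rs) = trans (rowSum-singleton (into r) p (chains rs)) (*-congˡ (chains-singleton p rs))

  module Top (p top : ℕ) (F : Term → Carrier) (L : Linear F) where

    -- In the use of this module the edges between p, its sources and its targets below `top` have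
    -- no endpoint among the vertices still to be treated.
    framed : List ℕ → List ℕ → Set _
    framed I rs = (∀ {i r} → i ∈ p ∷ I → r ∈ p ∷ rs → ∀ k es → F (k , (i , r) ∷ es) ≈ v (i , r) * F (k , es))

    private
      frames : ∀ es′ → (All (λ e → ∀ k es → F (k , e ∷ es) ≈ v e * F (k , es)) es′) → ∀ k es → F (k , es′ ++ es) ≈ ∏ K es′ v * F (k , es)
      frames []        []       k es = sym (*-identityˡ _)
      frames (e ∷ es′) (f ∷ fs) k es = trans (f k _) (trans (*-congˡ (frames es′ fs k es)) (sym (*-assoc _ _ _)))

    -- `reduceFan` drops the largest target, the smallest source or both, just as `rowSum-chains-∷ʳ`
    -- drops the topmost row, the leftmost column or both; the new edge (i , o) is the corner. When
    -- one side is used up, the remaining edges form a single column or a single row, whose boxes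
    -- are all free.
    fan-below : ∀ I rs → framed I rs → ∀ k es → fan F p I (reverse rs) (k , es) ≈ fanChains p I rs * F (k , es)
    fan-below I rs = go I (reverse rs) rs (≡.sym (List.reverse-involutive rs))
      where
        go : ∀ I os rs → rs ≡ reverse os → framed I rs → ∀ k es → fan F p I os (k , es) ≈ fanChains p I rs * F (k , es)
        go [] os rs eq f k es = begin
          fan F p [] os (k , es) ≈⟨ +-identityʳ _ ⟩
          F (k , map (p ,_) os ++ es)
            ≈⟨ frames (map (p ,_) os) (All.map⁺ (All.tabulate (λ {r} r∈ → f (here ≡.refl)
                 (there (≡.subst (r ∈_) (≡.sym eq) (Perm.∈-resp-↭ (↭-sym (Perm.↭-reverse os)) r∈)))))) k es ⟩
          ∏ K (map (p ,_) os) v * F (k , es)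
            ≈⟨ *-congʳ (trans (reflexive (∏-map (p ,_) os v)) (trans (∏-↭ (λ r → v (p , r)) (↭-sym (≡.subst (_↭ os) (≡.sym eq) (Perm.↭-reverse os))))
                 (sym (chains-singleton p rs)))) ⟩
          fanChains p [] rs * F (k , es) ∎
        go (i ∷ I) [] rs ≡.refl f k es = begin
          fan F p (i ∷ I) [] (k , es) ≈⟨ +-identityʳ _ ⟩
          F (k , map (_, p) (i ∷ I) ++ es)
            ≈⟨ frames (map (_, p) (i ∷ I)) (All.map⁺ (All.tabulate (λ i∈ → f (there i∈) (here ≡.refl)))) k es ⟩
          ∏ K (map (_, p) (i ∷ I)) v * F (k , es)
            ≈⟨ *-congʳ (trans (reflexive (∏-map (_, p) (i ∷ I) v)) (sym (rowSum-one (into p) (i ∷ I) [ p ]))) ⟩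
          fanChains p (i ∷ I) [] * F (k , es) ∎
        go (i ∷ I) (o ∷ os) rs eq f k es = begin
          fan F p (i ∷ I) (o ∷ os) (k , es)
            ≈⟨ fan-∷ F p i I o os k es ⟩
          fan F p (i ∷ I) os (k , es₁) ⊕ (fan F p I (o ∷ os) (k , es₁) ⊕ fan F p I os (suc k , es₁))
            ≈⟨ +-congˡ (+-congˡ (shift (fan-linear L p I os) k es₁)) ⟩
          fan F p (i ∷ I) os (k , es₁) ⊕ (fan F p I (o ∷ os) (k , es₁) ⊕ n₁ * fan F p I os (k , es₁))
            ≈⟨ +-cong (go (i ∷ I) os rs₀ ≡.refl (λ i∈ r∈ → f i∈ (up r∈)) k es₁)
                 (+-cong (go I (o ∷ os) rs eq (λ i∈ r∈ → f (left i∈) r∈) k es₁)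
                   (*-congˡ (go I os rs₀ ≡.refl (λ i∈ r∈ → f (left i∈) (up r∈)) k es₁))) ⟩
          fanChains p (i ∷ I) rs₀ * F (k , es₁) ⊕ (fanChains p I rs * F (k , es₁) ⊕ n₁ * (fanChains p I rs₀ * F (k , es₁)))
            ≈⟨ solve 5 (λ a b c n x → a :* x :+ (b :* x :+ n :* (c :* x)) := (a :+ (b :+ n :* c)) :* x) refl _ _ _ n₁ (F (k , es₁)) ⟩
          (fanChains p (i ∷ I) rs₀ ⊕ (fanChains p I rs ⊕ n₁ * fanChains p I rs₀)) * F (k , es₁)
            ≈⟨ *-congˡ (f (there (here ≡.refl)) (there (≡.subst (o ∈_) (≡.sym rs≡) (Mem.∈-++⁺ʳ rs₀ (here ≡.refl)))) k es) ⟩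
          (fanChains p (i ∷ I) rs₀ ⊕ (fanChains p I rs ⊕ n₁ * fanChains p I rs₀)) * (v (i , o) * F (k , es))
            ≈⟨ trans (sym (*-assoc _ _ _)) (*-congʳ (*-comm _ _)) ⟩
          v (i , o) * (fanChains p (i ∷ I) rs₀ ⊕ (fanChains p I rs ⊕ n₁ * fanChains p I rs₀)) * F (k , es)
            ≈⟨ *-congʳ (sym (≡.subst (λ z → fanChains p (i ∷ I) z ≈ v (i , o) * (fanChains p (i ∷ I) rs₀ ⊕ (fanChains p I z ⊕ n₁ * fanChains p I rs₀)))
                 (≡.sym rs≡) (rowSum-chains-∷ʳ (into p) rs₀ o i I [ p ]))) ⟩
          fanChains p (i ∷ I) rs * F (k , es) ∎
          where
            es₁ = (i , o) ∷ es
            rs₀ = reverse os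
            rs≡ : rs ≡ rs₀ ∷ʳ o
            rs≡ = ≡.trans eq (List.unfold-reverse o os)
            up : ∀ {r} → r ∈ p ∷ rs₀ → r ∈ p ∷ rs
            up (here x)  = here x
            up (there x) = there (≡.subst (_ ∈_) (≡.sym rs≡) (Mem.∈-++⁺ˡ x))
            left : ∀ {x} → x ∈ p ∷ I → x ∈ p ∷ i ∷ I
            left (here x)  = here x
            left (there x) = there (there x)

    -- Edges into `top` need not be factors, as `top` may itself be reduced later; they are gathered
    -- as the sources of `top`, `acc` being those already present. The sources obtained are the
    -- columns that are still permitted after the rows p and `rs`.
    fan-top : ∀ I rs acc rest → framed I rs →
      fan F p I (top ∷ reverse rs) (0 , map (_, top) acc ++ rest) ≈
      rowSum (into p) I [ p ] (λ S → rows rs S (λ S′ → F (0 , map (_, top) (acc ++ S′) ++ rest)))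
    -- With its sources used up, p keeps its own edge to `top` and is the last column to survive.
    fan-top [] rs acc rest f = begin
      fan F p [] (top ∷ reverse rs) (0 , map (_, top) acc ++ rest) ≈⟨ +-identityʳ _ ⟩
      F (0 , (p , top) ∷ map (p ,_) (reverse rs) ++ map (_, top) acc ++ rest)
        ≈⟨ perm L 0 (↭-sym (Perm.shift (p , top) (map (p ,_) (reverse rs)) _)) ⟩
      F (0 , map (p ,_) (reverse rs) ++ (p , top) ∷ map (_, top) acc ++ rest)
        ≈⟨ frames (map (p ,_) (reverse rs)) (All.map⁺ (All.tabulate (λ r∈ → f (here ≡.refl) (there (Perm.∈-resp-↭ (Perm.↭-reverse rs) r∈))))) 0 _ ⟩
      ∏ K (map (p ,_) (reverse rs)) v * F (0 , (p , top) ∷ map (_, top) acc ++ rest)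
        ≈⟨ *-cong (trans (reflexive (∏-map (p ,_) (reverse rs) v)) (trans (∏-↭ (λ r → v (p , r)) (Perm.↭-reverse rs)) (sym (chains-singleton p rs))))
             (perm L 0 (↭-trans (↭-sym (Perm.shift (p , top) (map (_, top) acc) rest))
               (Perm.↭-reflexive (≡.trans (≡.sym (List.++-assoc (map (_, top) acc) [ (p , top) ] rest))
                 (≡.cong (_++ rest) (≡.sym (List.map-++ (_, top) acc [ p ]))))))) ⟩
      chains rs [ p ] * F (0 , map (_, top) (acc ++ [ p ]) ++ rest) ≈⟨ *-comm _ _ ⟩
      F (0 , map (_, top) (acc ++ [ p ]) ++ rest) * chains rs [ p ]
        ≈⟨ sym (rows-singleton rs p _) ⟩
      rows rs [ p ] (λ S′ → F (0 , map (_, top) (acc ++ S′) ++ rest)) ∎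
    fan-top (i ∷ I) rs acc rest f = begin
      fan F p (i ∷ I) (top ∷ reverse rs) (0 , es)
        ≈⟨ fan-∷ F p i I top (reverse rs) 0 es ⟩
      -- If `top` is dropped, i is the last column to survive. If the source i is dropped, i
      -- survives and later columns may do so too. The term that drops both enters with the sign of
      -- β.
      fan F p (i ∷ I) (reverse rs) (0 , es₁) ⊕ (fan F p I (top ∷ reverse rs) (0 , es₁) ⊕ fan F p I (reverse rs) (1 , es₁))
        ≈⟨ +-cong (fan-below (i ∷ I) rs f 0 es₁)
             (+-cong (trans (perm (fan-linear L p I (top ∷ reverse rs)) 0 es₁↭) (fan-top I rs (acc ++ [ i ]) rest (λ i∈ → f (left i∈))))
               (trans (shift (fan-linear L p I (reverse rs)) 0 es₁) (*-congˡ (fan-below I rs (λ i∈ → f (left i∈)) 0 es₁)))) ⟩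
      fanChains p (i ∷ I) rs * F (0 , es₁) ⊕ (W (acc ++ [ i ]) ⊕ n₁ * (fanChains p I rs * F (0 , es₁)))
        ≈⟨ +-cong (*-congˡ F≈) (+-cong (rowSum-cong (into p) I [ p ] (λ S → rows-cong rs S (λ S′ →
             reflexive (≡.cong (λ X → F (0 , map (_, top) X ++ rest)) (List.++-assoc acc [ i ] S′))))) (*-congˡ (*-congˡ F≈))) ⟩
      fanChains p (i ∷ I) rs * g [ i ] ⊕ (rowSum (into p) I [ p ] (λ S → rows rs S (g ∘ (i ∷_))) ⊕ n₁ * (fanChains p I rs * g [ i ]))
        ≈⟨ solve 5 (λ a b n c g → a :* g :+ (b :+ n :* (c :* g)) := b :+ g :* (a :+ n :* c)) refl _ _ _ _ _ ⟩
      rowSum (into p) I [ p ] (λ S → rows rs S (g ∘ (i ∷_))) ⊕ g [ i ] * (fanChains p (i ∷ I) rs ⊕ n₁ * fanChains p I rs)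
        ≈⟨ sym (rowSum-rows-∷ (into p) rs i I [ p ] g) ⟩
      rowSum (into p) (i ∷ I) [ p ] (λ S → rows rs S g) ∎
      where
        g = λ S′ → F (0 , map (_, top) (acc ++ S′) ++ rest)
        W = λ acc → rowSum (into p) I [ p ] (λ S → rows rs S (λ S′ → F (0 , map (_, top) (acc ++ S′) ++ rest)))
        es = map (_, top) acc ++ rest
        es₁ = (i , top) ∷ es
        left : ∀ {x} → x ∈ p ∷ I → x ∈ p ∷ i ∷ I
        left (here x)  = here x
        left (there x) = there (there x)
        rows-cong : ∀ rs S {f g : List ℕ → Carrier} → (∀ S′ → f S′ ≈ g S′) → rows rs S f ≈ rows rs S g
        rows-cong []       S p = p S
        rows-cong (r ∷ rs) S p = rowSum-cong (into r) S [] (λ S′ → rows-cong rs S′ p)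
        es₁↭ : es₁ ↭ map (_, top) (acc ++ [ i ]) ++ rest
        es₁↭ = ↭-trans (↭-sym (Perm.shift (i , top) (map (_, top) acc) rest))
               (Perm.↭-reflexive (≡.trans (≡.sym (List.++-assoc (map (_, top) acc) [ (i , top) ] rest))
                 (≡.cong (_++ rest) (≡.sym (List.map-++ (_, top) acc [ i ])))))
        F≈ : F (0 , es₁) ≈ g [ i ]
        F≈ = perm L 0 es₁↭

-- Bounds on labels, and the edges at one vertex.

interval-bounds : ∀ j n → All (λ x → j ≤ x × x < j ℕ.+ n) (interval j n)
interval-bounds j zero    = []
interval-bounds j (suc n) = (ℕ.≤-refl , ℕ.m<m+n j (s≤s z≤n)) ∷
  All.map (λ {x} (p , q) → ℕ.<⇒≤ p , ≡.subst (x <_) (≡.sym (ℕ.+-suc j n)) q) (interval-bounds (suc j) n)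

interval-increasing : ∀ j n → Increasing (interval j n)
interval-increasing j zero    = []
interval-increasing j (suc n) = All.map proj₁ (interval-bounds (suc j) n) ∷ interval-increasing (suc j) n

vertices-≥ : ∀ j ds → All (j ≤_) (vertices j ds)
vertices-≥ j []           = ℕ.≤-refl ∷ []
vertices-≥ j (zero ∷ ds)  = ℕ.≤-refl ∷ All.map ℕ.<⇒≤ (vertices-≥ (suc j) ds)
vertices-≥ j (suc δ ∷ ds) = All.++⁺ (All.map proj₁ (interval-bounds j δ))
  (ℕ.m≤m+n j δ ∷ All.map (λ p → ℕ.≤-trans (ℕ.m≤m+n j δ) (ℕ.<⇒≤ p)) (vertices-≥ (suc (j ℕ.+ δ)) ds))

treeEdges-≥ : ∀ p j ds → p ≤ j → All (λ e → p ≤ proj₁ e × j ≤ proj₂ e) (treeEdges p j ds)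
treeEdges-≥ p j []           p≤j = (ℕ.≤-refl , ℕ.≤-refl) ∷ []
treeEdges-≥ p j (zero ∷ ds)  p≤j = (ℕ.≤-refl , ℕ.≤-refl) ∷
  All.map (λ (a , b) → a , ℕ.<⇒≤ b) (treeEdges-≥ p (suc j) ds (ℕ.m≤n⇒m≤1+n p≤j))
treeEdges-≥ p j (suc δ ∷ ds) p≤j = (ℕ.≤-refl , ℕ.m≤m+n j δ) ∷ All.++⁺
  (All.map⁺ (All.map (λ (a , _) → ℕ.≤-trans p≤j a , ℕ.m≤m+n j δ) (interval-bounds j δ)))
  (All.map (λ (a , b) → ℕ.≤-trans p≤j (ℕ.≤-trans (ℕ.m≤m+n j δ) a) , ℕ.≤-trans (ℕ.m≤m+n j δ) (ℕ.<⇒≤ b))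
    (treeEdges-≥ (j ℕ.+ δ) (suc (j ℕ.+ δ)) ds (ℕ.n≤1+n _)))

others? : ∀ j (e : Edge) → Dec (proj₁ e ≢ j × proj₂ e ≢ j)
others? j e = ¬? (proj₁ e ≟ j) ×-dec ¬? (proj₂ e ≟ j)

incoming-↭ : ∀ j es → All (λ e → proj₁ e ≢ j) es →
  map (_, j) (map proj₁ (filter (λ e → proj₂ e ≟ j) es)) ++ filter (others? j) es ↭ es
incoming-↭ j []             []       = Perm.refl
incoming-↭ j ((a , b) ∷ es) (p ∷ ps) with b ≟ j
... | yes ≡.refl
  rewrite List.filter-accept (λ e → proj₂ e ≟ j) {a , j} {es} ≡.refl
        | List.filter-reject (others? j) {a , j} {es} (λ q → proj₂ q ≡.refl) = Perm.prep (a , j) (incoming-↭ j es ps)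
... | no b≢j
  rewrite List.filter-reject (λ e → proj₂ e ≟ j) {a , b} {es} b≢j
        | List.filter-accept (others? j) {a , b} {es} (p , b≢j) =
  ↭-trans (Perm.shift (a , b) (map (_, j) (map proj₁ (filter (λ e → proj₂ e ≟ j) es))) _) (Perm.prep (a , b) (incoming-↭ j es ps))

outgoing-↭ : ∀ j es → All (λ e → proj₂ e ≢ j) es →
  map (j ,_) (map proj₂ (filter (λ e → proj₁ e ≟ j) es)) ++ filter (others? j) es ↭ es
outgoing-↭ j []             []       = Perm.refl
outgoing-↭ j ((a , b) ∷ es) (p ∷ ps) with a ≟ j
... | yes ≡.refl
  rewrite List.filter-accept (λ e → proj₁ e ≟ j) {j , b} {es} ≡.refl
        | List.filter-reject (others? j) {j , b} {es} (λ q → proj₁ q ≡.refl) = Perm.prep (j , b) (outgoing-↭ j es ps)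
... | no a≢j
  rewrite List.filter-reject (λ e → proj₁ e ≟ j) {a , b} {es} a≢j
        | List.filter-accept (others? j) {a , b} {es} (a≢j , p) =
  ↭-trans (Perm.shift (a , b) (map (j ,_) (map proj₂ (filter (λ e → proj₁ e ≟ j) es))) _) (Perm.prep (a , b) (outgoing-↭ j es ps))

-- The canonical reduced form of the tree as a labelled sum.

module Canonical {c ℓ} (K : CommutativeRing c ℓ) (v : Edge → CommutativeRing.Carrier K) where
  open CommutativeRing K hiding (zero) renaming (_+_ to _⊕_; -_ to ⊝_; _-_ to _⊖_)
  open Sums K
  open Bottom K
  open Labelled K
  open Fan K v
  open Chains K v
  open Linear
  open import Relation.Binary.Reasoning.Setoid setoid

  private
    fan-[] : ∀ F j is k es → fan F j is [] (k , es) ≈ F (k , map (_, j) is ++ es)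
    fan-[] F j []       k es = +-identityʳ _
    fan-[] F j (i ∷ is) k es = +-identityʳ _

    sort-↭ = SortingAlgorithm.sort-↭ (insertionSort ≤-decTotalOrder)

  value-no-outgoing : ∀ j js k es → All (λ e → proj₁ e ≢ j) es → value (j ∷ js) (k , es) ≈ value js (k , es)
  value-no-outgoing j js k es p = begin
    fan (value js) j is (reverse (sort ≤-decTotalOrder (map proj₂ (filter (λ e → proj₁ e ≟ j) es)))) (k , filter (others? j) es)
      ≡⟨ ≡.cong (λ z → fan (value js) j is (reverse (sort ≤-decTotalOrder (map proj₂ z))) (k , filter (others? j) es))
           (List.filter-none (λ e → proj₁ e ≟ j) p) ⟩
    fan (value js) j is [] (k , filter (others? j) es) ≈⟨ fan-[] (value js) j is k _ ⟩
    value js (k , map (_, j) is ++ filter (others? j) es)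
      ≈⟨ perm (value-linear js) k (↭-trans (Perm.++⁺ʳ (filter (others? j) es) (Perm.map⁺ (_, j) (sort-↭ (map proj₁ (filter (λ e → proj₂ e ≟ j) es))))) (incoming-↭ j es p)) ⟩
    value js (k , es) ∎
    where is = sort ≤-decTotalOrder (map proj₁ (filter (λ e → proj₂ e ≟ j) es))

  value-no-incoming : ∀ j js k es → All (λ e → proj₂ e ≢ j) es → value (j ∷ js) (k , es) ≈ value js (k , es)
  value-no-incoming j js k es p = begin
    fan (value js) j (sort ≤-decTotalOrder (map proj₁ (filter (λ e → proj₂ e ≟ j) es))) os (k , filter (others? j) es)
      ≡⟨ ≡.cong (λ z → fan (value js) j (sort ≤-decTotalOrder (map proj₁ z)) os (k , filter (others? j) es))
           (List.filter-none (λ e → proj₂ e ≟ j) p) ⟩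
    fan (value js) j [] os (k , filter (others? j) es) ≈⟨ +-identityʳ _ ⟩
    value js (k , map (j ,_) os ++ filter (others? j) es)
      ≈⟨ perm (value-linear js) k (↭-trans (Perm.++⁺ʳ (filter (others? j) es) (Perm.map⁺ (j ,_)
             (↭-trans (Perm.↭-reverse _) (sort-↭ (map proj₂ (filter (λ e → proj₁ e ≟ j) es)))))) (outgoing-↭ j es p)) ⟩
    value js (k , es) ∎
    where os = reverse (sort ≤-decTotalOrder (map proj₂ (filter (λ e → proj₁ e ≟ j) es)))

  -- The vertices of `ns` have only a north step and those of `Es` only an east step, so no pair of
  -- edges can be reduced there.
  value-skip : ∀ ns Es js k es → All (λ e → proj₁ e ∉ ns × proj₂ e ∉ Es) es →
    value (ns ++ Es ++ js) (k , es) ≈ value js (k , es)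
  value-skip []       []       js k es p = refl
  value-skip []       (x ∷ Es) js k es p =
    trans (value-no-incoming x (Es ++ js) k es (All.map (λ { (_ , q) ≡.refl → q (here ≡.refl) }) p))
      (value-skip [] Es js k es (All.map (λ (a , b) → a , b ∘ there) p))
  value-skip (n ∷ ns) Es js k es p =
    trans (value-no-outgoing n (ns ++ Es ++ js) k es (All.map (λ { (q , _) ≡.refl → q (here ≡.refl) }) p))
      (value-skip ns Es js k es (All.map (λ (a , b) → a ∘ there , b) p))

  -- Q is required of the other edges, of the edges at j that may remain, and of every edge (i , o)
  -- that a reduction may create.
  fan-cong : ∀ (Q : Edge → Set) {F G : Term → Carrier} → (∀ k es → All Q es → F (k , es) ≈ G (k , es)) →
    ∀ j is os k es → All (λ i → Q (i , j)) is → All (λ o → Q (j , o)) os → All (λ i → All (λ o → Q (i , o)) os) is → All Q es →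
    fan F j is os (k , es) ≈ fan G j is os (k , es)
  fan-cong Q eq j []       os       k es qi qo qq q = +-congʳ (eq k _ (All.++⁺ (All.map⁺ qo) q))
  fan-cong Q eq j (i ∷ is) []       k es qi qo qq q = +-congʳ (eq k _ (All.++⁺ (All.map⁺ qi) q))
  fan-cong Q {F} {G} eq j (i ∷ is) (o ∷ os) k es (pi ∷ qi) (po ∷ qo) ((pp ∷ qp) ∷ qq) q = trans (fan-∷ F j i is o os k es)
    (trans (+-cong (fan-cong Q eq j (i ∷ is) os k _ (pi ∷ qi) qo (qp ∷ All.map All.tail qq) (pp ∷ q))
      (+-cong (fan-cong Q eq j is (o ∷ os) k _ qi (po ∷ qo) qq (pp ∷ q))
        (fan-cong Q eq j is os (suc k) _ qi qo (All.map All.tail qq) (pp ∷ q))))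
    (sym (fan-∷ G j i is o os k es)))

  private
    <⇒∉ : ∀ {x} {xs : List ℕ} → All (x <_) xs → x ∉ xs
    <⇒∉ p x∈ = ℕ.<-irrefl ≡.refl (All.lookup p x∈)

    >⇒∉ : ∀ {x} {xs : List ℕ} → All (_< x) xs → x ∉ xs
    >⇒∉ p x∈ = ℕ.<-irrefl ≡.refl (All.lookup p x∈)

  -- Nothing is reduced at the vertices `ns` and `Es` between p and `top`, so the result of the
  -- reductions at p is handed over to `top` directly.
  value-top : ∀ p S ns j Es top js rest → Increasing S → All (_< p) S → Increasing ns → All (p <_) ns → All (_< j) ns → p < j →
    All (λ e → j ≤ e × e < top) Es → j ≤ top → All (top <_) js → All (λ e → j ≤ proj₁ e × top ≤ proj₂ e) rest →
    value (p ∷ ns ++ Es ++ top ∷ js) (0 , map (_, p) S ++ map (p ,_) ns ++ (p , top) ∷ rest) ≈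
    rowSum (into p) S [ p ] (λ S′ → rows ns S′ (λ S″ → value (top ∷ js) (0 , map (_, top) S″ ++ rest)))
  value-top p S ns j Es top js rest incS S<p incN p<N N<j p<j Esb j≤top top<js restb = begin
    value (p ∷ ns ++ Es ++ top ∷ js) (0 , map (_, p) S ++ map (p ,_) ns ++ (p , top) ∷ rest)
      ≈⟨ value-fan p (ns ++ Es ++ top ∷ js) {S} {ns ∷ʳ top} 0 incS incT (All.map ℕ.<⇒≢ S<p) (All.∷ʳ⁺ (All.map ℕ.>⇒≢ p<N) (ℕ.>⇒≢ p<top))
           (All.map (λ (a , b) → ℕ.>⇒≢ (ℕ.<-≤-trans p<j a) , ℕ.>⇒≢ (ℕ.<-≤-trans p<top b)) restb)
           (Perm.↭-reflexive (≡.cong (map (_, p) S ++_) (≡.sym (≡.trans (≡.cong (_++ rest) (List.map-++ (p ,_) ns [ top ]))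
             (List.++-assoc (map (p ,_) ns) [ (p , top) ] rest))))) ⟩
    fan (value (ns ++ Es ++ top ∷ js)) p S (reverse (ns ∷ʳ top)) (0 , rest)
      ≈⟨ fan-cong (λ e → proj₁ e ∉ ns × proj₂ e ∉ Es) (value-skip ns Es (top ∷ js)) p S (reverse (ns ∷ʳ top)) 0 rest
           (All.map (λ s<p → s∉ s<p , p∉Es) S<p) (All.map (p∉ns ,_) targets∉)
           (All.map (λ s<p → All.map (s∉ s<p ,_) targets∉) S<p)
           (All.map (λ (a , b) → >⇒∉ (All.map (λ q → ℕ.<-≤-trans q a) N<j) , >⇒∉ (All.map (λ (_ , q) → ℕ.<-≤-trans q b) Esb)) restb) ⟩
    fan (value (top ∷ js)) p S (reverse (ns ∷ʳ top)) (0 , rest)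
      ≡⟨ ≡.cong (λ os → fan (value (top ∷ js)) p S os (0 , rest)) (List.reverse-++ ns [ top ]) ⟩
    fan (value (top ∷ js)) p S (top ∷ reverse ns) (0 , rest)
      ≈⟨ Top.fan-top p top (value (top ∷ js)) (value-linear (top ∷ js)) S ns [] rest
           (λ {i} {r} i∈ r∈ k es → value-frame (top ∷ js) (i , r)
             (<⇒∉ (fresh (All.lookup {P = _< top} (p<top ∷ All.map (λ q → ℕ.<-trans q p<top) S<p) i∈))
             , <⇒∉ (fresh (All.lookup {P = _< top} (p<top ∷ All.map (λ q → ℕ.<-≤-trans q j≤top) N<j) r∈))) k es) ⟩
    rowSum (into p) S [ p ] (λ S′ → rows ns S′ (λ S″ → value (top ∷ js) (0 , map (_, top) S″ ++ rest))) ∎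
    where
      p<top = ℕ.<-≤-trans p<j j≤top
      incT : Increasing (ns ∷ʳ top)
      incT = AllPairs.++⁺ incN ([] ∷ []) (All.map (λ q → ℕ.<-≤-trans q j≤top ∷ []) N<j)
      fresh : ∀ {x} → x < top → All (x <_) (top ∷ js)
      fresh x<top = x<top ∷ All.map (ℕ.<-trans x<top) top<js
      s∉ : ∀ {s} → s < p → s ∉ ns
      s∉ s<p = <⇒∉ (All.map (ℕ.<-trans s<p) p<N)
      p∉ns : p ∉ ns
      p∉ns = <⇒∉ p<N
      p∉Es : p ∉ Es
      p∉Es = <⇒∉ (All.map (λ (a , _) → ℕ.<-≤-trans p<j a) Esb)
      targets∉ : All (_∉ Es) (reverse (ns ∷ʳ top))
      targets∉ = Perm.All-resp-↭ (↭-sym (Perm.↭-reverse (ns ∷ʳ top))) (All.∷ʳ⁺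
        (All.map (λ q → <⇒∉ (All.map (λ (a , _) → ℕ.<-≤-trans q a) Esb)) N<j) (>⇒∉ (All.map proj₂ Esb)))

  -- S are the sources of p, and `ns` the vertices with only a north step found after p. The
  -- reductions at p need all its targets, so they are evaluated only when the next vertex with both
  -- kinds of steps, or the last vertex, is reached; a row without new columns merely lengthens
  -- `ns`.
  value-tree : ∀ ds p S ns j → Increasing S → All (_< p) S → Increasing ns → All (p <_) ns → All (_< j) ns → p < j →
    value (p ∷ ns ++ vertices j ds) (0 , map (_, p) S ++ map (p ,_) ns ++ treeEdges p j ds) ≈
    rowSum (into p) S [ p ] (λ S′ → rows ns S′ (λ S″ → labelSum v j S″ ds))
  value-tree [] p S ns j incS S<p incN p<N N<j p<j = begin
    value (p ∷ ns ++ j ∷ []) (0 , map (_, p) S ++ map (p ,_) ns ++ (p , j) ∷ [])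
      -- The last vertex acts as `top`; it has incoming edges only, which become final factors.
      ≈⟨ value-top p S ns j [] j [] [] incS S<p incN p<N N<j p<j [] ℕ.≤-refl [] [] ⟩
    rowSum (into p) S [ p ] (λ S′ → rows ns S′ (λ S″ → value (j ∷ []) (0 , map (_, j) S″ ++ [])))
      ≈⟨ rowSum-cong-on (into p) (_≤ p) S [ p ] (increasing-∷ʳ incS S<p) (All.∷ʳ⁺ (All.map ℕ.<⇒≤ S<p) ℕ.≤-refl)
           (λ S′ inc q → rows-cong-on (_≤ p) ns S′ inc q final) ⟩
    rowSum (into p) S [ p ] (λ S′ → rows ns S′ (λ S″ → labelSum v j S″ [])) ∎
    where
      increasing-∷ʳ : ∀ {xs x} → Increasing xs → All (_< x) xs → Increasing (xs ∷ʳ x)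
      increasing-∷ʳ inc q = AllPairs.++⁺ inc ([] ∷ []) (All.map (_∷ []) q)
      final : ∀ S′ → Increasing S′ → All (_≤ p) S′ → value (j ∷ []) (0 , map (_, j) S′ ++ []) ≈ labelSum v j S′ []
      final S′ inc q = begin
        value (j ∷ []) (0 , map (_, j) S′ ++ [])
          ≈⟨ value-fan j [] {S′} {[]} {[]} 0 inc [] (All.map (λ q → ℕ.<⇒≢ (ℕ.≤-<-trans q p<j)) q) [] [] Perm.refl ⟩
        fan (value []) j S′ [] (0 , []) ≈⟨ fan-[] (value []) j S′ 0 [] ⟩
        1# * ∏ K (map (_, j) S′ ++ []) v ≈⟨ *-identityˡ _ ⟩
        ∏ K (map (_, j) S′ ++ []) v ≡⟨ ≡.trans (≡.cong (λ z → ∏ K z v) (List.++-identityʳ (map (_, j) S′))) (∏-map (_, j) S′ v) ⟩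
        ∏ K S′ (into j) ≈⟨ sym (rowSum-one (into j) S′ []) ⟩
        labelSum v j S′ [] ∎
  value-tree (zero ∷ ds) p S ns j incS S<p incN p<N N<j p<j = begin
    value (p ∷ ns ++ j ∷ vertices (suc j) ds) (0 , map (_, p) S ++ map (p ,_) ns ++ (p , j) ∷ treeEdges p (suc j) ds)
      ≡⟨ ≡.cong₂ (λ js es → value (p ∷ js) (0 , map (_, p) S ++ es)) (≡.sym (List.++-assoc ns [ j ] (vertices (suc j) ds)))
           (≡.sym (≡.trans (≡.cong (_++ treeEdges p (suc j) ds) (List.map-++ (p ,_) ns [ j ]))
             (List.++-assoc (map (p ,_) ns) [ (p , j) ] (treeEdges p (suc j) ds)))) ⟩
    value (p ∷ (ns ∷ʳ j) ++ vertices (suc j) ds) (0 , map (_, p) S ++ map (p ,_) (ns ∷ʳ j) ++ treeEdges p (suc j) ds)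
      ≈⟨ value-tree ds p S (ns ∷ʳ j) (suc j) incS S<p (AllPairs.++⁺ incN ([] ∷ []) (All.map (_∷ []) N<j)) (All.∷ʳ⁺ p<N p<j)
           (All.∷ʳ⁺ (All.map ℕ.m<n⇒m<1+n N<j) ℕ.≤-refl) (ℕ.m<n⇒m<1+n p<j) ⟩
    rowSum (into p) S [ p ] (λ S′ → rows (ns ∷ʳ j) S′ (λ S″ → labelSum v (suc j) S″ ds))
      ≈⟨ rowSum-cong (into p) S [ p ] (λ S′ → rows-∷ʳ ns j S′ _) ⟩
    rowSum (into p) S [ p ] (λ S′ → rows ns S′ (λ S″ → labelSum v j S″ (zero ∷ ds))) ∎
  value-tree (suc δ ∷ ds) p S ns j incS S<p incN p<N N<j p<j = begin
    value (p ∷ ns ++ interval j δ ++ top ∷ vertices (suc top) ds) (0 , map (_, p) S ++ map (p ,_) ns ++ (p , top) ∷ rest)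
      ≈⟨ value-top p S ns j (interval j δ) top (vertices (suc top) ds) rest incS S<p incN p<N N<j p<j
           (interval-bounds j δ) (ℕ.m≤m+n j δ) (vertices-≥ (suc top) ds)
           (All.++⁺ (All.map⁺ (All.map (λ (a , _) → a , ℕ.≤-refl) (interval-bounds j δ)))
             (All.map (λ (a , b) → ℕ.≤-trans (ℕ.m≤m+n j δ) a , ℕ.<⇒≤ b) (treeEdges-≥ top (suc top) ds (ℕ.n≤1+n _)))) ⟩
    rowSum (into p) S [ p ] (λ S′ → rows ns S′ (λ S″ → value (top ∷ vertices (suc top) ds) (0 , map (_, top) S″ ++ rest)))
      ≈⟨ rowSum-cong-on (into p) (_≤ p) S [ p ] (AllPairs.++⁺ incS ([] ∷ []) (All.map (_∷ []) S<p)) (All.∷ʳ⁺ (All.map ℕ.<⇒≤ S<p) ℕ.≤-refl)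
           (λ S′ inc q → rows-cong-on (_≤ p) ns S′ inc q next) ⟩
    rowSum (into p) S [ p ] (λ S′ → rows ns S′ (λ S″ → labelSum v j S″ (suc δ ∷ ds))) ∎
    where
      top = j ℕ.+ δ
      rest = map (_, top) (interval j δ) ++ treeEdges top (suc top) ds
      next : ∀ S′ → Increasing S′ → All (_≤ p) S′ →
        value (top ∷ vertices (suc top) ds) (0 , map (_, top) S′ ++ rest) ≈ labelSum v j S′ (suc δ ∷ ds)
      next S′ inc q = trans (reflexive (≡.cong (λ es → value (top ∷ vertices (suc top) ds) (0 , es))
          (≡.trans (≡.sym (List.++-assoc (map (_, top) S′) (map (_, top) (interval j δ)) _))
            (≡.cong (_++ treeEdges top (suc top) ds) (≡.sym (List.map-++ (_, top) S′ (interval j δ)))))))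
        (value-tree ds top (S′ ++ interval j δ) [] (suc top)
          (AllPairs.++⁺ inc (interval-increasing j δ) (All.map (λ x≤p → All.map (λ (a , _) → ℕ.≤-<-trans x≤p (ℕ.<-≤-trans p<j a)) (interval-bounds j δ)) q))
          (All.++⁺ (All.map (λ x≤p → ℕ.≤-<-trans x≤p (ℕ.<-≤-trans p<j (ℕ.m≤m+n j δ))) q) (All.map proj₂ (interval-bounds j δ)))
          [] [] [] ℕ.≤-refl)

  eval-crf : ∀ ds m es → oneTo m ≡ 1 ∷ vertices 2 ds → es ↭ treeEdges 1 2 ds →
    eval K (⊝ 1#) v (crf m es) ≈ labelSum v 2 [ 1 ] ds
  eval-crf ds m es m≡ es↭ = begin
    eval K (⊝ 1#) v (crf m es)           ≈⟨ eval-value (oneTo m) (monomial es ∷ []) ⟩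
    value (oneTo m) (0 , es) ⊕ 0#        ≈⟨ +-identityʳ _ ⟩
    value (oneTo m) (0 , es)             ≡⟨ ≡.cong (λ js → value js (0 , es)) m≡ ⟩
    value (1 ∷ vertices 2 ds) (0 , es)   ≈⟨ perm (value-linear (1 ∷ vertices 2 ds)) 0 es↭ ⟩
    -- The vertex 1 has no sources, so its row is empty and passes on the column [ 1 ] alone.
    value (1 ∷ vertices 2 ds) (0 , treeEdges 1 2 ds) ≈⟨ value-tree ds 1 [] [] 2 [] [] [] [] [] ℕ.≤-refl ⟩
    labelSum v 2 [ 1 ] ds ∎

-- Following the strands with a record of their crossings.

crossRow : ℕ → ℕ → List Bool → List Box
crossRow r i []           = []
crossRow r i (true ∷ bs)  = (r , i) ∷ crossRow r (suc i) bs
crossRow r i (false ∷ bs) = crossRow r (suc i) bs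

crosses : ℕ → List (List Bool) → List Box
crosses r []      = []
crosses r (b ∷ M) = crossRow r 1 b ++ crosses (suc r) M

crossing-comm : ∀ p q → crossing p q ≡ crossing q p
crossing-comm p q = ≡.cong₂ _,_ (ℕ.⊓-comm p q) (ℕ.⊔-comm p q)

crossing-∈ : ∀ p q p′ q′ → crossing p q ≡ crossing p′ q′ → p ≡ p′ ⊎ p ≡ q′
crossing-∈ p q p′ q′ eq with ℕ.≤-total p q
... | inj₁ p≤q = min (≡.trans (≡.sym (ℕ.m≤n⇒m⊓n≡m p≤q)) (≡.cong proj₁ eq))
  where
    min : p ≡ p′ ⊓ q′ → p ≡ p′ ⊎ p ≡ q′
    min e with ℕ.⊓-sel p′ q′
    ... | inj₁ s = inj₁ (≡.trans e s)
    ... | inj₂ s = inj₂ (≡.trans e s)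
... | inj₂ q≤p = max (≡.trans (≡.sym (ℕ.m≥n⇒m⊔n≡m q≤p)) (≡.cong proj₂ eq))
  where
    max : p ≡ p′ ⊔ q′ → p ≡ p′ ⊎ p ≡ q′
    max e with ℕ.⊔-sel p′ q′
    ... | inj₁ s = inj₁ (≡.trans e s)
    ... | inj₂ s = inj₂ (≡.trans e s)

-- Two strands, p to the left of q, have crossed exactly when q < p.
Recorded : List Crossing → ℕ → ℕ → Set
Recorded χ p q = (crossing p q ∈ χ → q < p) × (q < p → crossing p q ∈ χ)

Matches : PipeDream → ℕ → ℕ → List Bool → Set
Matches P r c []          = ∀ {i} → c ≤ i → (r , i) ∉ P
Matches P r c (true ∷ b)  = (r , c) ∈ P × Matches P r (suc c) b
Matches P r c (false ∷ b) = (r , c) ∉ P × Matches P r (suc c) b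

-- `out` and `w` will be the predictions of `rowF` and `wasted`. The strands from below the grid
-- bear the labels of `interval a q`; every row loses one of them on the right, so none is left at
-- the top. `old` says that new records concern pairs of `labels` only, and the two fields on
-- uniqueness that a repeated record is the same as a wasted cross.
record RowSpec (out : List ℕ) (w : ℕ) (labels : List ℕ) (a q : ℕ) (χ : List Crossing) (res : List ℕ × List Crossing) : Set where
  field
    strands  : proj₁ res ≡ out ++ interval a q
    recorded : AllPairs (Recorded (proj₂ res)) out
    old      : ∀ {p x} → p ∉ labels → crossing p x ∈ proj₂ res → crossing p x ∈ χ
    grow     : ∀ {z} → z ∈ χ → z ∈ proj₂ res
    reduced⇒ : Unique (proj₂ res) → Unique χ × w ≡ 0
    ⇒reduced : Unique χ → w ≡ 0 → Unique (proj₂ res)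
    bounded  : ∀ {l} → All (l ≤_) labels → All (λ z → l ≤ proj₁ z) χ → All (λ z → l ≤ proj₁ z) (proj₂ res)

-- An elbow turns the strand from the left upwards and the one from below to the right, so all
-- strands move on by one column and the last one leaves the grid.
sweep-elbows : ∀ P r c h a q χ → (∀ {i} → c ≤ i → (r , i) ∉ P) →
  sweepRow P r c h (interval a (suc q)) χ ≡ (h ∷ interval a q , χ)
sweep-elbows P r c h a q χ no-cross with (r , c) ∈? P | crossing h a ∈? χ
... | yes p | _ = contradiction p (no-cross ℕ.≤-refl)
sweep-elbows P r c h a zero    χ no-cross | no _ | _ = ≡.refl
sweep-elbows P r c h a (suc q) χ no-cross | no _ | _ =
  ≡.cong (λ (ts , χ′) → h ∷ ts , χ′) (sweep-elbows P r (suc c) a (suc a) q χ (no-cross ∘ ℕ.<⇒≤))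

recorded-weaken : ∀ {χ χ′ h xs} → (∀ {x} → crossing h x ∈ χ′ → crossing h x ∈ χ) → (∀ {z} → z ∈ χ → z ∈ χ′) →
  All (Recorded χ h) xs → All (Recorded χ′ h) xs
recorded-weaken f g = All.map (λ (a , b) → a ∘ f , g ∘ b)

-- By `Recorded`, the test of `sweepRow` for an earlier crossing and the comparison of labels in
-- `rowF` always agree; the cases in which they differ are contradictory.
sweepRow-spec : ∀ P r c b h V a q χ → length b ≡ length V → Matches P r c b → Unique (h ∷ V) →
  AllPairs (Recorded χ) (h ∷ V) → RowSpec (rowF b h V) (wasted b h V) (h ∷ V) a q χ (sweepRow P r c h (V ++ interval a (suc q)) χ)
sweepRow-spec P r c [] h [] a q χ l m u rec rewrite sweep-elbows P r c h a q χ m = record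
  { strands = ≡.refl ; recorded = [] ∷ [] ; old = λ _ z → z ; grow = id
  ; reduced⇒ = λ u → u , ≡.refl ; ⇒reduced = λ u _ → u ; bounded = λ _ z → z }
sweepRow-spec P r c (b ∷ bs) h (v ∷ V) a q χ l m u rec with (r , c) ∈? P | crossing h v ∈? χ
sweepRow-spec P r c (true ∷ bs) h (v ∷ V) a q χ l (m , _) u rec | no c∉ | _ = contradiction m c∉
sweepRow-spec P r c (false ∷ bs) h (v ∷ V) a q χ l (m , _) u rec | yes c∈ | _ = contradiction c∈ m
sweepRow-spec P r c (false ∷ bs) h (v ∷ V) a q χ l (_ , ms) (h∉ ∷ u) (rh ∷ rec) | no c∉ | _ = record
  { strands  = ≡.cong (h ∷_) IH.strands
  ; recorded = Perm.All-resp-↭ (↭-sym (rowF-↭ bs v V)) (recorded-weaken (IH.old (λ h∈ → All.lookup h∉ h∈ ≡.refl)) IH.grow rh) ∷ IH.recorded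
  ; old      = λ p∉ → IH.old (p∉ ∘ there)
  ; grow     = IH.grow
  ; reduced⇒ = IH.reduced⇒
  ; ⇒reduced = IH.⇒reduced
  ; bounded  = λ l → IH.bounded (All.tail l)
  }
  where module IH = RowSpec (sweepRow-spec P r (suc c) bs v V a q χ (ℕ.suc-injective l) ms u rec)
sweepRow-spec P r c (true ∷ bs) h (v ∷ V) a q χ l (_ , ms) ((h≢v ∷ h∉) ∷ u@(v∉ ∷ uV)) ((rhv ∷ rh) ∷ (rv ∷ rec)) | yes c∈ | no new with h <? v
... | no h≮v = contradiction (proj₂ rhv (ℕ.≤∧≢⇒< (ℕ.≮⇒≥ h≮v) (h≢v ∘ ≡.sym))) new
... | yes h<v = record
  { strands  = ≡.cong (v ∷_) IH.strands
  ; recorded = Perm.All-resp-↭ (↭-sym (rowF-↭ bs h V)) (vh ∷ All.zipWith (λ { ((f , g) , h≢x) → f ∘ v-old h≢x , IH.grow ∘ there ∘ g }) (rv , h∉)) ∷ IH.recorded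
  ; old      = λ p∉ x∈ → old-cons p∉ (IH.old (λ { (here e) → p∉ (here e) ; (there e) → p∉ (there (there e)) }) x∈)
  ; grow     = IH.grow ∘ there
  ; reduced⇒ = λ U → case IH.reduced⇒ U of λ { ((_ ∷ U′) , w) → U′ , w }
  ; ⇒reduced = λ U w → IH.⇒reduced (All.tabulate (λ z∈ e → new (≡.subst (_∈ χ) (≡.sym e) z∈)) ∷ U) w
  ; bounded  = λ { (lh ∷ lv ∷ lV) lχ → IH.bounded (lh ∷ lV) (ℕ.⊓-glb lh lv ∷ lχ) }
  }
  where
    old-cons : ∀ {p x} → p ∉ h ∷ v ∷ V → crossing p x ∈ crossing h v ∷ χ → crossing p x ∈ χ
    old-cons {p} {x} p∉ (there e) = e
    old-cons {p} {x} p∉ (here e) with crossing-∈ p x h v e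
    ... | inj₁ p≡h = contradiction (here p≡h) p∉
    ... | inj₂ p≡v = contradiction (there (here p≡v)) p∉
    v∉hV : v ∉ h ∷ V
    v∉hV (here v≡h) = h≢v (≡.sym v≡h)
    v∉hV (there v∈) = All.lookup v∉ v∈ ≡.refl
    from-cons : ∀ {x y} → x ≢ h → x ≢ v → crossing x y ∈ crossing h v ∷ χ → crossing x y ∈ χ
    from-cons x≢h x≢v (there e) = e
    from-cons {x} {y} x≢h x≢v (here e) with crossing-∈ x y h v e
    ... | inj₁ p = contradiction p x≢h
    ... | inj₂ p = contradiction p x≢v
    rec′ : AllPairs (Recorded (crossing h v ∷ χ)) (h ∷ V)
    rec′ = All.zipWith (λ { ((f , g) , x≢h , x≢v) → (λ z → f (≡.subst (_∈ χ) (crossing-comm _ h) (from-cons (x≢h ∘ ≡.sym) (x≢v ∘ ≡.sym)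
                (≡.subst (_∈ crossing h v ∷ χ) (crossing-comm h _) z)))) , there ∘ g }) (rh , All.zipWith id (h∉ , v∉)) ∷ inner V h∉ v∉ rec
      where
        inner : ∀ xs → All (h ≢_) xs → All (v ≢_) xs → AllPairs (Recorded χ) xs → AllPairs (Recorded (crossing h v ∷ χ)) xs
        inner []       _         _         _        = []
        inner (x ∷ xs) (hx ∷ hs) (vx ∷ vs) (rx ∷ rs) =
          All.map (λ (f , g) → (λ z → f (from-cons (hx ∘ ≡.sym) (vx ∘ ≡.sym) z)) , there ∘ g) rx ∷ inner xs hs vs rs
    module IH = RowSpec (sweepRow-spec P r (suc c) bs h V a q (crossing h v ∷ χ) (ℕ.suc-injective l) ms (h∉ ∷ uV) rec′)
    vh : Recorded _ v h
    vh = (λ _ → h<v) , (λ _ → IH.grow (here (crossing-comm v h)))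
    v-old : ∀ {x} → h ≢ x → crossing v x ∈ proj₂ (sweepRow P r (suc c) h (V ++ interval a (suc q)) (crossing h v ∷ χ)) → crossing v x ∈ χ
    v-old {x} h≢x z with IH.old v∉hV z
    ... | there e = e
    ... | here e with crossing-∈ h v v x (≡.sym e)
    ...   | inj₁ h≡v = contradiction h≡v h≢v
    ...   | inj₂ h≡x = contradiction h≡x h≢x
sweepRow-spec P r c (true ∷ bs) h (v ∷ V) a q χ l (_ , ms) ((h≢v ∷ h∉) ∷ u) ((rhv ∷ rh) ∷ rec) | yes c∈ | yes seen with h <? v
... | yes h<v = contradiction (proj₁ rhv seen) (ℕ.<⇒≯ h<v)
... | no h≮v = record
  { strands  = ≡.cong (h ∷_) IH.strands
  ; recorded = Perm.All-resp-↭ (↭-sym (rowF-↭ bs v V)) (recorded-weaken (from-seen ∘ IH.old (λ h∈ → h∉vV h∈)) (IH.grow ∘ there) (rhv ∷ rh)) ∷ IH.recorded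
  ; old      = λ p∉ x∈ → from-seen (IH.old (p∉ ∘ there) x∈)
  ; grow     = IH.grow ∘ there
  ; reduced⇒ = λ U → case IH.reduced⇒ U of λ { ((z∉ ∷ _) , _) → contradiction ≡.refl (All.lookup z∉ seen) }
  ; ⇒reduced = λ U ()
  ; bounded  = λ { (lh ∷ lv ∷ lV) lχ → IH.bounded (lv ∷ lV) (ℕ.⊓-glb lh lv ∷ lχ) }
  }
  where
    from-seen : ∀ {z} → z ∈ crossing h v ∷ χ → z ∈ χ
    from-seen (here ≡.refl) = seen
    from-seen (there e)     = e
    h∉vV : h ∉ v ∷ V
    h∉vV (here e)  = h≢v e
    h∉vV (there e) = All.lookup h∉ e ≡.refl
    rec′ : AllPairs (Recorded (crossing h v ∷ χ)) (v ∷ V)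
    rec′ = AllPairs.map (λ (f , g) → f ∘ from-seen , there ∘ g) rec
    module IH = RowSpec (sweepRow-spec P r (suc c) bs v V a q (crossing h v ∷ χ) (ℕ.suc-injective l) ms u rec′)

crossRow-∈ : ∀ {s i} r c b → (s , i) ∈ crossRow r c b → s ≡ r × c ≤ i
crossRow-∈ r c (true ∷ b)  (here ≡.refl) = ≡.refl , ℕ.≤-refl
crossRow-∈ r c (true ∷ b)  (there p) = let s≡r , c< = crossRow-∈ r (suc c) b p in s≡r , ℕ.<⇒≤ c<
crossRow-∈ r c (false ∷ b) p         = let s≡r , c< = crossRow-∈ r (suc c) b p in s≡r , ℕ.<⇒≤ c<

crosses-∈ : ∀ {s i} r M → (s , i) ∈ crosses r M → r ≤ s
crosses-∈ r (b ∷ M) p with Mem.∈-++⁻ (crossRow r 1 b) p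
... | inj₁ q = ℕ.≤-reflexive (≡.sym (proj₁ (crossRow-∈ r 1 b q)))
... | inj₂ q = ℕ.<⇒≤ (crosses-∈ (suc r) M q)

matches : ∀ P r c b → (∀ {i} → c ≤ i → (r , i) ∈ P → (r , i) ∈ crossRow r c b) →
  (∀ {i} → (r , i) ∈ crossRow r c b → (r , i) ∈ P) → Matches P r c b
matches P r c []          f g = λ c≤i p → case f c≤i p of λ ()
matches P r c (true ∷ b)  f g = g (here ≡.refl) , matches P r (suc c) b
  (λ c<i p → case f (ℕ.<⇒≤ c<i) p of λ { (here ≡.refl) → contradiction c<i (ℕ.n≮n c) ; (there q) → q }) (g ∘ there)
matches P r c (false ∷ b) f g =
  (λ p → ℕ.n≮n c (proj₂ (crossRow-∈ r (suc c) b (f ℕ.≤-refl p)))) , matches P r (suc c) b (f ∘ ℕ.<⇒≤) g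

AllMatch : PipeDream → ℕ → List (List Bool) → Set
AllMatch P r []      = Matches P r 1 []
AllMatch P r (b ∷ M) = Matches P r 1 b × AllMatch P (suc r) M

allMatch : ∀ X r M → (∀ {s i} → (s , i) ∈ X → s < r) → AllMatch (X ++ crosses r M) r M
allMatch X r [] below = λ _ p → ℕ.n≮n r (below (≡.subst (_ ∈_) (List.++-identityʳ X) p))
allMatch X r (b ∷ M) below =
  matches (X ++ crossRow r 1 b ++ crosses (suc r) M) r 1 b
    (λ _ p → case Mem.∈-++⁻ X p of λ
      { (inj₁ q) → contradiction (below q) (ℕ.n≮n r)
      ; (inj₂ q) → case Mem.∈-++⁻ (crossRow r 1 b) q of λ
          { (inj₁ z) → z ; (inj₂ z) → contradiction (crosses-∈ (suc r) M z) (ℕ.n≮n r) } })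
    (λ p → Mem.∈-++⁺ʳ X (Mem.∈-++⁺ˡ p)) ,
  ≡.subst (λ P → AllMatch P (suc r) M) (List.++-assoc X (crossRow r 1 b) _)
    (allMatch (X ++ crossRow r 1 b) (suc r) M (λ p → case Mem.∈-++⁻ X p of λ
      { (inj₁ q) → ℕ.m<n⇒m<1+n (below q)
      ; (inj₂ q) → ℕ.≤-reflexive (≡.cong suc (proj₁ (crossRow-∈ r 1 b q))) }))

applyUpTo-interval : ∀ a n → applyUpTo (a +_) n ≡ interval a n
applyUpTo-interval a n = go (a +_) a n (λ i → ≡.refl)
  where
    go : ∀ f a n → (∀ i → f i ≡ a + i) → applyUpTo f n ≡ interval a n
    go f a zero    p = ≡.refl
    go f a (suc n) p = ≡.cong₂ _∷_ (≡.trans (p 0) (ℕ.+-identityʳ a))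
      (go (f ∘ suc) (suc a) n (λ i → ≡.trans (p (suc i)) (ℕ.+-suc a i)))

applyDownFrom-∷ʳ : ∀ r k → applyDownFrom (r +_) (suc k) ≡ applyDownFrom (suc r +_) k ∷ʳ r
applyDownFrom-∷ʳ r zero    = ≡.cong [_] (ℕ.+-identityʳ r)
applyDownFrom-∷ʳ r (suc k) = ≡.cong₂ _∷_ (ℕ.+-suc r k) (applyDownFrom-∷ʳ r k)

sweepFrom : ℕ → PipeDream → List ℕ → List ℕ × List Crossing
sweepFrom N P = foldl (λ (vs , χ) r → sweepRow P r 1 r vs χ) (applyUpTo (λ i → suc N + i) N , [])

record SweepSpec (r′ N : ℕ) (M : List (List Bool)) (res : List ℕ × List Crossing) : Set where
  field
    strands  : proj₁ res ≡ fwd (suc r′) M ++ interval (suc N) r′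
    recorded : AllPairs (Recorded (proj₂ res)) (fwd (suc r′) M)
    bounded  : All (λ z → suc r′ ≤ proj₁ z) (proj₂ res)
    reduced⇒ : Unique (proj₂ res) → wastedM (suc r′) M ≡ 0
    ⇒reduced : wastedM (suc r′) M ≡ 0 → Unique (proj₂ res)

sweepFrom-spec : ∀ r′ N P M → suc r′ + length M ≡ N → Staircase M → AllMatch P (suc r′) M →
  SweepSpec r′ N M (sweepFrom N P (applyDownFrom (suc r′ +_) (suc (length M))))
sweepFrom-spec r′ N P [] N≡ s m = ≡.subst (SweepSpec r′ N []) (≡.sym eq) record
  { strands = ≡.refl ; recorded = [] ∷ [] ; bounded = [] ; reduced⇒ = λ _ → ≡.refl ; ⇒reduced = λ _ → [] }
  where
    N≡′ : N ≡ suc r′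
    N≡′ = ≡.trans (≡.sym N≡) (ℕ.+-identityʳ (suc r′))
    eq : sweepFrom N P (suc r′ + 0 ∷ []) ≡ (suc r′ ∷ interval (suc N) r′ , [])
    eq = ≡.trans (≡.cong₂ (λ r X → sweepRow P r 1 r X []) (ℕ.+-identityʳ (suc r′))
        (≡.trans (applyUpTo-interval (suc N) N) (≡.cong (interval (suc N)) N≡′)))
      (sweep-elbows P (suc r′) 1 (suc r′) (suc N) r′ [] m)
sweepFrom-spec r′ N P (b ∷ M) N≡ (lb , s) (m , ms) = ≡.subst (SweepSpec r′ N (b ∷ M)) (≡.sym eq)
  (lemma _ (sweepFrom-spec (suc r′) N P M (≡.trans (≡.cong suc (≡.sym (ℕ.+-suc r′ (length M)))) N≡) s ms))
  where
    previous = sweepFrom N P (applyDownFrom (suc (suc r′) +_) (suc (length M)))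
    eq : sweepFrom N P (applyDownFrom (suc r′ +_) (suc (suc (length M)))) ≡ sweepRow P (suc r′) 1 (suc r′) (proj₁ previous) (proj₂ previous)
    eq = ≡.trans (≡.cong (sweepFrom N P) (applyDownFrom-∷ʳ (suc r′) (suc (length M))))
      (List.foldl-∷ʳ (λ (vs , χ) r → sweepRow P r 1 r vs χ) (applyUpTo (λ i → suc N + i) N , []) (suc r′)
        (applyDownFrom (suc (suc r′) +_) (suc (length M))))
    r = suc r′
    V = fwd (suc r) M
    lemma : ∀ res → SweepSpec r N M res → SweepSpec r′ N (b ∷ M) (sweepRow P r 1 r (proj₁ res) (proj₂ res))
    lemma (_ , χ) record { strands = ≡.refl ; recorded = rec ; bounded = bd ; reduced⇒ = rd ; ⇒reduced = dr } = record
      { strands  = R.strands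
      ; recorded = R.recorded
      ; bounded  = R.bounded (ℕ.≤-refl ∷ All.map ℕ.<⇒≤ (fwd-≥ (suc r) M)) (All.map ℕ.<⇒≤ bd)
      ; reduced⇒ = λ U → let U′ , w = R.reduced⇒ U in ≡.cong₂ _+_ w (rd U′)
      ; ⇒reduced = λ w → R.⇒reduced (dr (ℕ.m+n≡0⇒n≡0 (wasted b r V) w)) (ℕ.m+n≡0⇒m≡0 (wasted b r V) w)
      }
      where
        -- So far only strands of lower rows have been recorded. Their labels are larger than r, and
        -- r enters to the left of all of them.
        new : All (Recorded χ r) V
        new = All.map (λ {x} r<x → (λ z∈ → contradiction (All.lookup bd z∈) (ℕ.≤⇒≯ (ℕ.m⊓n≤m r x))) , (λ x<r → contradiction x<r (ℕ.<-asym r<x)))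
          (fwd-≥ (suc r) M)
        module R = RowSpec (sweepRow-spec P r 1 b r V (suc N) r′ χ (≡.trans lb (≡.sym (fwd-length (suc r) M))) m (fwd-unique′ r M) (new ∷ rec))

sweep-spec : ∀ M → Staircase M → SweepSpec 0 (suc (length M)) M (sweep (suc (length M)) (crosses 1 M))
sweep-spec M s = sweepFrom-spec 0 (suc (length M)) (crosses 1 M) M ≡.refl s (allMatch [] 1 M λ ())

exits-fwd : ∀ M → Staircase M → exits (suc (length M)) (crosses 1 M) ≡ fwd 1 M
exits-fwd M s = ≡.trans (SweepSpec.strands (sweep-spec M s)) (List.++-identityʳ (fwd 1 M))

-- Subsets of the triangle as staircases.

triangleRows : ℕ → ℕ → List Box
triangleRows r zero    = []
triangleRows r (suc m) = map (r ,_) (interval 1 (suc m)) ++ triangleRows (suc r) m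

interval-++ : ∀ a m n → interval a (m + n) ≡ interval a m ++ interval (m + a) n
interval-++ a zero    n = ≡.refl
interval-++ a (suc m) n = ≡.cong (a ∷_) (≡.trans (interval-++ (suc a) m n)
  (≡.cong (λ k → interval (suc a) m ++ interval k n) (ℕ.+-suc m a)))

interval-≥ : ∀ a n → All (a ≤_) (interval a n)
interval-≥ a zero    = []
interval-≥ a (suc n) = ℕ.≤-refl ∷ All.map ℕ.<⇒≤ (interval-≥ (suc a) n)

interval-< : ∀ a n → All (_< n + a) (interval a n)
interval-< a zero    = []
interval-< a (suc n) = s≤s (ℕ.m≤n+m a n) ∷ All.map (λ {x} → ≡.subst (x <_) (ℕ.+-suc n a)) (interval-< (suc a) n)

filter-row : ∀ N r m → r + m ≡ N → filter (λ (a , b) → a + b ≤? N) (map (r ,_) (oneTo N)) ≡ map (r ,_) (interval 1 m)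
filter-row N r m r+m≡N = ≡.trans (≡.cong (filter P? ∘ map (r ,_)) split)
  (≡.trans (≡.cong (filter P?) (List.map-++ (r ,_) (interval 1 m) _))
  (≡.trans (List.filter-++ P? (map (r ,_) (interval 1 m)) _)
  (≡.trans (≡.cong₂ _++_
      (List.filter-all P? (All.map⁺ (All.map (λ {x} x< → ≡.subst (r + x ≤_) r+m≡N (ℕ.+-monoʳ-≤ r (ℕ.s≤s⁻¹ (≡.subst (x <_) (ℕ.+-comm m 1) x<)))) (interval-< 1 m))))
      (List.filter-none P? (All.map⁺ (All.map (λ {x} x≥ x≤ → ℕ.n≮n N (ℕ.≤-trans
        (ℕ.≤-trans (ℕ.≤-reflexive (≡.trans (≡.cong suc (≡.sym r+m≡N)) (≡.sym (ℕ.+-suc r m)))) (ℕ.+-monoʳ-≤ r (≡.subst (_≤ x) (ℕ.+-comm m 1) x≥))) x≤)) (interval-≥ (m + 1) r)))))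
    (List.++-identityʳ _))))
  where
    P? = λ ((a , b) : Box) → a + b ≤? N
    split : oneTo N ≡ interval 1 m ++ interval (m + 1) r
    split = ≡.trans (applyUpTo-interval 1 N) (≡.trans (≡.cong (interval 1) (≡.trans (≡.sym r+m≡N) (ℕ.+-comm r m))) (interval-++ 1 m r))

triangle-rows : ∀ m → triangle (suc m) ≡ triangleRows 1 m
triangle-rows m = ≡.trans (≡.cong (λ xs → filter P? (cartesianProduct xs (oneTo N))) (applyUpTo-interval 1 N)) (go m 1 ≡.refl)
  where
    N = suc m
    P? = λ ((a , b) : Box) → a + b ≤? N
    go : ∀ k r → r + k ≡ N → filter P? (cartesianProduct (interval r (suc k)) (oneTo N)) ≡ triangleRows r k
    go zero    r p = ≡.trans (List.filter-++ P? (map (r ,_) (oneTo N)) []) (≡.trans (List.++-identityʳ _) (filter-row N r 0 p))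
    go (suc k) r p = ≡.trans (List.filter-++ P? (map (r ,_) (oneTo N)) _)
      (≡.cong₂ _++_ (filter-row N r (suc k) p) (go k (suc r) (≡.trans (≡.sym (ℕ.+-suc r k)) p)))

sublists-++ : ∀ {a} {A : Set a} (xs ys : List A) →
  sublists (xs ++ ys) ≡ concatMap (λ zs → map (zs ++_) (sublists ys)) (sublists xs)
sublists-++ []       ys = ≡.sym (≡.trans (List.++-identityʳ _) (List.map-id (sublists ys)))
sublists-++ (x ∷ xs) ys = ≡.trans (≡.cong₂ _++_ (≡.trans (≡.cong (map (x ∷_)) (sublists-++ xs ys)) (prefix (sublists xs))) (sublists-++ xs ys))
    (≡.sym (List.concatMap-++ g (map (x ∷_) (sublists xs)) (sublists xs)))
  where
    g = λ zs → map (zs ++_) (sublists ys)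
    prefix : ∀ zss → map (x ∷_) (concatMap g zss) ≡ concatMap g (map (x ∷_) zss)
    prefix []         = ≡.refl
    prefix (zs ∷ zss) = ≡.trans (List.map-++ (x ∷_) (g zs) _) (≡.cong₂ _++_ (≡.sym (List.map-∘ (sublists ys))) (prefix zss))

sublists-row : ∀ r i l → sublists (map (r ,_) (interval i l)) ≡ map (crossRow r i) (bits l)
sublists-row r i zero    = ≡.refl
sublists-row r i (suc l) = ≡.sym (≡.trans (List.map-++ (crossRow r i) (map (true ∷_) (bits l)) _)
  (≡.cong₂ _++_ (≡.trans (≡.sym (List.map-∘ (bits l))) (≡.trans (List.map-∘ (bits l)) (≡.cong (map ((r , i) ∷_)) (≡.sym (sublists-row r (suc i) l)))))
    (≡.trans (≡.sym (List.map-∘ (bits l))) (≡.sym (sublists-row r (suc i) l)))))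

sublists-triangleRows : ∀ r m → sublists (triangleRows r m) ≡ map (crosses r) (staircases m)
sublists-triangleRows r zero    = ≡.refl
sublists-triangleRows r (suc m) = ≡.trans (sublists-++ (map (r ,_) (interval 1 (suc m))) (triangleRows (suc r) m))
  (≡.trans (≡.cong₂ (λ A B → concatMap (λ zs → map (zs ++_) B) A) (sublists-row r 1 (suc m)) (sublists-triangleRows (suc r) m)) (go (bits (suc m))))
  where
    go : ∀ bss → concatMap (λ zs → map (zs ++_) (map (crosses (suc r)) (staircases m))) (map (crossRow r 1) bss)
      ≡ map (crosses r) (concatMap (λ b → map (b ∷_) (staircases m)) bss)
    go []         = ≡.refl
    go (b ∷ bss) = ≡.trans (≡.cong₂ _++_ (≡.trans (≡.sym (List.map-∘ (staircases m))) (List.map-∘ (staircases m))) (go bss))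
      (≡.sym (List.map-++ (crosses r) (map (b ∷_) (staircases m)) _))

-- `sublists` takes a box before leaving it out, `bits` lists the cross before the elbow, and both
-- go through the boxes row by row; so the enumerations agree even in their order.
sublists-triangle : ∀ m → sublists (triangle (suc m)) ≡ map (crosses 1) (staircases m)
sublists-triangle m = ≡.trans (≡.cong sublists (triangle-rows m)) (sublists-triangleRows 1 m)

-- Inversions, wasted crosses and the codimension.

lessThan : ℕ → List ℕ → ℕ
lessThan x []       = 0
lessThan x (y ∷ ys) = choose (y <? x) 1 0 + lessThan x ys

inversions : List ℕ → ℕ
inversions []       = 0
inversions (x ∷ xs) = lessThan x xs + inversions xs

lessThan-↭ : ∀ x {xs ys} → xs ↭ ys → lessThan x xs ≡ lessThan x ys
lessThan-↭ x Perm.refl         = ≡.refl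
lessThan-↭ x (Perm.prep y p)   = ≡.cong (choose (y <? x) 1 0 +_) (lessThan-↭ x p)
lessThan-↭ x (Perm.swap y z p) = ≡.trans (≡.cong (λ n → a + (b + n)) (lessThan-↭ x p)) (lemma a b _)
  where
    a = choose (y <? x) 1 0
    b = choose (z <? x) 1 0
    lemma : ∀ a b c → a + (b + c) ≡ b + (a + c)
    lemma = solve-∀
lessThan-↭ x (Perm.trans p q)  = ≡.trans (lessThan-↭ x p) (lessThan-↭ x q)

lessThan-none : ∀ x ys → All (x ≤_) ys → lessThan x ys ≡ 0
lessThan-none x []       []       = ≡.refl
lessThan-none x (y ∷ ys) (p ∷ ps) with y <? x
... | yes y<x = contradiction y<x (ℕ.≤⇒≯ p)
... | no _    = lessThan-none x ys ps

elbow-inversions : ∀ bs h v V n → inversions (rowF bs v V) + wasted bs v V ≡ inversions (v ∷ V) + n →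
  lessThan h (rowF bs v V) + inversions (rowF bs v V) + wasted bs v V ≡ inversions (h ∷ v ∷ V) + n
elbow-inversions bs h v V n IH = begin
  lessThan h (rowF bs v V) + inversions (rowF bs v V) + wasted bs v V
    ≡⟨ ℕ.+-assoc (lessThan h (rowF bs v V)) _ _ ⟩
  lessThan h (rowF bs v V) + (inversions (rowF bs v V) + wasted bs v V)
    ≡⟨ ≡.cong₂ _+_ (lessThan-↭ h (rowF-↭ bs v V)) IH ⟩
  lessThan h (v ∷ V) + (inversions (v ∷ V) + n)
    ≡⟨ ℕ.+-assoc (lessThan h (v ∷ V)) _ _ ⟨
  lessThan h (v ∷ V) + inversions (v ∷ V) + n ∎
  where open ≡.≡-Reasoning

-- A cross either creates exactly one inversion or is wasted.
rowF-inversions : ∀ r c b h V → length b ≡ length V →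
  inversions (rowF b h V) + wasted b h V ≡ inversions (h ∷ V) + length (crossRow r c b)
rowF-inversions r c []           h []      l = ≡.refl
rowF-inversions r c (false ∷ bs) h (v ∷ V) l =
  elbow-inversions bs h v V _ (rowF-inversions r (suc c) bs v V (ℕ.suc-injective l))
rowF-inversions r c (true ∷ bs) h (v ∷ V) l with h <? v
... | yes h<v = begin
  lessThan v (rowF bs h V) + inversions (rowF bs h V) + wasted bs h V
    ≡⟨ ℕ.+-assoc (lessThan v (rowF bs h V)) _ _ ⟩
  lessThan v (rowF bs h V) + (inversions (rowF bs h V) + wasted bs h V)
    ≡⟨ ≡.cong₂ _+_ (lessThan-↭ v (rowF-↭ bs h V)) (rowF-inversions r (suc c) bs h V (ℕ.suc-injective l)) ⟩
  lessThan v (h ∷ V) + (lessThan h V + inversions V + length (crossRow r (suc c) bs))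
    ≡⟨ ≡.cong (λ n → n + lessThan v V + (lessThan h V + inversions V + length (crossRow r (suc c) bs))) counted ⟩
  1 + lessThan v V + (lessThan h V + inversions V + length (crossRow r (suc c) bs))
    ≡⟨ lemma (lessThan v V) (lessThan h V) (inversions V) _ ⟩
  lessThan h V + (lessThan v V + inversions V) + suc (length (crossRow r (suc c) bs))
    ≡⟨ ≡.cong (λ n → n + lessThan h V + (lessThan v V + inversions V) + suc (length (crossRow r (suc c) bs))) skipped ⟨
  lessThan h (v ∷ V) + (lessThan v V + inversions V) + suc (length (crossRow r (suc c) bs)) ∎
  where
    open ≡.≡-Reasoning
    lemma : ∀ a b c d → 1 + a + (b + c + d) ≡ b + (a + c) + suc d
    lemma = solve-∀
    counted : choose (h <? v) 1 0 ≡ 1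
    counted with h <? v
    ... | yes _  = ≡.refl
    ... | no h≮v = contradiction h<v h≮v
    skipped : choose (v <? h) 1 0 ≡ 0
    skipped with v <? h
    ... | yes v<h = contradiction v<h (ℕ.<-asym h<v)
    ... | no _    = ≡.refl
... | no h≮v = begin
  lessThan h (rowF bs v V) + inversions (rowF bs v V) + suc (wasted bs v V)
    ≡⟨ ℕ.+-suc _ _ ⟩
  suc (lessThan h (rowF bs v V) + inversions (rowF bs v V) + wasted bs v V)
    ≡⟨ ≡.cong suc (elbow-inversions bs h v V _ (rowF-inversions r (suc c) bs v V (ℕ.suc-injective l))) ⟩
  suc (lessThan h (v ∷ V) + inversions (v ∷ V) + length (crossRow r (suc c) bs))
    ≡⟨ ℕ.+-suc _ _ ⟨
  lessThan h (v ∷ V) + inversions (v ∷ V) + suc (length (crossRow r (suc c) bs)) ∎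
  where open ≡.≡-Reasoning

-- The strand r enters to the left of larger labels and so brings no inversion with it.
fwd-inversions : ∀ r M → Staircase M → inversions (fwd r M) + wastedM r M ≡ length (crosses r M)
fwd-inversions r []      s        = ≡.refl
fwd-inversions r (b ∷ M) (lb , s) = begin
  inversions (rowF b r V) + (wasted b r V + wastedM (suc r) M)
    ≡⟨ ℕ.+-assoc (inversions (rowF b r V)) _ _ ⟨
  inversions (rowF b r V) + wasted b r V + wastedM (suc r) M
    ≡⟨ ≡.cong (_+ wastedM (suc r) M) (rowF-inversions r 1 b r V (≡.trans lb (≡.sym (fwd-length (suc r) M)))) ⟩
  lessThan r V + inversions V + length (crossRow r 1 b) + wastedM (suc r) M
    ≡⟨ ≡.cong (λ n → n + inversions V + length (crossRow r 1 b) + wastedM (suc r) M) (lessThan-none r V (All.map ℕ.<⇒≤ (fwd-≥ (suc r) M))) ⟩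
  inversions V + length (crossRow r 1 b) + wastedM (suc r) M
    ≡⟨ lemma (inversions V) (length (crossRow r 1 b)) _ ⟩
  length (crossRow r 1 b) + (inversions V + wastedM (suc r) M)
    ≡⟨ ≡.cong (length (crossRow r 1 b) +_) (fwd-inversions (suc r) M s) ⟩
  length (crossRow r 1 b) + length (crosses (suc r) M)
    ≡⟨ List.length-++ (crossRow r 1 b) ⟨
  length (crossRow r 1 b ++ crosses (suc r) M) ∎
  where
    open ≡.≡-Reasoning
    V = fwd (suc r) M
    lemma : ∀ a b c → a + b + c ≡ b + (a + c)
    lemma = solve-∀

-- Turning the wasted crosses into elbows.
strip : List Bool → ℕ → List ℕ → List Bool
strip bs           h []       = bs
strip []           h (v ∷ vs) = []
strip (false ∷ bs) h (v ∷ vs) = false ∷ strip bs v vs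
strip (true ∷ bs)  h (v ∷ vs) = choose (h <? v) (true ∷ strip bs h vs) (false ∷ strip bs v vs)

stripM : ℕ → List (List Bool) → List (List Bool)
stripM r []      = []
stripM r (b ∷ M) = strip b r (fwd (suc r) M) ∷ stripM (suc r) M

strip-length : ∀ b h V → length (strip b h V) ≡ length b
strip-length b           h []      = ≡.refl
strip-length []          h (v ∷ V) = ≡.refl
strip-length (false ∷ b) h (v ∷ V) = ≡.cong suc (strip-length b v V)
strip-length (true ∷ b)  h (v ∷ V) with h <? v
... | yes _ = ≡.cong suc (strip-length b h V)
... | no _  = ≡.cong suc (strip-length b v V)

rowF-strip : ∀ b h V → rowF (strip b h V) h V ≡ rowF b h V × wasted (strip b h V) h V ≡ 0
rowF-strip b           h []      = ≡.refl , ≡.refl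
rowF-strip []          h (v ∷ V) = ≡.refl , ≡.refl
rowF-strip (false ∷ b) h (v ∷ V) = ≡.cong (h ∷_) (proj₁ (rowF-strip b v V)) , proj₂ (rowF-strip b v V)
rowF-strip (true ∷ b)  h (v ∷ V) with h <? v in eq
... | no _  = ≡.cong (h ∷_) (proj₁ (rowF-strip b v V)) , proj₂ (rowF-strip b v V)
... | yes h<v with h <? v
...   | yes _  = ≡.cong (v ∷_) (proj₁ (rowF-strip b h V)) , proj₂ (rowF-strip b h V)
...   | no h≮v = contradiction h<v h≮v

stripM-length : ∀ r M → length (stripM r M) ≡ length M
stripM-length r []      = ≡.refl
stripM-length r (b ∷ M) = ≡.cong suc (stripM-length (suc r) M)

stripM-Staircase : ∀ r M → Staircase M → Staircase (stripM r M)
stripM-Staircase r []      s        = tt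
stripM-Staircase r (b ∷ M) (lb , s) =
  ≡.trans (strip-length b r (fwd (suc r) M)) (≡.trans lb (≡.cong suc (≡.sym (stripM-length (suc r) M)))) , stripM-Staircase (suc r) M s

fwd-stripM : ∀ r M → fwd r (stripM r M) ≡ fwd r M
fwd-stripM r []      = ≡.refl
fwd-stripM r (b ∷ M) = ≡.trans (≡.cong (rowF (strip b r (fwd (suc r) M)) r) (fwd-stripM (suc r) M)) (proj₁ (rowF-strip b r (fwd (suc r) M)))

wastedM-stripM : ∀ r M → wastedM r (stripM r M) ≡ 0
wastedM-stripM r []      = ≡.refl
wastedM-stripM r (b ∷ M) = ≡.cong₂ _+_
  (≡.trans (≡.cong (wasted (strip b r (fwd (suc r) M)) r) (fwd-stripM (suc r) M)) (proj₂ (rowF-strip b r (fwd (suc r) M)))) (wastedM-stripM (suc r) M)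

∈-bits : ∀ b → b ∈ bits (length b)
∈-bits []          = here ≡.refl
∈-bits (true ∷ b)  = Mem.∈-++⁺ˡ (Mem.∈-map⁺ (true ∷_) (∈-bits b))
∈-bits (false ∷ b) = Mem.∈-++⁺ʳ (map (true ∷_) (bits (length b))) (Mem.∈-map⁺ (false ∷_) (∈-bits b))

∈-staircases : ∀ M → Staircase M → M ∈ staircases (length M)
∈-staircases []      s        = here ≡.refl
∈-staircases (b ∷ M) (lb , s) = Mem.∈-concat⁺′ (Mem.∈-map⁺ (b ∷_) (∈-staircases M s))
  (Mem.∈-map⁺ (λ b → map (b ∷_) (staircases (length M))) (≡.subst (λ l → b ∈ bits l) lb (∈-bits b)))

filter-cong-All : ∀ {a p q} {A : Set a} {P : A → Set p} {Q : A → Set q} (P? : ∀ x → Dec (P x)) (Q? : ∀ x → Dec (Q x)) xs →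
  All (λ x → (P x → Q x) × (Q x → P x)) xs → filter P? xs ≡ filter Q? xs
filter-cong-All P? Q? []       []             = ≡.refl
filter-cong-All P? Q? (x ∷ xs) ((f , g) ∷ ps) with P? x | Q? x
... | yes p | yes q = ≡.cong (x ∷_) (filter-cong-All P? Q? xs ps)
... | yes p | no ¬q = contradiction (f p) ¬q
... | no ¬p | yes q = contradiction (g q) ¬p
... | no ¬p | no ¬q = filter-cong-All P? Q? xs ps

complement-length : ∀ Q → Unique Q → All (λ P → (∀ {z} → z ∈ P → z ∈ Q) × length (filter (λ z → ¬? (z ∈? P)) Q) + length P ≡ length Q) (sublists Q)
complement-length []      u         = ((λ ()) , ≡.refl) ∷ []
complement-length (x ∷ Q) (x∉ ∷ u) = All.++⁺ (All.map⁺ (All.map with-x (complement-length Q u))) (All.map without-x (complement-length Q u))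
  where
    with-x : ∀ {P} → (∀ {z} → z ∈ P → z ∈ Q) × length (filter (λ z → ¬? (z ∈? P)) Q) + length P ≡ length Q →
      (∀ {z} → z ∈ x ∷ P → z ∈ x ∷ Q) × length (filter (λ z → ¬? (z ∈? (x ∷ P))) (x ∷ Q)) + suc (length P) ≡ suc (length Q)
    with-x {P} (sub , l) = (λ { (here e) → here e ; (there z) → there (sub z) }) ,
      ≡.trans (≡.cong (λ zs → length zs + suc (length P)) (≡.trans (List.filter-reject (λ z → ¬? (z ∈? (x ∷ P))) (λ ¬∈ → ¬∈ (here ≡.refl)))
        (filter-cong-All (λ z → ¬? (z ∈? (x ∷ P))) (λ z → ¬? (z ∈? P)) Q
          (All.map (λ x≢z → (λ z∉ → z∉ ∘ there) , λ { z∉ (here e) → x≢z (≡.sym e) ; z∉ (there z∈) → z∉ z∈ }) x∉))))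
      (≡.trans (ℕ.+-suc _ (length P)) (≡.cong suc l))
    without-x : ∀ {P} → (∀ {z} → z ∈ P → z ∈ Q) × length (filter (λ z → ¬? (z ∈? P)) Q) + length P ≡ length Q →
      (∀ {z} → z ∈ P → z ∈ x ∷ Q) × length (filter (λ z → ¬? (z ∈? P)) (x ∷ Q)) + length P ≡ suc (length Q)
    without-x {P} (sub , l) = (there ∘ sub) ,
      ≡.trans (≡.cong (λ zs → length zs + length P) (List.filter-accept (λ z → ¬? (z ∈? P)) {x} {Q} (λ x∈ → All.lookup x∉ (sub x∈) ≡.refl))) (≡.cong suc l)

triangle-unique : ∀ n → Unique (triangle n)
triangle-unique n = Unique.filter⁺ _ (Unique.cartesianProduct⁺ u u)
  where u = Unique.applyUpTo⁺₁ suc n (λ i<j _ e → ℕ.<⇒≢ i<j (ℕ.suc-injective e))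

elbows-length : ∀ n {P} → P ∈ sublists (triangle n) → length (elbows n P) + length P ≡ length (triangle n)
elbows-length n P∈ = proj₂ (All.lookup (complement-length (triangle n) (triangle-unique n)) P∈)

maximum-constant : ∀ {k xs} → All (_≡ k) xs → ∀ {x} → x ∈ xs → maximum xs ≡ k
maximum-constant {k} (≡.refl ∷ [])       _ = ℕ.⊔-identityʳ k
maximum-constant {k} (≡.refl ∷ p ∷ ps) _ = ≡.trans (≡.cong (k ⊔_) (maximum-constant (p ∷ ps) (here ≡.refl))) (ℕ.⊔-idem k)

module _ {m : ℕ} (π : Permutation′ (suc m)) where

  ∈-Pipes : ∀ {P} → P ∈ Pipes π → ∃[ M ] (Staircase M × length M ≡ m × P ≡ crosses 1 M × fwd 1 M ≡ oneLine π)
  ∈-Pipes {P} P∈ with Mem.∈-filter⁻ (λ P → List.≡-dec _≟_ (exits (suc m) P) (oneLine π)) P∈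
  ... | P∈s , e with Mem.∈-map⁻ (crosses 1) (≡.subst (P ∈_) (sublists-triangle m) P∈s)
  ...   | M , M∈ , ≡.refl = M , s , lM , ≡.refl ,
          ≡.trans (≡.sym (≡.subst (λ k → exits (suc k) (crosses 1 M) ≡ fwd 1 M) lM (exits-fwd M s))) e
    where
      s = All.lookup (staircases-Staircase m) M∈
      lM = All.lookup (staircases-length m) M∈

  -- A reduced pipe dream has as many crosses as π has inversions, so all facets have the same size.
  -- That there is a facet at all is shown by turning the wasted crosses of M into elbows. The
  -- number of crosses of M in excess of the inversions is then its codimension.
  codimPD-wasted : ∀ M → Staircase M → length M ≡ m → fwd 1 M ≡ oneLine π →
    codimPD π (elbows (suc m) (crosses 1 M)) ≡ wastedM 1 M
  codimPD-wasted M s lM eq = begin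
    maximum (map length (facetsPD π)) ∸ length (elbows (suc m) (crosses 1 M))
      ≡⟨ ≡.cong₂ _∸_ (maximum-constant facet-length (Mem.∈-map⁺ length (Mem.∈-map⁺ (elbows (suc m)) reduced∈))) (elbows≡ M s lM) ⟩
    (t ∸ I) ∸ (t ∸ length (crosses 1 M))
      ≡⟨ ≡.cong (λ k → (t ∸ I) ∸ (t ∸ k)) (≡.sym total) ⟩
    (t ∸ I) ∸ (t ∸ (I + wastedM 1 M))
      ≡⟨ ≡.cong ((t ∸ I) ∸_) (≡.sym (ℕ.∸-+-assoc t I (wastedM 1 M))) ⟩
    (t ∸ I) ∸ ((t ∸ I) ∸ wastedM 1 M)
      ≡⟨ ℕ.m∸[m∸n]≡n (ℕ.m+n≤o⇒m≤o∸n (wastedM 1 M) (≡.subst (_≤ t) (≡.trans (≡.sym total) (ℕ.+-comm I _)) (≡.subst (length (crosses 1 M) ≤_) (elbows-length (suc m) (P∈ M s lM)) (ℕ.m≤n+m _ _)))) ⟩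
    wastedM 1 M ∎
    where
      open ≡.≡-Reasoning
      t = length (triangle (suc m))
      I = inversions (oneLine π)
      P∈ : ∀ M → Staircase M → length M ≡ m → crosses 1 M ∈ sublists (triangle (suc m))
      P∈ M s lM = ≡.subst (crosses 1 M ∈_) (≡.sym (sublists-triangle m)) (Mem.∈-map⁺ (crosses 1) (≡.subst (λ k → M ∈ staircases k) lM (∈-staircases M s)))
      elbows≡ : ∀ M → Staircase M → length M ≡ m → length (elbows (suc m) (crosses 1 M)) ≡ t ∸ length (crosses 1 M)
      elbows≡ M s lM = ≡.trans (≡.sym (ℕ.m+n∸n≡m _ (length (crosses 1 M)))) (≡.cong (_∸ length (crosses 1 M)) (elbows-length (suc m) (P∈ M s lM)))
      total : I + wastedM 1 M ≡ length (crosses 1 M)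
      total = ≡.trans (≡.cong (λ W → inversions W + wastedM 1 M) (≡.sym eq)) (fwd-inversions 1 M s)
      sweep′ : ∀ M → Staircase M → length M ≡ m → SweepSpec 0 (suc m) M (sweep (suc m) (crosses 1 M))
      sweep′ M s lM = ≡.subst (λ k → SweepSpec 0 (suc k) M (sweep (suc k) (crosses 1 M))) lM (sweep-spec M s)
      facet-length : All (_≡ t ∸ I) (map length (facetsPD π))
      facet-length = All.map⁺ (All.map⁺ (All.tabulate λ P∈ → lemma (Mem.∈-filter⁻ (reduced? (suc m)) P∈)))
        where
          lemma : ∀ {P} → P ∈ Pipes π × Reduced (suc m) P → length (elbows (suc m) P) ≡ t ∸ I
          lemma (P∈ , red) with ∈-Pipes P∈
          ... | M′ , s′ , lM′ , ≡.refl , eq′ = ≡.trans (elbows≡ M′ s′ lM′) (≡.cong (t ∸_) (≡.trans (≡.sym (fwd-inversions 1 M′ s′))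
                  (≡.trans (≡.cong₂ _+_ (≡.cong inversions eq′) (SweepSpec.reduced⇒ (sweep′ M′ s′ lM′) red)) (ℕ.+-identityʳ I))))
      M₀ = stripM 1 M
      s₀ = stripM-Staircase 1 M s
      lM₀ = ≡.trans (stripM-length 1 M) lM
      reduced∈ : crosses 1 M₀ ∈ filter (reduced? (suc m)) (Pipes π)
      reduced∈ = Mem.∈-filter⁺ (reduced? (suc m))
        (Mem.∈-filter⁺ (λ P → List.≡-dec _≟_ (exits (suc m) P) (oneLine π)) (P∈ M₀ s₀ lM₀)
          (≡.trans (≡.trans (SweepSpec.strands (sweep′ M₀ s₀ lM₀)) (List.++-identityʳ _)) (≡.trans (fwd-stripM 1 M) eq)))
        (SweepSpec.⇒reduced (sweep′ M₀ s₀ lM₀) (wastedM-stripM 1 M))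

-- The double Grothendieck polynomial as a signed sum over staircases.

module Grothendieck {c ℓ} (K : CommutativeRing c ℓ) where
  open CommutativeRing K hiding (zero) renaming (-_ to ⊝_; _-_ to _⊖_; _+_ to _⊕_)
  open Exp semiring using (_^_)
  open Sums K
  open Hecke K
  open import Relation.Binary.Reasoning.Setoid setoid

  ∏-crossRow : ∀ (w : Box → Carrier) r i b → ∏ K (crossRow r (suc i) b) w ≈ rowWt (λ i → w (r , suc i)) one i b
  ∏-crossRow w r i []          = refl
  ∏-crossRow w r i (true ∷ b)  = *-congˡ (∏-crossRow w r (suc i) b)
  ∏-crossRow w r i (false ∷ b) = trans (∏-crossRow w r (suc i) b) (sym (*-identityˡ _))

  ∏-crosses : ∀ (w : Box → Carrier) r M → ∏ K (crosses r M) w ≈ wt (λ r i → w (r , suc i)) (λ _ → one) r M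
  ∏-crosses w r []      = refl
  ∏-crosses w r (b ∷ M) = trans (∏-++ (crossRow r 1 b) _ w) (*-cong (∏-crossRow w r 0 b) (∏-crosses w (suc r) M))

  𝔊-staircases : ∀ {m} (π : Permutation′ (suc m)) x y →
    𝔊 K π x y ≈ ∑ K (staircases m) (λ M → wt (λ r i → weight K x y (r , suc i)) (λ _ → one) 1 M *
      ((⊝ 1#) ^ wastedM 1 M * ⟦ fwd 1 M ≟ₗ oneLine π ⟧))
  𝔊-staircases {m} π x y = begin
    𝔊 K π x y
      ≈⟨ ∑-filter (λ P → List.≡-dec _≟_ (exits (suc m) P) (oneLine π)) (sublists (triangle (suc m))) _ ⟩
    ∑ K (sublists (triangle (suc m))) f
      ≡⟨ ≡.trans (≡.cong (λ X → ∑ K X f) (sublists-triangle m)) (∑-map (crosses 1) (staircases m) f) ⟩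
    ∑ K (staircases m) (f ∘ crosses 1)
      ≈⟨ ∑-cong-All (All.zipWith (λ { {M} (s , lM) → term M s lM }) (staircases-Staircase m , staircases-length m)) ⟩
    ∑ K (staircases m) (λ M → wt (λ r i → weight K x y (r , suc i)) (λ _ → one) 1 M * ((⊝ 1#) ^ wastedM 1 M * ⟦ fwd 1 M ≟ₗ oneLine π ⟧)) ∎
    where
      f = λ P → ⟦ List.≡-dec _≟_ (exits (suc m) P) (oneLine π) ⟧ * ((⊝ 1#) ^ codimPD π (elbows (suc m) P) * ∏ K P (weight K x y))
      term : ∀ M → Staircase M → length M ≡ m → f (crosses 1 M) ≈
        wt (λ r i → weight K x y (r , suc i)) (λ _ → one) 1 M * ((⊝ 1#) ^ wastedM 1 M * ⟦ fwd 1 M ≟ₗ oneLine π ⟧)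
      term M s lM = begin
        ⟦ exits (suc m) (crosses 1 M) ≟ₗ oneLine π ⟧ * ((⊝ 1#) ^ codimPD π (elbows (suc m) (crosses 1 M)) * ∏ K (crosses 1 M) (weight K x y))
          ≈⟨ *-congʳ (⟦⟧-cong (exits (suc m) (crosses 1 M) ≟ₗ oneLine π) (fwd 1 M ≟ₗ oneLine π) (≡.trans (≡.sym ex)) (≡.trans ex)) ⟩
        ⟦ fwd 1 M ≟ₗ oneLine π ⟧ * ((⊝ 1#) ^ codimPD π (elbows (suc m) (crosses 1 M)) * ∏ K (crosses 1 M) (weight K x y))
          -- The codimension is computed from the exits, so the exponents are compared under the
          -- indicator only.
          ≈⟨ ⟦⟧-*-cong (fwd 1 M ≟ₗ oneLine π) (λ eq → *-cong (reflexive (≡.cong ((⊝ 1#) ^_) (codimPD-wasted π M s lM eq))) (∏-crosses _ 1 M)) ⟩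
        ⟦ fwd 1 M ≟ₗ oneLine π ⟧ * ((⊝ 1#) ^ wastedM 1 M * wt (λ r i → weight K x y (r , suc i)) (λ _ → one) 1 M)
          ≈⟨ trans (sym (*-assoc _ _ _)) (trans (*-comm _ _) (*-congˡ (*-comm _ _))) ⟩
        wt (λ r i → weight K x y (r , suc i)) (λ _ → one) 1 M * ((⊝ 1#) ^ wastedM 1 M * ⟦ fwd 1 M ≟ₗ oneLine π ⟧) ∎
        where
          ex : exits (suc m) (crosses 1 M) ≡ fwd 1 M
          ex = ≡.subst (λ k → exits (suc k) (crosses 1 M) ≡ fwd 1 M) lM (exits-fwd M s)

-- Initial segments, tabulated words and bounds on counts.

Unique-length-≤ : ∀ {a} {A : Set a} {xs ys : List A} → Unique xs → (∀ {z} → z ∈ xs → z ∈ ys) → length xs ≤ length ys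
Unique-length-≤ {xs = []}     u        sub = z≤n
Unique-length-≤ {xs = x ∷ xs} (x∉ ∷ u) sub with Mem.∈-∃++ (sub (here ≡.refl))
... | ys₁ , ys₂ , ≡.refl = ℕ.≤-trans (s≤s (Unique-length-≤ u sub′))
      (ℕ.≤-reflexive (≡.trans (≡.cong suc (List.length-++ ys₁)) (≡.trans (≡.sym (ℕ.+-suc (length ys₁) (length ys₂))) (≡.sym (List.length-++ ys₁)))))
  where
    sub′ : ∀ {z} → z ∈ xs → z ∈ ys₁ ++ ys₂
    sub′ z∈ with Mem.∈-++⁻ ys₁ (sub (there z∈))
    ... | inj₁ p             = Mem.∈-++⁺ˡ p
    ... | inj₂ (here ≡.refl) = contradiction ≡.refl (All.lookup x∉ z∈)
    ... | inj₂ (there p)     = Mem.∈-++⁺ʳ ys₁ p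

interval-length : ∀ a n → length (interval a n) ≡ n
interval-length a zero    = ≡.refl
interval-length a (suc n) = ≡.cong suc (interval-length (suc a) n)

interval-unique : ∀ a n → Unique (interval a n)
interval-unique a zero    = []
interval-unique a (suc n) = All.map ℕ.<⇒≢ (interval-≥ (suc a) n) ∷ interval-unique (suc a) n

∈-interval : ∀ a n {x} → a ≤ x → x < n + a → x ∈ interval a n
∈-interval a zero    a≤x x<a = contradiction x<a (ℕ.≤⇒≯ a≤x)
∈-interval a (suc n) {x} a≤x x< with a ≟ x
... | yes ≡.refl = here ≡.refl
... | no a≢x     = there (∈-interval (suc a) n (ℕ.≤∧≢⇒< a≤x a≢x) (≡.subst (x <_) (≡.sym (ℕ.+-suc n a)) x<))

-- An element x brings the whole interval from 2 to x with it, and a missing x excludes everything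
-- from x on. Both bounds follow by comparing lengths. The segment starts at 2 because the diagram
-- does.
initial-segment : ∀ {xs : List ℕ} → Unique xs → (∀ {x} → x ∈ xs → 2 ≤ x) → (∀ {x y} → x ∈ xs → 2 ≤ y → y < x → y ∈ xs) →
  ∀ {x} → (x ∈ xs → x ≤ suc (length xs)) × (2 ≤ x → x ≤ suc (length xs) → x ∈ xs)
initial-segment {xs} u ≥2 closed {x} = below , inside
  where
    open DecMembership _≟_ using () renaming (_∈?_ to _∈ₙ?_)
    below : x ∈ xs → x ≤ suc (length xs)
    below x∈ = ≡.subst (_≤ suc (length xs)) (ℕ.m+[n∸m]≡n (ℕ.<⇒≤ (≥2 x∈))) (s≤s (≡.subst (_≤ length xs) (interval-length 2 (x ∸ 1))
      (Unique-length-≤ (interval-unique 2 (x ∸ 1)) sub)))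
      where
        sub : ∀ {z} → z ∈ interval 2 (x ∸ 1) → z ∈ xs
        sub {z} z∈ with ℕ.<-cmp z x
        ... | tri< z<x _ _ = closed x∈ (All.lookup (interval-≥ 2 (x ∸ 1)) z∈) z<x
        ... | tri≈ _ ≡.refl _ = x∈
        ... | tri> _ _ x<z = contradiction (All.lookup (interval-< 2 (x ∸ 1)) z∈) (ℕ.≤⇒≯
                (ℕ.≤-trans (ℕ.≤-reflexive (≡.trans (ℕ.+-suc (x ∸ 1) 1) (≡.cong suc (ℕ.m∸n+n≡m (ℕ.<⇒≤ (≥2 x∈)))))) x<z))
    inside : 2 ≤ x → x ≤ suc (length xs) → x ∈ xs
    inside 2≤x x≤ with x ∈ₙ? xs
    ... | yes p = p
    ... | no x∉ = contradiction (≡.subst (length xs ≤_) (interval-length 2 (x ∸ 2)) (Unique-length-≤ u sub))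
            (ℕ.<⇒≱ (ℕ.≤-trans (ℕ.≤-reflexive (≡.sym (ℕ.+-∸-assoc 1 2≤x))) (ℕ.∸-monoˡ-≤ {n = suc (length xs)} 1 x≤)))
      where
        sub : ∀ {z} → z ∈ xs → z ∈ interval 2 (x ∸ 2)
        sub {z} z∈ with ℕ.<-cmp z x
        ... | tri< z<x _ _ = ∈-interval 2 (x ∸ 2) (≥2 z∈) (≡.subst (z <_) (≡.sym (ℕ.m∸n+n≡m 2≤x)) z<x)
        ... | tri≈ _ ≡.refl _ = contradiction z∈ x∉
        ... | tri> _ _ x<z = contradiction (closed z∈ 2≤x x<z) x∉

At-tabulate : ∀ {n} (f : Fin n → ℕ) i → At (tabulate f) (toℕ i) (f i)
At-tabulate f Fin.zero    = here
At-tabulate f (Fin.suc i) = there (At-tabulate (f ∘ Fin.suc) i)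

At-tabulate⁻ : ∀ {n} (f : Fin n → ℕ) {p v} → At (tabulate f) p v → ∃[ i ] (toℕ i ≡ p × f i ≡ v)
At-tabulate⁻ {suc n} f here      = Fin.zero , ≡.refl , ≡.refl
At-tabulate⁻ {suc n} f (there a) = let i , p , q = At-tabulate⁻ (f ∘ Fin.suc) a in Fin.suc i , ≡.cong suc p , q

larger-≤ : ∀ v k xs → (∀ {i w q} → At xs i w → v < w → At xs q v → i < q → i < k) → v ∈ xs → larger v xs ≤ k
larger-≤ v k (x ∷ xs) bound v∈ with x ≟ v | v <? x
... | yes _  | _     = z≤n
... | no x≢v | no _  = larger-≤ v k xs (λ a v<w b i<q → ℕ.<⇒≤ (bound (there a) v<w (there b) (s≤s i<q))) (tail∈ v∈)
  where
    tail∈ : v ∈ x ∷ xs → v ∈ xs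
    tail∈ (here v≡x) = contradiction (≡.sym v≡x) x≢v
    tail∈ (there p)  = p
larger-≤ v zero (x ∷ xs) bound (here v≡x) | no x≢v | yes v<x = contradiction (≡.sym v≡x) x≢v
larger-≤ v zero (x ∷ xs) bound (there v∈) | no x≢v | yes v<x =
  contradiction (bound here v<x (there (proj₂ (∈⇒At v∈))) (s≤s z≤n)) λ ()
larger-≤ v (suc k) (x ∷ xs) bound (here v≡x) | no x≢v | yes v<x = contradiction (≡.sym v≡x) x≢v
larger-≤ v (suc k) (x ∷ xs) bound (there v∈) | no x≢v | yes v<x =
  s≤s (larger-≤ v k xs (λ a v<w b i<q → ℕ.s≤s⁻¹ (bound (there a) v<w (there b) (s≤s i<q))) v∈)

count≤-none : ∀ v k xs → (∀ {i w} → i < k → At xs i w → v < w) → count≤ v (take k xs) ≡ 0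
count≤-none v zero    xs       f = ≡.refl
count≤-none v (suc k) []       f = ≡.refl
count≤-none v (suc k) (x ∷ xs) f with x ≤? v
... | yes x≤v = contradiction (f (s≤s z≤n) here) (ℕ.≤⇒≯ x≤v)
... | no _    = count≤-none v k xs (λ i<k a → f (s≤s i<k) (there a))

count≤-head : ∀ v k xs → (∀ {i w} → 1 ≤ i → i ≤ k → At xs i w → v < w) → count≤ v (take (suc k) xs) ≤ 1
count≤-head v k []       f = z≤n
count≤-head v k (x ∷ xs) f = ≡.subst (λ n → le v x + n ≤ 1) (≡.sym (count≤-none v k xs (λ i<k a → f (s≤s z≤n) i<k (there a))))
  (≡.subst (_≤ 1) (≡.sym (ℕ.+-identityʳ _)) (le-≤1 v x))

larger-head-1 : ∀ v k xs → 1 ≤ v → At xs 0 1 → (∀ {i w q} → At xs i w → v < w → At xs q v → i < q → i ≤ k) → v ∈ xs → larger v xs ≤ k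
larger-head-1 v k (x ∷ xs) 1≤v here f v∈ with 1 ≟ v
... | yes _ = z≤n
... | no 1≢v with v <? 1
...   | yes v<1 = contradiction v<1 (ℕ.≤⇒≯ 1≤v)
...   | no _    = larger-≤ v k xs (λ a v<w b i<q → f (there a) v<w (there b) (s≤s i<q)) (tail∈ v∈)
  where
    tail∈ : v ∈ 1 ∷ xs → v ∈ xs
    tail∈ (here v≡1) = contradiction (≡.sym v≡1) 1≢v
    tail∈ (there p)  = p

All-take : ∀ {P : ℕ → Set} k xs → (∀ {i w} → i < k → At xs i w → P w) → All P (take k xs)
All-take zero    xs       f = []
All-take (suc k) []       f = []
All-take (suc k) (x ∷ xs) f = f (s≤s z≤n) here ∷ All-take k xs (λ i<k a → f (s≤s i<k) (there a))

At-exists : ∀ {xs : List ℕ} {i} → i < length xs → ∃[ v ] At xs i v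
At-exists {x ∷ xs} {zero}  _       = x , here
At-exists {x ∷ xs} {suc i} (s≤s p) = let v , a = At-exists p in v , there a

-- The diagram of 1π′ with π′ dominant.

module Dominant {m : ℕ} (π : Permutation′ (suc m))
  (π0≡0 : π ⟨$⟩ʳ Fin.zero ≡ Fin.zero) (avoids : Avoids132 (λ i → π ⟨$⟩ʳ Fin.suc i)) where

  N = suc m

  W = oneLine π

  oneLine-tabulate : W ≡ tabulate (letter π)
  oneLine-tabulate = List.map-tabulate id (letter π)

  letter-injective : ∀ {i j} → letter π i ≡ letter π j → i ≡ j
  letter-injective {i} {j} e = ≡.trans (≡.sym (inverseˡ π)) (≡.trans (≡.cong (π ⟨$⟩ˡ_) (Fin.toℕ-injective (ℕ.suc-injective e))) (inverseˡ π))

  at : ∀ i → At W (toℕ i) (letter π i)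
  at i = ≡.subst (λ X → At X (toℕ i) (letter π i)) (≡.sym oneLine-tabulate) (At-tabulate (letter π) i)

  at⁻ : ∀ {p v} → At W p v → ∃[ i ] (toℕ i ≡ p × letter π i ≡ v)
  at⁻ {p} {v} a = At-tabulate⁻ (letter π) (≡.subst (λ X → At X p v) oneLine-tabulate a)

  W-unique : Unique W
  W-unique = Unique.map⁺ letter-injective (Unique.allFin⁺ N)

  W-length : length W ≡ N
  W-length = ≡.trans (≡.cong length oneLine-tabulate) (List.length-tabulate (letter π))

  W-bounds : All (λ v → 1 ≤ v × v ≤ N) W
  W-bounds = All.map⁺ (All.tabulate {xs = allFin N} λ {i} _ → s≤s z≤n , Fin.toℕ<n (π ⟨$⟩ʳ i))

  ∈-W : ∀ {v} → 1 ≤ v → v ≤ N → v ∈ W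
  ∈-W {suc v} _ v<N = ≡.subst (_∈ W) (≡.cong suc (≡.trans (≡.cong toℕ (inverseʳ π)) (Fin.toℕ-fromℕ< v<N)))
    (Mem.∈-map⁺ (letter π) (Mem.∈-allFin (π ⟨$⟩ˡ Fin.fromℕ< v<N)))

  W-head : At W 0 1
  W-head = ≡.subst (At W 0) (≡.cong (suc ∘ toℕ) π0≡0) (at Fin.zero)

  position-1 : ∀ {q} → At W q 1 → q ≡ 0
  position-1 a = At-unique W-unique a W-head

  avoids-W : ∀ {i j k a b c} → 0 < i → i < j → j < k → At W i a → At W j b → At W k c → a < c → c < b → ⊥
  avoids-W 0<i i<j j<k ai bj ck a<c c<b with at⁻ ai | at⁻ bj | at⁻ ck
  avoids-W () i<j j<k ai bj ck a<c c<b | Fin.zero , ≡.refl , _ | _ | _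
  ... | Fin.suc i , ≡.refl , ≡.refl | Fin.zero , ≡.refl , _ | _ = contradiction i<j λ ()
  ... | Fin.suc i , ≡.refl , ≡.refl | Fin.suc j , ≡.refl , ≡.refl | Fin.zero , ≡.refl , _ = contradiction j<k λ ()
  ... | Fin.suc i , ≡.refl , ≡.refl | Fin.suc j , ≡.refl , ≡.refl | Fin.suc k , ≡.refl , ≡.refl =
    avoids (ℕ.s≤s⁻¹ i<j) (ℕ.s≤s⁻¹ j<k) (ℕ.s≤s⁻¹ a<c , ℕ.s≤s⁻¹ c<b)

  record InDiagram (r c : ℕ) : Set where
    constructor inversion
    field
      {i j w} : ℕ
      column  : c ≡ suc i
      upper   : At W i w
      lower   : At W j r
      i<j     : i < j
      r<w     : r < w

  ∈-diagram⁻ : ∀ {r c} → (r , c) ∈ diagram π → InDiagram r c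
  ∈-diagram⁻ p with Mem.∈-map⁻ (λ (i , j) → letter π j , suc (toℕ i)) p
  ... | (i , j) , q , ≡.refl with Mem.∈-filter⁻ (λ (i , j) → (i Fin.<? j) ×-dec (letter π j <? letter π i)) {xs = cartesianProduct (allFin N) (allFin N)} q
  ...   | _ , i<j , r<w = inversion ≡.refl (at i) (at j) i<j r<w

  ∈-diagram⁺ : ∀ {r c} → InDiagram r c → (r , c) ∈ diagram π
  ∈-diagram⁺ (inversion ≡.refl ai aj i<j r<w) with at⁻ ai | at⁻ aj
  ... | i , ≡.refl , ≡.refl | j , ≡.refl , ≡.refl =
    Mem.∈-map⁺ (λ (i , j) → letter π j , suc (toℕ i)) (Mem.∈-filter⁺ (λ (i , j) → (i Fin.<? j) ×-dec (letter π j <? letter π i))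
      (Mem.∈-cartesianProduct⁺ (Mem.∈-allFin i) (Mem.∈-allFin j)) (i<j , r<w))

  diagram-unique : Unique (diagram π)
  diagram-unique = Unique.map⁺ (λ { {i , j} {i′ , j′} e → ≡.cong₂ _,_ (Fin.toℕ-injective (ℕ.suc-injective (≡.cong proj₂ e))) (letter-injective (≡.cong proj₁ e)) })
    (Unique.filter⁺ (λ (i , j) → (i Fin.<? j) ×-dec (letter π j <? letter π i)) {cartesianProduct (allFin N) (allFin N)} (Unique.cartesianProduct⁺ (Unique.allFin⁺ N) (Unique.allFin⁺ N)))

  abstract
    L : ℕ → ℕ
    L r = length (filter (λ (r′ , _) → r′ ≟ r) (diagram π))

    C : ℕ → ℕ
    C c = length (filter (λ (_ , c′) → c′ ≟ c) (diagram π))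

    L-length : ∀ r → length (filter (λ (r′ , _) → r′ ≟ r) (diagram π)) ≡ L r
    L-length r = ≡.refl

    C-length : ∀ c → length (filter (λ (_ , c′) → c′ ≟ c) (diagram π)) ≡ C c
    C-length c = ≡.refl

  column-≥2 : ∀ {r c} → InDiagram r c → 2 ≤ c
  column-≥2 (inversion {zero} ≡.refl ai aj i<j r<w) =
    contradiction (≡.subst (_ <_) (At-functional ai W-head) r<w) (ℕ.≤⇒≯ (proj₁ (All.lookup W-bounds (At⇒∈ aj))))
  column-≥2 (inversion {suc i} ≡.refl ai aj i<j r<w) = s≤s (s≤s z≤n)

  row-≥2 : ∀ {r c} → InDiagram r c → 2 ≤ r
  row-≥2 (inversion ≡.refl ai aj i<j r<w) = ℕ.≤∧≢⇒< (proj₁ (All.lookup W-bounds (At⇒∈ aj)))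
    λ { ≡.refl → contradiction (≡.subst (_ <_) (position-1 aj) i<j) λ () }

  -- If the letter w′ of column c′ were smaller than r, then w′, w, r would form a pattern 132.
  row-closed : ∀ {r c c′} → InDiagram r c → 2 ≤ c′ → c′ < c → InDiagram r c′
  row-closed {c′ = suc i′} (inversion {i} ≡.refl ai aj i<j r<w) (s≤s 0<i′) (s≤s i′<i) with At-exists {W} {i′} (ℕ.<-trans i′<i (At-<length ai))
  ... | w′ , a′ with ℕ.<-cmp w′ _
  ...   | tri< w′<r _ _    = ⊥-elim (avoids-W 0<i′ i′<i i<j a′ ai aj w′<r r<w)
  ...   | tri≈ _ ≡.refl _  = contradiction (At-unique W-unique a′ aj) (ℕ.<⇒≢ (ℕ.<-trans i′<i i<j))
  ...   | tri> _ _ r<w′    = inversion ≡.refl a′ aj (ℕ.<-trans i′<i i<j) r<w′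

  -- If r′ stood in front of w, then r′, w, r would form a pattern 132.
  column-closed : ∀ {r c r′} → InDiagram r c → 2 ≤ r′ → r′ < r → InDiagram r′ c
  column-closed {r} {c} {r′} (inversion {i} {j} ≡.refl ai aj i<j r<w) 2≤r′ r′<r
    with ∈⇒At (∈-W (ℕ.<⇒≤ 2≤r′) (ℕ.<⇒≤ (ℕ.<-≤-trans r′<r (proj₂ (All.lookup W-bounds (At⇒∈ aj))))))
  ... | j′ , a′ with ℕ.<-cmp i j′
  ...   | tri< i<j′ _ _   = inversion ≡.refl ai a′ i<j′ (ℕ.<-trans r′<r r<w)
  ...   | tri≈ _ ≡.refl _ = contradiction (At-functional ai a′) (λ w≡ → ℕ.<-irrefl (≡.sym w≡) (ℕ.<-trans r′<r r<w))
  ...   | tri> _ _ j′<i   = ⊥-elim (avoids-W (ℕ.n≢0⇒n>0 λ { ≡.refl → contradiction (At-functional a′ W-head) (ℕ.>⇒≢ 2≤r′) }) j′<i i<j a′ ai aj r′<r r<w)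

  private
    rowColumns : ℕ → List ℕ
    rowColumns r = map proj₂ (filter (λ (r′ , _) → r′ ≟ r) (diagram π))

    ∈-rowColumns : ∀ {r c} → (c ∈ rowColumns r → InDiagram r c) × (InDiagram r c → c ∈ rowColumns r)
    ∈-rowColumns {r} {c} = to , λ d → Mem.∈-map⁺ proj₂ (Mem.∈-filter⁺ (λ (r′ , _) → r′ ≟ r) (∈-diagram⁺ d) ≡.refl)
      where
        to : c ∈ rowColumns r → InDiagram r c
        to p with Mem.∈-map⁻ proj₂ p
        ... | (r′ , c′) , q , ≡.refl with Mem.∈-filter⁻ (λ (r′ , _) → r′ ≟ r) q
        ...   | q′ , ≡.refl = ∈-diagram⁻ q′

    columnRows : ℕ → List ℕ
    columnRows c = map proj₁ (filter (λ (_ , c′) → c′ ≟ c) (diagram π))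

    ∈-columnRows : ∀ {r c} → (r ∈ columnRows c → InDiagram r c) × (InDiagram r c → r ∈ columnRows c)
    ∈-columnRows {r} {c} = to , λ d → Mem.∈-map⁺ proj₁ (Mem.∈-filter⁺ (λ (_ , c′) → c′ ≟ c) (∈-diagram⁺ d) ≡.refl)
      where
        to : r ∈ columnRows c → InDiagram r c
        to p with Mem.∈-map⁻ proj₁ p
        ... | (r′ , c′) , q , ≡.refl with Mem.∈-filter⁻ (λ (_ , c′) → c′ ≟ c) q
        ...   | q′ , ≡.refl = ∈-diagram⁻ q′

    Unique-map-on : ∀ {A B : Set} (f : A → B) {xs : List A} → (∀ {x y} → x ∈ xs → y ∈ xs → f x ≡ f y → x ≡ y) → Unique xs → Unique (map f xs)
    Unique-map-on f {[]}     inj []       = []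
    Unique-map-on f {x ∷ xs} inj (p ∷ u) = All.map⁺ (All.tabulate λ y∈ e → All.lookup p y∈ (inj (here ≡.refl) (there y∈) e)) ∷
      Unique-map-on f (λ x∈ y∈ → inj (there x∈) (there y∈)) u

  row-diagram : ∀ {r c} → (InDiagram r c → c ≤ suc (L r)) × (2 ≤ c → c ≤ suc (L r) → InDiagram r c)
  row-diagram {r} {c} = (λ d → ≡.subst (λ l → c ≤ suc l) len (proj₁ seg (proj₂ ∈-rowColumns d))) ,
      λ 2≤c c≤ → proj₁ ∈-rowColumns (proj₂ seg 2≤c (≡.subst (λ l → c ≤ suc l) (≡.sym len) c≤))
    where
      len : length (rowColumns r) ≡ L r
      len = ≡.trans (List.length-map proj₂ (filter (λ (r′ , _) → r′ ≟ r) (diagram π))) (L-length r)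
      seg = initial-segment
        (Unique-map-on proj₂ (λ x∈ y∈ e → ≡.cong₂ _,_ (≡.trans (proj₂ (Mem.∈-filter⁻ (λ (r′ , _) → r′ ≟ r) {xs = diagram π} x∈))
            (≡.sym (proj₂ (Mem.∈-filter⁻ (λ (r′ , _) → r′ ≟ r) {xs = diagram π} y∈)))) e)
          (Unique.filter⁺ (λ (r′ , _) → r′ ≟ r) diagram-unique))
        (λ c∈ → column-≥2 (proj₁ (∈-rowColumns {r}) c∈))
        (λ c∈ 2≤ < → proj₂ ∈-rowColumns (row-closed (proj₁ (∈-rowColumns {r}) c∈) 2≤ <)) {c}

  column-diagram : ∀ {r c} → (InDiagram r c → r ≤ suc (C c)) × (2 ≤ r → r ≤ suc (C c) → InDiagram r c)
  column-diagram {r} {c} = (λ d → ≡.subst (λ l → r ≤ suc l) len (proj₁ seg (proj₂ ∈-columnRows d))) ,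
      λ 2≤r r≤ → proj₁ ∈-columnRows (proj₂ seg 2≤r (≡.subst (λ l → r ≤ suc l) (≡.sym len) r≤))
    where
      len : length (columnRows c) ≡ C c
      len = ≡.trans (List.length-map proj₁ (filter (λ (_ , c′) → c′ ≟ c) (diagram π))) (C-length c)
      seg = initial-segment
        (Unique-map-on proj₁ (λ x∈ y∈ e → ≡.cong₂ _,_ e (≡.trans (proj₂ (Mem.∈-filter⁻ (λ (_ , c′) → c′ ≟ c) {xs = diagram π} x∈))
            (≡.sym (proj₂ (Mem.∈-filter⁻ (λ (_ , c′) → c′ ≟ c) {xs = diagram π} y∈)))))
          (Unique.filter⁺ (λ (_ , c′) → c′ ≟ c) diagram-unique))
        (λ r∈ → row-≥2 (proj₁ (∈-columnRows {c = c}) r∈))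
        (λ r∈ 2≤ < → proj₂ ∈-columnRows (column-closed (proj₁ (∈-columnRows {c = c}) r∈) 2≤ <)) {r}

  L-anti : ∀ {r s} → 2 ≤ r → r ≤ s → L s ≤ L r
  L-anti {r} {s} 2≤r r≤s with L s in eq
  ... | zero  = z≤n
  ... | suc l = ℕ.s≤s⁻¹ (proj₁ row-diagram (lower′ (proj₂ (row-diagram {s} {2 + l}) (s≤s (s≤s z≤n)) (ℕ.≤-reflexive (≡.cong suc (≡.sym eq))))))
    where
      lower′ : InDiagram s (2 + l) → InDiagram r (2 + l)
      lower′ d with ℕ.m≤n⇒m<n∨m≡n r≤s
      ... | inj₁ r<s    = column-closed d 2≤r r<s
      ... | inj₂ ≡.refl = d

  L-1 : L 1 ≡ 0
  L-1 with L 1 in eq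
  ... | zero  = ≡.refl
  ... | suc l = contradiction (row-≥2 (proj₂ (row-diagram {1} {2}) ℕ.≤-refl (s≤s (≡.subst (1 ≤_) (≡.sym eq) (s≤s z≤n))))) λ { (s≤s ()) }

  -- The row lengths of the diagram, except in row 1. That row is empty in the diagram, but it has
  -- no row above it and so its bound concerns no pair of elbows; the value L 2 keeps Λ weakly
  -- decreasing and makes row 1 a row in which no column begins. The entry 0 continues this.
  Λ : ℕ → ℕ
  Λ zero          = L 2
  Λ (suc zero)    = L 2
  Λ (suc (suc r)) = L (2 + r)

  Λ-anti : ∀ {r s} → r ≤ s → Λ s ≤ Λ r
  Λ-anti {zero}        {zero}        _ = ℕ.≤-refl
  Λ-anti {zero}        {suc zero}    _ = ℕ.≤-refl
  Λ-anti {zero}        {suc (suc s)} _ = L-anti ℕ.≤-refl (s≤s (s≤s z≤n))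
  Λ-anti {suc zero}    {suc zero}    _ = ℕ.≤-refl
  Λ-anti {suc zero}    {suc (suc s)} _ = L-anti ℕ.≤-refl (s≤s (s≤s z≤n))
  Λ-anti {suc (suc r)} {suc (suc s)} p = L-anti (s≤s (s≤s z≤n)) p
  Λ-anti {suc (suc r)} {suc zero}    (s≤s ())

  -- Among the values > r there are those at the indices 1, …, Λ r.
  L-fits : ∀ {r} → 0 < L r → L r + r ≤ N
  L-fits {r} 0<L with proj₂ (row-diagram {r} {suc (L r)}) (s≤s 0<L) ℕ.≤-refl
  ... | inversion {i} {j} {w} c≡ ai aj i<j r<w = ≡.subst₂ _≤_ (≡.cong (_+ r) len) (≡.trans (≡.cong (_+ r) (interval-length (suc r) (N ∸ r)))
          (ℕ.m∸n+n≡m r≤N)) (ℕ.+-monoˡ-≤ r (Unique-length-≤ {xs = take (L r) (drop 1 W)} {ys = interval (suc r) (N ∸ r)}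
            (Unique.take⁺ (L r) (Unique.drop⁺ 1 W-unique)) sub))
    where
      r≤N = proj₂ (All.lookup W-bounds (At⇒∈ aj))
      At-drop : ∀ {xs i v} → At (drop 1 xs) i v → At xs (suc i) v
      At-drop {x ∷ xs} a = there a
      greater : All (λ v → r < v × v ≤ N) (take (L r) (drop 1 W))
      greater = All-take (L r) (drop 1 W) λ {i} {w} i<L a → lemma i<L (At-drop a)
        where
          lemma : ∀ {i w} → i < L r → At W (suc i) w → r < w × w ≤ N
          lemma {i} i<L a with proj₂ (row-diagram {r} {2 + i}) (s≤s (s≤s z≤n)) (s≤s i<L)
          ... | inversion ≡.refl ai′ _ _ r<w′ = ≡.subst (r <_) (At-functional ai′ a) r<w′ , proj₂ (All.lookup W-bounds (At⇒∈ a))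
      sub : ∀ {z} → z ∈ take (L r) (drop 1 W) → z ∈ interval (suc r) (N ∸ r)
      sub {z} z∈ with All.lookup greater z∈
      ... | r<z , z≤N = ∈-interval (suc r) (N ∸ r) r<z (≡.subst (z <_) (≡.trans (≡.cong suc (≡.sym (ℕ.m∸n+n≡m r≤N))) (≡.sym (ℕ.+-suc (N ∸ r) r))) (s≤s z≤N))
      len : length (take (L r) (drop 1 W)) ≡ L r
      len = ≡.trans (List.length-take (L r) (drop 1 W)) (ℕ.m≤n⇒m⊓n≡m (≡.subst (L r ≤_) (≡.sym (List.length-drop 1 W))
        (ℕ.≤-trans (ℕ.≤-reflexive (ℕ.suc-injective c≡)) (ℕ.∸-monoˡ-≤ 1 (At-<length ai)))))

  open Shape Λ Λ-anti

  private
    Λ-InDiagram : ∀ {v q} → 2 ≤ v → 1 ≤ q → q ≤ Λ v → InDiagram v (suc q)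
    Λ-InDiagram {suc (suc v)} {q} _ 1≤q q≤ = proj₂ (row-diagram {2 + v} {suc q}) (s≤s 1≤q) (s≤s q≤)
    Λ-InDiagram {suc zero} (s≤s ()) 1≤q q≤

    tail-larger : ∀ {v i w} → 1 ≤ v → 1 ≤ i → i ≤ Λ v → At W i w → v < w
    tail-larger {suc zero} {i} {w} _ 1≤i _ a = ℕ.≤∧≢⇒< (proj₁ (All.lookup W-bounds (At⇒∈ a)))
      λ { ≡.refl → contradiction (position-1 a) (ℕ.>⇒≢ 1≤i) }
    tail-larger {suc (suc v)} {i} {w} _ 1≤i i≤ a with Λ-InDiagram {2 + v} (s≤s (s≤s z≤n)) 1≤i i≤
    ... | inversion ≡.refl ai _ _ v<w = ≡.subst (_ <_) (At-functional ai a) v<w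

  -- For v ≥ 2, row v of the diagram consists of the columns 2, ..., Λ v + 1 and marks the larger
  -- letters in front of v. So the letters at the indices 1, ..., Λ v exceed v, and no larger letter
  -- in front of v has an index beyond Λ v. For v = 1 the bounds hold because 1 is the first letter.
  initial : Inv 1 W (λ _ → ⊥)
  initial = record
    { unique  = W-unique
    ; bounded = All.map proj₁ W-bounds
    ; full    = λ {v} 1≤v v< → ∈-W 1≤v (ℕ.s≤s⁻¹ (≡.subst (v <_) (≡.cong suc W-length) v<))
    ; atMost1 = at-most-1
    ; fewer   = fewer′
    ; stopped = stopped′
    ; beyond  = λ _ ()
    }
    where
      at-most-1 : ∀ {v} → 1 ≤ v → count≤ v (take (suc (Λ v)) W) ≤ 1
      at-most-1 {v} 1≤v = count≤-head v (Λ v) W (tail-larger 1≤v)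
      column-bound : ∀ {v i w q} → 1 ≤ v → At W i w → v < w → At W q v → i < q → i ≤ Λ v
      column-bound {suc zero} _ a v<w b i<q = contradiction (≡.subst (_ <_) (position-1 b) i<q) λ ()
      column-bound {suc (suc v)} {i} _ a v<w b i<q = ℕ.s≤s⁻¹ (proj₁ (row-diagram {2 + v} {suc i}) (inversion ≡.refl a b i<q v<w))
      fewer′ : ∀ {v} → v ∈ W → larger v W ≤ Λ v
      fewer′ {v} v∈ = larger-head-1 v (Λ v) W 1≤v W-head (column-bound 1≤v) v∈
        where 1≤v = proj₁ (All.lookup W-bounds v∈)
      stopped′ : ∀ {v q} → At W q v → q ≤ Λ v → q ≡ 0 ⊎ ⊥
      stopped′ {v} {zero}  a q≤ = inj₁ ≡.refl
      stopped′ {v} {suc q} a q≤ = contradiction (tail-larger (proj₁ (All.lookup W-bounds (At⇒∈ a))) (s≤s z≤n) q≤ a) (ℕ.n≮n v)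

-- The region R(π) row by row, and its boundary.

interval-bounds′ : ∀ a n {x} → x ∈ interval a n → a ≤ x × x < n + a
interval-bounds′ a n x∈ = All.lookup (interval-≥ a n) x∈ , All.lookup (interval-< a n) x∈

filter-segment : ∀ {A : Set} {P : A → Set} (P? : ∀ z → Dec (P z)) (f : ℕ → A) a k l n →
  (∀ {c} → c ∈ interval a k → ¬ P (f c)) → (∀ {c} → c ∈ interval (k + a) l → P (f c)) →
  (∀ {c} → c ∈ interval (l + (k + a)) n → ¬ P (f c)) →
  filter P? (map f (interval a (k + (l + n)))) ≡ map f (interval (k + a) l)
filter-segment P? f a k l n before inside after = begin
  filter P? (map f (interval a (k + (l + n))))
    ≡⟨ ≡.cong (filter P? ∘ map f) (≡.trans (interval-++ a k (l + n)) (≡.cong (interval a k ++_) (interval-++ (k + a) l n))) ⟩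
  filter P? (map f (interval a k ++ interval (k + a) l ++ interval (l + (k + a)) n))
    ≡⟨ ≡.cong (filter P?) (≡.trans (List.map-++ f (interval a k) _) (≡.cong (map f (interval a k) ++_) (List.map-++ f (interval (k + a) l) _))) ⟩
  filter P? (map f (interval a k) ++ map f (interval (k + a) l) ++ map f (interval (l + (k + a)) n))
    ≡⟨ ≡.trans (List.filter-++ P? (map f (interval a k)) _) (≡.cong (filter P? (map f (interval a k)) ++_) (List.filter-++ P? (map f (interval (k + a) l)) _)) ⟩
  filter P? (map f (interval a k)) ++ filter P? (map f (interval (k + a) l)) ++ filter P? (map f (interval (l + (k + a)) n))
    ≡⟨ ≡.cong₂ _++_ (List.filter-none P? (All.map⁺ (All.tabulate before)))
         (≡.cong₂ _++_ (List.filter-all P? (All.map⁺ (All.tabulate inside))) (List.filter-none P? (All.map⁺ (All.tabulate after)))) ⟩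
  map f (interval (k + a) l) ++ []
    ≡⟨ List.++-identityʳ _ ⟩
  map f (interval (k + a) l) ∎
  where open ≡.≡-Reasoning

find-∈ : ∀ {A : Set} {P : A → Set} (P? : ∀ z → Dec (P z)) {xs x} → x ∈ xs → P x → (∀ {z} → z ∈ xs → P z → z ≡ x) →
  find P? xs ≡ just x
find-∈ P? {y ∷ ys} x∈ px unique with P? y
... | yes py = ≡.cong just (unique (here ≡.refl) py)
find-∈ P? {y ∷ ys} (here ≡.refl) px unique | no ¬py = contradiction px ¬py
find-∈ P? {y ∷ ys} (there x∈)    px unique | no ¬py = find-∈ P? x∈ px (unique ∘ there)

module Region {m : ℕ} (π : Permutation′ (suc m))
  (π0≡0 : π ⟨$⟩ʳ Fin.zero ≡ Fin.zero) (avoids : Avoids132 (λ i → π ⟨$⟩ʳ Fin.suc i)) where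
  open Dominant π π0≡0 avoids public

  Λ-suc : ∀ {r} → 2 ≤ r → Λ r ≡ L r
  Λ-suc {suc (suc r)} _ = ≡.refl
  Λ-suc {suc zero} (s≤s ())

  private
    findHeight : ∀ n → (∀ {r} → suc n < r → Λ r ≡ 0) → ∃[ h ] (0 < h × (∀ {r} → h < r → Λ r ≡ 0) × (h ≡ 1 ⊎ 0 < Λ h))
    findHeight zero    empty = 1 , s≤s z≤n , empty , inj₁ ≡.refl
    findHeight (suc n) empty = cases _ ≡.refl
      where
        cases : ∀ l → Λ (2 + n) ≡ l → ∃[ h ] (0 < h × (∀ {r} → h < r → Λ r ≡ 0) × (h ≡ 1 ⊎ 0 < Λ h))
        cases (suc l) eq = 2 + n , s≤s z≤n , empty , inj₂ (≡.subst (0 <_) (≡.sym eq) (s≤s z≤n))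
        cases zero    eq = findHeight n (λ {r} n<r → case ℕ.m≤n⇒m<n∨m≡n n<r of λ { (inj₁ p) → empty p ; (inj₂ ≡.refl) → eq })

    Λ-beyond : ∀ {r} → N < r → Λ r ≡ 0
    Λ-beyond {r} N<r with Λ r in eq
    ... | zero  = ≡.refl
    Λ-beyond {suc zero} (s≤s ()) | suc l
    Λ-beyond {suc (suc r)} N<r | suc l = contradiction (L-fits {2 + r} (≡.subst (0 <_) (≡.sym eq) (s≤s z≤n)))
      (ℕ.<⇒≱ (ℕ.<-≤-trans N<r (ℕ.m≤n+m (2 + r) (L (2 + r)))))

    abstract
      height : ∃[ h ] (0 < h × (∀ {r} → h < r → Λ r ≡ 0) × (h ≡ 1 ⊎ 0 < Λ h))
      height = findHeight m Λ-beyond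

  -- The number of rows of R(π). For the identity all Λ vanish, and h is 1 because of the box (1 ,
  -- 1).
  h : ℕ
  h = proj₁ height

  0<h : 0 < h
  0<h = proj₁ (proj₂ height)

  Λ-empty : ∀ {r} → h < r → Λ r ≡ 0
  Λ-empty = proj₁ (proj₂ (proj₂ height))

  h-tight : h ≡ 1 ⊎ 0 < Λ h
  h-tight = proj₂ (proj₂ (proj₂ height))

  Λ-positive : ∀ {r} → 2 ≤ r → r ≤ h → 0 < L r
  Λ-positive {r} 2≤r r≤h with h-tight
  ... | inj₁ h≡1 = contradiction (ℕ.≤-trans 2≤r (ℕ.≤-trans r≤h (ℕ.≤-reflexive h≡1))) λ { (s≤s ()) }
  ... | inj₂ 0<Λ = ≡.subst (0 <_) (Λ-suc 2≤r) (ℕ.≤-trans 0<Λ (Λ-anti r≤h))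

  h≤N : h ≤ N
  h≤N with ℕ.m≤n⇒m<n∨m≡n 0<h
  ... | inj₁ 2≤h = ℕ.≤-trans (ℕ.m≤n+m h (L h)) (L-fits (Λ-positive 2≤h ℕ.≤-refl))
  ... | inj₂ 1≡h = ≡.subst (_≤ N) 1≡h (s≤s z≤n)

  δ : ℕ → ℕ
  δ r = Λ r ∸ Λ (suc r)

  abstract
    -- The number of boxes of R(π) in row r. From row 2 on, the bottom pipe dream reaches column L r
    -- and the top one column L (r + 1) + 1 of the row. The latter is larger only if L r = L (r +
    -- 1), that is, if no column begins in the row. In row 1 the box (1 , 1) and the top crosses
    -- make up L 2 + 1.
    ρ : ℕ → ℕ
    ρ r = choose (r ≤? h) (choose (δ r ≟ 0) (suc (Λ r)) (Λ r)) 0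

    ρ-empty : ∀ {r} → h < r → ρ r ≡ 0
    ρ-empty {r} h<r with r ≤? h
    ... | yes r≤h = contradiction h<r (ℕ.≤⇒≯ r≤h)
    ... | no _    = ≡.refl

    ρ-flat : ∀ {r} → r ≤ h → δ r ≡ 0 → ρ r ≡ suc (Λ r)
    ρ-flat {r} r≤h δ≡0 with r ≤? h | δ r ≟ 0
    ... | no r≰h | _      = contradiction r≤h r≰h
    ... | yes _  | no δ≢0 = contradiction δ≡0 δ≢0
    ... | yes _  | yes _  = ≡.refl

    ρ-drop : ∀ {r} → r ≤ h → δ r ≢ 0 → ρ r ≡ Λ r
    ρ-drop {r} r≤h δ≢0 with r ≤? h | δ r ≟ 0
    ... | no r≰h | _       = contradiction r≤h r≰h
    ... | yes _  | yes δ≡0 = contradiction δ≡0 δ≢0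
    ... | yes _  | no _    = ≡.refl

  flat? : ∀ r → δ r ≡ 0 ⊎ δ r ≢ 0
  flat? r with δ r ≟ 0
  ... | yes p = inj₁ p
  ... | no ¬p = inj₂ ¬p

  δ-1 : δ 1 ≡ 0
  δ-1 = ℕ.n∸n≡0 (L 2)

  Λ-flat : ∀ {r} → δ r ≡ 0 → Λ r ≡ Λ (suc r)
  Λ-flat {r} δ≡0 = ℕ.≤-antisym (ℕ.m∸n≡0⇒m≤n δ≡0) (Λ-anti (ℕ.n≤1+n r))

  Λ-drop : ∀ r → δ r + Λ (suc r) ≡ Λ r
  Λ-drop r = ℕ.m∸n+n≡m (Λ-anti (ℕ.n≤1+n r))

  drop-≢0 : ∀ {r} → δ r ≢ 0 → Λ (suc r) < Λ r
  drop-≢0 {r} δ≢0 = ℕ.≰⇒> (λ Λ≤ → δ≢0 (ℕ.m≤n⇒m∸n≡0 Λ≤))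

  ρ-bounds : ∀ {r} → r ≤ h → Λ r ≤ ρ r × ρ r ≤ suc (Λ r)
  ρ-bounds {r} r≤h with flat? r
  ... | inj₁ δ≡0 rewrite ρ-flat r≤h δ≡0 = ℕ.n≤1+n _ , ℕ.≤-refl
  ... | inj₂ δ≢0  rewrite ρ-drop r≤h δ≢0 = ℕ.≤-refl , ℕ.n≤1+n _

  Λ<ρ : ∀ {r} → r ≤ h → Λ (suc r) < ρ r
  Λ<ρ {r} r≤h with flat? r
  ... | inj₁ δ≡0 rewrite ρ-flat r≤h δ≡0 = s≤s (ℕ.≤-reflexive (≡.sym (Λ-flat {r} δ≡0)))
  ... | inj₂ δ≢0  rewrite ρ-drop r≤h δ≢0 = drop-≢0 {r} δ≢0

  ρ-anti : ∀ r → ρ (suc r) ≤ ρ r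
  ρ-anti r with ℕ.≤-<-connex (suc r) h
  ... | inj₁ r<h = ℕ.≤-trans (proj₂ (ρ-bounds r<h)) (Λ<ρ (ℕ.<⇒≤ r<h))
  ... | inj₂ h<r rewrite ρ-empty h<r = z≤n

  ρ-anti* : ∀ {r s} → r ≤ s → ρ s ≤ ρ r
  ρ-anti* {r} {s} r≤s = ≡.subst (λ k → ρ k ≤ ρ r) (ℕ.m+[n∸m]≡n r≤s) (go (s ∸ r))
    where
      go : ∀ d → ρ (r + d) ≤ ρ r
      go zero    = ℕ.≤-reflexive (≡.cong ρ (ℕ.+-identityʳ r))
      go (suc d) = ℕ.≤-trans (≡.subst (λ k → ρ k ≤ ρ (r + d)) (≡.sym (ℕ.+-suc r d)) (ρ-anti (r + d))) (go d)

  0<ρ : ∀ {r} → r ≤ h → 0 < ρ r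
  0<ρ r≤h = ℕ.≤-<-trans z≤n (Λ<ρ r≤h)

  ρ-1 : ρ 1 ≡ suc (Λ 1)
  ρ-1 = ρ-flat 0<h δ-1

  -- For n = 1 the region is the box (1 , 1), which lies outside the triangle.
  ρ-fits : 0 < m → ∀ {r} → 0 < r → r ≤ h → ρ r + r ≤ N
  ρ-fits 0<m {r} 0<r r≤h with flat? r
  ... | inj₁ δ≡0 rewrite ρ-flat r≤h δ≡0 with ℕ.m≤n⇒m<n∨m≡n 0<r
  ...   | inj₁ 2≤r = ≡.subst (_≤ N) (≡.trans (≡.cong (_+ suc r) (≡.sym L≡)) (ℕ.+-suc (Λ r) r)) (L-fits {suc r} (≡.subst (0 <_) (≡.trans (≡.sym (Λ-suc 2≤r)) L≡) (Λ-positive 2≤r r≤h)))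
    where
      L≡ : Λ r ≡ L (suc r)
      L≡ = ≡.trans (Λ-flat {r} δ≡0) (Λ-suc (ℕ.≤-trans 2≤r (ℕ.n≤1+n r)))
  ...   | inj₂ ≡.refl with L 2 in eq
  ...     | zero  = s≤s 0<m
  ...     | suc l = ≡.subst (_≤ N) (≡.trans (≡.cong (_+ 2) eq) (ℕ.+-suc (suc l) 1)) (L-fits {2} (≡.subst (0 <_) (≡.sym eq) (s≤s z≤n)))
  ρ-fits 0<m {r} 0<r r≤h | inj₂ δ≢0 rewrite ρ-drop r≤h δ≢0 with ℕ.m≤n⇒m<n∨m≡n 0<r
  ...   | inj₁ 2≤r = ≡.subst (λ l → l + r ≤ N) (≡.sym (Λ-suc 2≤r)) (L-fits (Λ-positive 2≤r r≤h))
  ...   | inj₂ ≡.refl = contradiction δ-1 δ≢0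

  ρ≤N : ∀ r → 0 < r → ρ r ≤ N
  ρ≤N r 0<r with ℕ.≤-<-connex r h
  ... | inj₂ h<r rewrite ρ-empty h<r = z≤n
  ... | inj₁ r≤h with ℕ.m≤n⇒m<n∨m≡n (z≤n {m})
  ...   | inj₁ 0<m = ℕ.≤-trans (ℕ.m≤m+n _ r) (ρ-fits 0<m 0<r r≤h)
  ...   | inj₂ 0≡m = ℕ.≤-trans (ρ-anti* 0<r) (≡.subst (_≤ N) (≡.sym ρ-1) (s≤s (ℕ.≤-trans (ℕ.≤-reflexive (L2≡0 _ ≡.refl)) z≤n)))
    where
      L2≡0 : ∀ l → L 2 ≡ l → L 2 ≡ 0
      L2≡0 zero    eq = eq
      L2≡0 (suc l) eq = contradiction (ℕ.≤-trans (ℕ.m≤n+m 2 (L 2)) (L-fits {2} (≡.subst (0 <_) (≡.sym eq) (s≤s z≤n))))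
        (ℕ.<⇒≱ (s≤s (s≤s (ℕ.≤-reflexive (≡.sym 0≡m)))))

  oneTo-interval : oneTo N ≡ interval 1 N
  oneTo-interval = applyUpTo-interval 1 N

  ∈-grid : ∀ {r c} → 1 ≤ r → r ≤ N → 1 ≤ c → c ≤ N → (r , c) ∈ grid N
  ∈-grid {r} {c} 1≤r r≤N 1≤c c≤N = Mem.∈-cartesianProduct⁺ (lemma 1≤r r≤N) (lemma 1≤c c≤N)
    where
      lemma : ∀ {x} → 1 ≤ x → x ≤ N → x ∈ oneTo N
      lemma {x} 1≤x x≤N = ≡.subst (x ∈_) (≡.sym oneTo-interval) (∈-interval 1 N 1≤x (≡.subst (x <_) (ℕ.+-comm 1 N) (s≤s x≤N)))

  grid-bounds : ∀ {r c} → (r , c) ∈ grid N → (1 ≤ r × r ≤ N) × (1 ≤ c × c ≤ N)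
  grid-bounds {r} {c} p with Mem.∈-cartesianProduct⁻ (oneTo N) (oneTo N) p
  ... | r∈ , c∈ = lemma r∈ , lemma c∈
    where
      lemma : ∀ {x} → x ∈ oneTo N → 1 ≤ x × x ≤ N
      lemma {x} x∈ with interval-bounds′ 1 N (≡.subst (x ∈_) oneTo-interval x∈)
      ... | a , b = a , ℕ.s≤s⁻¹ (≡.subst (x <_) (ℕ.+-comm N 1) b)

  private
    bottom? : (b : Box) → Dec (proj₂ b ≤ length (filter (λ (r′ , _) → r′ ≟ proj₁ b) (diagram π)))
    bottom? (r , c) = c ≤? length (filter (λ (r′ , _) → r′ ≟ r) (diagram π))

    top? : (b : Box) → Dec (proj₁ b ≤ length (filter (λ (_ , c′) → c′ ≟ proj₂ b) (diagram π)))
    top? (r , c) = r ≤? length (filter (λ (_ , c′) → c′ ≟ c) (diagram π))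

  ∈-bottom⁻ : ∀ {r c} → (r , c) ∈ bottomCrosses π → c ≤ L r
  ∈-bottom⁻ {r} {c} p = ≡.subst (c ≤_) (L-length r) (proj₂ (Mem.∈-filter⁻ bottom? {xs = grid N} p))

  ∈-bottom⁺ : ∀ {r c} → (r , c) ∈ grid N → c ≤ L r → (r , c) ∈ bottomCrosses π
  ∈-bottom⁺ {r} {c} g p = Mem.∈-filter⁺ bottom? g (≡.subst (c ≤_) (≡.sym (L-length r)) p)

  ∈-top⁻ : ∀ {r c} → (r , c) ∈ topCrosses π → r ≤ C c
  ∈-top⁻ {r} {c} p = ≡.subst (r ≤_) (C-length c) (proj₂ (Mem.∈-filter⁻ top? {xs = grid N} p))

  ∈-top⁺ : ∀ {r c} → (r , c) ∈ grid N → r ≤ C c → (r , c) ∈ topCrosses π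
  ∈-top⁺ {r} {c} g p = Mem.∈-filter⁺ top? g (≡.subst (r ≤_) (≡.sym (C-length c)) p)

  inR : (b : Box) → Dec ((b ∈ bottomCrosses π ⊎ b ∈ topCrosses π) ⊎ b ≡ (1 , 1))
  inR b = (b ∈? bottomCrosses π ⊎-dec b ∈? topCrosses π) ⊎-dec b ≟₂ (1 , 1)

  private
    InR : Box → Set
    InR b = (b ∈ bottomCrosses π ⊎ b ∈ topCrosses π) ⊎ b ≡ (1 , 1)

    bottom-top : ∀ {r c} → 2 ≤ r → r ≤ h → c ≤ L r ⊎ c ≤ suc (L (suc r)) → c ≤ ρ r
    bottom-top {r} 2≤r r≤h (inj₁ c≤) = ℕ.≤-trans c≤ (ℕ.≤-trans (ℕ.≤-reflexive (≡.sym (Λ-suc 2≤r))) (proj₁ (ρ-bounds r≤h)))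
    bottom-top {r} 2≤r r≤h (inj₂ c≤) = ℕ.≤-trans c≤ (ℕ.≤-trans (s≤s (ℕ.≤-reflexive (≡.sym (Λ-suc (ℕ.≤-trans 2≤r (ℕ.n≤1+n r)))))) (Λ<ρ r≤h))

    -- Column c of the diagram occupies the rows 2, ..., C c + 1, so a cross of the top pipe dream
    -- at (r , c) is a box of the diagram at (r + 1 , c).
    region⇒ : ∀ {r c} → (r , c) ∈ grid N → InR (r , c) → c ≤ ρ r
    region⇒ {r} {c} g (inj₁ (inj₂ t)) = top (proj₂ (column-diagram {suc r} {c}) (s≤s (proj₁ (proj₁ (grid-bounds g))))
        (s≤s (∈-top⁻ t)))
      where
        top : InDiagram (suc r) c → c ≤ ρ r
        top d with ℕ.m≤n⇒m<n∨m≡n (proj₁ (proj₁ (grid-bounds g)))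
        ... | inj₂ ≡.refl = ≡.subst (c ≤_) (≡.sym ρ-1) (proj₁ row-diagram d)
        ... | inj₁ 2≤r with ℕ.≤-<-connex r h
        ...   | inj₁ r≤h = bottom-top 2≤r r≤h (inj₂ (proj₁ row-diagram d))
        ...   | inj₂ h<r = contradiction (ℕ.≤-trans (column-≥2 d) (proj₁ row-diagram d))
                  (ℕ.<⇒≱ (s≤s (s≤s (ℕ.≤-reflexive (≡.trans (≡.sym (Λ-suc (ℕ.≤-trans 2≤r (ℕ.n≤1+n r)))) (Λ-empty (ℕ.m<n⇒m<1+n h<r)))))))
    region⇒ {r} {c} g (inj₁ (inj₁ b)) with ℕ.m≤n⇒m<n∨m≡n (proj₁ (proj₁ (grid-bounds g)))
    ... | inj₂ ≡.refl = contradiction (ℕ.≤-trans (proj₁ (proj₂ (grid-bounds g))) (ℕ.≤-trans (∈-bottom⁻ b) (ℕ.≤-reflexive L-1))) λ ()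
    ... | inj₁ 2≤r with ℕ.≤-<-connex r h
    ...   | inj₁ r≤h = bottom-top 2≤r r≤h (inj₁ (∈-bottom⁻ b))
    ...   | inj₂ h<r = contradiction (ℕ.≤-trans (proj₁ (proj₂ (grid-bounds g))) (ℕ.≤-trans (∈-bottom⁻ b)
              (ℕ.≤-reflexive (≡.trans (≡.sym (Λ-suc 2≤r)) (Λ-empty h<r))))) λ ()
    region⇒ g (inj₂ ≡.refl) = ≡.subst (1 ≤_) (≡.sym ρ-1) (s≤s z≤n)

    ⇒region : ∀ {r c} → (r , c) ∈ grid N → c ≤ ρ r → InR (r , c)
    ⇒region {r} {c} g c≤ρ with ℕ.≤-<-connex r h
    ... | inj₂ h<r = contradiction (ℕ.≤-trans (proj₁ (proj₂ (grid-bounds g))) (≡.subst (c ≤_) (ρ-empty h<r) c≤ρ)) λ ()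
    ... | inj₁ r≤h with c ≤? L r
    ...   | yes c≤L = inj₁ (inj₁ (∈-bottom⁺ g c≤L))
    ...   | no c≰L with c ≟ 1
    ...     | no c≢1 = inj₁ (inj₂ (∈-top⁺ g (ℕ.s≤s⁻¹ (proj₁ column-diagram
                (proj₂ (row-diagram {suc r} {c}) (ℕ.≤∧≢⇒< (proj₁ (proj₂ (grid-bounds g))) (c≢1 ∘ ≡.sym)) c≤)))))
      where
        1≤r = proj₁ (proj₁ (grid-bounds g))
        c≤ : c ≤ suc (L (suc r))
        c≤ with flat? r
        ... | inj₁ δ≡0 = ≡.subst (c ≤_) (≡.trans (ρ-flat r≤h δ≡0) (≡.cong suc (≡.trans (Λ-flat {r} δ≡0) (Λ-suc (s≤s 1≤r))))) c≤ρ
        ... | inj₂ δ≢0 with ℕ.m≤n⇒m<n∨m≡n 1≤r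
        ...   | inj₂ ≡.refl = contradiction δ-1 δ≢0
        ...   | inj₁ 2≤r = contradiction (≡.subst (c ≤_) (≡.trans (ρ-drop r≤h δ≢0) (Λ-suc 2≤r)) c≤ρ) c≰L
    ...     | yes ≡.refl with ℕ.m≤n⇒m<n∨m≡n (proj₁ (proj₁ (grid-bounds g)))
    ...       | inj₂ ≡.refl = inj₂ ≡.refl
    ...       | inj₁ 2≤r    = contradiction (Λ-positive 2≤r r≤h) c≰L

  rowBoxes : ℕ → List Box
  rowBoxes r = map (r ,_) (interval 1 (ρ r))

  R-rows : R π ≡ concatMap rowBoxes (interval 1 N)
  R-rows = ≡.trans (≡.cong (λ xs → filter inR (cartesianProduct xs xs)) oneTo-interval) (go 1 N (s≤s z≤n) (ℕ.+-comm N 1))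
    where
      go : ∀ a n → 1 ≤ a → n + a ≡ suc N → filter inR (cartesianProduct (interval a n) (interval 1 N)) ≡ concatMap rowBoxes (interval a n)
      go a zero    1≤a p = ≡.refl
      go a (suc n) 1≤a p = ≡.trans (List.filter-++ inR (map (a ,_) (interval 1 N)) _) (≡.cong₂ _++_ row (go (suc a) n (s≤s z≤n) (≡.trans (ℕ.+-suc n a) p)))
        where
          a≤N : a ≤ N
          a≤N = ℕ.s≤s⁻¹ (≡.subst (suc a ≤_) p (s≤s (ℕ.m≤n+m a n)))
          split : ρ a + (N ∸ ρ a) ≡ N
          split = ℕ.m+[n∸m]≡n (ρ≤N a 1≤a)
          row : filter inR (map (a ,_) (interval 1 N)) ≡ rowBoxes a
          row = ≡.trans (≡.cong (λ k → filter inR (map (a ,_) (interval 1 k))) (≡.sym split))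
            (filter-segment inR (a ,_) 1 0 (ρ a) (N ∸ ρ a) (λ ())
              (λ {c} c∈ → let 1≤c , c< = interval-bounds′ 1 (ρ a) c∈
                              c≤ρ = ℕ.s≤s⁻¹ (≡.subst (c <_) (ℕ.+-comm (ρ a) 1) c<)
                          in ⇒region (∈-grid 1≤a a≤N 1≤c (ℕ.≤-trans c≤ρ (ρ≤N a 1≤a))) c≤ρ)
              (λ {c} c∈ p → let lo , hi = interval-bounds′ (ρ a + 1) (N ∸ ρ a) c∈
                                lo′ = ≡.subst (_≤ c) (ℕ.+-comm (ρ a) 1) lo
                                hi′ = ≡.subst (c <_) (≡.trans (≡.sym (ℕ.+-assoc (N ∸ ρ a) (ρ a) 1)) (≡.trans (≡.cong (_+ 1) (ℕ.m∸n+n≡m (ρ≤N a 1≤a))) (ℕ.+-comm N 1))) hi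
                            in ℕ.n≮n (ρ a) (ℕ.≤-trans lo′ (region⇒ (∈-grid 1≤a a≤N (ℕ.≤-trans (s≤s z≤n) lo′) (ℕ.s≤s⁻¹ hi′)) p))))

  ∈-R⁺ : ∀ {r c} → 1 ≤ r → r ≤ h → 1 ≤ c → c ≤ ρ r → (r , c) ∈ R π
  ∈-R⁺ {r} {c} 1≤r r≤h 1≤c c≤ρ = Mem.∈-filter⁺ inR g (⇒region g c≤ρ)
    where g = ∈-grid 1≤r (ℕ.≤-trans r≤h h≤N) 1≤c (ℕ.≤-trans c≤ρ (ρ≤N r 1≤r))

  ∈-R⁻ : ∀ {r c} → (r , c) ∈ R π → ((1 ≤ r × r ≤ h) × (1 ≤ c × c ≤ ρ r))
  ∈-R⁻ {r} {c} p with Mem.∈-filter⁻ inR {xs = grid N} p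
  ... | g , q = (proj₁ (proj₁ (grid-bounds g)) , r≤h) , (proj₁ (proj₂ (grid-bounds g)) , region⇒ g q)
    where
      r≤h : r ≤ h
      r≤h with ℕ.≤-<-connex r h
      ... | inj₁ r≤h = r≤h
      ... | inj₂ h<r = contradiction (ℕ.≤-trans (proj₁ (proj₂ (grid-bounds g))) (≡.subst (c ≤_) (ρ-empty h<r) (region⇒ g q))) λ ()

  R-unique : Unique (R π)
  R-unique = Unique.filter⁺ inR (Unique.cartesianProduct⁺ u u)
    where u = ≡.subst Unique (≡.sym oneTo-interval) (interval-unique 1 N)

  filter-R : ∀ {P : Box → Set} (P? : ∀ b → Dec (P b)) {r} → 1 ≤ r → r ≤ N → (∀ {s c} → P (s , c) → s ≡ r) →
    filter P? (R π) ≡ filter P? (rowBoxes r)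
  filter-R {P} P? {r} 1≤r r≤N only = ≡.trans (≡.cong (filter P?) R-rows) (go 1 N 1≤r (≡.subst (r <_) (ℕ.+-comm 1 N) (s≤s r≤N)))
    where
      empty-row : ∀ {s} → s ≢ r → filter P? (rowBoxes s) ≡ []
      empty-row {s} s≢r = List.filter-none P? {rowBoxes s} (All.map⁺ {f = s ,_} (All.tabulate {xs = interval 1 (ρ s)} λ {c} _ p → s≢r (only {s} {c} p)))
      empty-rows : ∀ a n → r < a → filter P? (concatMap rowBoxes (interval a n)) ≡ []
      empty-rows a zero    r<a = ≡.refl
      empty-rows a (suc n) r<a = ≡.trans (List.filter-++ P? (rowBoxes a) _)
        (≡.cong₂ _++_ (empty-row (ℕ.>⇒≢ r<a)) (empty-rows (suc a) n (ℕ.m<n⇒m<1+n r<a)))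
      go : ∀ a n → a ≤ r → r < n + a → filter P? (concatMap rowBoxes (interval a n)) ≡ filter P? (rowBoxes r)
      go a zero    a≤r r<a = contradiction r<a (ℕ.≤⇒≯ a≤r)
      go a (suc n) a≤r r<  with ℕ.m≤n⇒m<n∨m≡n a≤r
      ... | inj₁ a<r = ≡.trans (List.filter-++ P? (rowBoxes a) _)
              (≡.cong₂ _++_ (empty-row (ℕ.<⇒≢ a<r)) (go (suc a) n a<r (≡.subst (r <_) (≡.sym (ℕ.+-suc n a)) r<)))
      ... | inj₂ ≡.refl = ≡.trans (List.filter-++ P? (rowBoxes a) _)
              (≡.trans (≡.cong (filter P? (rowBoxes a) ++_) (empty-rows (suc a) n ℕ.≤-refl)) (List.++-identityʳ _))

  boundaryInRow-empty : ∀ {r} → h < r → r ≤ N → boundaryInRow π r ≡ []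
  boundaryInRow-empty {r} h<r r≤N = ≡.cong₂ (λ x y → map east x ++ map north y)
      (≡.trans (filter-R E? 1≤r r≤N proj₁) (≡.cong (λ k → filter E? (map (r ,_) (interval 1 k))) (ρ-empty h<r)))
      (≡.trans (filter-R N? 1≤r r≤N proj₁) (≡.cong (λ k → filter N? (map (r ,_) (interval 1 k))) (ρ-empty h<r)))
    where
      1≤r = ℕ.≤-trans (s≤s z≤n) h<r
      E? = λ ((r′ , c) : Box) → r′ ≟ r ×-dec ¬? ((suc r , c) ∈? R π)
      N? = λ ((r′ , c) : Box) → r′ ≟ r ×-dec ¬? ((r , suc c) ∈? R π)

  boundaryInRow-steps : ∀ {r} → 1 ≤ r → r ≤ h →
    boundaryInRow π r ≡ map (λ c → east (r , c)) (interval (suc (ρ (suc r))) (ρ r ∸ ρ (suc r))) ++ north (r , ρ r) ∷ []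
  boundaryInRow-steps {r} 1≤r r≤h = ≡.cong₂ _++_
      (≡.trans (≡.cong (map east) easts) (≡.sym (List.map-∘ (interval (suc (ρ (suc r))) (ρ r ∸ ρ (suc r))))))
      (≡.cong (map north) norths)
    where
      r≤N = ℕ.≤-trans r≤h h≤N
      E? = λ ((r′ , c) : Box) → r′ ≟ r ×-dec ¬? ((suc r , c) ∈? R π)
      N? = λ ((r′ , c) : Box) → r′ ≟ r ×-dec ¬? ((r , suc c) ∈? R π)
      easts : filter E? (R π) ≡ map (r ,_) (interval (suc (ρ (suc r))) (ρ r ∸ ρ (suc r)))
      easts = ≡.trans (filter-R E? 1≤r r≤N proj₁) (≡.trans (≡.cong (λ k → filter E? (map (r ,_) (interval 1 k)))
          (≡.sym (≡.trans (≡.cong (ρ (suc r) +_) (ℕ.+-identityʳ _)) (ℕ.m+[n∸m]≡n (ρ-anti r)))))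
        (≡.trans (filter-segment E? (r ,_) 1 (ρ (suc r)) (ρ r ∸ ρ (suc r)) 0
          (λ {c} c∈ (_ , ∉R) → let lo , hi = interval-bounds′ 1 (ρ (suc r)) c∈
                                   c≤ = ℕ.s≤s⁻¹ (≡.subst (c <_) (ℕ.+-comm (ρ (suc r)) 1) hi)
                               in ∉R (∈-R⁺ (s≤s z≤n) (nonempty (ℕ.≤-trans lo c≤)) lo c≤))
          (λ {c} c∈ → ≡.refl , λ ∈R → ℕ.n≮n (ρ (suc r)) (ℕ.≤-trans (≡.subst (_≤ c) (ℕ.+-comm (ρ (suc r)) 1) (proj₁ (interval-bounds′ (ρ (suc r) + 1) _ c∈)))
              (proj₂ (proj₂ (∈-R⁻ ∈R)))))
          (λ ())) (≡.cong (λ k → map (r ,_) (interval k (ρ r ∸ ρ (suc r)))) (ℕ.+-comm (ρ (suc r)) 1))))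
        where
          nonempty : 1 ≤ ρ (suc r) → suc r ≤ h
          nonempty 1≤ρ with ℕ.≤-<-connex (suc r) h
          ... | inj₁ p = p
          ... | inj₂ p = contradiction (≡.subst (1 ≤_) (ρ-empty p) 1≤ρ) λ ()
      norths : filter N? (R π) ≡ (r , ρ r) ∷ []
      norths = ≡.trans (filter-R N? 1≤r r≤N proj₁) (≡.trans (≡.cong (λ k → filter N? (map (r ,_) (interval 1 k))) (≡.sym k≡))
        (≡.trans (filter-segment N? (r ,_) 1 (ℕ.pred (ρ r)) 1 0
          (λ {c} c∈ (_ , ∉R) → let lo , hi = interval-bounds′ 1 (ℕ.pred (ρ r)) c∈
                               in ∉R (∈-R⁺ 1≤r r≤h (s≤s z≤n) (≡.subst (suc c ≤_) pred≡ hi)))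
          (λ {c} c∈ → ≡.refl , λ ∈R → ℕ.n≮n (ρ r) (≡.subst (λ z → suc z ≤ ρ r) (last c∈) (proj₂ (proj₂ (∈-R⁻ ∈R)))))
          (λ ())) (≡.cong (λ k → (r , k) ∷ []) pred≡)))
        where
          pred≡ : ℕ.pred (ρ r) + 1 ≡ ρ r
          pred≡ = ≡.trans (ℕ.+-comm _ 1) (ℕ.suc-pred (ρ r) {{ℕ.>-nonZero (0<ρ r≤h)}})
          k≡ : ℕ.pred (ρ r) + (1 + 0) ≡ ρ r
          k≡ = pred≡
          last : ∀ {c} → c ∈ interval (ℕ.pred (ρ r) + 1) 1 → c ≡ ρ r
          last (here ≡.refl) = pred≡

-- The labels of the boundary steps.

maximum-attained : ∀ {k xs} → All (_≤ k) xs → k ∈ xs → maximum xs ≡ k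
maximum-attained {k} {x ∷ xs} (x≤k ∷ p) (here ≡.refl) = ℕ.m≥n⇒m⊔n≡m (bound p)
  where
    bound : ∀ {xs} → All (_≤ k) xs → maximum xs ≤ k
    bound []       = z≤n
    bound (q ∷ qs) = ℕ.⊔-lub q (bound qs)
maximum-attained (x≤k ∷ p) (there k∈) = ≡.trans (≡.cong (_ ⊔_) (maximum-attained p k∈)) (ℕ.m≤n⇒m⊔n≡n x≤k)

findRow : ∀ (f : ℕ → ℕ) n {c} → 0 < n → f (suc n) < c → c ≤ f 1 → ∃[ r ] (0 < r × r ≤ n × f (suc r) < c × c ≤ f r)
findRow f (suc n) {c} _ = go n
  where
    go : ∀ n → f (2 + n) < c → c ≤ f 1 → ∃[ r ] (0 < r × r ≤ suc n × f (suc r) < c × c ≤ f r)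
    go zero    lo hi = 1 , s≤s z≤n , s≤s z≤n , lo , hi
    go (suc n) lo hi with ℕ.≤-<-connex c (f (2 + n))
    ... | inj₁ c≤ = 2 + n , s≤s z≤n , ℕ.≤-refl , lo , c≤
    ... | inj₂ <c with go n <c hi
    ...   | r , 0<r , r≤ , lo′ , hi′ = r , 0<r , ℕ.m≤n⇒m≤1+n r≤ , lo′ , hi′

module Labels {m : ℕ} (π : Permutation′ (suc m))
  (π0≡0 : π ⟨$⟩ʳ Fin.zero ≡ Fin.zero) (avoids : Avoids132 (λ i → π ⟨$⟩ʳ Fin.suc i)) where
  open Region π π0≡0 avoids public

  -- ν r is the label of the north step in row r, and ε i that of the east step in column i + 1.
  abstract
    nu : ℕ → ℕ
    nu zero    = 1
    nu (suc d) = suc (nu d) + (δ (h ∸ d) ∸ 1)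

    ν : ℕ → ℕ
    ν r = nu (suc h ∸ r)

    -- Searches from row r on for the row in which column c begins, in at most as many rows as the
    -- first argument says.
    scan : ℕ → ℕ → ℕ → ℕ
    scan zero    r c = 0
    scan (suc f) r c = choose (Λ (suc r) <? c) (c ∸ suc (Λ (suc r)) + suc (ν (suc r))) (scan f (suc r) c)

    ε : ℕ → ℕ
    ε zero    = 1
    ε (suc c) = scan h 1 (suc c)

    ε-zero : ε 0 ≡ 1
    ε-zero = ≡.refl

    -- There is no north step in row h + 1; its value stands for the first east step, from which the
    -- labels are counted on.
    ν-last : ν (suc h) ≡ 1
    ν-last = ≡.cong nu (ℕ.n∸n≡0 h)

    -- Of the columns that begin in row r, all but the last have an east step of A just before the
    -- north step of the row. The truncated difference also covers rows in which none begins.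
    ν-step : ∀ {r} → 0 < r → r ≤ h → ν r ≡ suc (ν (suc r)) + (δ r ∸ 1)
    ν-step {r} 0<r r≤h = ≡.trans (≡.cong nu (ℕ.+-∸-assoc 1 r≤h))
      (≡.cong (λ k → suc (nu (h ∸ r)) + (δ k ∸ 1)) (ℕ.m∸[m∸n]≡n r≤h))

    scan-stop : ∀ f r s c → r ≤ s → s < f + r → Λ (suc s) < c → c ≤ Λ s → scan f r c ≡ c ∸ suc (Λ (suc s)) + suc (ν (suc s))
    scan-stop zero    r s c r≤s s<r lo hi = contradiction s<r (ℕ.≤⇒≯ r≤s)
    scan-stop (suc f) r s c r≤s s<r lo hi with Λ (suc r) <? c
    ... | yes p with ℕ.m≤n⇒m<n∨m≡n r≤s
    ...   | inj₁ r<s    = contradiction (ℕ.<-≤-trans p (ℕ.≤-trans hi (Λ-anti r<s))) (ℕ.n≮n _)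
    ...   | inj₂ ≡.refl = ≡.refl
    scan-stop (suc f) r s c r≤s s<r lo hi | no ¬p with ℕ.m≤n⇒m<n∨m≡n r≤s
    ...   | inj₂ ≡.refl = contradiction lo ¬p
    ...   | inj₁ r<s    = scan-stop f (suc r) s c r<s (≡.subst (s <_) (≡.sym (ℕ.+-suc f r)) s<r) lo hi

    ε-step : ∀ {r i} → 0 < r → r ≤ h → i < δ r → ε (i + suc (Λ (suc r))) ≡ i + suc (ν (suc r))
    ε-step {r} {i} 0<r r≤h i<δ = ≡.trans (≡.cong ε (ℕ.+-suc i (Λ (suc r))))
      (≡.trans (scan-stop h 1 r (suc (i + Λ (suc r))) 0<r (≡.subst (r <_) (ℕ.+-comm 1 h) (s≤s r≤h)) (s≤s (ℕ.m≤n+m _ i))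
          (≡.subst (i + Λ (suc r) <_) (Λ-drop r) (ℕ.+-monoˡ-< (Λ (suc r)) i<δ)))
        (≡.cong (_+ suc (ν (suc r))) (ℕ.m+n∸n≡m i (Λ (suc r)))))

  ν-< : ∀ {r} → 0 < r → r ≤ h → ν (suc r) < ν r
  ν-< {r} 0<r r≤h = ≡.subst (ν (suc r) <_) (≡.sym (ν-step 0<r r≤h)) (ℕ.m≤m+n (suc (ν (suc r))) (δ r ∸ 1))

  ν-anti : ∀ {r s} → 0 < r → r < s → s ≤ suc h → ν s < ν r
  ν-anti {r} {suc s} 0<r (s≤s r≤s) (s≤s s≤h) with ℕ.m≤n⇒m<n∨m≡n r≤s
  ... | inj₂ ≡.refl = ν-< 0<r s≤h
  ... | inj₁ r<s    = ℕ.<-trans (ν-< (ℕ.≤-<-trans z≤n r<s) s≤h) (ν-anti 0<r r<s (ℕ.m≤n⇒m≤1+n s≤h))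

  ν-≤1 : ∀ {r} → 0 < r → r ≤ suc h → ν r ≤ ν 1
  ν-≤1 {r} 0<r r≤h with ℕ.m≤n⇒m<n∨m≡n 0<r
  ... | inj₁ 1<r    = ℕ.<⇒≤ (ν-anti (s≤s z≤n) 1<r r≤h)
  ... | inj₂ ≡.refl = ℕ.≤-refl

  -- This is the last column to begin in row r: its east step comes right after the north step of
  -- the row and repeats its label.
  ε-Λ : ∀ {r} → 0 < r → r ≤ h → δ r ≢ 0 → ε (Λ r) ≡ ν r
  ε-Λ {r} 0<r r≤h δ≢0 with δ r in eq
  ... | zero  = contradiction ≡.refl δ≢0
  ... | suc d = ≡.trans (≡.cong ε (≡.trans (≡.sym (Λ-drop r)) (≡.trans (≡.cong (_+ Λ (suc r)) eq) (≡.sym (ℕ.+-suc d _)))))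
    (≡.trans (ε-step 0<r r≤h (≡.subst (d <_) (≡.sym eq) ℕ.≤-refl))
      (≡.trans (ℕ.+-comm d _) (≡.sym (≡.trans (ν-step 0<r r≤h) (≡.cong (λ k → suc (ν (suc r)) + (k ∸ 1)) eq)))))

  ε-Λ-≤ : ∀ d {r} → 0 < r → r + d ≡ suc h → ε (Λ r) ≤ ν r
  ε-Λ-≤ zero {r} 0<r eq = ℕ.≤-reflexive (≡.trans (≡.trans (≡.cong ε (Λ-empty (≡.subst (h <_) (≡.sym r≡) ℕ.≤-refl))) ε-zero) (≡.sym (≡.trans (≡.cong ν r≡) ν-last)))
    where
      r≡ : r ≡ suc h
      r≡ = ≡.trans (≡.sym (ℕ.+-identityʳ r)) eq
  ε-Λ-≤ (suc d) {r} 0<r eq with flat? r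
  ... | inj₂ δ≢0 = ℕ.≤-reflexive (ε-Λ 0<r r≤h δ≢0)
    where r≤h = ℕ.s≤s⁻¹ (ℕ.≤-trans (s≤s (ℕ.m≤m+n r d)) (ℕ.≤-reflexive (≡.trans (≡.sym (ℕ.+-suc r d)) eq)))
  ... | inj₁ δ≡0 = ≡.subst (λ l → ε l ≤ ν r) (≡.sym (Λ-flat {r} δ≡0))
        (ℕ.≤-trans (ε-Λ-≤ d {suc r} (s≤s z≤n) (≡.trans (≡.sym (ℕ.+-suc r d)) eq)) (ℕ.<⇒≤ (ν-< 0<r r≤h)))
    where r≤h = ℕ.s≤s⁻¹ (ℕ.≤-trans (s≤s (ℕ.m≤m+n r d)) (ℕ.≤-reflexive (≡.trans (≡.sym (ℕ.+-suc r d)) eq)))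

  ε-suc : ∀ {i} → i < Λ 1 → ε i < ε (suc i)
  ε-suc {i} i<Λ with findRow Λ h {suc i} 0<h (≡.subst (_< suc i) (≡.sym (Λ-empty ℕ.≤-refl)) (s≤s z≤n)) i<Λ
  ... | r , 0<r , r≤h , s≤s lo , hi = ≡.subst₂ _<_ (≡.cong ε i≡) (≡.cong (ε ∘ suc) i≡) (step t ≡.refl)
    where
      t = i ∸ Λ (suc r)
      i≡ : t + Λ (suc r) ≡ i
      i≡ = ℕ.m∸n+n≡m lo
      t<δ : t < δ r
      t<δ = ℕ.+-cancelʳ-< (Λ (suc r)) t (δ r) (≡.subst₂ _<_ (≡.sym i≡) (≡.sym (Λ-drop r)) hi)
      step : ∀ t′ → t′ ≡ t → ε (t + Λ (suc r)) < ε (suc (t + Λ (suc r)))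
      step zero     eq = ≡.subst (λ t → ε (t + Λ (suc r)) < ε (suc (t + Λ (suc r)))) eq
        (ℕ.≤-<-trans (ε-Λ-≤ (h ∸ r) {suc r} (s≤s z≤n) (≡.cong suc (ℕ.m+[n∸m]≡n r≤h)))
          (ℕ.≤-reflexive (≡.sym (ε-step 0<r r≤h (≡.subst (_< δ r) (≡.sym eq) t<δ)))))
      step (suc t′) eq = ≡.subst (λ t → ε (t + Λ (suc r)) < ε (suc (t + Λ (suc r)))) eq
        (ℕ.≤-reflexive (≡.trans (≡.cong suc (≡.trans (≡.cong ε (≡.sym (ℕ.+-suc t′ (Λ (suc r))))) (ε-step 0<r r≤h (ℕ.<-trans ℕ.≤-refl t<δ′))))
          (≡.sym (≡.trans (≡.cong (ε ∘ suc) (≡.sym (ℕ.+-suc t′ (Λ (suc r))))) (ε-step 0<r r≤h t<δ′)))))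
        where
          t<δ′ : suc t′ < δ r
          t<δ′ = ≡.subst (_< δ r) (≡.sym eq) t<δ

  ε-mono : ∀ {i j} → i < j → j ≤ Λ 1 → ε i < ε j
  ε-mono {i} {suc j} (s≤s i≤j) j<Λ with ℕ.m≤n⇒m<n∨m≡n i≤j
  ... | inj₂ ≡.refl = ε-suc j<Λ
  ... | inj₁ i<j    = ℕ.<-trans (ε-mono i<j (ℕ.<⇒≤ j<Λ)) (ε-suc j<Λ)

  label : Step → ℕ
  label (east (r , c))  = ε (ℕ.pred c)
  label (north (r , c)) = ν r

  -- The bound by ν 1, the label of the topmost north step, later yields the number of vertices.
  Correct : Step × ℕ → Set
  Correct (s , l) = l ≡ label s × l ≤ ν 1

  private
    if-true : ∀ {A : Set} {P : Set} (d : Dec P) {x y : A} → P → (if does d then x else y) ≡ x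
    if-true d p rewrite dec-true d p = ≡.refl

    if-false : ∀ {A : Set} {P : Set} (d : Dec P) {x y : A} → ¬ P → (if does d then x else y) ≡ y
    if-false d ¬p rewrite dec-false d ¬p = ≡.refl

    label-in : ∀ {p k s ss} → InA π p s → labelFrom π p k (s ∷ ss) ≡ (s , suc k) ∷ labelFrom π (just s) (suc k) ss
    label-in {p} {k} {s} {ss} i = ≡.cong (λ l → (s , l) ∷ labelFrom π (just s) l ss) (if-true (inA? π p s) i)

    label-out : ∀ {p k s ss} → ¬ InA π p s → labelFrom π p k (s ∷ ss) ≡ (s , k) ∷ labelFrom π (just s) k ss
    label-out {p} {k} {s} {ss} i = ≡.cong (λ l → (s , l) ∷ labelFrom π (just s) l ss) (if-false (inA? π p s) i)

  -- Only the first step needs an assumption on its predecessor; each later one follows an east step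
  -- and belongs to A as soon as it bounds a bottom cross.
  run : ∀ r c n p k rest → (0 < n → InA π p (east (r , suc c))) →
    (∀ {x} → suc c < x → x ≤ n + c → (r , x) ∈ bottomCrosses π) → (∀ {j} → j < n → ε (j + c) ≡ j + suc k) → n + k ≤ ν 1 →
    (∀ p′ → All Correct (labelFrom π p′ (n + k) rest)) →
    All Correct (labelFrom π p k (map (λ c → east (r , c)) (interval (suc c) n) ++ rest))
  run r c zero    p k rest first bot lab bd ok = ok p
  run r c (suc n) p k rest first bot lab bd ok = ≡.subst (All Correct) (≡.sym (label-in {p} (first (s≤s z≤n))))
    ((≡.sym (lab (s≤s z≤n)) , ℕ.≤-trans (ℕ.m≤n+m (suc k) n) (ℕ.≤-trans (ℕ.≤-reflexive (ℕ.+-suc n k)) bd)) ∷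
      run r (suc c) n (just (east (r , suc c))) (suc k) rest
        (λ 0<n → bot ℕ.≤-refl (s≤s (ℕ.m<n+m c 0<n)))
        (λ {x} lo hi → bot (ℕ.<-trans ℕ.≤-refl lo) (≡.subst (x ≤_) (ℕ.+-suc n c) hi))
        (λ {j} j<n → ≡.trans (≡.cong ε (ℕ.+-suc j c)) (≡.trans (lab (s≤s j<n)) (≡.sym (ℕ.+-suc j (suc k)))))
        (≡.subst (_≤ ν 1) (≡.sym (ℕ.+-suc n k)) bd)
        (λ p′ → ≡.subst (λ l → All Correct (labelFrom π p′ l rest)) (≡.sym (ℕ.+-suc n k)) (ok p′)))

  abstract
    rowBoundary : ℕ → List Step
    rowBoundary r = boundaryInRow π r

    rowBoundary-empty : ∀ {r} → h < r → r ≤ N → rowBoundary r ≡ []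
    rowBoundary-empty = boundaryInRow-empty

    rowBoundary-steps : ∀ {r} → 1 ≤ r → r ≤ h →
      rowBoundary r ≡ map (λ c → east (r , c)) (interval (suc (ρ (suc r))) (ρ r ∸ ρ (suc r))) ++ north (r , ρ r) ∷ []
    rowBoundary-steps = boundaryInRow-steps

    steps : ℕ → List Step
    steps r = concatMap (boundaryInRow π) (applyDownFrom suc r)

    steps-zero : steps 0 ≡ []
    steps-zero = ≡.refl

    steps-suc : ∀ r → steps (suc r) ≡ rowBoundary (suc r) ++ steps r
    steps-suc r = ≡.refl

    labelled : List (Step × ℕ)
    labelled = labelledBoundary π

    labelled-steps : labelled ≡ labelFrom π nothing 0 (steps N)
    labelled-steps = ≡.refl

    treeLabel-labelled : ∀ r c → treeLabel π (r , c) ≡ (labelEast c labelled , labelNorth r labelled)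
    treeLabel-labelled r c = ≡.refl

    numVertices-labelled : numVertices π ≡ maximum (map proj₂ labelled)
    numVertices-labelled = ≡.refl

  ρ-from-Λ : ∀ {r} → r ≤ h → ρ r ∸ Λ (suc r) ≡ suc (δ r ∸ 1)
  ρ-from-Λ {r} r≤h with flat? r
  ... | inj₁ δ≡0 = ≡.trans (≡.cong (_∸ Λ (suc r)) (≡.trans (ρ-flat r≤h δ≡0) (≡.cong suc (Λ-flat {r} δ≡0))))
        (≡.trans (ℕ.m+n∸n≡m 1 (Λ (suc r))) (≡.cong (λ d → suc (d ∸ 1)) (≡.sym δ≡0)))
  ... | inj₂ δ≢0 = ≡.trans (≡.cong (_∸ Λ (suc r)) (ρ-drop r≤h δ≢0)) (lemma (δ r) δ≢0)
    where
      lemma : ∀ d → d ≢ 0 → d ≡ suc (d ∸ 1)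
      lemma zero    d≢0 = contradiction ≡.refl d≢0
      lemma (suc d) _   = ≡.refl

  private
    run-bottom : ∀ {r x} → 0 < r → r ≤ h → 0 < δ r ∸ 1 → 0 < x → x ≤ (δ r ∸ 1) + suc (Λ (suc r)) → (r , x) ∈ bottomCrosses π
    run-bottom {r} {x} 0<r r≤h 0<δ 0<x x≤ with ℕ.m≤n⇒m<n∨m≡n 0<r
    ... | inj₂ ≡.refl = contradiction (≡.subst (λ d → 0 < d ∸ 1) δ-1 0<δ) λ ()
    ... | inj₁ 2≤r = ∈-bottom⁺ (∈-grid 0<r (ℕ.≤-trans r≤h h≤N) 0<x (ℕ.≤-trans x≤Λ (ℕ.≤-trans (proj₁ (ρ-bounds r≤h)) (ρ≤N r 0<r))))
          (≡.subst (x ≤_) (Λ-suc 2≤r) x≤Λ)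
      where
        lemma : ∀ d → 0 < d ∸ 1 → (d ∸ 1) + suc (Λ (suc r)) ≡ d + Λ (suc r)
        lemma (suc d) _ = ℕ.+-suc d _
        x≤Λ : x ≤ Λ r
        x≤Λ = ≡.subst (x ≤_) (≡.trans (lemma (δ r) 0<δ) (Λ-drop r)) x≤

    ∸1-< : ∀ {j} d → j < d ∸ 1 → j < d
    ∸1-< (suc d) j<d = ℕ.m<n⇒m<1+n j<d

    -- The run starts two columns after Λ (r + 1): the column in between either ends further down or
    -- has the east step treated separately by the callers.
    row-tail : ∀ {r} p → 0 < r → r ≤ h → (0 < δ r ∸ 1 → InA π p (east (r , suc (suc (Λ (suc r)))))) →
      All Correct (labelFrom π (just (north (r , ρ r))) (ν r) (steps (ℕ.pred r))) →
      All Correct (labelFrom π p (ν (suc r)) (map (λ c → east (r , c)) (interval (suc (suc (Λ (suc r)))) (δ r ∸ 1)) ++ north (r , ρ r) ∷ steps (ℕ.pred r)))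
    row-tail {r} p 0<r r≤h first ok = run r (suc (Λ (suc r))) (δ r ∸ 1) p (ν (suc r)) _ first
        (λ {x} lo hi → run-bottom 0<r r≤h (positive lo hi) (ℕ.≤-trans (s≤s z≤n) lo) hi)
        (λ {j} j< → ε-step 0<r r≤h (∸1-< (δ r) j<))
        (ℕ.≤-trans (ℕ.n≤1+n _) (≡.subst (_≤ ν 1) (≡.sym ν≡) (ν-≤1 0<r (ℕ.m≤n⇒m≤1+n r≤h))))
        (λ p′ → ≡.subst (All Correct) (≡.sym (label-in {p′} (north-in p′)))
          ((ν≡ , ≡.subst (_≤ ν 1) (≡.sym ν≡) (ν-≤1 0<r (ℕ.m≤n⇒m≤1+n r≤h))) ∷
            ≡.subst (λ l → All Correct (labelFrom π (just (north (r , ρ r))) l (steps (ℕ.pred r)))) (≡.sym ν≡) ok))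
      where
        ν≡ : suc ((δ r ∸ 1) + ν (suc r)) ≡ ν r
        ν≡ = ≡.trans (≡.cong suc (ℕ.+-comm (δ r ∸ 1) _)) (≡.sym (ν-step 0<r r≤h))
        positive : ∀ {x} → suc (suc (Λ (suc r))) < x → x ≤ (δ r ∸ 1) + suc (Λ (suc r)) → 0 < δ r ∸ 1
        positive {x} lo hi = ℕ.+-cancelʳ-< (suc (Λ (suc r))) 0 (δ r ∸ 1) (ℕ.<-≤-trans (ℕ.<-trans ℕ.≤-refl lo) hi)
        north-in : ∀ p′ → InA π p′ (north (r , ρ r))
        north-in nothing  = tt
        north-in (just _) = tt

    row-steps : ∀ r → suc r ≤ h → steps (suc r) ≡
      map (λ c → east (suc r , c)) (interval (suc (ρ (2 + r))) (ρ (suc r) ∸ ρ (2 + r))) ++ north (suc r , ρ (suc r)) ∷ steps r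
    row-steps r r<h = ≡.trans (≡.trans (steps-suc r) (≡.cong (_++ steps r) (rowBoundary-steps (s≤s z≤n) r<h))) (List.++-assoc (map (λ c → east (suc r , c)) (interval (suc (ρ (2 + r))) (ρ (suc r) ∸ ρ (2 + r)))) (north (suc r , ρ (suc r)) ∷ []) (steps r))

    row-first : ∀ {r} → r ≤ h → interval (suc (Λ (suc r))) (ρ r ∸ Λ (suc r)) ≡ suc (Λ (suc r)) ∷ interval (suc (suc (Λ (suc r)))) (δ r ∸ 1)
    row-first {r} r≤h = ≡.cong (interval (suc (Λ (suc r)))) (ρ-from-Λ r≤h)

  -- If no column begins in row r + 1, its last box lies beyond the bottom crosses, so an east step
  -- after its north step can belong to A. Otherwise the last box is a bottom cross, and the east
  -- step that follows repeats the label of the north step.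
  steps-correct : ∀ r → r < h → All Correct (labelFrom π (just (north (suc r , ρ (suc r)))) (ν (suc r)) (steps r))
  steps-correct zero    r<h = ≡.subst (λ ss → All Correct (labelFrom π (just (north (1 , ρ 1))) (ν 1) ss)) (≡.sym steps-zero) []
  steps-correct (suc r) r<h with flat? (2 + r)
  ... | inj₁ δ≡0 = ≡.subst (λ ss → All Correct (labelFrom π before (ν (2 + r)) ss)) (≡.sym (≡.trans (row-steps r (ℕ.<⇒≤ r<h))
            (≡.cong (λ X → map (λ c → east (suc r , c)) X ++ north (suc r , ρ (suc r)) ∷ steps r) tail≡)))
          (row-tail before (s≤s z≤n) (ℕ.<⇒≤ r<h)
            (λ 0<δ → run-bottom (s≤s z≤n) (ℕ.<⇒≤ r<h) 0<δ (s≤s z≤n) (ℕ.+-monoˡ-≤ (suc (Λ (2 + r))) 0<δ) ,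
              λ b∈ → ℕ.n≮n (Λ (2 + r)) (≡.subst (_≤ Λ (2 + r)) (ρ-flat r<h δ≡0) (∈-bottom⁻ b∈)))
            (steps-correct r (ℕ.<⇒≤ r<h)))
    where
      before = just (north (2 + r , ρ (2 + r)))
      tail≡ : interval (suc (ρ (2 + r))) (ρ (suc r) ∸ ρ (2 + r)) ≡ interval (suc (suc (Λ (2 + r)))) (δ (suc r) ∸ 1)
      tail≡ = ≡.cong₂ interval (≡.cong suc (ρ-flat r<h δ≡0)) (≡.trans (≡.cong (ρ (suc r) ∸_) (ρ-flat r<h δ≡0))
        (≡.trans (≡.cong (ρ (suc r) ∸_) (ℕ.+-comm 1 (Λ (2 + r)))) (≡.trans (≡.sym (ℕ.∸-+-assoc (ρ (suc r)) (Λ (2 + r)) 1)) (≡.cong (_∸ 1) (ρ-from-Λ (ℕ.<⇒≤ r<h))))))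
  ... | inj₂ δ≢0 = ≡.subst (λ ss → All Correct (labelFrom π before (ν (2 + r)) ss)) (≡.sym (≡.trans (row-steps r (ℕ.<⇒≤ r<h))
            (≡.cong (λ X → map (λ c → east (suc r , c)) X ++ north (suc r , ρ (suc r)) ∷ steps r) tail≡)))
          (≡.subst (All Correct) (≡.sym (label-out {before} not-in)) ((≡.sym (ε-Λ (s≤s z≤n) r<h δ≢0) , ν-≤1 (s≤s z≤n) (ℕ.m≤n⇒m≤1+n r<h)) ∷
            row-tail (just (east (suc r , suc (Λ (2 + r))))) (s≤s z≤n) (ℕ.<⇒≤ r<h)
              (λ 0<δ → run-bottom (s≤s z≤n) (ℕ.<⇒≤ r<h) 0<δ (s≤s z≤n) (ℕ.+-monoˡ-≤ (suc (Λ (2 + r))) 0<δ))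
              (steps-correct r (ℕ.<⇒≤ r<h))))
    where
      before = just (north (2 + r , ρ (2 + r)))
      tail≡ : interval (suc (ρ (2 + r))) (ρ (suc r) ∸ ρ (2 + r)) ≡ suc (Λ (2 + r)) ∷ interval (suc (suc (Λ (2 + r)))) (δ (suc r) ∸ 1)
      tail≡ = ≡.trans (≡.cong (λ k → interval (suc k) (ρ (suc r) ∸ k)) (ρ-drop r<h δ≢0)) (row-first (ℕ.<⇒≤ r<h))
      not-in : ¬ InA π before (east (suc r , suc (Λ (2 + r))))
      not-in (_ , a∉) = a∉ (∈-bottom⁺ (∈-grid (s≤s z≤n) (ℕ.≤-trans r<h h≤N) (0<ρ r<h) (ρ≤N (2 + r) (s≤s z≤n)))
        (ℕ.≤-reflexive (ρ-drop r<h δ≢0)))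

  private
    boundary-steps : ∀ d → d + h ≤ N → steps (d + h) ≡ steps h
    boundary-steps zero    p = ≡.refl
    boundary-steps (suc d) p = ≡.trans (≡.trans (steps-suc (d + h)) (≡.cong (_++ steps (d + h)) (rowBoundary-empty (s≤s (ℕ.m≤n+m h d)) p))) (boundary-steps d (ℕ.<⇒≤ p))

    first-row : ∀ k → k ≡ h → All Correct (labelFrom π nothing 0 (steps k))
    first-row zero    eq = ≡.subst (λ ss → All Correct (labelFrom π nothing 0 ss)) (≡.sym steps-zero) []
    first-row (suc r) eq = ≡.subst (λ ss → All Correct (labelFrom π nothing 0 ss)) (≡.sym (≡.trans (row-steps r r<h)
            (≡.cong (λ X → map (λ c → east (suc r , c)) X ++ north (suc r , ρ (suc r)) ∷ steps r) tail≡)))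
          ((≡.sym ε-zero , ≡.subst (_≤ ν 1) ν≡1 (ν-≤1 (s≤s z≤n) (s≤s r<h))) ∷
            ≡.subst (λ l → All Correct (labelFrom π (just (east (suc r , 1))) l rest)) ν≡1
              (row-tail (just (east (suc r , 1))) (s≤s z≤n) r<h
                (λ 0<δ → run-bottom (s≤s z≤n) r<h 0<δ (s≤s z≤n) (ℕ.+-monoˡ-≤ (suc (Λ (2 + r))) 0<δ))
                (steps-correct r (≡.subst (r <_) eq ℕ.≤-refl))))
      where
        r<h : suc r ≤ h
        r<h = ℕ.≤-reflexive eq
        rest = map (λ c → east (suc r , c)) (interval (suc (suc (Λ (2 + r)))) (δ (suc r) ∸ 1)) ++ north (suc r , ρ (suc r)) ∷ steps r
        ν≡1 : ν (2 + r) ≡ 1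
        ν≡1 = ≡.trans (≡.cong (ν ∘ suc) eq) ν-last
        Λ≡0 : Λ (2 + r) ≡ 0
        Λ≡0 = Λ-empty (s≤s (ℕ.≤-reflexive (≡.sym eq)))
        tail≡ : interval (suc (ρ (2 + r))) (ρ (suc r) ∸ ρ (2 + r)) ≡ 1 ∷ interval (suc (suc (Λ (2 + r)))) (δ (suc r) ∸ 1)
        tail≡ = ≡.trans (≡.cong (λ k → interval (suc k) (ρ (suc r) ∸ k)) (≡.trans (ρ-empty (s≤s (ℕ.≤-reflexive (≡.sym eq)))) (≡.sym Λ≡0)))
          (≡.trans (row-first r<h) (≡.cong (λ k → suc k ∷ interval (suc (suc (Λ (2 + r)))) (δ (suc r) ∸ 1)) Λ≡0))

  labels-correct : All Correct labelled
  labels-correct = ≡.subst (All Correct) (≡.sym labelled-steps) (≡.subst (λ ss → All Correct (labelFrom π nothing 0 ss))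
    (≡.sym (≡.trans (≡.cong steps (≡.sym (ℕ.m∸n+n≡m h≤N))) (boundary-steps (N ∸ h) (ℕ.≤-reflexive (ℕ.m∸n+n≡m h≤N))))) (first-row h ≡.refl))

  labelFrom-steps : ∀ p k ss {s} → s ∈ ss → ∃[ l ] (s , l) ∈ labelFrom π p k ss
  labelFrom-steps p k (s ∷ ss) (here ≡.refl) = _ , here ≡.refl
  labelFrom-steps p k (s ∷ ss) (there s∈)    = let l , p = labelFrom-steps (just s) _ ss s∈ in l , there p

  labelEast-correct : ∀ {lb r c l} → All Correct lb → (east (r , c) , l) ∈ lb → labelEast c lb ≡ ε (ℕ.pred c)
  labelEast-correct {(east (r′ , c′) , k) ∷ lb} {r} {c} ((eq , _) ∷ ok) p with c ≟ c′
  ... | yes ≡.refl = ≡.trans (if-true (c ≟ c) ≡.refl) eq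
  labelEast-correct {(east (r′ , c′) , k) ∷ lb} {r} {c} (_ ∷ ok) (here ≡.refl) | no c≢c′ = contradiction ≡.refl c≢c′
  labelEast-correct {(east (r′ , c′) , k) ∷ lb} {r} {c} (_ ∷ ok) (there p)     | no c≢c′ = ≡.trans (if-false (c ≟ c′) c≢c′) (labelEast-correct ok p)
  labelEast-correct {(north b , k) ∷ lb} (_ ∷ ok) (there p) = labelEast-correct ok p

  labelNorth-correct : ∀ {lb r c l} → All Correct lb → (north (r , c) , l) ∈ lb → labelNorth r lb ≡ ν r
  labelNorth-correct {(north (r′ , c′) , k) ∷ lb} {r} ((eq , _) ∷ ok) p with r ≟ r′
  ... | yes ≡.refl = ≡.trans (if-true (r ≟ r) ≡.refl) eq
  labelNorth-correct {(north (r′ , c′) , k) ∷ lb} {r} (_ ∷ ok) (here ≡.refl) | no r≢r′ = contradiction ≡.refl r≢r′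
  labelNorth-correct {(north (r′ , c′) , k) ∷ lb} {r} (_ ∷ ok) (there p)     | no r≢r′ = ≡.trans (if-false (r ≟ r′) r≢r′) (labelNorth-correct ok p)
  labelNorth-correct {(east b , k) ∷ lb} (_ ∷ ok) (there p) = labelNorth-correct ok p

  private
    ∈-steps : ∀ {r s} → 0 < r → s ∈ rowBoundary r → ∀ n → r ≤ n → s ∈ steps n
    ∈-steps 0<r s∈ zero    r≤n = contradiction (ℕ.≤-trans 0<r r≤n) λ ()
    ∈-steps {r} {s} 0<r s∈ (suc n) r≤n with ℕ.m≤n⇒m<n∨m≡n r≤n
    ... | inj₂ r≡ = ≡.subst (s ∈_) (≡.sym (steps-suc n)) (Mem.∈-++⁺ˡ (≡.subst (λ r → s ∈ rowBoundary r) r≡ s∈))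
    ... | inj₁ r<n = ≡.subst (s ∈_) (≡.sym (steps-suc n)) (Mem.∈-++⁺ʳ (rowBoundary (suc n)) (∈-steps 0<r s∈ n (ℕ.s≤s⁻¹ r<n)))

    ∈-labelled : ∀ {r s} → 0 < r → r ≤ h → s ∈ rowBoundary r → ∃[ l ] (s , l) ∈ labelled
    ∈-labelled {r} {s} 0<r r≤h s∈ = ≡.subst (λ lb → ∃[ l ] (s , l) ∈ lb) (≡.sym labelled-steps)
      (labelFrom-steps nothing 0 (steps N) (∈-steps 0<r s∈ N (ℕ.≤-trans r≤h h≤N)))

    east∈ : ∀ {c} → 1 ≤ c → c ≤ ρ 1 → ∃[ r ] ∃[ l ] (east (r , c) , l) ∈ labelled
    east∈ {c} 1≤c c≤ with findRow ρ h {c} 0<h (≡.subst (_< c) (≡.sym (ρ-empty ℕ.≤-refl)) 1≤c) c≤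
    ... | r , 0<r , r≤h , lo , hi = r , ∈-labelled 0<r r≤h (≡.subst (east (r , c) ∈_) (≡.sym (rowBoundary-steps 0<r r≤h))
          (Mem.∈-++⁺ˡ (Mem.∈-map⁺ (λ c → east (r , c)) (∈-interval (suc (ρ (suc r))) (ρ r ∸ ρ (suc r)) lo
            (≡.subst (c <_) (≡.trans (≡.cong suc (≡.sym (ℕ.m∸n+n≡m (ρ-anti r)))) (≡.sym (ℕ.+-suc (ρ r ∸ ρ (suc r)) (ρ (suc r))))) (s≤s hi))))))

    north∈ : ∀ {r} → 0 < r → r ≤ h → ∃[ l ] (north (r , ρ r) , l) ∈ labelled
    north∈ {r} 0<r r≤h = ∈-labelled 0<r r≤h (≡.subst (north (r , ρ r) ∈_) (≡.sym (rowBoundary-steps 0<r r≤h))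
      (Mem.∈-++⁺ʳ (map (λ c → east (r , c)) (interval (suc (ρ (suc r))) (ρ r ∸ ρ (suc r)))) (here ≡.refl)))

  treeLabel-correct : ∀ {r c} → (r , c) ∈ R π → treeLabel π (r , c) ≡ (ε (ℕ.pred c) , ν r)
  treeLabel-correct {r} {c} b∈ = ≡.trans (treeLabel-labelled r c) (lemma (∈-R⁻ b∈))
    where
      lemma : (0 < r × r ≤ h) × (1 ≤ c × c ≤ ρ r) → (labelEast c labelled , labelNorth r labelled) ≡ (ε (ℕ.pred c) , ν r)
      lemma ((0<r , r≤h) , (1≤c , c≤ρ)) = ≡.cong₂ _,_
        (labelEast-correct labels-correct (proj₂ (proj₂ (east∈ 1≤c (ℕ.≤-trans c≤ρ (ρ-anti* 0<r))))))
        (labelNorth-correct labels-correct (proj₂ (north∈ 0<r r≤h)))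

  numVertices-correct : numVertices π ≡ ν 1
  numVertices-correct = ≡.trans numVertices-labelled (lemma (north∈ (s≤s z≤n) 0<h))
    where
      lemma : ∃[ l ] (north (1 , ρ 1) , l) ∈ labelled → maximum (map proj₂ labelled) ≡ ν 1
      lemma (l , p) = maximum-attained (All.map⁺ (All.map proj₂ labels-correct))
        (≡.subst (_∈ map proj₂ labelled) (proj₁ (All.lookup labels-correct p)) (Mem.∈-map⁺ proj₂ p))

  private
    injective-< : ∀ {f : ℕ → ℕ} {P : ℕ → Set} → (∀ {i j} → P i → P j → i < j → f i ≢ f j) → ∀ {i j} → P i → P j → f i ≡ f j → i ≡ j
    injective-< apart {i} {j} pi pj e with ℕ.<-cmp i j
    ... | tri< i<j _ _ = contradiction e (apart pi pj i<j)
    ... | tri≈ _ i≡j _ = i≡j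
    ... | tri> _ _ j<i = contradiction (≡.sym e) (apart pj pi j<i)

  -- ν strictly decreases downwards and ε strictly increases to the right, so a tree label
  -- determines row and column.
  treeLabel-injective : ∀ {a b} → a ∈ R π → b ∈ R π → treeLabel π a ≡ treeLabel π b → a ≡ b
  treeLabel-injective {r , c} {r′ , c′} a∈ b∈ e =
      lemma (∈-R⁻ a∈) (∈-R⁻ b∈) (≡.trans (≡.sym (treeLabel-correct a∈)) (≡.trans e (treeLabel-correct b∈)))
    where
      column≤ : ∀ {r c} → 0 < r → 1 ≤ c → c ≤ ρ r → ℕ.pred c ≤ Λ 1
      column≤ {r} {c} 0<r 1≤c c≤ρ = ℕ.≤-trans (ℕ.pred-mono-≤ (ℕ.≤-trans c≤ρ (ρ-anti* 0<r))) (ℕ.≤-reflexive (≡.cong ℕ.pred ρ-1))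
      lemma : (0 < r × r ≤ h) × (1 ≤ c × c ≤ ρ r) → (0 < r′ × r′ ≤ h) × (1 ≤ c′ × c′ ≤ ρ r′) →
        (ε (ℕ.pred c) , ν r) ≡ (ε (ℕ.pred c′) , ν r′) → (r , c) ≡ (r′ , c′)
      lemma ((0<r , r≤h) , (1≤c , c≤ρ)) ((0<r′ , r′≤h) , (1≤c′ , c′≤ρ)) e′ = ≡.cong₂ _,_
        (injective-< {ν} {λ r → 0 < r × r ≤ h} (λ (0<i , _) (_ , j≤h) i<j → ℕ.>⇒≢ (ν-anti 0<i i<j (ℕ.m≤n⇒m≤1+n j≤h))) (0<r , r≤h) (0<r′ , r′≤h) (≡.cong proj₂ e′))
        (≡.trans (≡.sym (ℕ.suc-pred c {{ℕ.>-nonZero 1≤c}})) (≡.trans (≡.cong suc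
          (injective-< {ε} {λ i → i ≤ Λ 1} (λ _ j≤ i<j → ℕ.<⇒≢ (ε-mono i<j j≤)) (column≤ 0<r 1≤c c≤ρ) (column≤ 0<r′ 1≤c′ c′≤ρ) (≡.cong proj₁ e′)))
          (ℕ.suc-pred c′ {{ℕ.>-nonZero 1≤c′}})))

  φ-treeLabel : ∀ {b} → b ∈ R π → φ π (treeLabel π b) ≡ just b
  φ-treeLabel {b} b∈ = find-∈ (λ b′ → treeLabel π b′ ≟₂ treeLabel π b) b∈ ≡.refl (λ z∈ e → treeLabel-injective z∈ b∈ e)

-- The dots and the tree T(π).

filter-concatMap : ∀ {A B : Set} {P : B → Set} (P? : ∀ b → Dec (P b)) (f : A → List B) xs →
  filter P? (concatMap f xs) ≡ concatMap (filter P? ∘ f) xs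
filter-concatMap P? f []       = ≡.refl
filter-concatMap P? f (x ∷ xs) = ≡.trans (List.filter-++ P? (f x) _) (≡.cong (filter P? (f x) ++_) (filter-concatMap P? f xs))

map-concatMap : ∀ {A B C : Set} (g : B → C) (f : A → List B) xs → map g (concatMap f xs) ≡ concatMap (map g ∘ f) xs
map-concatMap g f []       = ≡.refl
map-concatMap g f (x ∷ xs) = ≡.trans (List.map-++ g (f x) _) (≡.cong (map g (f x) ++_) (map-concatMap g f xs))

concatMap-cong-All : ∀ {A B : Set} {f g : A → List B} {xs} → All (λ x → f x ≡ g x) xs → concatMap f xs ≡ concatMap g xs
concatMap-cong-All []       = ≡.refl
concatMap-cong-All (p ∷ ps) = ≡.cong₂ _++_ p (concatMap-cong-All ps)

concatMap-down : ∀ {B : Set} (f : ℕ → List B) n → concatMap f (interval 1 n) ↭ concatMap f (applyDownFrom suc n)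
concatMap-down f zero    = Perm.refl
concatMap-down f (suc n) = ↭-trans (Perm.↭-reflexive (≡.trans
    (≡.cong (concatMap f) (≡.trans (≡.cong (interval 1) (ℕ.+-comm 1 n)) (≡.trans (interval-++ 1 n 1) (≡.cong (λ k → interval 1 n ++ k ∷ []) (ℕ.+-comm n 1)))))
    (List.concatMap-++ f (interval 1 n) (suc n ∷ []))))
  (↭-trans (Perm.++-comm (concatMap f (interval 1 n)) _)
    (↭-trans (Perm.↭-reflexive (≡.cong (_++ concatMap f (interval 1 n)) (List.++-identityʳ (f (suc n)))))
      (Perm.++⁺ˡ (f (suc n)) (concatMap-down f n))))

map-interval : ∀ {ℓ} {A : Set ℓ} (f g : ℕ → A) a b n → (∀ {j} → j < n → f (j + a) ≡ g (j + b)) → map f (interval a n) ≡ map g (interval b n)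
map-interval f g a b zero    p = ≡.refl
map-interval f g a b (suc n) p = ≡.cong₂ _∷_ (p (s≤s z≤n)) (map-interval f g (suc a) (suc b) n λ {j} j<n →
  ≡.trans (≡.cong f (ℕ.+-suc j a)) (≡.trans (p (s≤s j<n)) (≡.cong g (≡.sym (ℕ.+-suc j b)))))

module Tree {m : ℕ} (π : Permutation′ (suc m))
  (π0≡0 : π ⟨$⟩ʳ Fin.zero ≡ Fin.zero) (avoids : Avoids132 (λ i → π ⟨$⟩ʳ Fin.suc i)) where
  open Labels π π0≡0 avoids public

  private
    ∉-bottom : ∀ {r c} → (r , c) ∈ R π → L r < c → (r , c) ∉ bottomCrosses π
    ∉-bottom _ L<c b∈ = ℕ.<⇒≱ L<c (∈-bottom⁻ b∈)

    bottom-≰ : ∀ {r c} → (r , c) ∈ R π → (r , c) ∉ bottomCrosses π → L r < c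
    bottom-≰ b∈ ∉b = ℕ.≰⇒> λ c≤L → ∉b (∈-bottom⁺ (proj₁ (Mem.∈-filter⁻ inR {xs = grid N} b∈)) c≤L)

  module _ {r c : ℕ} (b∈ : (r , c) ∈ R π) where
    private
      0<r = proj₁ (proj₁ (∈-R⁻ b∈))
      r≤h = proj₂ (proj₁ (∈-R⁻ b∈))
      1≤c = proj₁ (proj₂ (∈-R⁻ b∈))
      c≤ρ = proj₂ (proj₂ (∈-R⁻ b∈))
      below = filter (columnBelow? π (r , c)) (R π)
      elbow = filter (columnElbow? π (r , c)) (R π)
      further? = λ (z : Box) → proj₂ z ≟ c ×-dec suc r <? proj₁ z
      further = filter further? (R π)

      top∈ : (1 , c) ∈ R π
      top∈ = ∈-R⁺ (s≤s z≤n) 0<h 1≤c (ℕ.≤-trans c≤ρ (ρ-anti* 0<r))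

    -- Below row r the bottom pipe dream then has no cross in column c, so all boxes below are
    -- elbows, and the box in row 1 is one more.
    dot⁺ : Λ (suc r) < c → length below < length elbow
    dot⁺ Λ<c = Unique-length-≤ {xs = (1 , c) ∷ below} {ys = elbow}
        (All.tabulate (λ {z} z∈ e → contradiction (≡.subst (λ z → r < proj₁ z) (≡.sym e) (proj₂ (proj₂ (Mem.∈-filter⁻ (columnBelow? π (r , c)) {xs = R π} z∈))))
            (ℕ.≤⇒≯ 0<r)) ∷
          Unique.filter⁺ (columnBelow? π (r , c)) R-unique)
        λ { (here ≡.refl) → Mem.∈-filter⁺ (columnElbow? π (r , c)) top∈ (≡.refl , ∉-bottom top∈ (≡.subst (_< c) (≡.sym L-1) 1≤c))
          ; (there z∈) → move (Mem.∈-filter⁻ (columnBelow? π (r , c)) {xs = R π} z∈) }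
      where
        move : ∀ {z} → z ∈ R π × proj₂ z ≡ c × r < proj₁ z → z ∈ elbow
        move {r′ , c} (z∈ , ≡.refl , r<r′) = Mem.∈-filter⁺ (columnElbow? π (r , c)) z∈ (≡.refl , ∉-bottom z∈
          (ℕ.≤-<-trans (ℕ.≤-trans (ℕ.≤-reflexive (≡.sym (Λ-suc (ℕ.≤-trans (s≤s 0<r) r<r′)))) (Λ-anti r<r′)) Λ<c))

    -- Otherwise the column has crosses in the rows 2, ..., r + 1. Its elbows are (1 , c) and some
    -- boxes below row r + 1, no more in number than the boxes below row r, of which (r + 1 , c) is
    -- one.
    dot⁻ : length below < length elbow → Λ (suc r) < c
    dot⁻ below<elbow = ℕ.≰⇒> λ c≤Λ → ℕ.<⇒≱ below<elbow (ℕ.≤-trans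
        (Unique-length-≤ {xs = elbow} {ys = (1 , c) ∷ further} (Unique.filter⁺ (columnElbow? π (r , c)) R-unique)
          (λ z∈ → shrink c≤Λ (Mem.∈-filter⁻ (columnElbow? π (r , c)) {xs = R π} z∈)))
        (Unique-length-≤ {xs = (suc r , c) ∷ further} {ys = below}
          (All.tabulate (λ {z} z∈ e → ℕ.n≮n (suc r) (≡.subst (λ z → suc r < proj₁ z) (≡.sym e) (proj₂ (proj₂ (Mem.∈-filter⁻ further? {xs = R π} z∈))))) ∷
            Unique.filter⁺ further? R-unique)
          λ { (here ≡.refl) → Mem.∈-filter⁺ (columnBelow? π (r , c)) (next∈ c≤Λ) (≡.refl , ℕ.≤-refl)
            ; (there z∈) → grow (Mem.∈-filter⁻ further? {xs = R π} z∈) }))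
      where
        shrink : ∀ {z} → c ≤ Λ (suc r) → z ∈ R π × proj₂ z ≡ c × z ∉ bottomCrosses π → z ∈ (1 , c) ∷ further
        shrink {r′ , c} c≤Λ (z∈ , ≡.refl , z∉) = lemma (ℕ.m≤n⇒m<n∨m≡n (proj₁ (proj₁ (∈-R⁻ z∈))))
          where
            lemma : 1 < r′ ⊎ 1 ≡ r′ → (r′ , c) ∈ (1 , c) ∷ further
            lemma (inj₂ ≡.refl) = here ≡.refl
            lemma (inj₁ 1<r′)   = there (Mem.∈-filter⁺ further? z∈ (≡.refl , ℕ.≰⇒> λ r′≤ → ℕ.n≮n c
              (ℕ.≤-<-trans (ℕ.≤-trans c≤Λ (ℕ.≤-trans (Λ-anti r′≤) (ℕ.≤-reflexive (Λ-suc 1<r′)))) (bottom-≰ z∈ z∉))))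
        next∈ : c ≤ Λ (suc r) → (suc r , c) ∈ R π
        next∈ c≤Λ = lemma (ℕ.≤-<-connex (suc r) h)
          where
            lemma : suc r ≤ h ⊎ h < suc r → (suc r , c) ∈ R π
            lemma (inj₁ r<h) = ∈-R⁺ (s≤s z≤n) r<h 1≤c (ℕ.≤-trans c≤Λ (proj₁ (ρ-bounds r<h)))
            lemma (inj₂ h<r) = contradiction (ℕ.≤-trans 1≤c (≡.subst (c ≤_) (Λ-empty h<r) c≤Λ)) λ ()
        grow : ∀ {z} → z ∈ R π × proj₂ z ≡ c × suc r < proj₁ z → z ∈ below
        grow (z∈ , c≡ , r<) = Mem.∈-filter⁺ (columnBelow? π (r , c)) z∈ (c≡ , ℕ.<⇒≤ r<)

  dotRow : ℕ → List Box
  dotRow r = map (r ,_) (interval (suc (Λ (suc r))) (ρ r ∸ Λ (suc r)))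

  private
    dot? : (b : Box) → Dec (Λ (suc (proj₁ b)) < proj₂ b)
    dot? (r , c) = Λ (suc r) <? c

    filter-row-dots : ∀ r → filter dot? (rowBoxes r) ≡ dotRow r
    filter-row-dots r = cases (ℕ.≤-<-connex r h)
      where
        cases : r ≤ h ⊎ h < r → filter dot? (rowBoxes r) ≡ dotRow r
        cases (inj₂ h<r) = ≡.trans (≡.cong (λ k → filter dot? (map (r ,_) (interval 1 k))) (ρ-empty h<r))
          (≡.cong (λ k → map (r ,_) (interval (suc (Λ (suc r))) k)) (≡.sym (≡.trans (≡.cong (_∸ Λ (suc r)) (ρ-empty h<r)) (ℕ.0∸n≡0 (Λ (suc r))))))
        cases (inj₁ r≤h) = ≡.trans (≡.cong (λ k → filter dot? (map (r ,_) (interval 1 k)))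
            (≡.sym (≡.trans (≡.cong (Λ (suc r) +_) (ℕ.+-identityʳ _)) (ℕ.m+[n∸m]≡n (ℕ.<⇒≤ (Λ<ρ r≤h))))))
          (≡.trans (filter-segment dot? (r ,_) 1 (Λ (suc r)) (ρ r ∸ Λ (suc r)) 0
              (λ {c} c∈ Λ<c → ℕ.n≮n c (ℕ.<-≤-trans (≡.subst (c <_) (ℕ.+-comm (Λ (suc r)) 1) (proj₂ (interval-bounds′ 1 (Λ (suc r)) c∈))) Λ<c))
              (λ {c} c∈ → ≡.subst (_≤ c) (ℕ.+-comm (Λ (suc r)) 1) (proj₁ (interval-bounds′ (Λ (suc r) + 1) (ρ r ∸ Λ (suc r)) c∈)))
              (λ ()))
            (≡.cong (λ k → map (r ,_) (interval k (ρ r ∸ Λ (suc r)))) (ℕ.+-comm (Λ (suc r)) 1)))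

  dots-rows : dots π ≡ concatMap dotRow (interval 1 N)
  dots-rows = ≡.trans
    (filter-cong-All (λ b → length (filter (columnBelow? π b) (R π)) <? length (filter (columnElbow? π b) (R π))) dot? (R π)
      (All.tabulate λ {b} b∈ → dot⁻ b∈ , dot⁺ b∈))
    (≡.trans (≡.cong (filter dot?) R-rows) (≡.trans (filter-concatMap dot? rowBoxes (interval 1 N))
      (List.concatMap-cong filter-row-dots (interval 1 N))))

  rowEdges : ℕ → List Edge
  rowEdges r = map (λ c → ε (ℕ.pred c) , ν r) (interval (suc (Λ (suc r))) (ρ r ∸ Λ (suc r)))

  private
    dotRow-edges : ∀ {r} → 1 ≤ r → map (treeLabel π) (dotRow r) ≡ rowEdges r
    dotRow-edges {r} 1≤r = ≡.trans (≡.sym (List.map-∘ (interval (suc (Λ (suc r))) (ρ r ∸ Λ (suc r)))))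
        (List.map-cong-local (All.tabulate λ c∈ → treeLabel-correct (inside (ℕ.≤-<-connex r h) c∈)))
      where
        inside : r ≤ h ⊎ h < r → ∀ {c} → c ∈ interval (suc (Λ (suc r))) (ρ r ∸ Λ (suc r)) → (r , c) ∈ R π
        inside (inj₁ r≤h) {c} c∈ = ∈-R⁺ 1≤r r≤h (ℕ.≤-trans (s≤s z≤n) (proj₁ bounds))
            (ℕ.s≤s⁻¹ (≡.subst (c <_) (≡.trans (ℕ.+-suc _ _) (≡.cong suc (ℕ.m∸n+n≡m (ℕ.<⇒≤ (Λ<ρ r≤h))))) (proj₂ bounds)))
          where bounds = interval-bounds′ (suc (Λ (suc r))) (ρ r ∸ Λ (suc r)) c∈
        inside (inj₂ h<r) {c} c∈ = contradiction (≡.subst (c ∈_) (≡.cong (interval (suc (Λ (suc r))))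
          (≡.trans (≡.cong (_∸ Λ (suc r)) (ρ-empty h<r)) (ℕ.0∸n≡0 (Λ (suc r))))) c∈) λ ()

    rowEdges-empty : ∀ {r} → h < r → rowEdges r ≡ []
    rowEdges-empty {r} h<r = ≡.cong (λ k → map (λ c → ε (ℕ.pred c) , ν r) (interval (suc (Λ (suc r))) k))
      (≡.trans (≡.cong (_∸ Λ (suc r)) (ρ-empty h<r)) (ℕ.0∸n≡0 (Λ (suc r))))

    rowEdges-down : ∀ d → concatMap rowEdges (applyDownFrom suc (d + h)) ≡ concatMap rowEdges (applyDownFrom suc h)
    rowEdges-down zero    = ≡.refl
    rowEdges-down (suc d) = ≡.trans (≡.cong (_++ concatMap rowEdges (applyDownFrom suc (d + h))) (rowEdges-empty (s≤s (ℕ.m≤n+m h d)))) (rowEdges-down d)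

    -- The leftmost dot of row r lies in column Λ (r + 1) + 1, which does not begin in this row and
    -- supplies the vertex p of `treeEdges`. The other dots lie in the columns that begin in row r,
    -- except for the last of these, which has no box there.
    rowEdges-split : ∀ {r} d → 0 < r → r ≤ h → δ r ∸ 1 ≡ d →
      rowEdges r ≡ (ε (Λ (suc r)) , suc (ν (suc r)) + d) ∷ map (_, suc (ν (suc r)) + d) (interval (suc (ν (suc r))) d)
    rowEdges-split {r} d 0<r r≤h eq = ≡.trans
      (≡.cong (λ k → map (λ c → ε (ℕ.pred c) , ν r) (interval (suc (Λ (suc r))) k)) (≡.trans (ρ-from-Λ r≤h) (≡.cong suc eq)))
      (≡.cong₂ _∷_ (≡.cong (ε (Λ (suc r)) ,_) ν≡)
        (map-interval _ _ (suc (suc (Λ (suc r)))) (suc (ν (suc r))) d λ {j} j<d → ≡.cong₂ _,_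
          (≡.trans (≡.cong (ε ∘ ℕ.pred) (ℕ.+-suc j _)) (ε-step 0<r r≤h (smaller (δ r) eq j<d))) ν≡))
      where
        ν≡ : ν r ≡ suc (ν (suc r)) + d
        ν≡ = ≡.trans (ν-step 0<r r≤h) (≡.cong (suc (ν (suc r)) +_) eq)
        smaller : ∀ k → k ∸ 1 ≡ d → ∀ {j} → j < d → j < k
        smaller (suc k) ≡.refl j<k = ℕ.m<n⇒m<1+n j<k

  private
    ν-next : ∀ {r d} → 0 < r → r ≤ h → δ r ∸ 1 ≡ d → ν r ≡ suc (ν (suc r)) + d
    ν-next {r} 0<r r≤h eq = ≡.trans (ν-step 0<r r≤h) (≡.cong (suc (ν (suc r)) +_) eq)

  treeEdges-rows : ∀ r → r < h →
    treeEdges (ε (Λ (2 + r))) (suc (ν (2 + r))) (drops Λ (suc r)) ≡ concatMap rowEdges (applyDownFrom suc (suc r))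
  treeEdges-rows zero r≤h = ≡.sym (≡.trans (List.++-identityʳ (rowEdges 1)) (≡.trans (rowEdges-split 0 (s≤s z≤n) r≤h (≡.cong (_∸ 1) δ-1))
    (≡.cong (λ k → (ε (Λ 2) , k) ∷ []) (ℕ.+-identityʳ _))))
  treeEdges-rows (suc r) r≤h = cases (δ (2 + r)) ≡.refl
    where
      0<r : 0 < 2 + r
      0<r = s≤s z≤n
      j = suc (ν (3 + r))
      p = ε (Λ (3 + r))
      rest = concatMap rowEdges (applyDownFrom suc (suc r))
      IH : treeEdges (ε (Λ (2 + r))) (suc (ν (2 + r))) (drops Λ (suc r)) ≡ rest
      IH = treeEdges-rows r (ℕ.<⇒≤ r≤h)
      cases : ∀ d → δ (2 + r) ≡ d → treeEdges p j (δ (2 + r) ∷ drops Λ (suc r)) ≡ rowEdges (2 + r) ++ rest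
      cases zero eq = ≡.trans (≡.cong (λ d → treeEdges p j (d ∷ drops Λ (suc r))) eq)
        (≡.trans (≡.cong ((p , j) ∷_) (≡.trans (≡.cong₂ (λ a b → treeEdges a (suc b) (drops Λ (suc r)))
            (≡.cong ε (≡.sym (Λ-flat {2 + r} eq))) (≡.sym (≡.trans (ν-next 0<r r≤h (≡.cong (_∸ 1) eq)) (ℕ.+-identityʳ j)))) IH))
          (≡.cong (_++ rest) (≡.sym (≡.trans (rowEdges-split 0 0<r r≤h (≡.cong (_∸ 1) eq)) (≡.cong (λ k → (p , k) ∷ []) (ℕ.+-identityʳ j))))))
      cases (suc d) eq = ≡.trans (≡.cong (λ d → treeEdges p j (d ∷ drops Λ (suc r))) eq)
        (≡.trans (≡.cong (λ X → (p , j + d) ∷ map (_, j + d) (interval j d) ++ X) (≡.trans (≡.cong₂ (λ a b → treeEdges a (suc b) (drops Λ (suc r)))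
            (≡.sym (≡.trans (ε-Λ 0<r r≤h (λ z → case ≡.trans (≡.sym eq) z of λ ())) ν≡)) (≡.sym ν≡)) IH))
          (≡.cong (_++ rest) (≡.sym (rowEdges-split d 0<r r≤h (≡.cong (_∸ 1) eq)))))
        where
          ν≡ : ν (2 + r) ≡ j + d
          ν≡ = ν-next 0<r r≤h (≡.cong (_∸ 1) eq)

  T-treeEdges : T π ↭ treeEdges 1 2 (drops Λ h)
  T-treeEdges = ↭-trans (Perm.↭-reflexive (≡.trans (≡.cong (map (treeLabel π)) dots-rows)
      (≡.trans (map-concatMap (treeLabel π) dotRow (interval 1 N))
        (concatMap-cong-All (All.map dotRow-edges (interval-≥ 1 N))))))
    (↭-trans (concatMap-down rowEdges N) (Perm.↭-reflexive (≡.trans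
      (≡.trans (≡.cong (concatMap rowEdges ∘ applyDownFrom suc) (≡.sym (ℕ.m∸n+n≡m h≤N))) (rowEdges-down (N ∸ h)))
      (≡.trans (≡.sym (at-h h ≡.refl 0<h))
        (≡.cong₂ (λ a b → treeEdges a (suc b) (drops Λ h)) (≡.trans (≡.cong ε (Λ-empty ℕ.≤-refl)) ε-zero) ν-last)))))

    where
      at-h : ∀ k → k ≡ h → 0 < k → treeEdges (ε (Λ (suc k))) (suc (ν (suc k))) (drops Λ k) ≡ concatMap rowEdges (applyDownFrom suc k)
      at-h (suc k) k≡h _ = treeEdges-rows k (ℕ.≤-reflexive k≡h)

  vertices-interval : ∀ r → r < h → vertices (suc (ν (2 + r))) (drops Λ (suc r)) ≡ interval (suc (ν (2 + r))) (ν 1 ∸ ν (2 + r))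
  vertices-interval zero r≤h = ≡.cong (interval (suc (ν 2))) (≡.sym (≡.trans
    (≡.cong (_∸ ν 2) (≡.trans (ν-next (s≤s z≤n) r≤h (≡.cong (_∸ 1) δ-1)) (ℕ.+-identityʳ _))) (ℕ.m+n∸n≡m 1 (ν 2))))
  vertices-interval (suc r) r≤h = cases (δ (2 + r)) ≡.refl
    where
      0<r : 0 < 2 + r
      0<r = s≤s z≤n
      j = suc (ν (3 + r))
      IH : vertices (suc (ν (2 + r))) (drops Λ (suc r)) ≡ interval (suc (ν (2 + r))) (ν 1 ∸ ν (2 + r))
      IH = vertices-interval r (ℕ.<⇒≤ r≤h)
      ν≤ : ν (2 + r) ≤ ν 1
      ν≤ = ν-≤1 0<r (ℕ.m≤n⇒m≤1+n r≤h)
      counted : ∀ d → ν (2 + r) ≡ j + d → d + suc (ν 1 ∸ ν (2 + r)) ≡ ν 1 ∸ ν (3 + r)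
      counted d eq = ≡.sym (≡.trans (≡.cong (λ k → suc k ∸ j) (≡.trans (≡.sym (ℕ.m+[n∸m]≡n ν≤)) (≡.trans (≡.cong (_+ q) eq) (ℕ.+-assoc j d q))))
          (≡.trans (≡.cong (_∸ j) (≡.sym (ℕ.+-suc j (d + q)))) (≡.trans (ℕ.m+n∸m≡n j (suc (d + q))) (≡.sym (ℕ.+-suc d q)))))
        where q = ν 1 ∸ ν (2 + r)
      cases : ∀ d → δ (2 + r) ≡ d → vertices j (δ (2 + r) ∷ drops Λ (suc r)) ≡ interval j (ν 1 ∸ ν (3 + r))
      cases zero eq = ≡.trans (≡.cong (λ d → vertices j (d ∷ drops Λ (suc r))) eq)
          (≡.trans (≡.cong (j ∷_) (≡.trans (≡.cong (λ k → vertices (suc k) (drops Λ (suc r))) (≡.sym ν≡′)) (≡.trans IH (≡.cong (λ k → interval (suc k) (ν 1 ∸ ν (2 + r))) ν≡′))))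
            (≡.cong (interval j) (counted 0 ν≡)))
        where
          ν≡ : ν (2 + r) ≡ j + 0
          ν≡ = ν-next 0<r r≤h (≡.cong (_∸ 1) eq)
          ν≡′ : ν (2 + r) ≡ j
          ν≡′ = ≡.trans ν≡ (ℕ.+-identityʳ j)
      cases (suc d) eq = ≡.trans (≡.cong (λ d → vertices j (d ∷ drops Λ (suc r))) eq)
          (≡.trans (≡.cong (λ X → interval j d ++ j + d ∷ X) (≡.trans (≡.cong (λ k → vertices (suc k) (drops Λ (suc r))) (≡.sym ν≡)) (≡.trans IH
              (≡.cong (λ k → interval (suc k) (ν 1 ∸ ν (2 + r))) ν≡))))
            (≡.trans (≡.cong (λ k → interval j d ++ interval k (suc (ν 1 ∸ ν (2 + r)))) (ℕ.+-comm j d))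
              (≡.trans (≡.sym (interval-++ j d (suc (ν 1 ∸ ν (2 + r))))) (≡.cong (interval j) (counted d ν≡)))))
        where
          ν≡ : ν (2 + r) ≡ j + d
          ν≡ = ν-next 0<r r≤h (≡.cong (_∸ 1) eq)

  oneTo-vertices : oneTo (numVertices π) ≡ 1 ∷ vertices 2 (drops Λ h)
  oneTo-vertices = ≡.trans (≡.cong oneTo numVertices-correct) (≡.trans (applyUpTo-interval 1 (ν 1))
    (≡.trans (≡.cong (interval 1) (≡.sym (≡.trans (≡.cong (λ k → suc (ν 1 ∸ k)) ν-last) (ℕ.m+[n∸m]≡n 1≤ν))))
      (≡.cong (1 ∷_) (≡.sym (≡.subst (λ k → vertices (suc k) (drops Λ h) ≡ interval (suc k) (ν 1 ∸ ν (suc h))) ν-last (at-h h ≡.refl 0<h))))))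
    where
      at-h : ∀ k → k ≡ h → 0 < k → vertices (suc (ν (suc k))) (drops Λ k) ≡ interval (suc (ν (suc k))) (ν 1 ∸ ν (suc k))
      at-h (suc k) k≡h _ = vertices-interval k (ℕ.≤-reflexive k≡h)
      1≤ν : 1 ≤ ν 1
      1≤ν = ≡.subst (_≤ ν 1) ν-last (ν-≤1 (s≤s z≤n) ℕ.≤-refl)

-- Comparing the two sides.

module Theorem {c ℓ} (K : CommutativeRing c ℓ) {m : ℕ} (π : Permutation′ (suc m))
  (π0≡0 : π ⟨$⟩ʳ Fin.zero ≡ Fin.zero) (avoids : Avoids132 (λ i → π ⟨$⟩ʳ Fin.suc i))
  (x y : ℕ → CommutativeRing.Carrier K) (u : Box → CommutativeRing.Carrier K)
  (weight-u : ∀ {b} → b ∈ R π →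
    CommutativeRing._≈_ K (CommutativeRing._*_ K (weight K x y b) (u b)) (CommutativeRing.1# K)) where
  open CommutativeRing K hiding (zero) renaming (_+_ to _⊕_; -_ to ⊝_; _-_ to _⊖_)
  open Exp semiring using (_^_)
  open Sums K
  open Hecke K
  open Bottom K
  open Labelled K
  open Tree π π0≡0 avoids
  open import Relation.Binary.Reasoning.Setoid setoid
  open SemiringSolver commutativeSemiring using (solve; _:+_; _:*_; _:=_; con)

  v : Edge → Carrier
  v = substitution K π u

  v-treeLabel : ∀ {b} → b ∈ R π → v (treeLabel π b) ≡ u b
  v-treeLabel b∈ = ≡.cong (maybe′ u 0#) (φ-treeLabel b∈)

  v-label : ∀ {r i} → r < h → i < ρ (suc r) → v (ε i , ν (suc r)) ≡ u (suc r , suc i)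
  v-label {r} {i} r<h i<ρ = ≡.trans (≡.cong v (≡.sym (treeLabel-correct b∈))) (v-treeLabel b∈)
    where
      b∈ : (suc r , suc i) ∈ R π
      b∈ = ∈-R⁺ (s≤s z≤n) r<h (s≤s z≤n) i<ρ

  ∏-treeLabels : ∏ K (treeLabels π) v ≈ ∏ K (concatMap rowBoxes (interval 1 N)) u
  ∏-treeLabels = trans (reflexive (∏-map (treeLabel π) (R π) v))
    (trans (∏-cong-All (All.tabulate λ b∈ → reflexive (v-treeLabel b∈))) (reflexive (≡.cong (λ bs → ∏ K bs u) R-rows)))

  crf-labelSum : eval K (⊝ 1#) v (crf (numVertices π) (T π)) ≈ labelSum v 2 [ 1 ] (drops Λ h)
  crf-labelSum = Canonical.eval-crf K v (drops Λ h) (numVertices π) (T π) oneTo-vertices T-treeEdges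

  t e : ℕ → ℕ → Carrier
  t r i = weight K x y (r , suc i)
  e r i = 1# ⊖ t r i

  t+e : ∀ r i → t r i ⊕ e r i ≈ 1#
  t+e r i = trans (+-comm _ _) (trans (+-assoc _ _ _) (trans (+-congˡ (-‿inverseˡ _)) (+-identityʳ 1#)))

  -- On R(π), where u is inverse to the weight of a cross, both weights of a tile are divided by
  -- that weight; tiles outside are left alone.
  scale a e′ : ℕ → ℕ → Carrier
  scale r i = choose (i <? ρ r) (u (r , suc i)) 1#
  a r i     = scale r i * t r i
  e′ r i    = scale r i * e r i

  scale-inside : ∀ {r i} → i < ρ r → scale r i ≡ u (r , suc i)
  scale-inside {r} {i} i<ρ with i <? ρ r
  ... | yes _  = ≡.refl
  ... | no i≮ρ = contradiction i<ρ i≮ρ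

  scale-outside : ∀ {r i} → ρ r ≤ i → scale r i ≡ 1#
  scale-outside {r} {i} ρ≤i with i <? ρ r
  ... | yes i<ρ = contradiction i<ρ (ℕ.≤⇒≯ ρ≤i)
  ... | no _    = ≡.refl

  inside : ∀ {r i} → r < h → i < ρ (suc r) → a (suc r) i ≈ 1# × e′ (suc r) i ≈ v (ε i , ν (suc r)) ⊖ 1#
  inside {r} {i} r<h i<ρ = a≈1 , (begin
      scale (suc r) i * e (suc r) i              ≡⟨ ≡.cong (_* e (suc r) i) (scale-inside i<ρ) ⟩
      u′ * (1# ⊕ ⊝ t (suc r) i)                  ≈⟨ distribˡ _ _ _ ⟩
      u′ * 1# ⊕ u′ * (⊝ t (suc r) i)             ≈⟨ +-cong (*-identityʳ _) (sym (-‿distribʳ-* _ _)) ⟩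
      u′ ⊕ ⊝ (u′ * t (suc r) i)                  ≈⟨ +-congˡ (-‿cong ut≈1) ⟩
      u′ ⊖ 1#                                    ≡⟨ ≡.cong (_⊖ 1#) (v-label r<h i<ρ) ⟨
      v (ε i , ν (suc r)) ⊖ 1#                   ∎)
    where
      open import Algebra.Properties.Ring ring using (-‿distribʳ-*)
      u′ = u (suc r , suc i)
      ut≈1 : u′ * t (suc r) i ≈ 1#
      ut≈1 = trans (*-comm _ _) (weight-u (∈-R⁺ (s≤s z≤n) r<h (s≤s z≤n) i<ρ))
      a≈1 : a (suc r) i ≈ 1#
      a≈1 = trans (reflexive (≡.cong (_* t (suc r) i) (scale-inside i<ρ))) ut≈1

  outside : ∀ {r i} → ρ (suc r) ≤ i → a (suc r) i ⊕ e′ (suc r) i ≈ 1#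
  outside {r} {i} ρ≤i = trans (sym (distribˡ _ _ _)) (trans (*-cong (reflexive (scale-outside ρ≤i)) (t+e _ _)) (*-identityˡ _))

  scale-row : ∀ (f t e : ℕ → Carrier) i b → ∏ K (interval i (length b)) f * rowWt t e i b ≈ rowWt (λ i → f i * t i) (λ i → f i * e i) i b
  scale-row f t e i []          = *-identityˡ _
  scale-row f t e i (true ∷ b)  = trans (solve 4 (λ f p t w → (f :* p) :* (t :* w) := (f :* t) :* (p :* w)) refl _ _ _ _) (*-congˡ (scale-row f t e (suc i) b))
  scale-row f t e i (false ∷ b) = trans (solve 4 (λ f p t w → (f :* p) :* (t :* w) := (f :* t) :* (p :* w)) refl _ _ _ _) (*-congˡ (scale-row f t e (suc i) b))

  ∏-one : ∀ {A : Set} (as : List A) {f : A → Carrier} → All (λ z → f z ≈ 1#) as → ∏ K as f ≈ 1#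
  ∏-one []       []       = refl
  ∏-one (z ∷ as) (p ∷ ps) = trans (*-cong p (∏-one as ps)) (*-identityˡ 1#)

  ∏-rowBoxes : ∀ r l → ρ r ≤ l → ∏ K (rowBoxes r) u ≈ ∏ K (interval 0 l) (scale r)
  ∏-rowBoxes r l ρ≤l = begin
    ∏ K (map (r ,_) (interval 1 (ρ r))) u ≡⟨ ∏-map (r ,_) (interval 1 (ρ r)) u ⟩
    ∏ K (interval 1 (ρ r)) (u ∘ (r ,_))
      ≡⟨ ≡.cong (foldr _*_ 1#) (map-interval (u ∘ (r ,_)) (scale r) 1 0 (ρ r) λ {j} j<ρ →
           ≡.trans (≡.cong (λ k → u (r , k)) (ℕ.+-comm j 1)) (≡.trans (≡.sym (scale-inside j<ρ)) (≡.cong (scale r) (≡.sym (ℕ.+-identityʳ j))))) ⟩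
    ∏ K (interval 0 (ρ r)) (scale r) ≈⟨ sym (*-identityʳ _) ⟩
    ∏ K (interval 0 (ρ r)) (scale r) * 1#
      ≈⟨ *-congˡ (sym (∏-one (interval (ρ r ℕ.+ 0) (l ∸ ρ r)) (All.map (λ {i} ≤i → reflexive (scale-outside (≡.subst (_≤ i) (ℕ.+-identityʳ _) ≤i)))
           (interval-≥ (ρ r ℕ.+ 0) (l ∸ ρ r))))) ⟩
    ∏ K (interval 0 (ρ r)) (scale r) * ∏ K (interval (ρ r ℕ.+ 0) (l ∸ ρ r)) (scale r)
      ≈⟨ sym (∏-++ (interval 0 (ρ r)) _ (scale r)) ⟩
    ∏ K (interval 0 (ρ r) ++ interval (ρ r ℕ.+ 0) (l ∸ ρ r)) (scale r)
      ≡⟨ ≡.cong (λ is → ∏ K is (scale r)) (≡.trans (≡.sym (interval-++ 0 (ρ r) (l ∸ ρ r))) (≡.cong (interval 0) (ℕ.m+[n∸m]≡n ρ≤l))) ⟩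
    ∏ K (interval 0 l) (scale r) ∎

  module _ (0<m : 0 < m) where

    h≤m : h ≤ m
    h≤m = ℕ.s≤s⁻¹ (ℕ.≤-trans (ℕ.+-monoˡ-≤ h (0<ρ ℕ.≤-refl)) (ρ-fits 0<m 0<h ℕ.≤-refl))

    -- For n ≥ 2 every box of R(π) lies in the triangle, so each factor u meets the tile of its own
    -- box.
    scale-staircase : ∀ k r M → length M ≡ k → Staircase M → 0 < r → r ℕ.+ k ≡ N →
      ∏ K (concatMap rowBoxes (interval r (suc k))) u * wt t e r M ≈ wt a e′ r M
    scale-staircase zero r [] lM s 0<r r+k≡N = trans (*-congʳ (begin
      ∏ K (rowBoxes r ++ []) u ≡⟨ ≡.cong (λ bs → ∏ K bs u) (List.++-identityʳ (rowBoxes r)) ⟩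
      ∏ K (rowBoxes r) u ≡⟨ ≡.cong (λ k → ∏ K (map (r ,_) (interval 1 k)) u) (ρ-empty (≡.subst (h <_) (≡.sym r≡N) (s≤s h≤m))) ⟩
      1# ∎)) (*-identityˡ _)
      where r≡N = ≡.trans (≡.sym (ℕ.+-identityʳ r)) r+k≡N
    scale-staircase (suc k) r (b ∷ M) lM (lb , s) 0<r r+k≡N = begin
      ∏ K (rowBoxes r ++ concatMap rowBoxes (interval (suc r) (suc k))) u * (rowWt (t r) (e r) 0 b * wt t e (suc r) M)
        ≈⟨ *-congʳ (∏-++ (rowBoxes r) _ u) ⟩
      (∏ K (rowBoxes r) u * ∏ K (concatMap rowBoxes (interval (suc r) (suc k))) u) * (rowWt (t r) (e r) 0 b * wt t e (suc r) M)
        ≈⟨ solve 4 (λ A B C D → (A :* B) :* (C :* D) := (A :* C) :* (B :* D)) refl _ _ _ _ ⟩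
      (∏ K (rowBoxes r) u * rowWt (t r) (e r) 0 b) * (∏ K (concatMap rowBoxes (interval (suc r) (suc k))) u * wt t e (suc r) M)
        ≈⟨ *-cong (trans (*-congʳ (∏-rowBoxes r (length b) fits)) (scale-row (scale r) (t r) (e r) 0 b))
             (scale-staircase k (suc r) M lM′ s (s≤s z≤n) (≡.trans (≡.sym (ℕ.+-suc r k)) r+k≡N)) ⟩
      rowWt (a r) (e′ r) 0 b * wt a e′ (suc r) M ∎
      where
        lM′ = ℕ.suc-injective lM
        fits : ρ r ≤ length b
        fits = ≡.subst (ρ r ≤_) (≡.sym (≡.trans lb (≡.cong suc lM′))) (cases (ℕ.≤-<-connex r h))
          where
            cases : r ≤ h ⊎ h < r → ρ r ≤ suc k
            cases (inj₂ h<r) = ≡.subst (_≤ suc k) (≡.sym (ρ-empty h<r)) z≤n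
            cases (inj₁ r≤h) = ℕ.+-cancelʳ-≤ r (ρ r) (suc k) (ℕ.≤-trans (ρ-fits 0<m 0<r r≤h) (ℕ.≤-reflexive (≡.trans (≡.sym r+k≡N) (ℕ.+-comm r (suc k)))))

    module U = Upward Λ Λ-anti
    module S = Shape Λ Λ-anti
    module C′ = Climb Λ Λ-anti m a e′

    trues : List Bool
    trues = replicate (suc (Λ m)) true

    good-allows : ∀ M → length M ≡ m → Staircase M → ⟦ good? 1 M W ⟧ ≈ ⟦ T? (U.allowsAll m trues (reverse M)) ⟧
    good-allows M lM s = ⟦⟧-cong (good? 1 M W) (T? (U.allowsAll m trues (reverse M)))
        (λ g → U.noBadPair⇒allowsAll m (reverse M) lrM (≡.subst (λ X → S.NoBadPair 1 X (λ _ → ⊥)) (≡.sym (List.reverse-involutive M)) (proj₁ iff g)))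
        (λ a → proj₂ iff (≡.subst (λ X → S.NoBadPair 1 X (λ _ → ⊥)) (List.reverse-involutive M) (U.allowsAll⇒noBadPair m (reverse M) lrM a)))
      where
        lrM : length (reverse M) ≡ m
        lrM = ≡.trans (List.length-reverse M) lM
        iff = S.good⇔noBadPair 1 M W initial s (≡.trans W-length (≡.cong suc (≡.sym lM)))

    matrices-length : ∀ ls → All (λ M → length M ≡ length ls) (matrices ls)
    matrices-length []       = ≡.refl ∷ []
    matrices-length (l ∷ ls) = All.concat⁺ (All.map⁺ (All.tabulate {xs = bits l} λ {b} _ →
      All.map⁺ {f = b ∷_} (All.map (≡.cong suc) (matrices-length ls))))

    heights-length : ∀ m r → length (heights m r) ≡ r
    heights-length m zero    = ≡.refl
    heights-length m (suc r) = ≡.cong suc (heights-length m r)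

    -- The rows are reversed because sorting runs downwards from π, while the flags are propagated
    -- upwards.
    𝔊-climb : ∏ K (concatMap rowBoxes (interval 1 N)) u * 𝔊 K π x y ≈ C′.climb m trues
    𝔊-climb = begin
      P * 𝔊 K π x y
        ≈⟨ *-congˡ (trans (Grothendieck.𝔊-staircases K π x y) (hecke {t} {e} t+e m 1 W W-length)) ⟩
      P * ∑ K (staircases m) (λ M → wt t e 1 M * ⟦ good? 1 M W ⟧)
        ≈⟨ sym (∑-*ˡ (staircases m) P _) ⟩
      ∑ K (staircases m) (λ M → P * (wt t e 1 M * ⟦ good? 1 M W ⟧))
        ≈⟨ ∑-cong-All (All.zipWith (λ { {M} (lM , s) → trans (sym (*-assoc _ _ _))
             (*-cong (scale-staircase m 1 M lM s (s≤s z≤n) ≡.refl) (good-allows M lM s)) }) (staircases-length m , staircases-Staircase m)) ⟩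
      ∑ K (staircases m) F
        ≡⟨ ≡.cong (λ Ms → ∑ K Ms F) (staircases-matrices m) ⟩
      ∑ K (matrices (reverse (heights m m))) F
        ≈⟨ ∑-matrices-reverse (heights m m) F ⟩
      ∑ K (matrices (heights m m)) (F ∘ reverse)
        ≈⟨ ∑-cong-All (All.map (λ {M} lM → *-cong (wt-reverse a e′ m M (≡.trans lM (heights-length m m)))
             (reflexive (≡.cong (λ X → ⟦ T? (U.allowsAll m trues X) ⟧) (List.reverse-involutive M)))) (matrices-length (heights m m))) ⟩
      C′.climb m trues ∎
      where
        P = ∏ K (concatMap rowBoxes (interval 1 N)) u
        F = λ M → wt a e′ 1 M * ⟦ T? (U.allowsAll m trues (reverse M)) ⟧

    climb-labelSum : C′.climb m trues ≈ labelSum v 2 [ 1 ] (drops Λ h)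
    climb-labelSum = begin
      C′.climb m trues
        ≡⟨ ≡.cong (λ k → C′.climb k (replicate (suc (Λ k)) true)) (≡.sym (ℕ.m∸n+n≡m h≤m)) ⟩
      C′.climb (m ∸ h ℕ.+ h) (replicate (suc (Λ (m ∸ h ℕ.+ h))) true)
        ≈⟨ empty (m ∸ h) ⟩
      C′.climb h (replicate (suc (Λ h)) true)
        ≈⟨ from h ≡.refl 0<h ⟩
      labelSum v (suc (ν (suc h))) (ε 0 ∷ []) (drops Λ h)
        ≡⟨ ≡.cong₂ (λ j i → labelSum v (suc j) (i ∷ []) (drops Λ h)) ν-last ε-zero ⟩
      labelSum v 2 [ 1 ] (drops Λ h) ∎
      where
        ρ-drop′ : ∀ {r d} → 0 < r → r ≤ h → Λ r ∸ Λ (suc r) ≡ suc d → ρ r ≡ Λ r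
        ρ-drop′ _ r≤h eq = ρ-drop r≤h (λ z → case ≡.trans (≡.sym eq) z of λ ())
        fits′ : ∀ {r} → r < h → ρ (suc r) ≤ m ∸ r
        fits′ {r} r<h = ≡.subst (_≤ m ∸ r) (ℕ.m+n∸n≡m (ρ (suc r)) r)
          (ℕ.∸-monoˡ-≤ r (ℕ.s≤s⁻¹ (≡.subst (_≤ suc m) (ℕ.+-suc (ρ (suc r)) r) (ρ-fits 0<m (s≤s z≤n) r<h))))
        empty : ∀ d → C′.climb (d ℕ.+ h) (replicate (suc (Λ (d ℕ.+ h))) true) ≈ C′.climb h (replicate (suc (Λ h)) true)
        empty = C′.climb-empty ε ν v h ρ 0<h ≡.refl Λ-empty ρ-empty (λ _ → ρ-flat) ρ-drop′ fits′ ν-step ε-step inside outside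
        -- The list of labels starts with column 0 alone; the other flagged columns of row h begin
        -- there.
        from : ∀ k → k ≡ h → 0 < k → C′.climb k (replicate (suc (Λ k)) true) ≈ labelSum v (suc (ν (suc k))) (ε 0 ∷ []) (drops Λ k)
        from (suc r) eq _ = trans (reflexive (≡.cong (λ l → C′.climb (suc r) (replicate (suc l) true)) (≡.sym (≡.cong (Λ (suc r) ∸_) Λ≡0))))
            (C′.climb-labels ε ν v h ρ 0<h ≡.refl Λ-empty ρ-empty (λ _ → ρ-flat) ρ-drop′ fits′ ν-step ε-step inside outside
              r (true ∷ []) (ℕ.≤-reflexive eq) (≡.cong suc (≡.sym Λ≡0)))
          where
            Λ≡0 : Λ (2 ℕ.+ r) ≡ 0
            Λ≡0 = Λ-empty (≡.subst (_< 2 ℕ.+ r) eq ℕ.≤-refl)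

    conclusion : eval K (⊝ 1#) v (crf (numVertices π) (T π)) ≈ ∏ K (treeLabels π) v * 𝔊 K π x y
    conclusion = trans crf-labelSum (sym (trans (*-congʳ ∏-treeLabels) (trans 𝔊-climb climb-labelSum)))

  module _ (m≡0 : m ≡ 0) where

    private
      h≡1 : h ≡ 1
      h≡1 = ℕ.≤-antisym (≡.subst (λ k → h ≤ suc k) m≡0 h≤N) 0<h

      ρ1≡1 : ρ 1 ≡ 1
      ρ1≡1 = ℕ.≤-antisym (≡.subst (λ k → ρ 1 ≤ suc k) m≡0 (ρ≤N 1 (s≤s z≤n))) (0<ρ 0<h)

      ν1≡2 : ν 1 ≡ 2
      ν1≡2 = ≡.trans (ν-step (s≤s z≤n) 0<h) (≡.cong₂ (λ k d → suc k ℕ.+ (d ∸ 1)) (≡.trans (≡.cong (ν ∘ suc) (≡.sym h≡1)) ν-last) δ-1)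

      labelSum≈ : labelSum v 2 [ 1 ] (drops Λ h) ≈ u (1 , 1)
      labelSum≈ = begin
        labelSum v 2 [ 1 ] (drops Λ h) ≡⟨ ≡.cong (λ k → labelSum v 2 [ 1 ] (drops Λ k)) h≡1 ⟩
        rowSum (λ s → v (s , 2)) [ 1 ] [] (λ _ → 1#) ≈⟨ solve 1 (λ z → z :* (con 1 :* con 1) :+ con 1 := z :+ con 1) refl _ ⟩
        (v (1 , 2) ⊖ 1#) ⊕ 1# ≈⟨ trans (+-assoc _ _ _) (trans (+-congˡ (-‿inverseˡ 1#)) (+-identityʳ _)) ⟩
        v (1 , 2) ≡⟨ ≡.cong₂ (λ i j → v (i , j)) (≡.sym ε-zero) (≡.sym ν1≡2) ⟩
        v (ε 0 , ν 1) ≡⟨ v-label 0<h (≡.subst (0 <_) (≡.sym ρ1≡1) (s≤s z≤n)) ⟩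
        u (1 , 1) ∎

      ∏≈ : ∏ K (concatMap rowBoxes (interval 1 N)) u ≈ u (1 , 1)
      ∏≈ = trans (reflexive (≡.cong₂ (λ n k → ∏ K (concatMap (λ r → map (r ,_) (interval 1 (ρ r))) (interval 1 (suc n))) u) m≡0 ρ1≡1))
        (trans (reflexive (≡.cong (λ k → ∏ K (map (1 ,_) (interval 1 k) ++ []) u) ρ1≡1)) (*-identityʳ _))

      𝔊≈1 : 𝔊 K π x y ≈ 1#
      𝔊≈1 = trans (trans (Grothendieck.𝔊-staircases K π x y) (hecke {t} {e} t+e m 1 W W-length))
        (trans (reflexive (≡.cong (λ k → ∑ K (staircases k) (λ M → wt t e 1 M * ⟦ good? 1 M W ⟧)) m≡0))
          (trans (+-identityʳ _) (trans (*-identityˡ _) (⟦⟧-yes (good? 1 [] W) (singleton W (≡.trans W-length (≡.cong suc m≡0)) W-head)))))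
        where
          singleton : ∀ xs → length xs ≡ 1 → At xs 0 1 → xs ≡ 1 ∷ []
          singleton (x ∷ []) _ here = ≡.refl

    -- For n = 1 the triangle is empty and 𝔊 is 1, while R(π) still contains (1 , 1); both sides
    -- equal `u (1 , 1)`.
    conclusion-trivial : eval K (⊝ 1#) v (crf (numVertices π) (T π)) ≈ ∏ K (treeLabels π) v * 𝔊 K π x y
    conclusion-trivial = trans crf-labelSum (trans labelSum≈ (sym (trans (*-cong (trans ∏-treeLabels ∏≈) 𝔊≈1) (*-identityʳ _))))

theorem5p4 : ∀ {c ℓ} (K : CommutativeRing c ℓ) (let open CommutativeRing K) {n : ℕ} (π : Permutation′ (suc n)) →
    π ⟨$⟩ʳ Fin.zero ≡ Fin.zero →
    Avoids132 (λ i → π ⟨$⟩ʳ Fin.suc i) →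
    (x y : ℕ → Carrier) (u : Box → Carrier) →
    (∀ {b} → b ∈ R π → weight K x y b * u b ≈ 1#) →
    eval K (- 1#) (substitution K π u) (crf (numVertices π) (T π))
      ≈ ∏ K (treeLabels π) (substitution K π u) * 𝔊 K π x y
theorem5p4 K {zero}  π π0≡0 avoids x y u weight-u = Theorem.conclusion-trivial K π π0≡0 avoids x y u weight-u ≡.refl
theorem5p4 K {suc n} π π0≡0 avoids x y u weight-u = Theorem.conclusion K π π0≡0 avoids x y u weight-u (s≤s z≤n)
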